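{- Let $q$ be a prime power, $n\ge1$, $d=\lceil 2\log_q n\rceil$, $m=q^{\lceil\log_q n\rceil}$ and $t=\lfloor\log_d n\rfloor$. Let $g,h\in\mathbb{F}_q[X]$ be coprime with $\deg g,\deg h\le d$, and suppose $f=g/h$ has degree at least $2$, is not a monomial, is not a binomial of the form $aX^{p^{\ell}}+b$ ($p$ the characteristic of $\mathbb{F}_q$, $a\ne0$, $\ell\ge0$), is not linearly conjugate to $1/X^{\deg f}$, and satisfies: $\deg g\ne\deg h$, or $f$ is separable, or $f$ is not of the form $L(X^{p^{\ell}})$ with $L\in\mathbb{F}_q(X)$ of degree $1$ and $\ell\ge1$. Suppose $\alpha\in\mathbb{F}_{q^n}$ has degree $n$ over $\mathbb{F}_q$ and is a root of $X^m h(X)-g(X)$. Then the multiplicative order of $\alpha$ in $\mathbb{F}_{q^n}^*$ is at least $$\binom{n+t-1}{t}\prod_{i=0}^{t-1}\frac{1}{d^i}.$$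
   Context: Rational functions are in lowest terms, $\deg(g/h)=\max\{\deg g,\deg h\}$. Linear conjugacy means $\phi'=\psi^{ -1}\circ\phi\circ\psi$ with $\psi$ of degree one; $f$ is separable if $f'\ne0$. Iterates $f^{(k)}$ are $k$-fold compositions of $f$. -}

module Defs where

open import Algebra.Apartness.Bundles using (HeytingCommutativeRing; HeytingField)
import Algebra.Apartness.Properties.HeytingCommutativeRing as HeytingProperties
open import Algebra.Bundles using (CommutativeRing)
open import Algebra.Bundles.Raw using (RawRing)
import Algebra.Definitions.RawSemiring as RawSemiringDefinitions
open import Algebra.Morphism.Structures using (module RingMorphisms)
open import Data.Fin.Base using (Fin)
open import Data.Integer.Base using (+_)
open import Data.List.Base as List using (List; []; _∷_; length; upTo)
open import Data.Nat.Base as ℕ using (ℕ; zero; suc; _≤_; _<_; _∸_; _⊔_)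
open import Data.Nat.Combinatorics using (_C_)
open import Data.Product.Base using (Σ; ∃-syntax; _×_; _,_)
open import Data.Rational.Base as ℚ using (ℚ; 0ℚ; 1ℚ)
open import Function.Bundles using (Inverse)
open import Level using (Level) renaming (suc to lsuc; _⊔_ to _⊔ˡ_)
open import Relation.Binary.PropositionalEquality as ≡ using (_≡_)
open import Relation.Nullary.Negation.Core using (¬_)

private
  variable
    c ℓ₁ ℓ₂ c′ ℓ₁′ ℓ₂′ : Level

------------------------------------------------------------------------
-- Integer parts of logarithms

-- k = ⌈ s · log_b n ⌉: since s · log_b n ≤ j means n ^ s ≤ b ^ j (n ≥ 1,
-- b ≥ 2), this is the least natural number j with n ^ s ≤ b ^ j.
IsCeilMulLog : (s b n k : ℕ) → Set
IsCeilMulLog s b n k =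
  n ℕ.^ s ≤ b ℕ.^ k × (∀ j → n ℕ.^ s ≤ b ℕ.^ j → k ≤ j)

-- k = ⌊ log_b n ⌋, likewise.
IsFloorLog : (b n k : ℕ) → Set
IsFloorLog b n k = b ℕ.^ k ≤ n × (∀ j → b ℕ.^ j ≤ n → j ≤ k)

------------------------------------------------------------------------
-- The bound

fromℕ : ℕ → ℚ
fromℕ n = + n ℚ./ 1

-- The value at 0 is a dummy.
reciprocal : ℕ → ℚ
reciprocal zero    = 0ℚ
reciprocal (suc n) = + 1 ℚ./ suc n

∏[i<_]_ : ℕ → (ℕ → ℚ) → ℚ
∏[i< t ] f = List.foldr ℚ._*_ 1ℚ (List.map f (upTo t))

orderBound : (n t d : ℕ) → ℚ
orderBound n t d =
  fromℕ ((n ℕ.+ t ∸ 1) C t) ℚ.* (∏[i< t ] λ i → reciprocal (d ℕ.^ i))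

------------------------------------------------------------------------
-- Fields

fieldRing : HeytingField c ℓ₁ ℓ₂ → CommutativeRing c ℓ₁
fieldRing F = HeytingCommutativeRing.commutativeRing
  (HeytingField.heytingCommutativeRing F)

HasCardinality : HeytingField c ℓ₁ ℓ₂ → ℕ → Set (c ⊔ˡ ℓ₁)
HasCardinality F q =
  Inverse (CommutativeRing.setoid (fieldRing F)) (≡.setoid (Fin q))

IsFieldHom : (F : HeytingField c ℓ₁ ℓ₂) (K : HeytingField c′ ℓ₁′ ℓ₂′) →
             (HeytingField.Carrier F → HeytingField.Carrier K) →
             Set (c ⊔ˡ ℓ₁ ⊔ˡ ℓ₁′)
IsFieldHom F K = RingMorphisms.IsRingHomomorphism
  (CommutativeRing.rawRing (fieldRing F))
  (CommutativeRing.rawRing (fieldRing K))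

module _ (F : HeytingField c ℓ₁ ℓ₂) where

  open HeytingField F using (Carrier; _≈_; 0#; 1#)
  open RawSemiringDefinitions
    (RawRing.rawSemiring (CommutativeRing.rawRing (fieldRing F))) using (_^_)
    renaming (_×_ to _·_)

  HasCharacteristic : ℕ → Set ℓ₁
  HasCharacteristic p =
    1 ≤ p × p · 1# ≈ 0# × (∀ k → 1 ≤ k → k · 1# ≈ 0# → p ≤ k)

  HasMultiplicativeOrder : Carrier → ℕ → Set ℓ₁
  HasMultiplicativeOrder α N =
    1 ≤ N × α ^ N ≈ 1# × (∀ k → 1 ≤ k → α ^ k ≈ 1# → N ≤ k)

------------------------------------------------------------------------
-- Polynomials and rational functions in one variable over a field

module Polynomials (F : HeytingField c ℓ₁ ℓ₂) where

  open HeytingField F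
  open HeytingProperties heytingCommutativeRing using (1#0)

  -- Coefficient lists, constant term first; trailing zeros are allowed
  -- and ignored by _≋_.
  Poly : Set c
  Poly = List Carrier

  coeff : Poly → ℕ → Carrier
  coeff []      _       = 0#
  coeff (a ∷ p) zero    = a
  coeff (a ∷ p) (suc i) = coeff p i

  infix 4 _≋_
  _≋_ : Poly → Poly → Set ℓ₁
  p ≋ r = ∀ i → coeff p i ≈ coeff r i

  infixl 6 _+ᴾ_ _-ᴾ_
  infixl 7 _*ᴾ_
  infix  8 -ᴾ_

  _+ᴾ_ : Poly → Poly → Poly
  []      +ᴾ r       = r
  (a ∷ p) +ᴾ []      = a ∷ p
  (a ∷ p) +ᴾ (b ∷ r) = (a + b) ∷ (p +ᴾ r)

  -ᴾ_ : Poly → Poly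
  -ᴾ p = List.map -_ p

  _-ᴾ_ : Poly → Poly → Poly
  p -ᴾ r = p +ᴾ (-ᴾ r)

  _*ᴾ_ : Poly → Poly → Poly
  []      *ᴾ r = []
  (a ∷ p) *ᴾ r = List.map (a *_) r +ᴾ (0# ∷ (p *ᴾ r))

  monomial : Carrier → ℕ → Poly
  monomial a k = List.replicate k 0# List.++ (a ∷ [])

  constant : Carrier → Poly
  constant a = monomial a 0

  polyRawRing : RawRing c ℓ₁
  polyRawRing = record
    { Carrier = Poly
    ; _≈_     = _≋_
    ; _+_     = _+ᴾ_
    ; _*_     = _*ᴾ_
    ; -_      = -ᴾ_
    ; 0#      = []
    ; 1#      = constant 1#
    }

  open RawSemiringDefinitions (RawRing.rawSemiring polyRawRing) public
    using (Coprime) renaming (_^_ to _^ᴾ_)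

  eval : Poly → Carrier → Carrier
  eval []      x = 0#
  eval (a ∷ p) x = a + x * eval p x

  -- (a + X p)′ = p + X p′
  derivative : Poly → Poly
  derivative []      = []
  derivative (a ∷ p) = p +ᴾ (0# ∷ derivative p)

  -- The zero polynomial has no degree.
  HasDegree : Poly → ℕ → Set (ℓ₁ ⊔ˡ ℓ₂)
  HasDegree p n = coeff p n # 0# × (∀ i → n < i → coeff p i ≈ 0#)

  NonZeroᴾ : Poly → Set ℓ₂
  NonZeroᴾ p = ∃[ i ] coeff p i # 0#

  record RatFun : Set (c ⊔ˡ ℓ₂) where
    constructor ratFun
    field
      num         : Poly
      den         : Poly
      den-nonZero : NonZeroᴾ den

  open RatFun public

  infix 4 _≐_
  _≐_ : RatFun → RatFun → Set ℓ₁
  f ≐ f′ = num f *ᴾ den f′ ≋ num f′ *ᴾ den f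

  InLowestTerms : RatFun → Set (c ⊔ˡ ℓ₁)
  InLowestTerms f = Coprime (num f) (den f)

  -- Meaningful for f in lowest terms.
  HasMaxDegree : RatFun → ℕ → Set (ℓ₁ ⊔ˡ ℓ₂)
  HasMaxDegree f D =
    ∃[ a ] ∃[ b ] HasDegree (num f) a × HasDegree (den f) b × D ≡ a ⊔ b

  HasDegreeʳ : RatFun → ℕ → Set (c ⊔ˡ ℓ₁ ⊔ˡ ℓ₂)
  HasDegreeʳ f D = InLowestTerms f × HasMaxDegree f D

  polynomial : Poly → RatFun
  polynomial p = ratFun p (constant 1#) (0 , 1#0)

  𝕏^_ : ℕ → RatFun
  𝕏^ k = polynomial (monomial 1# k)

  coeff-monomial : ∀ a k → coeff (monomial a k) k ≡ a
  coeff-monomial a zero    = ≡.refl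
  coeff-monomial a (suc k) = coeff-monomial a k

  1/𝕏^_ : ℕ → RatFun
  1/𝕏^ k = ratFun (constant 1#) (monomial 1# k)
    (k , ≡.subst (_# 0#) (≡.sym (coeff-monomial 1# k)) 1#0)

  -- homogenize N p u v = Σᵢ pᵢ uⁱ vᴺ⁻ⁱ, provided N + 1 is at least the
  -- length of p, so that v ^ N · p (u / v) = homogenize N p u v.
  homogenize : ℕ → Poly → Poly → Poly → Poly
  homogenize N []      u v = []
  homogenize N (a ∷ p) u v =
    constant a *ᴾ v ^ᴾ N +ᴾ u *ᴾ homogenize (N ∸ 1) p u v

  -- χ = φ ∘ ψ as rational functions. For φ = g / h and ψ = u / v the
  -- composite is homogenize N g u v / homogenize N h u v for any large N;
  -- it is undefined when ψ is a constant at which h vanishes.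
  IsComposite : (χ φ ψ : RatFun) → Set (ℓ₁ ⊔ˡ ℓ₂)
  IsComposite χ φ ψ =
    NonZeroᴾ (subst (den φ)) ×
    num χ *ᴾ subst (den φ) ≋ subst (num φ) *ᴾ den χ
    where
    subst : Poly → Poly
    subst p = homogenize (length (num φ) ⊔ length (den φ)) p (num ψ) (den ψ)

  -- (g / h)′ ≠ 0, where (g / h)′ = (g′ h - g h′) / h².
  IsSeparable : RatFun → Set ℓ₁
  IsSeparable f =
    ¬ (derivative (num f) *ᴾ den f -ᴾ num f *ᴾ derivative (den f) ≋ [])

  IsMonomial : RatFun → Set (c ⊔ˡ ℓ₁ ⊔ˡ ℓ₂)
  IsMonomial f = ∃[ a ] ∃[ k ] a # 0# × f ≐ polynomial (monomial a k)

  -- a X ^ (p ^ ℓ) + b with a ≠ 0 and ℓ ≥ 0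
  IsPPowerBinomial : ℕ → RatFun → Set (c ⊔ˡ ℓ₁ ⊔ˡ ℓ₂)
  IsPPowerBinomial p f = ∃[ a ] ∃[ b ] ∃[ l ]
    a # 0# × f ≐ polynomial (monomial a (p ℕ.^ l) +ᴾ constant b)

  -- L (X ^ (p ^ ℓ)) with deg L = 1 and ℓ ≥ 1
  IsLinearInPPower : ℕ → RatFun → Set (c ⊔ˡ ℓ₁ ⊔ˡ ℓ₂)
  IsLinearInPPower p f = ∃[ L ] ∃[ l ]
    HasDegreeʳ L 1 × 1 ≤ l × IsComposite f L (𝕏^ (p ℕ.^ l))

  -- φ′ = ψ⁻¹ ∘ φ ∘ ψ for some ψ of degree one with coefficients in F.
  IsConjugateVia : (φ φ′ : RatFun) → Set (c ⊔ˡ ℓ₁ ⊔ˡ ℓ₂)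
  IsConjugateVia φ φ′ = ∃[ ψ ] ∃[ ψ⁻¹ ] ∃[ φ∘ψ ]
    HasDegreeʳ ψ 1 ×
    IsComposite (𝕏^ 1) ψ ψ⁻¹ × IsComposite (𝕏^ 1) ψ⁻¹ ψ ×
    IsComposite φ∘ψ φ ψ × IsComposite φ′ ψ⁻¹ φ∘ψ

------------------------------------------------------------------------
-- Extensions

module Extension
  (F : HeytingField c ℓ₁ ℓ₂) (K : HeytingField c′ ℓ₁′ ℓ₂′)
  (ι : HeytingField.Carrier F → HeytingField.Carrier K)
  (ι-hom : IsFieldHom F K ι)
  where

  private
    module F  = HeytingField F
    module FR = CommutativeRing (fieldRing F)
    module FP = Polynomials F
    module K  = HeytingField K
    module KR = CommutativeRing (fieldRing K)
    module KP = Polynomials K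
    module FH = HeytingProperties F.heytingCommutativeRing
    module KH = HeytingProperties K.heytingCommutativeRing

  open RingMorphisms.IsRingHomomorphism ι-hom
    using (⟦⟧-cong; *-homo; 0#-homo; 1#-homo)

  extendPoly : FP.Poly → KP.Poly
  extendPoly = List.map ι

  ι-# : ∀ {x} → x F.# F.0# → ι x K.# K.0#
  ι-# {x} x#0 with F.#⇒invertible x#0
  ... | y , yx≈1 , _ = KH.invertibleˡ⇒# (ι y , (begin
    ι y K.* (ι x K.- K.0#)  ≈⟨ KR.*-congˡ (KH.x-0≈x (ι x)) ⟩
    ι y K.* ι x             ≈⟨ *-homo y x ⟨
    ι (y F.* x)             ≈⟨ ⟦⟧-cong (FR.*-congˡ (FH.x-0≈x x)) ⟨
    ι (y F.* (x F.- F.0#))  ≈⟨ ⟦⟧-cong yx≈1 ⟩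
    ι F.1#                  ≈⟨ 1#-homo ⟩
    K.1#                    ∎))
    where open import Relation.Binary.Reasoning.Setoid KR.setoid

  extend-nonZero : ∀ p → FP.NonZeroᴾ p → KP.NonZeroᴾ (extendPoly p)
  extend-nonZero []      (i     , 0#0) = i , KH.#-congʳ 0#-homo (ι-# 0#0)
  extend-nonZero (a ∷ p) (zero  , a#0) = zero , ι-# a#0
  extend-nonZero (a ∷ p) (suc i , x#0) with extend-nonZero p (i , x#0)
  ... | j , y#0 = suc j , y#0

  extendRatFun : FP.RatFun → KP.RatFun
  extendRatFun (FP.ratFun g h h#0) =
    KP.ratFun (extendPoly g) (extendPoly h) (extend-nonZero h h#0)

  IsRootIn : FP.Poly → K.Carrier → Set ℓ₁′
  IsRootIn p α = KP.eval (extendPoly p) α K.≈ K.0#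

  IsMinimalPolynomial : FP.Poly → K.Carrier → Set (c ⊔ˡ ℓ₁ ⊔ˡ ℓ₂ ⊔ˡ ℓ₁′)
  IsMinimalPolynomial μ α = ∃[ n ]
    FP.HasDegree μ n × FP.coeff μ n F.≈ F.1# × IsRootIn μ α ×
    (∀ p k → FP.HasDegree p k → IsRootIn p α → n ≤ k)

  HasDegreeOver : K.Carrier → ℕ → Set (c ⊔ˡ ℓ₁ ⊔ˡ ℓ₂ ⊔ˡ ℓ₁′)
  HasDegreeOver α n = ∃[ μ ] IsMinimalPolynomial μ α × FP.HasDegree μ n

-- The conjugating ψ may have coefficients in any extension field of F, as is
-- usual for conjugacy of rational maps (for finite F the extensions at the
-- levels of F already include all the finite ones). In particular every
-- a / X ^ D with a ≠ 0 is linearly conjugate to 1 / X ^ D, although for ψ over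
-- F itself this would need a to be a (D + 1)-st power in F.
LinearlyConjugate : (F : HeytingField c ℓ₁ ℓ₂) (φ φ′ : Polynomials.RatFun F) →
                    Set (lsuc (c ⊔ˡ ℓ₁ ⊔ˡ ℓ₂))
LinearlyConjugate {c} {ℓ₁} {ℓ₂} F φ φ′ =
  Σ (HeytingField c ℓ₁ ℓ₂) λ E →
  Σ (HeytingField.Carrier F → HeytingField.Carrier E) λ ι →
  Σ (IsFieldHom F E ι) λ ι-hom →
    let open Extension F E ι ι-hom in
    Polynomials.IsConjugateVia E (extendRatFun φ) (extendRatFun φ′)

{-# OPTIONS --safe #-}

-- Let fᵢ be the i-th iterate of f, of degree Dⁱ with D = deg f. Since X ↦ X^m fixes 𝔽_q, α^(mⁱ) = fᵢ(α), so
-- α^(Σ cᵢ mⁱ) = 1 with Σ |cᵢ| Dⁱ < n = deg α turns into a relation ∏ fᵢ^cᵢ = 1 of rational functions. A nontrivial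
-- relation makes f totally ramified over f (0) and over f (∞), hence f = (a X^D + b) / (c X^D + e). If D is not
-- a power of p, comparing the roots of its two sides after raising it to the power D leaves a X^D and a / X^D; if
-- it is, f is inseparable and of the form L (X^(p^l)), and in the remaining cases it is a binomial or, by Lang's
-- theorem, conjugate to 1 / X^D over an extension. So the hypotheses exclude all nontrivial relations.
--
-- Therefore points of ℤ^(k+1) at mutual distance Σ |cᵢ| dⁱ < n give distinct powers of α. The points with
-- Σ dⁱ |jᵢ| ≤ c₀ and c₀ + Σ dⁱ |jᵢ| < n are such a set, and N is at least their number. Estimating this number by the
-- trapezoidal rule gives the bound except for finitely many (d , n), which are checked by computation; a few
-- of them also need that N divides q^n − 1 or has no short relation.
module Submission where

open import Defs
open import Algebra.Apartness.Bundles using (HeytingField)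
import Algebra.Apartness.Properties.HeytingCommutativeRing as HeytingProperties
open import Algebra.Bundles using (CommutativeRing)
open import Algebra.Bundles.Raw using (RawRing)
import Algebra.Definitions.RawMagma as RawMagmaDefinitions
import Algebra.Morphism.Construct.Identity as Identity
open import Algebra.Morphism.Structures using (module RingMorphisms)
import Algebra.Properties.CommutativeMonoid.Sum as Sums
import Algebra.Properties.CommutativeSemiring.Binomial as Binomial
import Algebra.Properties.CommutativeSemiring.Exp as Exponentiation
import Algebra.Properties.Monoid.Mult as MonoidMult
import Algebra.Properties.Monoid.Mult.TCOptimised as OptimisedMult
import Algebra.Properties.Ring as RingProperties
import Algebra.Solver.Ring as RingSolver
open import Algebra.Solver.Ring.AlmostCommutativeRing using (fromCommutativeRing; _-Raw-AlmostCommutative⟶_)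
open import Data.Empty using (⊥; ⊥-elim)
open import Data.Fin.Base as Fin using (Fin; zero; suc)
open import Data.Fin.Permutation using (permutation)
import Data.Fin.Properties as Finₚ
import Data.Integer.Properties as ℤₚ
open import Data.List.Base as List using (List; []; _∷_; length)
open import Data.List.Relation.Unary.All as All using (All; []; _∷_)
open import Data.Maybe.Base using (Maybe; just; nothing)
open import Data.Nat.Base as ℕ using (ℕ; zero; suc; _≤_; _<_; z≤n; s≤s; s<s; z<s)
import Data.Nat.DivMod as DivMod
open import Data.Nat.Divisibility as Div using (divides) renaming (_∣_ to _∣ⁿ_; _∣?_ to _∣ⁿ?_)
open import Data.Nat.Induction using (<-wellFounded; Acc; acc)
open import Data.Nat.Primality using (Prime; euclidsLemma; prime⇒nonTrivial)
import Data.Nat.Properties as ℕₚ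
open import Data.Nat.Solver using (module +-*-Solver)
open import Data.Product.Base using (∃-syntax; _×_; _,_; proj₁; proj₂; swap)
open import Data.Sum.Base using (_⊎_; inj₁; inj₂)
open import Function.Base using (case_of_)
open import Function.Bundles using (Inverse; Equivalence)
open import Level using (Level) renaming (_⊔_ to _⊔ˡ_)
open import Relation.Binary.Definitions using (Tri; tri<; tri≈; tri>)
open import Relation.Binary.PropositionalEquality as ≡ using (_≡_; _≢_)
import Relation.Binary.Reasoning.Setoid as SetoidReasoning
open import Relation.Nullary using (¬_; Dec; yes; no)

module BinomialCoefficients where
  open import Data.Nat.Base using (_+_; _*_)
  open import Data.Nat.Combinatorics using (_C_; nCk+nC[k+1]≡[n+1]C[k+1]; nC1≡n)

  absorption : ∀ n k → suc k * (suc n C suc k) ≡ suc n * (n C k)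
  absorption n       zero    = ≡.trans (ℕₚ.*-identityˡ _) (≡.trans (nC1≡n (suc n)) (≡.sym (ℕₚ.*-identityʳ (suc n))))
  absorption zero    (suc k) = ℕₚ.*-zeroʳ (suc (suc k))
  absorption (suc n) (suc k) = begin
    suc (suc k) * (suc (suc n) C suc (suc k))
      ≡⟨ ≡.cong (suc (suc k) *_) (nCk+nC[k+1]≡[n+1]C[k+1] (suc n) (suc k)) ⟨
    suc (suc k) * (suc n C suc k + suc n C suc (suc k))
      ≡⟨ solve 3 (λ k x y → (con 1 :+ k) :* (x :+ y) := x :+ k :* x :+ (con 1 :+ k) :* y) ≡.refl (suc k) (suc n C suc k) (suc n C suc (suc k)) ⟩
    suc n C suc k + suc k * (suc n C suc k) + suc (suc k) * (suc n C suc (suc k))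
      ≡⟨ ≡.cong₂ (λ x y → suc n C suc k + x + y) (absorption n k) (absorption n (suc k)) ⟩
    suc n C suc k + suc n * (n C k) + suc n * (n C suc k)
      ≡⟨ solve 4 (λ c n x y → c :+ n :* x :+ n :* y := c :+ n :* (x :+ y)) ≡.refl (suc n C suc k) (suc n) (n C k) (n C suc k) ⟩
    suc n C suc k + suc n * (n C k + n C suc k)
      ≡⟨ ≡.cong (λ z → suc n C suc k + suc n * z) (nCk+nC[k+1]≡[n+1]C[k+1] n k) ⟩
    suc (suc n) * (suc n C suc k) ∎
    where
    open ≡.≡-Reasoning
    open +-*-Solver

  prime∣binomial : ∀ {p} → Prime p → ∀ k → 1 ≤ k → k < p → p ∣ⁿ (p C k)
  prime∣binomial {suc p} pr (suc k) _ k<p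
    with euclidsLemma (suc k) (suc p C suc k) pr (divides (p C k) (≡.trans (absorption p k) (ℕₚ.*-comm (suc p) (p C k))))
  ... | inj₁ p∣k = ⊥-elim (ℕₚ.<⇒≱ k<p (Div.∣⇒≤ p∣k))
  ... | inj₂ p∣C = p∣C

inBase : ℕ → List ℕ → ℕ
inBase m []       = 0
inBase m (x ∷ xs) = x ℕ.+ m ℕ.* inBase m xs

module Arithmetic where
  open import Data.Bool.Base using (Bool; true; false; if_then_else_; _∧_; _∨_; not; T)
  open import Data.Bool.Properties using (T-∧; T-∨)
  open import Data.Fin.Base using (fromℕ<)
  open import Data.List.Base using (_++_; lookup; upTo; applyUpTo)
  open import Data.List.Membership.Propositional.Properties using (∈-lookup)
  import Data.List.Properties as Listₚ
  open import Data.List.Relation.Binary.Disjoint.Propositional using (Disjoint)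
  import Data.List.Relation.Unary.All.Properties as Allₚ
  open import Data.List.Relation.Unary.AllPairs using ([]; _∷_)
  open import Data.List.Relation.Unary.Unique.Propositional using (Unique)
  import Data.List.Relation.Unary.Unique.Propositional.Properties as Uniqueₚ
  open import Data.Nat.Base
  open import Data.Nat.Combinatorics using (_C_)
  open import Data.Nat.DivMod using (_%_; m%n<n)
  open import Data.Nat.ListAction using (product)
  open import Data.Nat.Properties
  open import Data.Rational.Base as ℚ using (ℚ; 1ℚ)
  import Data.Rational.Properties as ℚₚ
  open import Data.Rational.Unnormalised.Base as ℚᵘ using (ℚᵘ; mkℚᵘ; *≡*; *≤*)
  import Data.Rational.Unnormalised.Properties as ℚᵘₚ
  open import Data.Sum.Base using ([_,_]′)
  open import Data.Unit.Base using (tt)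
  open import Relation.Binary.PropositionalEquality using (refl; sym; trans; cong; cong₂; subst; subst₂)

  module PowerInequalities where
    open ≤-Reasoning
    open +-*-Solver

    bernoulli : ∀ j x h → x ^ suc j + suc j * h * x ^ j ≤ (x + h) ^ suc j
    bernoulli zero    x h = ≤-reflexive (solve 2 (λ x h → x :* con 1 :+ con 1 :* h :* con 1 := (x :+ h) :* con 1) refl x h)
    bernoulli (suc j) x h = begin
      x ^ suc (suc j) + suc (suc j) * h * x ^ suc j
        ≤⟨ m≤m+n _ (h * (suc j * h * x ^ j)) ⟩
      x * (x * x ^ j) + suc (suc j) * h * (x * x ^ j) + h * (suc j * h * x ^ j)
        ≡⟨ solve 4 (λ x h j u → x :* (x :* u) :+ (con 2 :+ j) :* h :* (x :* u) :+ h :* ((con 1 :+ j) :* h :* u)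
             := (x :+ h) :* (x :* u :+ (con 1 :+ j) :* h :* u)) refl x h j (x ^ j) ⟩
      (x + h) * (x ^ suc j + suc j * h * x ^ j)
        ≤⟨ *-monoʳ-≤ (x + h) (bernoulli j x h) ⟩
      (x + h) ^ suc (suc j) ∎

    -- The trapezoidal rule for x^(j+1) overestimates the integral, with an explicit part of the error.
    trapezoid⁺ : ∀ j x w → let y = x + 2 * w in
      y ^ (2 + j) + suc j * (w * w) * y ^ j ≤ x ^ (2 + j) + suc j * (w * w) * x ^ j + (2 + j) * w * (y ^ suc j + x ^ suc j)
    trapezoid⁺ zero    x w = ≤-reflexive (solve 2 (λ x w → let y = x :+ con 2 :* w in
      y :* (y :* con 1) :+ con 1 :* (w :* w) :* con 1 := x :* (x :* con 1) :+ con 1 :* (w :* w) :* con 1 :+ con 2 :* w :* (y :* con 1 :+ x :* con 1)) refl x w)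
    trapezoid⁺ (suc j) x w = +-cancelʳ-≤ (y * B + w * G) A′ B′ (begin
      A′ + (y * B + w * G)   ≡⟨ identity ⟩
      B′ + (y * A + w * H)   ≤⟨ +-monoʳ-≤ B′ (+-mono-≤ (*-monoʳ-≤ y (trapezoid⁺ j x w)) (*-monoʳ-≤ w (*-monoʳ-≤ (x + w) (bernoulli j x (2 * w))))) ⟩
      B′ + (y * B + w * G)   ∎)
      where
      y = x + 2 * w
      A = y ^ (2 + j) + suc j * (w * w) * y ^ j
      B = x ^ (2 + j) + suc j * (w * w) * x ^ j + (2 + j) * w * (y ^ suc j + x ^ suc j)
      A′ = y ^ (3 + j) + suc (suc j) * (w * w) * y ^ suc j
      B′ = x ^ (3 + j) + suc (suc j) * (w * w) * x ^ suc j + (3 + j) * w * (y ^ (2 + j) + x ^ (2 + j))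
      G = (x + w) * y ^ suc j
      H = (x + w) * (x ^ suc j + suc j * (2 * w) * x ^ j)
      identity : A′ + (y * B + w * G) ≡ B′ + (y * A + w * H)
      identity = solve 5 (λ x w j u v → let y = x :+ con 2 :* w ; j₁ = con 1 :+ j ; ww = w :* w in
        (y :* (y :* (y :* v)) :+ (con 2 :+ j) :* ww :* (y :* v))
        :+ (y :* (x :* (x :* u) :+ j₁ :* ww :* u :+ (con 2 :+ j) :* w :* (y :* v :+ x :* u)) :+ w :* ((x :+ w) :* (y :* v)))
        := (x :* (x :* (x :* u)) :+ (con 2 :+ j) :* ww :* (x :* u) :+ (con 3 :+ j) :* w :* (y :* (y :* v) :+ x :* (x :* u)))
        :+ (y :* (y :* (y :* v) :+ j₁ :* ww :* v) :+ w :* ((x :+ w) :* (x :* u :+ j₁ :* (con 2 :* w) :* u))))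
        refl x w j (x ^ j) (y ^ j)

    trapezoid : ∀ k x w → let y = x + 2 * w in y ^ (2 + k) ≤ x ^ (2 + k) + (2 + k) * w * (y ^ suc k + x ^ suc k)
    trapezoid k x w = +-cancelʳ-≤ (suc k * (w * w) * y ^ k) _ _ (begin
      y ^ (2 + k) + suc k * (w * w) * y ^ k
        ≤⟨ trapezoid⁺ k x w ⟩
      x ^ (2 + k) + suc k * (w * w) * x ^ k + (2 + k) * w * (y ^ suc k + x ^ suc k)
        ≤⟨ +-monoˡ-≤ _ (+-monoʳ-≤ (x ^ (2 + k)) (*-monoʳ-≤ (suc k * (w * w)) (^-monoˡ-≤ k (m≤m+n x (2 * w))))) ⟩
      x ^ (2 + k) + suc k * (w * w) * y ^ k + (2 + k) * w * (y ^ suc k + x ^ suc k)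
        ≡⟨ solve 3 (λ a b c → a :+ b :+ c := a :+ c :+ b) refl (x ^ (2 + k)) (suc k * (w * w) * y ^ k) _ ⟩
      x ^ (2 + k) + (2 + k) * w * (y ^ suc k + x ^ suc k) + suc k * (w * w) * y ^ k ∎)
      where y = x + 2 * w

    rising : ℕ → ℕ → ℕ
    rising n zero    = 1
    rising n (suc t) = rising n t * (n + t)

    rising-≤ : ∀ n t → suc t * t ≤ n → rising n (suc t) ≤ n ^ suc t + suc t * t * n ^ t
    rising-≤ n zero    _ = ≤-reflexive (solve 1 (λ n → con 1 :* (n :+ con 0) := n :* con 1 :+ con 0) refl n)
    rising-≤ n (suc t) h = begin
      rising n (suc t) * (n + suc t)
        ≤⟨ *-monoˡ-≤ (n + suc t) (rising-≤ n t small) ⟩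
      (n * n ^ t + suc t * t * n ^ t) * (n + suc t)
        ≡⟨ solve 3 (λ n t u → (n :* u :+ (con 1 :+ t) :* t :* u) :* (n :+ (con 1 :+ t))
             := n :* (n :* u) :+ (con 1 :+ t) :* (con 1 :+ t) :* (n :* u) :+ (con 1 :+ t) :* u :* ((con 1 :+ t) :* t)) refl n t (n ^ t) ⟩
      n * (n * n ^ t) + suc t * suc t * (n * n ^ t) + suc t * n ^ t * (suc t * t)
        ≤⟨ +-monoʳ-≤ (n * (n * n ^ t) + suc t * suc t * (n * n ^ t)) (*-monoʳ-≤ (suc t * n ^ t) small) ⟩
      n * (n * n ^ t) + suc t * suc t * (n * n ^ t) + suc t * n ^ t * n
        ≡⟨ solve 3 (λ n t u → n :* (n :* u) :+ (con 1 :+ t) :* (con 1 :+ t) :* (n :* u) :+ (con 1 :+ t) :* u :* n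
             := n :* (n :* u) :+ (con 2 :+ t) :* (con 1 :+ t) :* (n :* u)) refl n t (n ^ t) ⟩
      n ^ suc (suc t) + suc (suc t) * suc t * n ^ suc t ∎
      where
      small : suc t * t ≤ n
      small = ≤-trans (*-mono-≤ (n≤1+n (suc t)) (n≤1+n t)) h

  open PowerInequalities

  module Counting (d : ℕ) where
    open ≤-Reasoning
    open +-*-Solver

    layers : ℕ → (ℕ → ℕ) → ℕ → ℕ → ℕ
    layers zero    f h x = 0
    layers (suc u) f h x = if h <ᵇ x then f (x ∸ h) + layers u f h (x ∸ h) else 0

    -- The number of (c₀; j₁, …, jₖ) with Σ dⁱ ∣jᵢ∣ ≤ c₀ and c₀ + Σ dⁱ ∣jᵢ∣ < n.
    count : ℕ → ℕ → ℕ
    count zero    n = n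
    count (suc k) n = count k n + 2 * layers n (count k) (2 * d ^ suc k) n

    layers-fuel : ∀ u u′ f h x → 0 < h → x ≤ u → x ≤ u′ → layers u f h x ≡ layers u′ f h x
    layers-fuel zero    zero     f h x h>0 _   _ = refl
    layers-fuel zero    (suc u′) f h zero h>0 _ _ = refl
    layers-fuel (suc u) zero     f h zero h>0 _ _ = refl
    layers-fuel (suc u) (suc u′) f h x h>0 p q with h <ᵇ x
    ... | false = refl
    ... | true  = cong (f (x ∸ h) +_) (layers-fuel u u′ f h (x ∸ h) h>0 (shrink u p) (shrink u′ q))
      where
      shrink : ∀ u → x ≤ suc u → x ∸ h ≤ u
      shrink u p = ≤-trans (∸-monoʳ-≤ x h>0) (≤-trans (∸-monoˡ-≤ 1 p) ≤-refl)

    layers-step : ∀ f h x → 0 < h → f 0 ≡ 0 → layers (x + h) f h (x + h) ≡ f x + layers x f h x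
    layers-step f h zero (s≤s _) f0 with h <ᵇ h in eq
    ... | false = sym (trans (+-identityʳ _) f0)
    ... | true  = ⊥-elim (<-irrefl refl (<ᵇ⇒< h h (subst T (sym eq) _)))
    layers-step f h (suc x) h>0 f0 with h <ᵇ suc x + h in eq
    ... | true  = trans (cong (λ z → f z + layers (x + h) f h z) (m+n∸n≡m (suc x) h))
                    (cong (f (suc x) +_) (layers-fuel (x + h) (suc x) f h (suc x) h>0 (subst (_≤ x + h) (+-comm x 1) (+-monoʳ-≤ x h>0)) ≤-refl))
    ... | false = ⊥-elim (subst T eq (<⇒<ᵇ (s≤s (m≤n+m h x))))

    count-0 : ∀ k → count k 0 ≡ 0
    count-0 zero    = refl
    count-0 (suc k) = trans (+-identityʳ _) (count-0 k)

    count-mono-k : ∀ k x → count k x ≤ count (suc k) x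
    count-mono-k k x = m≤m+n _ _

    module _ (d>0 : 0 < d) where
      d^k>0 : ∀ k → 0 < d ^ k
      d^k>0 k = m^n>0 d {{>-nonZero d>0}} k

      count-step : ∀ k x → count (suc k) (x + 2 * d ^ suc k) ≡ count k (x + 2 * d ^ suc k) + count k x + count (suc k) x
      count-step k x = trans (cong (λ z → count k (x + h) + 2 * z) (layers-step (count k) h x (*-mono-≤ {1} {2} (s≤s z≤n) (d^k>0 (suc k))) (count-0 k)))
        (solve 3 (λ a b c → a :+ con 2 :* (b :+ c) := a :+ b :+ (b :+ con 2 :* c)) refl (count k (x + h)) (count k x) (layers x (count k) h x))
        where h = 2 * d ^ suc k

      denominator : ℕ → ℕ
      denominator zero    = 1
      denominator (suc k) = denominator k * (suc k * d ^ k)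

      split : ∀ x h → (x ≤ h) ⊎ (∃[ y ] (x ≡ y + h))
      split x h with ≤-total x h
      ... | inj₁ x≤h = inj₁ x≤h
      ... | inj₂ h≤x = inj₂ (x ∸ h , sym (m∸n+n≡m h≤x))

      by-steps : ∀ (P : ℕ → Set) h → 0 < h → (∀ x → x ≤ h → P x) → (∀ x → P x → P (x + h)) → ∀ x → P x
      by-steps P h h>0 base step x = go x x ≤-refl
        where
        go : ∀ u x → x ≤ u → P x
        go u x x≤u with split x h
        ... | inj₁ x≤h = base x x≤h
        go zero    x x≤u | inj₂ (y , refl) = ⊥-elim (<⇒≱ h>0 (≤-trans (m≤n+m h y) x≤u))
        go (suc u) x x≤u | inj₂ (y , refl) = step y (go u y (≤-pred (≤-trans (≤-trans (≤-reflexive (+-comm 1 y)) (+-monoʳ-≤ y h>0)) x≤u)))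

      private
        h>0 : ∀ k → 0 < 2 * d ^ k
        h>0 k = *-mono-≤ {1} {2} (s≤s z≤n) (d^k>0 k)

        denominator-count : ∀ k x y → y ^ suc k ≤ denominator (suc k) * x →
          (2 + k) * d ^ suc k * y ^ suc k ≤ denominator (2 + k) * x
        denominator-count k x y h = ≤-trans (*-monoʳ-≤ ((2 + k) * d ^ suc k) h)
          (≤-reflexive (solve 3 (λ a b c → a :* (b :* c) := b :* a :* c) refl ((2 + k) * d ^ suc k) (denominator (suc k)) x))

      volume : ∀ k x → x ^ suc k ≤ denominator (suc k) * count k x
      volume zero    x = ≤-reflexive (solve 1 (λ x → x :* con 1 := con 1 :* x) refl x)
      volume (suc k) = by-steps _ (2 * w) (h>0 (suc k)) base step
        where
        w = d ^ suc k
        base : ∀ x → x ≤ 2 * w → x ^ suc (suc k) ≤ denominator (2 + k) * count (suc k) x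
        base x x≤h = begin
          x * x ^ suc k                         ≤⟨ *-monoˡ-≤ (x ^ suc k) (≤-trans x≤h (*-monoˡ-≤ w (m≤m+n 2 k))) ⟩
          (2 + k) * w * x ^ suc k               ≤⟨ denominator-count k (count k x) x (volume k x) ⟩
          denominator (2 + k) * count k x       ≤⟨ *-monoʳ-≤ (denominator (2 + k)) (count-mono-k k x) ⟩
          denominator (2 + k) * count (suc k) x ∎
        step : ∀ x → x ^ suc (suc k) ≤ denominator (2 + k) * count (suc k) x →
               (x + 2 * w) ^ suc (suc k) ≤ denominator (2 + k) * count (suc k) (x + 2 * w)
        step x ih = begin
          y ^ (2 + k)
            ≤⟨ trapezoid k x w ⟩
          x ^ (2 + k) + (2 + k) * w * (y ^ suc k + x ^ suc k)
            ≡⟨ cong (x ^ (2 + k) +_) (*-distribˡ-+ ((2 + k) * w) (y ^ suc k) (x ^ suc k)) ⟩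
          x ^ (2 + k) + ((2 + k) * w * y ^ suc k + (2 + k) * w * x ^ suc k)
            ≤⟨ +-mono-≤ ih (+-mono-≤ (denominator-count k (count k y) y (volume k y)) (denominator-count k (count k x) x (volume k x))) ⟩
          W * count (suc k) x + (W * count k y + W * count k x)
            ≡⟨ solve 4 (λ W a b c → W :* a :+ (W :* b :+ W :* c) := W :* (b :+ c :+ a)) refl W (count (suc k) x) (count k y) (count k x) ⟩
          W * (count k y + count k x + count (suc k) x)
            ≡⟨ cong (W *_) (count-step k x) ⟨
          W * count (suc k) y ∎
          where
          y = x + 2 * w
          W = denominator (2 + k)

      two-layers : ∀ k x → (x + 2 * d ^ suc k) ^ suc k + 2 * x ^ suc k ≤ denominator (suc k) * count (suc k) (x + 2 * d ^ suc k)
      two-layers k x = begin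
        y ^ suc k + 2 * x ^ suc k
          ≡⟨ solve 2 (λ a b → a :+ con 2 :* b := a :+ (b :+ b)) refl (y ^ suc k) (x ^ suc k) ⟩
        y ^ suc k + (x ^ suc k + x ^ suc k)
          ≤⟨ +-mono-≤ (volume k y) (+-mono-≤ (volume k x) (volume k x)) ⟩
        W * count k y + (W * count k x + W * count k x)
          ≡⟨ solve 3 (λ W a b → W :* a :+ (W :* b :+ W :* b) := W :* (a :+ b :+ b)) refl W (count k y) (count k x) ⟩
        W * (count k y + count k x + count k x)
          ≤⟨ *-monoʳ-≤ W (+-monoʳ-≤ (count k y + count k x) (count-mono-k k x)) ⟩
        W * (count k y + count k x + count (suc k) x)
          ≡⟨ cong (W *_) (count-step k x) ⟨
        W * count (suc k) y ∎
        where
        y = x + 2 * d ^ suc k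
        W = denominator (suc k)

      -- The kink of the layer sizes at the central layer is worth (t − 1) w² n^(t−2) for t = 3 + j.
      volume⁺ : ∀ j x → let w = d ^ (2 + j) in
        x ^ (3 + j) + (2 + j) * (w * w) * x ^ suc j ≤ denominator (3 + j) * count (2 + j) x + (2 + j) * w ^ (3 + j)
      volume⁺ j = by-steps _ (2 * w) (h>0 (2 + j)) base step
        where
        w = d ^ (2 + j)
        W = denominator (3 + j)
        base′ : ∀ x → x ≤ 2 * w → x ^ (3 + j) + (2 + j) * (w * w) * x ^ suc j ≤ (3 + j) * w * x ^ (2 + j) + (2 + j) * w ^ (3 + j)
        base′ x x≤2w with ≤-total x w
        ... | inj₁ x≤w = +-mono-≤
                (*-monoˡ-≤ (x ^ (2 + j)) (≤-trans x≤w (m≤m+n w ((2 + j) * w))))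
                (≤-trans (*-monoʳ-≤ ((2 + j) * (w * w)) (^-monoˡ-≤ (suc j) x≤w))
                  (≤-reflexive (solve 3 (λ a w u → a :* (w :* w) :* u := a :* (w :* (w :* u))) refl (2 + j) w (w ^ suc j))))
        ... | inj₂ w≤x = ≤-trans (subst (λ x → x ^ (3 + j) + (2 + j) * (w * w) * x ^ suc j ≤ (3 + j) * w * x ^ (2 + j)) (m+[n∸m]≡n w≤x)
                (factored (x ∸ w) (m≤n+o⇒m∸n≤o x w (subst (x ≤_) (cong (w +_) (+-identityʳ w)) x≤2w)))) (m≤m+n _ _)
          where
          factored : ∀ y → y ≤ w → (w + y) ^ (3 + j) + (2 + j) * (w * w) * (w + y) ^ suc j ≤ (3 + j) * w * (w + y) ^ (2 + j)
          factored y y≤w = let x = w + y in begin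
            x * (x * x ^ suc j) + (2 + j) * (w * w) * x ^ suc j
              ≡⟨ solve 4 (λ w y j u → let x = w :+ y in x :* (x :* u) :+ (con 2 :+ j) :* (w :* w) :* u
                   := u :* ((con 3 :+ j) :* (w :* w) :+ con 2 :* (w :* y) :+ y :* y)) refl w y j (x ^ suc j) ⟩
            x ^ suc j * ((3 + j) * (w * w) + 2 * (w * y) + y * y)
              ≤⟨ *-monoʳ-≤ (x ^ suc j) (+-monoʳ-≤ ((3 + j) * (w * w) + 2 * (w * y)) (≤-trans (*-monoˡ-≤ y y≤w) (m≤n+m (w * y) (j * (w * y))))) ⟩
            x ^ suc j * ((3 + j) * (w * w) + 2 * (w * y) + (j * (w * y) + w * y))
              ≡⟨ solve 4 (λ w y j u → let x = w :+ y in u :* ((con 3 :+ j) :* (w :* w) :+ con 2 :* (w :* y) :+ (j :* (w :* y) :+ w :* y))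
                   := (con 3 :+ j) :* w :* (x :* u)) refl w y j (x ^ suc j) ⟩
            (3 + j) * w * x ^ (2 + j) ∎
        base : ∀ x → x ≤ 2 * w → x ^ (3 + j) + (2 + j) * (w * w) * x ^ suc j ≤ W * count (2 + j) x + (2 + j) * w ^ (3 + j)
        base x x≤2w = ≤-trans (base′ x x≤2w) (+-monoˡ-≤ _ (≤-trans
          (denominator-count (suc j) (count (suc j) x) x (volume (suc j) x))
          (*-monoʳ-≤ W (count-mono-k (suc j) x))))
        step : ∀ x → x ^ (3 + j) + (2 + j) * (w * w) * x ^ suc j ≤ W * count (2 + j) x + (2 + j) * w ^ (3 + j) →
          (x + 2 * w) ^ (3 + j) + (2 + j) * (w * w) * (x + 2 * w) ^ suc j ≤ W * count (2 + j) (x + 2 * w) + (2 + j) * w ^ (3 + j)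
        step x ih = begin
          y ^ (3 + j) + (2 + j) * (w * w) * y ^ suc j
            ≤⟨ trapezoid⁺ (suc j) x w ⟩
          x ^ (3 + j) + (2 + j) * (w * w) * x ^ suc j + (3 + j) * w * (y ^ (2 + j) + x ^ (2 + j))
            ≡⟨ cong (x ^ (3 + j) + (2 + j) * (w * w) * x ^ suc j +_) (*-distribˡ-+ ((3 + j) * w) (y ^ (2 + j)) (x ^ (2 + j))) ⟩
          x ^ (3 + j) + (2 + j) * (w * w) * x ^ suc j + ((3 + j) * w * y ^ (2 + j) + (3 + j) * w * x ^ (2 + j))
            ≤⟨ +-mono-≤ ih (+-mono-≤ (denominator-count (suc j) (count (suc j) y) y (volume (suc j) y))
                                     (denominator-count (suc j) (count (suc j) x) x (volume (suc j) x))) ⟩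
          W * count (2 + j) x + V + (W * count (suc j) y + W * count (suc j) x)
            ≡⟨ solve 5 (λ W V a b c → W :* a :+ V :+ (W :* b :+ W :* c) := W :* (b :+ c :+ a) :+ V) refl W V (count (2 + j) x) (count (suc j) y) (count (suc j) x) ⟩
          W * (count (suc j) y + count (suc j) x + count (2 + j) x) + V
            ≡⟨ cong (λ z → W * z + V) (count-step (suc j) x) ⟨
          W * count (2 + j) y + V ∎
          where
          y = x + 2 * w
          V = (2 + j) * w ^ (3 + j)

  module CountBound where
    open ≤-Reasoning
    open +-*-Solver

    ^-distribʳ-* : ∀ n a b → (a * b) ^ n ≡ a ^ n * b ^ n
    ^-distribʳ-* zero    a b = refl
    ^-distribʳ-* (suc n) a b = trans (cong (a * b *_) (^-distribʳ-* n a b))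
      (solve 4 (λ a b u v → a :* b :* (u :* v) := a :* u :* (b :* v)) refl a b (a ^ n) (b ^ n))

    module _ (d n N : ℕ) (2≤d : 2 ≤ d) where
      open Counting d
      private
        d>0 : 0 < d
        d>0 = ≤-trans (s≤s z≤n) 2≤d
      open Counting d using () renaming (denominator to denominatorᵈ)
      W : ℕ → ℕ
      W = denominatorᵈ d>0

      module _ (bound : ∀ k → count k n ≤ N) where
        private
          via : ∀ k t → rising n t ≤ W t * count k n → rising n t ≤ W t * N
          via k t h = ≤-trans h (*-monoʳ-≤ (W t) (bound k))

          d^ : ∀ i {j} → d ^ i ≤ d ^ (j + i)
          d^ i {j} = ^-monoʳ-≤ d {{>-nonZero d>0}} (m≤n+m i j)

        case-2 : 2 * (d * d) + 2 * d ≤ n → rising n 2 ≤ W 2 * N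
        case-2 h = via 2 2 (subst (λ n → rising n 2 ≤ W 2 * count 2 n) n≡ (begin
            1 * (n′ + 0) * (n′ + 1)
              ≡⟨ solve 1 (λ n → con 1 :* (n :+ con 0) :* (n :+ con 1) := n :* n :+ n) refl n′ ⟩
            n′ * n′ + n′
              ≤⟨ +-monoʳ-≤ (n′ * n′) excess ⟩
            n′ * n′ + 2 * (y * y)
              ≡⟨ solve 2 (λ a b → a :* a :+ con 2 :* (b :* b) := a :* (a :* con 1) :+ con 2 :* (b :* (b :* con 1))) refl n′ y ⟩
            n′ ^ 2 + 2 * y ^ 2
              ≤⟨ two-layers d>0 1 y ⟩
            W 2 * count 2 n′ ∎))
          where
          y = n ∸ 2 * d ^ 2
          n′ = y + 2 * d ^ 2
          d²≡ : 2 * d ^ 2 ≡ 2 * (d * d)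
          d²≡ = cong (λ z → 2 * (d * z)) (*-identityʳ d)
          n≡ : n′ ≡ n
          n≡ = m∸n+n≡m (≤-trans (≤-reflexive d²≡) (≤-trans (m≤m+n _ (2 * d)) h))
          2d≤y : 2 * d ≤ y
          2d≤y = ≤-trans (≤-reflexive (sym (m+n∸m≡n (2 * (d * d)) (2 * d)))) (≤-trans (∸-monoˡ-≤ (2 * (d * d)) h) (≤-reflexive (cong (n ∸_) (sym d²≡))))
          y>0 : 0 < y
          y>0 = ≤-trans (*-mono-≤ {1} {2} (s≤s z≤n) d>0) 2d≤y
          excess : n′ ≤ 2 * (y * y)
          excess = begin
            y + 2 * d ^ 2              ≡⟨ cong (y +_) d²≡ ⟩
            y + 2 * (d * d)            ≤⟨ +-mono-≤ (m≤m*n y y {{>-nonZero y>0}}) (m≤m+n (2 * (d * d)) (2 * (d * d))) ⟩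
            y * y + (2 * (d * d) + 2 * (d * d)) ≡⟨ cong (y * y +_) (solve 1 (λ d → con 2 :* (d :* d) :+ con 2 :* (d :* d) := con 2 :* d :* (con 2 :* d)) refl d) ⟩
            y * y + 2 * d * (2 * d)    ≤⟨ +-monoʳ-≤ (y * y) (*-mono-≤ 2d≤y 2d≤y) ⟩
            y * y + y * y              ≡⟨ solve 1 (λ a → a :+ a := con 2 :* a) refl (y * y) ⟩
            2 * (y * y)                ∎

        case-3-low : 5 ≤ d → d ^ 3 ≤ n → 2 * n ≤ d ^ 4 → rising n 3 ≤ W 3 * N
        case-3-low 5≤d d³≤n 2n≤d⁴ = via 2 3 (+-cancelʳ-≤ (2 * w ^ 3) _ _ (begin
            rising n 3 + 2 * w ^ 3
              ≡⟨ cong (_+ 2 * w ^ 3) (solve 1 (λ n → con 1 :* (n :+ con 0) :* (n :+ con 1) :* (n :+ con 2) := n :* (n :* (n :* con 1)) :+ (con 3 :* (n :* n) :+ con 2 :* n)) refl n) ⟩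
            n ^ 3 + (3 * (n * n) + 2 * n) + 2 * w ^ 3
              ≡⟨ +-assoc (n ^ 3) _ _ ⟩
            n ^ 3 + (3 * (n * n) + 2 * n + 2 * w ^ 3)
              ≤⟨ +-monoʳ-≤ (n ^ 3) (*-cancelˡ-≤ 2 twice) ⟩
            n ^ 3 + 2 * (w * w) * n ^ 1
              ≤⟨ volume⁺ d>0 0 n ⟩
            W 3 * count 2 n + 2 * w ^ 3 ∎))
          where
          w = d ^ 2
          twice : 2 * (3 * (n * n) + 2 * n + 2 * w ^ 3) ≤ 2 * (2 * (w * w) * n ^ 1)
          twice = begin
            2 * (3 * (n * n) + 2 * n + 2 * w ^ 3)
              ≡⟨ solve 2 (λ n d → con 2 :* (con 3 :* (n :* n) :+ con 2 :* n :+ con 2 :* ((d :^ 2) :^ 3))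
                   := con 3 :* n :* (con 2 :* n) :+ (con 4 :* n :+ con 4 :* (d :^ 3 :* d :^ 3))) refl n d ⟩
            3 * n * (2 * n) + (4 * n + 4 * (d ^ 3 * d ^ 3))
              ≤⟨ +-mono-≤ (*-monoʳ-≤ (3 * n) 2n≤d⁴) (+-mono-≤ (*-monoˡ-≤ n 4≤d³) (*-monoʳ-≤ 4 (*-monoʳ-≤ (d ^ 3) d³≤n))) ⟩
            3 * n * d ^ 4 + (d ^ 3 * n + 4 * (d ^ 3 * n))
              ≡⟨ solve 2 (λ n d → con 3 :* n :* (d :^ 4) :+ (d :^ 3 :* n :+ con 4 :* (d :^ 3 :* n)) := con 3 :* n :* (d :^ 4) :+ con 5 :* (d :^ 3 :* n)) refl n d ⟩
            3 * n * d ^ 4 + 5 * (d ^ 3 * n)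
              ≤⟨ +-monoʳ-≤ (3 * n * d ^ 4) (*-monoˡ-≤ (d ^ 3 * n) 5≤d) ⟩
            3 * n * d ^ 4 + d * (d ^ 3 * n)
              ≡⟨ solve 2 (λ n d → con 3 :* n :* (d :^ 4) :+ d :* (d :^ 3 :* n) := con 2 :* (con 2 :* (d :^ 2 :* d :^ 2) :* (n :* con 1))) refl n d ⟩
            2 * (2 * (w * w) * n ^ 1) ∎
            where
            4≤d³ : 4 ≤ d ^ 3
            4≤d³ = ≤-trans (m≤m+n 4 121) (^-monoˡ-≤ 3 5≤d)

        case-3-high : 5 ≤ d → d ^ 4 ≤ 2 * n → rising n 3 ≤ W 3 * N
        case-3-high 5≤d d⁴≤2n = via 3 3 (subst (λ n → rising n 3 ≤ W 3 * count 3 n) n≡ (begin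
            rising n′ 3
              ≡⟨ solve 1 (λ n → con 1 :* (n :+ con 0) :* (n :+ con 1) :* (n :+ con 2) := n :* (n :* (n :* con 1)) :+ (con 3 :* (n :* n) :+ con 2 :* n)) refl n′ ⟩
            n′ ^ 3 + (3 * (n′ * n′) + 2 * n′)
              ≤⟨ +-monoʳ-≤ (n′ ^ 3) (subst (λ n → 3 * (n * n) + 2 * n ≤ 2 * y ^ 3) (sym n≡) excess) ⟩
            n′ ^ 3 + 2 * y ^ 3
              ≤⟨ two-layers d>0 2 y ⟩
            W 3 * count 3 n′ ∎))
          where
          y = n ∸ 2 * d ^ 3
          n′ = y + 2 * d ^ 3
          5d³≤2n : 5 * d ^ 3 ≤ 2 * n
          5d³≤2n = ≤-trans (*-monoˡ-≤ (d ^ 3) 5≤d) d⁴≤2n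
          10d³≤4n : 10 * d ^ 3 ≤ 4 * n
          10d³≤4n = subst₂ _≤_ (sym (*-assoc 2 5 (d ^ 3))) (sym (*-assoc 2 2 n)) (*-monoʳ-≤ 2 5d³≤2n)
          n≡ : n′ ≡ n
          n≡ = m∸n+n≡m (*-cancelˡ-≤ {2 * d ^ 3} {n} 5 (subst (_≤ 5 * n) (*-assoc 5 2 (d ^ 3)) (≤-trans 10d³≤4n (*-monoˡ-≤ n (n≤1+n 4)))))
          n≤5y : n ≤ 5 * y
          n≤5y = begin
            n                          ≡⟨ m+n∸m≡n (4 * n) n ⟨
            4 * n + n ∸ 4 * n          ≡⟨ cong (_∸ 4 * n) (+-comm (4 * n) n) ⟩
            5 * n ∸ 4 * n              ≤⟨ ∸-monoʳ-≤ (5 * n) 10d³≤4n ⟩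
            5 * n ∸ 10 * d ^ 3         ≡⟨ cong (5 * n ∸_) (*-assoc 5 2 (d ^ 3)) ⟩
            5 * n ∸ 5 * (2 * d ^ 3)    ≡⟨ *-distribˡ-∸ 5 n (2 * d ^ 3) ⟨
            5 * y                      ∎
          250≤n : 250 ≤ n
          250≤n = *-cancelˡ-≤ 2 (≤-trans (m≤m+n 500 125) (≤-trans (^-monoˡ-≤ 4 5≤d) d⁴≤2n))
          excess : 3 * (n * n) + 2 * n ≤ 2 * y ^ 3
          excess = *-cancelˡ-≤ 125 (begin
            125 * (3 * (n * n) + 2 * n)
              ≡⟨ solve 1 (λ n → con 125 :* (con 3 :* (n :* n) :+ con 2 :* n) := con 375 :* (n :* n) :+ con 250 :* n) refl n ⟩
            375 * (n * n) + 250 * n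
              ≤⟨ +-monoʳ-≤ (375 * (n * n)) (*-monoˡ-≤ n 250≤n) ⟩
            375 * (n * n) + n * n
              ≡⟨ solve 1 (λ m → con 375 :* m :+ m := con 376 :* m) refl (n * n) ⟩
            376 * (n * n)
              ≤⟨ *-monoˡ-≤ (n * n) (≤-trans (m≤m+n 376 124) (*-monoʳ-≤ 2 250≤n)) ⟩
            2 * n * (n * n)
              ≤⟨ *-mono-≤ (*-monoʳ-≤ 2 n≤5y) (*-mono-≤ n≤5y n≤5y) ⟩
            2 * (5 * y) * (5 * y * (5 * y))
              ≡⟨ solve 1 (λ y → con 2 :* (con 5 :* y) :* (con 5 :* y :* (con 5 :* y)) := con 125 :* (con 2 :* (y :* (y :* (y :* con 1))))) refl y ⟩
            125 * (2 * y ^ 3) ∎)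

        private
          from-volume⁺ : ∀ j → let w = d ^ (2 + j) in
            rising n (3 + j) + (2 + j) * w ^ (3 + j) ≤ n ^ (3 + j) + (2 + j) * (w * w) * n ^ suc j → rising n (3 + j) ≤ W (3 + j) * N
          from-volume⁺ j h = via (2 + j) (3 + j) (+-cancelʳ-≤ _ _ _ (≤-trans h (volume⁺ d>0 j n)))

        case-4 : 3 ≤ d → d ^ 4 ≤ n → n ≤ d ^ 5 → rising n 4 ≤ W 4 * N
        case-4 3≤d d⁴≤n n≤d⁵ = from-volume⁺ 1 (begin
            rising n 4 + 3 * w ^ 4
              ≡⟨ solve 2 (λ n d → con 1 :* (n :+ con 0) :* (n :+ con 1) :* (n :+ con 2) :* (n :+ con 3) :+ con 3 :* ((d :^ 3) :^ 4)
                   := n :^ 4 :+ (con 6 :* n :* (n :* n) :+ (con 11 :* (n :* n) :+ con 6 :* n) :+ con 3 :* (d :^ 4 :* (d :^ 4 :* d :^ 4)))) refl n d ⟩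
            n ^ 4 + (6 * n * (n * n) + (11 * (n * n) + 6 * n) + 3 * (d ^ 4 * (d ^ 4 * d ^ 4)))
              ≤⟨ +-monoʳ-≤ (n ^ 4) (+-mono-≤ (+-mono-≤ (*-monoˡ-≤ (n * n) (*-monoʳ-≤ 6 n≤d⁵))
                   (+-monoʳ-≤ (11 * (n * n)) (*-monoʳ-≤ 6 (m≤m*n n n {{>-nonZero n>0}}))))
                   (*-monoʳ-≤ 3 (*-monoʳ-≤ (d ^ 4) (*-mono-≤ d⁴≤n d⁴≤n)))) ⟩
            n ^ 4 + (6 * d ^ 5 * (n * n) + (11 * (n * n) + 6 * (n * n)) + 3 * (d ^ 4 * (n * n)))
              ≡⟨ solve 2 (λ n d → n :^ 4 :+ (con 6 :* d :^ 5 :* (n :* n) :+ (con 11 :* (n :* n) :+ con 6 :* (n :* n)) :+ con 3 :* (d :^ 4 :* (n :* n)))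
                   := n :^ 4 :+ (con 6 :* d :^ 5 :+ (con 17 :+ con 3 :* d :^ 4)) :* (n :* n)) refl n d ⟩
            n ^ 4 + (6 * d ^ 5 + (17 + 3 * d ^ 4)) * (n * n)
              ≤⟨ +-monoʳ-≤ (n ^ 4) (*-monoˡ-≤ (n * n) coefficients) ⟩
            n ^ 4 + 3 * d ^ 6 * (n * n)
              ≡⟨ solve 2 (λ n d → n :^ 4 :+ con 3 :* d :^ 6 :* (n :* n) := n :^ 4 :+ con 3 :* (d :^ 3 :* d :^ 3) :* n :^ 2) refl n d ⟩
            n ^ 4 + 3 * (w * w) * n ^ 2 ∎)
          where
          w = d ^ 3
          n>0 : 0 < n
          n>0 = ≤-trans (d^k>0 d>0 4) d⁴≤n
          coefficients : 6 * d ^ 5 + (17 + 3 * d ^ 4) ≤ 3 * d ^ 6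
          coefficients = begin
            6 * d ^ 5 + (17 + 3 * d ^ 4)       ≤⟨ +-monoʳ-≤ (6 * d ^ 5) (+-monoˡ-≤ (3 * d ^ 4) (≤-trans (m≤m+n 17 64) (^-monoˡ-≤ 4 3≤d))) ⟩
            6 * d ^ 5 + (d ^ 4 + 3 * d ^ 4)    ≡⟨ solve 1 (λ d → con 6 :* d :^ 5 :+ (d :^ 4 :+ con 3 :* d :^ 4) := con 6 :* d :^ 5 :+ con 4 :* d :^ 4) refl d ⟩
            6 * d ^ 5 + 4 * d ^ 4              ≤⟨ +-monoʳ-≤ (6 * d ^ 5) (*-monoˡ-≤ (d ^ 4) (≤-trans (m≤m+n 4 5) (*-monoʳ-≤ 3 3≤d))) ⟩
            6 * d ^ 5 + 3 * d * d ^ 4          ≡⟨ solve 1 (λ d → con 6 :* d :^ 5 :+ con 3 :* d :* d :^ 4 := con 3 :* (con 3 :* d :^ 5)) refl d ⟩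
            3 * (3 * d ^ 5)                    ≤⟨ *-monoʳ-≤ 3 (*-monoˡ-≤ (d ^ 5) 3≤d) ⟩
            3 * d ^ 6                          ∎

        case-5 : d ^ 5 ≤ n → n ≤ d ^ 6 → rising n 5 ≤ W 5 * N
        case-5 d⁵≤n n≤d⁶ = from-volume⁺ 2 (begin
            rising n 5 + 4 * w ^ 5
              ≡⟨ solve 2 (λ n d → con 1 :* (n :+ con 0) :* (n :+ con 1) :* (n :+ con 2) :* (n :+ con 3) :* (n :+ con 4) :+ con 4 :* ((d :^ 4) :^ 5)
                   := n :^ 5 :+ (con 10 :* n :* n :^ 3 :+ (con 35 :* n :^ 3 :+ con 50 :* (n :* n) :+ con 24 :* n) :+ con 4 :* (d :^ 5 :* (d :^ 5) :^ 3))) refl n d ⟩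
            n ^ 5 + (10 * n * n ^ 3 + (35 * n ^ 3 + 50 * (n * n) + 24 * n) + 4 * (d ^ 5 * (d ^ 5) ^ 3))
              ≤⟨ +-monoʳ-≤ (n ^ 5) (+-mono-≤ (+-mono-≤ (*-monoˡ-≤ (n ^ 3) (*-monoʳ-≤ 10 n≤d⁶))
                   (+-mono-≤ (+-monoʳ-≤ (35 * n ^ 3) (*-monoˡ-≤ (n * n) (≤-trans (m≤m+n 50 14) (*-monoʳ-≤ 2 32≤n))))
                             (≤-trans (*-monoˡ-≤ n (≤-trans (m≤m+n 24 8) 32≤n)) (m≤m*n (n * n) n {{>-nonZero n>0}}))))
                   (*-monoʳ-≤ 4 (*-monoʳ-≤ (d ^ 5) (^-monoˡ-≤ 3 d⁵≤n)))) ⟩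
            n ^ 5 + (10 * d ^ 6 * n ^ 3 + (35 * n ^ 3 + 2 * n * (n * n) + n * n * n) + 4 * (d ^ 5 * n ^ 3))
              ≡⟨ solve 2 (λ n d → n :^ 5 :+ (con 10 :* d :^ 6 :* n :^ 3 :+ (con 35 :* n :^ 3 :+ con 2 :* n :* (n :* n) :+ n :* n :* n) :+ con 4 :* (d :^ 5 :* n :^ 3))
                   := n :^ 5 :+ (con 10 :* d :^ 6 :+ (con 38 :+ con 4 :* d :^ 5)) :* n :^ 3) refl n d ⟩
            n ^ 5 + (10 * d ^ 6 + (38 + 4 * d ^ 5)) * n ^ 3
              ≤⟨ +-monoʳ-≤ (n ^ 5) (*-monoˡ-≤ (n ^ 3) coefficients) ⟩
            n ^ 5 + 4 * d ^ 8 * n ^ 3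
              ≡⟨ solve 2 (λ n d → n :^ 5 :+ con 4 :* d :^ 8 :* n :^ 3 := n :^ 5 :+ con 4 :* (d :^ 4 :* d :^ 4) :* n :^ 3) refl n d ⟩
            n ^ 5 + 4 * (w * w) * n ^ 3 ∎)
          where
          w = d ^ 4
          32≤d⁵ : 32 ≤ d ^ 5
          32≤d⁵ = ^-monoˡ-≤ 5 2≤d
          32≤n : 32 ≤ n
          32≤n = ≤-trans 32≤d⁵ d⁵≤n
          n>0 : 0 < n
          n>0 = ≤-trans (s≤s z≤n) 32≤n
          coefficients : 10 * d ^ 6 + (38 + 4 * d ^ 5) ≤ 4 * d ^ 8
          coefficients = begin
            10 * d ^ 6 + (38 + 4 * d ^ 5)       ≤⟨ +-monoʳ-≤ (10 * d ^ 6) (+-monoˡ-≤ (4 * d ^ 5) (≤-trans (m≤m+n 38 26) (*-monoʳ-≤ 2 32≤d⁵))) ⟩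
            10 * d ^ 6 + (2 * d ^ 5 + 4 * d ^ 5) ≡⟨ solve 1 (λ d → con 10 :* d :^ 6 :+ (con 2 :* d :^ 5 :+ con 4 :* d :^ 5) := con 10 :* d :^ 6 :+ con 6 :* d :^ 5) refl d ⟩
            10 * d ^ 6 + 6 * d ^ 5              ≤⟨ +-monoʳ-≤ (10 * d ^ 6) (*-monoʳ-≤ 6 (d^ 5 {1})) ⟩
            10 * d ^ 6 + 6 * d ^ 6              ≡⟨ solve 1 (λ a → con 10 :* a :+ con 6 :* a := con 4 :* (con 4 :* a)) refl (d ^ 6) ⟩
            4 * (4 * d ^ 6)                     ≤⟨ *-monoʳ-≤ 4 (*-monoˡ-≤ (d ^ 6) (*-mono-≤ 2≤d 2≤d)) ⟩
            4 * (d * d * d ^ 6)                 ≡⟨ cong (4 *_) (*-assoc d d (d ^ 6)) ⟩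
            4 * d ^ 8                           ∎

        -- t = s + 6
        case-6 : ∀ s → d ^ (6 + s) ≤ n → n ≤ d ^ (7 + s) → rising n (6 + s) ≤ W (6 + s) * N
        case-6 s dᵗ≤n n≤dᵗ = from-volume⁺ (3 + s) (begin
            rising n t + (5 + s) * w ^ t
              ≤⟨ +-monoˡ-≤ _ (rising-≤ n (5 + s) (≤-trans (t²≤2ᵗ s) (≤-trans (^-monoˡ-≤ t 2≤d) dᵗ≤n))) ⟩
            n ^ t + t * (5 + s) * n ^ (5 + s) + (5 + s) * w ^ t
              ≡⟨ solve 6 (λ t s a n u v → a :+ t :* s :* (n :* u) :+ s :* v := a :+ s :* (t :* n :* u :+ v)) refl t (5 + s) (n ^ t) n (n ^ (4 + s)) (w ^ t) ⟩
            n ^ t + (5 + s) * (t * n * n ^ (4 + s) + w ^ t)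
              ≤⟨ +-monoʳ-≤ (n ^ t) (*-monoʳ-≤ (5 + s) (*-cancelˡ-≤ {t * n * n ^ (4 + s) + w ^ t} {w * w * n ^ (4 + s)} 16 scaled)) ⟩
            n ^ t + (5 + s) * (w * w * n ^ (4 + s))
              ≡⟨ cong (n ^ t +_) (sym (*-assoc (5 + s) (w * w) (n ^ (4 + s)))) ⟩
            n ^ t + (5 + s) * (w * w) * n ^ (4 + s) ∎)
          where
          t = 6 + s
          w = d ^ (5 + s)
          t²≤2ᵗ : ∀ s → (6 + s) * (5 + s) ≤ 2 ^ (6 + s)
          t²≤2ᵗ zero    = m≤m+n 30 34
          t²≤2ᵗ (suc s) = begin
            (7 + s) * (6 + s)        ≤⟨ m≤m+n _ ((3 + s) * (6 + s)) ⟩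
            (7 + s) * (6 + s) + (3 + s) * (6 + s) ≡⟨ solve 1 (λ s → (con 7 :+ s) :* (con 6 :+ s) :+ (con 3 :+ s) :* (con 6 :+ s) := con 2 :* ((con 6 :+ s) :* (con 5 :+ s))) refl s ⟩
            2 * ((6 + s) * (5 + s))  ≤⟨ *-monoʳ-≤ 2 (t²≤2ᵗ s) ⟩
            2 ^ (7 + s)              ∎
          16t≤15d : ∀ s → 16 * (6 + s) ≤ 15 * d ^ (3 + s)
          16t≤15d zero    = ≤-trans (m≤m+n 96 24) (*-monoʳ-≤ 15 (^-monoˡ-≤ 3 2≤d))
          16t≤15d (suc s) = begin
            16 * (7 + s)              ≤⟨ *-monoʳ-≤ 16 (m≤m+n (7 + s) (5 + s)) ⟩
            16 * (7 + s + (5 + s))    ≡⟨ solve 1 (λ s → con 16 :* (con 7 :+ s :+ (con 5 :+ s)) := con 2 :* (con 16 :* (con 6 :+ s))) refl s ⟩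
            2 * (16 * (6 + s))        ≤⟨ *-mono-≤ 2≤d (16t≤15d s) ⟩
            d * (15 * d ^ (3 + s))    ≡⟨ solve 2 (λ d u → d :* (con 15 :* u) := con 15 :* (d :* u)) refl d (d ^ (3 + s)) ⟩
            15 * d ^ (4 + s)          ∎
          16tn≤15w² : 16 * t * n ≤ 15 * (w * w)
          16tn≤15w² = begin
            16 * t * n                     ≤⟨ *-mono-≤ (16t≤15d s) n≤dᵗ ⟩
            15 * d ^ (3 + s) * d ^ (7 + s) ≡⟨ solve 2 (λ d u → con 15 :* (d :* (d :* (d :* u))) :* (d :* (d :* (d :* (d :* (d :* (d :* (d :* u))))))) := con 15 :* ((d :* (d :* (d :* (d :* (d :* u))))) :* (d :* (d :* (d :* (d :* (d :* u))))))) refl d (d ^ s) ⟩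
            15 * (w * w)                   ∎
          2w≤n : 2 * w ≤ n
          2w≤n = ≤-trans (*-monoˡ-≤ w 2≤d) dᵗ≤n
          16≤2^ : 16 ≤ 2 ^ (4 + s)
          16≤2^ = ^-monoʳ-≤ 2 {4} {4 + s} (m≤m+n 4 s)
          16w≤n : 16 * w ^ (4 + s) ≤ n ^ (4 + s)
          16w≤n = ≤-trans (*-monoˡ-≤ (w ^ (4 + s)) 16≤2^) (≤-trans (≤-reflexive (sym (^-distribʳ-* (4 + s) 2 w))) (^-monoˡ-≤ (4 + s) 2w≤n))
          scaled : 16 * (t * n * n ^ (4 + s) + w ^ t) ≤ 16 * (w * w * n ^ (4 + s))
          scaled = begin
            16 * (t * n * n ^ (4 + s) + w ^ t)
              ≡⟨ solve 5 (λ t n u w v → con 16 :* (t :* n :* u :+ w :* (w :* v)) := con 16 :* t :* n :* u :+ w :* w :* (con 16 :* v)) refl t n (n ^ (4 + s)) w (w ^ (4 + s)) ⟩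
            16 * t * n * n ^ (4 + s) + w * w * (16 * w ^ (4 + s))
              ≤⟨ +-mono-≤ (*-monoˡ-≤ (n ^ (4 + s)) 16tn≤15w²) (*-monoʳ-≤ (w * w) 16w≤n) ⟩
            15 * (w * w) * n ^ (4 + s) + w * w * n ^ (4 + s)
              ≡⟨ solve 2 (λ a b → con 15 :* a :* b :+ a :* b := con 16 :* (a :* b)) refl (w * w) (n ^ (4 + s)) ⟩
            16 * (w * w * n ^ (4 + s)) ∎

  _mod_ : ℕ → ℕ → ℕ
  x mod zero    = x
  x mod (suc n) = x % suc n

  module FiniteChecks where

    ∧-split : ∀ {a b} → T (a ∧ b) → T a × T b
    ∧-split = Equivalence.to T-∧

    ∨-split : ∀ {a b} → T (a ∨ b) → T a ⊎ T b
    ∨-split = Equivalence.to T-∨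

    allFrom : ℕ → ℕ → (ℕ → Bool) → Bool
    allFrom zero    x P = true
    allFrom (suc u) x P = P x ∧ allFrom u (suc x) P

    allFrom-sound : ∀ u x P → T (allFrom u x P) → ∀ y → x ≤ y → y < x + u → T (P y)
    allFrom-sound zero    x P h y x≤y y<x = ⊥-elim (<⇒≱ y<x (≤-trans (≤-reflexive (+-identityʳ x)) x≤y))
    allFrom-sound (suc u) x P h y x≤y y<x with m≤n⇒m<n∨m≡n x≤y
    ... | inj₁ x<y  = allFrom-sound u (suc x) P (proj₂ (∧-split h)) y x<y (≤-trans y<x (≤-reflexive (+-suc x u)))
    ... | inj₂ refl = proj₁ (∧-split h)

    allWhile : ℕ → ℕ → (G P : ℕ → Bool) → Bool
    allWhile zero    x G P = false
    allWhile (suc u) x G P = if G x then P x ∧ allWhile u (suc x) G P else true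

    allWhile-sound : ∀ u x G P → T (allWhile u x G P) → ∀ y → x ≤ y → (∀ z → z ≤ y → T (G z)) → T (P y)
    allWhile-sound (suc u) x G P h y x≤y g with G x in eq
    ... | false = ⊥-elim (subst T eq (g x x≤y))
    ... | true with m≤n⇒m<n∨m≡n x≤y
    ...   | inj₁ x<y  = allWhile-sound u (suc x) G P (proj₂ (∧-split h)) y x<y g
    ...   | inj₂ refl = proj₁ (∧-split h)

    anyBelow : ℕ → (ℕ → Bool) → Bool
    anyBelow zero    P = false
    anyBelow (suc u) P = P u ∨ anyBelow u P

    anyBelow-sound : ∀ u P → T (anyBelow u P) → ∃[ x ] T (P x)
    anyBelow-sound (suc u) P h with ∨-split {P u} h
    ... | inj₁ p = u , p
    ... | inj₂ p = anyBelow-sound u P p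

    larger : ℕ → ℕ → ℕ
    larger x y = if x <ᵇ y then y else x

    larger-lub : ∀ x {y z} → x ≤ z → y ≤ z → larger x y ≤ z
    larger-lub x {y} x≤z y≤z with x <ᵇ y
    ... | true  = y≤z
    ... | false = x≤z

    -- Matching on the number evaluates it once for all its uses in P.
    shared : ℕ → (ℕ → Bool) → Bool
    shared zero    P = P zero
    shared (suc x) P = P (suc x)

    shared-sound : ∀ x P → T (shared x P) → T (P x)
    shared-sound zero    P h = h
    shared-sound (suc x) P h = h

    module _ (d : ℕ) where
      open Counting d

      denominatorᵇ : ℕ → ℕ
      denominatorᵇ zero    = 1
      denominatorᵇ (suc k) = denominatorᵇ k * (suc k * d ^ k)

      denominatorᵇ≡ : ∀ d>0 k → denominatorᵇ k ≡ denominator d>0 k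
      denominatorᵇ≡ d>0 zero    = refl
      denominatorᵇ≡ d>0 (suc k) = cong (_* (suc k * d ^ k)) (denominatorᵇ≡ d>0 k)

      fits : ℕ → ℕ → ℕ → Bool
      fits t n k = rising n t ≤ᵇ denominatorᵇ t * count k n

      module _ (n m N : ℕ) where
        isShort : (a₀ a₁ a₂ b₀ b₁ b₂ : ℕ) → Bool
        isShort a₀ a₁ a₂ b₀ b₁ b₂ =
          (∣ a₀ - b₀ ∣ + ∣ a₁ - b₁ ∣ * d + ∣ a₂ - b₂ ∣ * (d * d) <ᵇ n) ∧
          (((a₀ + a₁ * m + a₂ * (m * m)) mod N ≡ᵇ (b₀ + b₁ * m + b₂ * (m * m)) mod N) ∧
          not ((a₁ ≡ᵇ b₁) ∧ (a₂ ≡ᵇ b₂)))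

        shortFor : ℕ → ℕ → Bool
        shortFor c₁ c₂ =
          let r = (c₁ * m + c₂ * (m * m)) mod N
              s = (c₁ * m + (N ∸ (c₂ * (m * m)) mod N)) mod N
          in isShort 0 c₁ c₂ r 0 0 ∨ (isShort (N ∸ r) c₁ c₂ 0 0 0 ∨ (isShort 0 c₁ 0 s 0 c₂ ∨ isShort (N ∸ s) c₁ 0 0 0 c₂))

        hasShort : ℕ → ℕ → Bool
        hasShort v u = anyBelow v λ c₁ → anyBelow u (shortFor c₁)

        NoShort : Set
        NoShort = ∀ a₀ a₁ a₂ b₀ b₁ b₂ → ∣ a₀ - b₀ ∣ + ∣ a₁ - b₁ ∣ * d + ∣ a₂ - b₂ ∣ * (d * d) < n →
          (a₀ + a₁ * m + a₂ * (m * m)) mod N ≡ (b₀ + b₁ * m + b₂ * (m * m)) mod N → a₁ ≡ b₁ × a₂ ≡ b₂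

        isShort-sound : NoShort → ∀ a₀ a₁ a₂ b₀ b₁ b₂ → ¬ T (isShort a₀ a₁ a₂ b₀ b₁ b₂)
        isShort-sound ns a₀ a₁ a₂ b₀ b₁ b₂ h with ∧-split h
        ... | h₁ , h₂ with ∧-split h₂
        ...   | h₃ , h₄ with ns a₀ a₁ a₂ b₀ b₁ b₂ (<ᵇ⇒< _ n h₁) (≡ᵇ⇒≡ _ _ h₃)
        ...     | refl , refl = contradiction h₄
          where
          contradiction : ¬ T (not ((a₁ ≡ᵇ a₁) ∧ (a₂ ≡ᵇ a₂)))
          contradiction h with (a₁ ≡ᵇ a₁) | ≡⇒≡ᵇ a₁ a₁ refl | (a₂ ≡ᵇ a₂) | ≡⇒≡ᵇ a₂ a₂ refl
          contradiction () | true | _ | true | _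

        hasShort-sound : NoShort → ∀ v u → ¬ T (hasShort v u)
        hasShort-sound ns v u h with anyBelow-sound v (λ c₁ → anyBelow u (shortFor c₁)) h
        ... | c₁ , h₁ with anyBelow-sound u (shortFor c₁) h₁
        ...   | c₂ , h₂ = none _ _ _ _
                  (isShort-sound ns 0 c₁ c₂ r 0 0) (isShort-sound ns (N ∸ r) c₁ c₂ 0 0 0)
                  (isShort-sound ns 0 c₁ 0 s 0 c₂) (isShort-sound ns (N ∸ s) c₁ 0 0 0 c₂) h₂
          where
          r = (c₁ * m + c₂ * (m * m)) mod N
          s = (c₁ * m + (N ∸ (c₂ * (m * m)) mod N)) mod N
          none : ∀ a b c d → ¬ T a → ¬ T b → ¬ T c → ¬ T d → ¬ T (a ∨ (b ∨ (c ∨ d)))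
          none true  _     _     _    ¬a _ _ _ h = ¬a h
          none false true  _     _    _ ¬b _ _ h = ¬b h
          none false false true  _    _ _ ¬c _ h = ¬c h
          none false false false true _ _ _ ¬d h = ¬d h

      module _ (t v u n : ℕ) where
        -- The range of q is that of d = ⌈2 log_q n⌉.
        inRange : ℕ → Bool
        inRange q = q ^ (d ∸ 1) <ᵇ n * n

        checkOrder : ℕ → ℕ → ℕ → Bool
        checkOrder m qⁿ N = not (qⁿ mod N ≡ᵇ 1 mod N) ∨ hasShort n m N v u

        checkOrders : ℕ → ℕ → Bool
        checkOrders m qⁿ = allWhile (rising n t) (larger (count 1 n) (count 2 n)) (λ N → denominatorᵇ t * N <ᵇ rising n t) (checkOrder m qⁿ)

        checkField : ℕ → Bool
        checkField q = (q ^ d <ᵇ n * n) ∨ shared (q ^ n) (checkOrders (q ^ ⌈ d /2⌉))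

        check : Bool
        check = allWhile (n * n) 2 inRange checkField

        module _ (d>0 : 0 < d) (h : T check) where
          check-sound : ∀ q N → 2 ≤ q → n * n ≤ q ^ d → q ^ (d ∸ 1) < n * n →
            (∀ k → count k n ≤ N) → (q ^ n) mod N ≡ 1 mod N → NoShort n (q ^ ⌈ d /2⌉) N →
            rising n t ≤ denominator d>0 t * N
          check-sound q N 2≤q n²≤qᵈ qᵈ⁻¹<n² bound qⁿ≡1 ns = ≮⇒≥ λ lt → absurd (subst (λ w → w * N < rising n t) (sym (denominatorᵇ≡ d>0 t)) lt)
            where
            absurd : ¬ denominatorᵇ t * N < rising n t
            absurd lt with ∨-split {q ^ d <ᵇ n * n} {shared (q ^ n) (checkOrders (q ^ ⌈ d /2⌉))} (allWhile-sound (n * n) 2 inRange checkField h q 2≤q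
                              (λ z z≤q → <⇒<ᵇ (≤-<-trans (^-monoˡ-≤ (d ∸ 1) z≤q) qᵈ⁻¹<n²)))
            ... | inj₁ q<  = <⇒≱ (<ᵇ⇒< _ _ q<) n²≤qᵈ
            ... | inj₂ h₁ with ∨-split {not ((q ^ n) mod N ≡ᵇ 1 mod N)} {hasShort n (q ^ ⌈ d /2⌉) N v u} (allWhile-sound (rising n t) (larger (count 1 n) (count 2 n)) _ (checkOrder (q ^ ⌈ d /2⌉) (q ^ n))
                                (shared-sound (q ^ n) (checkOrders (q ^ ⌈ d /2⌉)) h₁) N (larger-lub (count 1 n) (bound 1) (bound 2))
                              (λ z z≤N → <⇒<ᵇ (≤-<-trans (*-monoʳ-≤ (denominatorᵇ t) z≤N) lt)))
            ...   | inj₂ s = hasShort-sound n (q ^ ⌈ d /2⌉) N ns v u s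
            ...   | inj₁ ne with ((q ^ n) mod N ≡ᵇ 1 mod N) | ≡⇒≡ᵇ _ _ qⁿ≡1
            ...     | true | _ = ne

      fits-sound : ∀ t n {N} (d>0 : 0 < d) k → (∀ k → count k n ≤ N) → T (fits t n k) → rising n t ≤ denominator d>0 t * N
      fits-sound t n {N} d>0 k bound h = ≤-trans (≤ᵇ⇒≤ _ _ h)
        (≤-trans (*-monoʳ-≤ (denominatorᵇ t) (bound k)) (≤-reflexive (cong (_* N) (denominatorᵇ≡ d>0 t))))

    fitsSome : ℕ → ℕ → ℕ → Bool
    fitsSome d t n = fits d t n 2 ∨ fits d t n 3

    fitsSome-sound : ∀ {d t n N} (d>0 : 0 < d) → (∀ k → Counting.count d k n ≤ N) → T (fitsSome d t n) →
      rising n t ≤ Counting.denominator d d>0 t * N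
    fitsSome-sound {d} {t} {n} d>0 bound h with ∨-split {fits d t n 2} h
    ... | inj₁ h₂ = fits-sound d t n d>0 2 bound h₂
    ... | inj₂ h₃ = fits-sound d t n d>0 3 bound h₃

    row₃ : ℕ → ℕ → Bool
    row₃ d n = fitsSome d 3 n ∨ check d 3 64 4 n

    row₃-sound : ∀ d n → T (row₃ d n) → T (fitsSome d 3 n) ⊎ T (check d 3 64 4 n)
    row₃-sound d n = ∨-split

    band small₃ : ℕ → Bool
    band d = allFrom (d * d + 2 * d) (d * d) (check d 2 64 1)
    small₃ d = allFrom (d ^ 4 ∸ d ^ 3) (d ^ 3) (row₃ d)

    -- Unlike T b, this type does not evaluate b.
    record Holds (b : Bool) : Set where
      constructor holds
      field proof : T b

    allFrom-holds : ∀ u x P → Holds (allFrom u x P) → ∀ y → x ≤ y → y < x + u → T (P y)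
    allFrom-holds u x P (holds h) = allFrom-sound u x P h

    opaque
      band-checked : Holds (allFrom 19 2 band)
      band-checked = holds tt

      small₃-checked : Holds (allFrom 3 2 small₃)
      small₃-checked = holds tt

      small₄-checked : Holds (allFrom 16 16 (fitsSome 2 4))
      small₄-checked = holds tt

  open FiniteChecks
  open CountBound using (case-2; case-3-low; case-3-high; case-4; case-5; case-6)

  module LowerBound where
    open ≤-Reasoning
    open +-*-Solver

    band-edge : ℕ → ℕ
    band-edge d = 2 * (d * d) + 2 * d

    band-edge-growth : ∀ d → 5 ≤ d → band-edge (suc d) * band-edge (suc d) ≤ 2 * (band-edge d * band-edge d)
    band-edge-growth d 5≤d = begin
      band-edge (suc d) * band-edge (suc d)
        ≡⟨ solve 1 (λ d → let e = con 1 :+ d ; b = con 2 :* (e :* e) :+ con 2 :* e in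
             b :* b := con 4 :* (e :* e) :* (d :* d :+ (con 4 :* d :+ con 4))) refl d ⟩
      4 * (suc d * suc d) * (d * d + (4 * d + 4))
        ≤⟨ *-monoʳ-≤ (4 * (suc d * suc d)) (+-monoʳ-≤ (d * d) (≤-trans (+-monoʳ-≤ (4 * d) (≤-trans (n≤1+n 4) 5≤d))
             (≤-trans (≤-reflexive (+-comm (4 * d) d)) (*-monoˡ-≤ d 5≤d)))) ⟩
      4 * (suc d * suc d) * (d * d + d * d)
        ≡⟨ solve 1 (λ d → let e = con 1 :+ d ; b = con 2 :* (d :* d) :+ con 2 :* d in
             con 4 :* (e :* e) :* (d :* d :+ d :* d) := con 2 :* (b :* b)) refl d ⟩
      2 * (band-edge d * band-edge d) ∎

    exponential-beats : ∀ s → band-edge (s + 21) * band-edge (s + 21) ≤ 2 ^ (s + 20)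
    exponential-beats zero    = ≤ᵇ⇒≤ _ _ _
    exponential-beats (suc s) = ≤-trans (band-edge-growth (s + 21) (≤-trans (m≤n+m 5 16) (m≤n+m 21 s)))
      (*-monoʳ-≤ 2 (exponential-beats s))

    module _ (d n N q : ℕ) (2≤d : 2 ≤ d) (2≤q : 2 ≤ q) (n²≤qᵈ : n * n ≤ q ^ d) (qᵈ⁻¹<n² : q ^ (d ∸ 1) < n * n)
      (bound : ∀ k → Counting.count d k n ≤ N) (qⁿ≡1 : (q ^ n) mod N ≡ 1 mod N) (ns : NoShort d n (q ^ ⌈ d /2⌉) N) where

      private
        d>0 : 0 < d
        d>0 = ≤-trans (s≤s z≤n) 2≤d
        W = Counting.denominator d d>0

        checked : ∀ t u → T (check d t 64 u n) → rising n t ≤ W t * N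
        checked t u h = check-sound d t 64 u n d>0 h q N 2≤q n²≤qᵈ qᵈ⁻¹<n² bound qⁿ≡1 ns

        beats-at : ∀ d → 21 ≤ d → band-edge d * band-edge d ≤ 2 ^ (d ∸ 1)
        beats-at d 21≤d = subst (λ d → band-edge d * band-edge d ≤ 2 ^ (d ∸ 1)) (m∸n+n≡m 21≤d)
          (subst (λ k → band-edge (d ∸ 21 + 21) * band-edge (d ∸ 21 + 21) ≤ 2 ^ k) (sym (+-∸-assoc (d ∸ 21) {21} {1} (s≤s z≤n))) (exponential-beats (d ∸ 21)))

        bound-2 : d * d ≤ n → rising n 2 ≤ W 2 * N
        bound-2 d²≤n with ≤-total (2 * (d * d) + 2 * d) n
        ... | inj₁ large = case-2 d n N 2≤d bound large
        ... | inj₂ small with <-≤-connex n (2 * (d * d) + 2 * d)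
        ...   | inj₂ large = case-2 d n N 2≤d bound large
        ...   | inj₁ n< with <-≤-connex d 21
        ...     | inj₁ d<21 = checked 2 1 (allFrom-sound (d * d + 2 * d) (d * d) (check d 2 64 1)
                    (allFrom-holds 19 2 band band-checked d 2≤d d<21) n d²≤n
                    (≤-trans n< (≤-reflexive (solve 1 (λ d → con 2 :* (d :* d) :+ con 2 :* d := d :* d :+ (d :* d :+ con 2 :* d)) refl d))))
        ...     | inj₂ 21≤d = ⊥-elim (<-irrefl refl (begin-strict
                    n * n ≤⟨ *-mono-≤ small small ⟩
                    band-edge d * band-edge d ≤⟨ beats-at d 21≤d ⟩
                    2 ^ (d ∸ 1) ≤⟨ ^-monoˡ-≤ (d ∸ 1) 2≤q ⟩
                    q ^ (d ∸ 1) <⟨ qᵈ⁻¹<n² ⟩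
                    n * n ∎))

        row₃-holds : d ^ 3 ≤ n → n < d ^ 4 → d < 5 → T (row₃ d n)
        row₃-holds d³≤n n<d⁴ d<5 = allFrom-sound (d ^ 4 ∸ d ^ 3) (d ^ 3) (row₃ d)
          (allFrom-holds 3 2 small₃ small₃-checked d 2≤d d<5) n d³≤n (≤-trans n<d⁴ (m≤n+m∸n (d ^ 4) (d ^ 3)))

        bound-3 : d ^ 3 ≤ n → n < d ^ 4 → rising n 3 ≤ W 3 * N
        bound-3 d³≤n n<d⁴ =
          [ (λ d<5 → [ fitsSome-sound {d} {3} {n} d>0 bound , checked 3 4 ]′ (row₃-sound d n (row₃-holds d³≤n n<d⁴ d<5)))
          , (λ 5≤d → [ case-3-low d n N 2≤d bound 5≤d d³≤n , case-3-high d n N 2≤d bound 5≤d ]′ (≤-total (2 * n) (d ^ 4)))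
          ]′ (<-≤-connex d 5)

        bound-4 : d ^ 4 ≤ n → n < d ^ 5 → rising n 4 ≤ W 4 * N
        bound-4 d⁴≤n n<d⁵ with m≤n⇒m<n∨m≡n 2≤d
        ... | inj₁ 3≤d  = case-4 d n N 2≤d bound 3≤d d⁴≤n (<⇒≤ n<d⁵)
        ... | inj₂ refl = fitsSome-sound {2} {4} {n} d>0 bound (allFrom-holds 16 16 (fitsSome 2 4) small₄-checked n d⁴≤n n<d⁵)

      lower-bound : ∀ t → d ^ t ≤ n → n < d ^ suc t → rising n t ≤ W t * N
      lower-bound 0 lo hi = ≤-trans (≤-trans lo (bound 0)) (≤-reflexive (sym (*-identityˡ N)))
      lower-bound 1 lo hi = ≤-trans (≤-reflexive (solve 1 (λ n → con 1 :* (n :+ con 0) := n) refl n))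
        (≤-trans (bound 0) (≤-reflexive (sym (*-identityˡ N))))
      lower-bound 2 lo hi = bound-2 (≤-trans (≤-reflexive (cong (d *_) (sym (*-identityʳ d)))) lo)
      lower-bound 3 lo hi = bound-3 lo hi
      lower-bound 4 lo hi = bound-4 lo hi
      lower-bound 5 lo hi = case-5 d n N 2≤d bound lo (<⇒≤ hi)
      lower-bound (suc (suc (suc (suc (suc (suc s)))))) lo hi = case-6 d n N 2≤d bound s lo (<⇒≤ hi)

  module Pigeonhole where
    unique-lookup : ∀ {A : Set} {xs : List A} → Unique xs → ∀ i j → lookup xs i ≡ lookup xs j → i ≡ j
    unique-lookup (x∉ ∷ u) zero    zero    e = refl
    unique-lookup {xs = x ∷ xs} (x∉ ∷ u) zero    (suc j) e = ⊥-elim (All.lookup x∉ (∈-lookup {xs = xs} j) e)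
    unique-lookup {xs = x ∷ xs} (x∉ ∷ u) (suc i) zero    e = ⊥-elim (All.lookup x∉ (∈-lookup {xs = xs} i) (sym e))
    unique-lookup (x∉ ∷ u) (suc i) (suc j) e = cong suc (unique-lookup u i j e)

    length-≤ : ∀ {A : Set} {xs : List A} N → 1 ≤ N → Unique xs → (f : A → ℕ) →
      (∀ i j → f (lookup xs i) mod N ≡ f (lookup xs j) mod N → lookup xs i ≡ lookup xs j) → length xs ≤ N
    length-≤ {xs = xs} (suc N) _ u f inj = Finₚ.injective⇒≤
      {f = λ i → fromℕ< (m%n<n (f (lookup xs i)) (suc N))}
      (λ {i} {j} e → unique-lookup u i j (inj i j (Finₚ.fromℕ<-injective _ _ (m%n<n (f (lookup xs i)) (suc N)) (m%n<n (f (lookup xs j)) (suc N)) e)))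

  Point : ℕ → Set
  Point zero    = ℕ
  Point (suc k) = Point k × ℕ

  distance : ℕ → ∀ k → Point k → Point k → ℕ
  distance d zero    a       b       = ∣ a - b ∣
  distance d (suc k) (p , x) (q , y) = distance d k p q + ∣ x - y ∣ * d ^ suc k

  exponent : ℕ → ∀ k → Point k → ℕ
  exponent m zero    a       = a
  exponent m (suc k) (p , x) = exponent m k p + x * m ^ suc k

  module Anticode (d n : ℕ) (d>0 : 0 < d) where
    open ≤-Reasoning
    open +-*-Solver
    open Counting d

    -- The coordinates jᵢ of `count` are stored as n + jᵢ.
    layerPoints : ∀ {k} → ℕ → (ℕ → ℕ → List (Point k)) → ℕ → ℕ → ℕ → ℕ → List (Point (suc k))
    layerPoints zero    f w j s ν = []
    layerPoints (suc u) f w j s ν = if 2 * w <ᵇ ν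
      then List.map (_, n + j) (f (s + w) (ν ∸ 2 * w)) ++ List.map (_, n ∸ j) (f (s + w) (ν ∸ 2 * w)) ++ layerPoints u f w (suc j) (s + w) (ν ∸ 2 * w)
      else []

    points : ∀ k → ℕ → ℕ → List (Point k)
    points zero    s ν = List.map (s +_) (upTo ν)
    points (suc k) s ν = List.map (_, n) (points k s ν) ++ layerPoints ν (points k) (d ^ suc k) 1 s ν

    layerPoints-length : ∀ {k} (f : ℕ → ℕ → List (Point k)) (g : ℕ → ℕ) → (∀ s ν → length (f s ν) ≡ g ν) →
      ∀ u w j s ν → length (layerPoints u f w j s ν) ≡ 2 * layers u g (2 * w) ν
    layerPoints-length f g eq zero    w j s ν = refl
    layerPoints-length f g eq (suc u) w j s ν with 2 * w <ᵇ ν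
    ... | false = refl
    ... | true  = trans (Listₚ.length-++ (List.map (_, n + j) xs))
        (trans (cong₂ _+_ (trans (Listₚ.length-map _ xs) (eq _ _))
          (trans (Listₚ.length-++ (List.map (_, n ∸ j) xs)) (cong₂ _+_ (trans (Listₚ.length-map _ xs) (eq _ _))
            (layerPoints-length f g eq u w (suc j) (s + w) (ν ∸ 2 * w)))))
        (solve 2 (λ a b → a :+ (a :+ con 2 :* b) := con 2 :* (a :+ b)) refl (g (ν ∸ 2 * w)) (layers u g (2 * w) (ν ∸ 2 * w))))
      where xs = f (s + w) (ν ∸ 2 * w)

    points-length : ∀ k s ν → length (points k s ν) ≡ count k ν
    points-length zero    s ν = trans (Listₚ.length-map (s +_) (upTo ν)) (Listₚ.length-upTo ν)
    points-length (suc k) s ν = trans (Listₚ.length-++ (List.map (_, n) (points k s ν)))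
      (cong₂ _+_ (trans (Listₚ.length-map _ (points k s ν)) (points-length k s ν))
        (layerPoints-length (points k) (count k) (points-length k) ν (d ^ suc k) 1 s ν))

    Inside : ∀ k → ℕ → Point k → Set
    Inside zero    t a       = t ≤ a × a + t < n
    Inside (suc k) t (p , x) = Inside k (t + ∣ x - n ∣ * d ^ suc k) p

    Inside-distance : ∀ k t u p q → Inside k t p → Inside k u q → distance d k p q + (t + u) < n
    Inside-distance zero    t u a b (t≤a , a+t<n) (u≤b , b+u<n) with ≤-total a b
    ... | inj₁ a≤b = begin-strict
          ∣ a - b ∣ + (t + u)  ≡⟨ cong (_+ (t + u)) (m≤n⇒∣m-n∣≡n∸m a≤b) ⟩
          b ∸ a + (t + u)      ≤⟨ +-monoʳ-≤ (b ∸ a) (+-monoˡ-≤ u t≤a) ⟩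
          b ∸ a + (a + u)      ≡⟨ +-assoc (b ∸ a) a u ⟨
          b ∸ a + a + u        ≡⟨ cong (_+ u) (m∸n+n≡m a≤b) ⟩
          b + u                <⟨ b+u<n ⟩
          n                    ∎
    ... | inj₂ b≤a = begin-strict
          ∣ a - b ∣ + (t + u)  ≡⟨ cong₂ _+_ (trans (∣-∣-comm a b) (m≤n⇒∣m-n∣≡n∸m b≤a)) (+-comm t u) ⟩
          a ∸ b + (u + t)      ≤⟨ +-monoʳ-≤ (a ∸ b) (+-monoˡ-≤ t u≤b) ⟩
          a ∸ b + (b + t)      ≡⟨ +-assoc (a ∸ b) b t ⟨
          a ∸ b + b + t        ≡⟨ cong (_+ t) (m∸n+n≡m b≤a) ⟩
          a + t                <⟨ a+t<n ⟩
          n                    ∎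
    Inside-distance (suc k) t u (p , x) (q , y) hp hq = begin-strict
      distance d k p q + ∣ x - y ∣ * w + (t + u)
        ≤⟨ +-monoˡ-≤ (t + u) (+-monoʳ-≤ (distance d k p q) (*-monoˡ-≤ w (≤-trans (∣-∣-triangle x n y) (≤-reflexive (cong (∣ x - n ∣ +_) (∣-∣-comm n y)))))) ⟩
      distance d k p q + (∣ x - n ∣ + ∣ y - n ∣) * w + (t + u)
        ≡⟨ solve 6 (λ D x y w t u → D :+ (x :+ y) :* w :+ (t :+ u) := D :+ ((t :+ x :* w) :+ (u :+ y :* w))) refl (distance d k p q) ∣ x - n ∣ ∣ y - n ∣ w t u ⟩
      distance d k p q + ((t + ∣ x - n ∣ * w) + (u + ∣ y - n ∣ * w))
        <⟨ Inside-distance k _ _ p q hp hq ⟩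
      n ∎
      where w = d ^ suc k

    Centred : ℕ → ℕ → Set
    Centred s ν = s + ν + s ≡ n

    private
      Centred-step : ∀ s ν w → 2 * w < ν → Centred s ν → Centred (s + w) (ν ∸ 2 * w)
      Centred-step s ν w lt c = trans (solve 3 (λ s w y → s :+ w :+ y :+ (s :+ w) := s :+ (y :+ con 2 :* w) :+ s) refl s w (ν ∸ 2 * w))
        (trans (cong (λ z → s + z + s) (m∸n+n≡m (<⇒≤ lt))) c)

      ∣n+j-n∣ : ∀ j → ∣ n + j - n ∣ ≡ j
      ∣n+j-n∣ j = trans (∣-∣-comm (n + j) n) (∣m-m+n∣≡n n j)

      ∣n∸j-n∣ : ∀ j → j ≤ n → ∣ n ∸ j - n ∣ ≡ j
      ∣n∸j-n∣ j j≤n = trans (m≤n⇒∣m-n∣≡n∸m (m∸n≤m n j)) (m∸[m∸n]≡n j≤n)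

      small-index : ∀ s ν w j → 2 * w < ν → Centred s ν → j ≤ suc s → j ≤ n
      small-index s ν w j lt c j≤ = ≤-trans j≤ (≤-trans (≤-reflexive (+-comm 1 s)) (≤-trans (+-monoʳ-≤ s (≤-trans (s≤s z≤n) lt)) (≤-trans (m≤m+n (s + ν) s) (≤-reflexive c))))

      <ᵇ-true : ∀ a b → (a <ᵇ b) ≡ true → a < b
      <ᵇ-true a b eq = <ᵇ⇒< a b (subst T (sym eq) _)

    disjoint-by : ∀ {A : Set} {xs ys : List A} {P Q : A → Set} → All P xs → All Q ys → (∀ {x} → P x → Q x → ⊥) → Disjoint xs ys
    disjoint-by ps qs contra (x∈xs , x∈ys) = contra (All.lookup ps x∈xs) (All.lookup qs x∈ys)

    last-is : ∀ {k} (y : ℕ) (xs : List (Point k)) → All (λ p → proj₂ p ≡ y) (List.map (_, y) xs)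
    last-is y xs = Allₚ.map⁺ (All.universal (λ _ → refl) xs)

    module _ {k : ℕ} (f : ℕ → ℕ → List (Point k)) (w : ℕ) (w>0 : 0 < w) where
      layers-inside : (w ≡ d ^ suc k) → (∀ s ν → Centred s ν → All (Inside k s) (f s ν)) →
        ∀ u s₀ j s ν → Centred s ν → s₀ + j * w ≡ s + w → j ≤ suc s → All (Inside (suc k) s₀) (layerPoints u f w j s ν)
      layers-inside w≡ inside zero    s₀ j s ν c e j≤ = []
      layers-inside refl inside (suc u) s₀ j s ν c e j≤ with 2 * w <ᵇ ν in lt
      ... | false = []
      ... | true  = Allₚ.++⁺ (Allₚ.map⁺ (All.map (λ {p} → subst (λ t → Inside k t p) (at (n + j) (∣n+j-n∣ j))) ih))
            (Allₚ.++⁺ (Allₚ.map⁺ (All.map (λ {p} → subst (λ t → Inside k t p) (at (n ∸ j) (∣n∸j-n∣ j (small-index s ν w j lt′ c j≤)))) ih))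
              (layers-inside refl inside u s₀ (suc j) (s + w) (ν ∸ 2 * w) c′
                (trans (solve 3 (λ a j w → a :+ (w :+ j :* w) := a :+ j :* w :+ w) refl s₀ j w) (cong (_+ w) e))
                (≤-trans (s≤s j≤) (≤-trans (≤-reflexive (+-comm 1 (suc s))) (+-monoʳ-≤ (suc s) w>0)))))
        where
        lt′ = <ᵇ-true (2 * w) ν lt
        c′ = Centred-step s ν w lt′ c
        ih = inside (s + w) (ν ∸ 2 * w) c′
        at : ∀ x → ∣ x - n ∣ ≡ j → s + w ≡ s₀ + ∣ x - n ∣ * w
        at x eq = sym (trans (cong (λ z → s₀ + z * w) eq) e)

      layers-far : ∀ u j s ν → Centred s ν → j ≤ suc s → All (λ p → j ≤ ∣ proj₂ p - n ∣) (layerPoints u f w j s ν)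
      layers-far zero    j s ν c j≤ = []
      layers-far (suc u) j s ν c j≤ with 2 * w <ᵇ ν in lt
      ... | false = []
      ... | true  = Allₚ.++⁺ (All.map (λ { refl → ≤-reflexive (sym (∣n+j-n∣ j)) }) (last-is (n + j) xs))
            (Allₚ.++⁺ (All.map (λ { refl → ≤-reflexive (sym (∣n∸j-n∣ j (small-index s ν w j lt′ c j≤))) }) (last-is (n ∸ j) xs))
              (All.map (≤-trans (n≤1+n j)) (layers-far u (suc j) (s + w) (ν ∸ 2 * w) (Centred-step s ν w lt′ c)
                (≤-trans (s≤s j≤) (≤-trans (≤-reflexive (+-comm 1 (suc s))) (+-monoʳ-≤ (suc s) w>0))))))
        where
        lt′ = <ᵇ-true (2 * w) ν lt
        xs = f (s + w) (ν ∸ 2 * w)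

      layers-unique : (∀ s ν → Centred s ν → Unique (f s ν)) →
        ∀ u j s ν → Centred s ν → j ≤ suc s → 1 ≤ j → Unique (layerPoints u f w j s ν)
      layers-unique uniq zero    j s ν c j≤ 1≤j = []
      layers-unique uniq (suc u) j s ν c j≤ 1≤j with 2 * w <ᵇ ν in lt
      ... | false = []
      ... | true  = Uniqueₚ.++⁺ (Uniqueₚ.map⁺ (cong proj₁) (uniq _ _ c′))
            (Uniqueₚ.++⁺ (Uniqueₚ.map⁺ (cong proj₁) (uniq _ _ c′)) (layers-unique uniq u (suc j) (s + w) (ν ∸ 2 * w) c′ j≤′ (s≤s z≤n))
              (disjoint-by (last-is (n ∸ j) xs) far (λ { refl j< → <-irrefl (sym (∣n∸j-n∣ j j≤n)) j< })))
            (disjoint-by {Q = λ p → proj₂ p ≡ n ∸ j ⊎ suc j ≤ ∣ proj₂ p - n ∣} (last-is (n + j) xs) (Allₚ.++⁺ (All.map inj₁ (last-is (n ∸ j) xs)) (All.map inj₂ far)) λ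
              { refl (inj₁ e)  → <-irrefl (sym e) (≤-<-trans (m∸n≤m n j) (m<m+n n 1≤j))
              ; refl (inj₂ j<) → <-irrefl (sym (∣n+j-n∣ j)) j< })
        where
        lt′ = <ᵇ-true (2 * w) ν lt
        c′ = Centred-step s ν w lt′ c
        j≤n = small-index s ν w j lt′ c j≤
        j≤′ = ≤-trans (s≤s j≤) (≤-trans (≤-reflexive (+-comm 1 (suc s))) (+-monoʳ-≤ (suc s) w>0))
        xs = f (s + w) (ν ∸ 2 * w)
        far = layers-far u (suc j) (s + w) (ν ∸ 2 * w) c′ j≤′

    points-inside : ∀ k s ν → Centred s ν → All (Inside k s) (points k s ν)
    points-inside zero    s ν c = Allₚ.map⁺ (All.map (λ {i} i<ν → m≤m+n s i , ≤-trans (+-monoˡ-< s (+-monoʳ-< s i<ν)) (≤-reflexive c)) (Allₚ.all-upTo ν))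
    points-inside (suc k) s ν c = Allₚ.++⁺
      (Allₚ.map⁺ (All.map (λ {p} → subst (λ t → Inside k t p) (sym (trans (cong (λ z → s + z * d ^ suc k) (∣n-n∣≡0 n)) (+-identityʳ s)))) (points-inside k s ν c)))
      (layers-inside (points k) (d ^ suc k) (d^k>0 d>0 (suc k)) refl (points-inside k) ν s 1 s ν c (cong (s +_) (+-identityʳ _)) (s≤s z≤n))

    points-unique : ∀ k s ν → Centred s ν → Unique (points k s ν)
    points-unique zero    s ν c = Uniqueₚ.map⁺ (+-cancelˡ-≡ s _ _) (Uniqueₚ.upTo⁺ ν)
    points-unique (suc k) s ν c = Uniqueₚ.++⁺ (Uniqueₚ.map⁺ (cong proj₁) (points-unique k s ν c))
      (layers-unique (points k) w w>0 (points-unique k) ν 1 s ν c (s≤s z≤n) (s≤s z≤n))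
      (disjoint-by (last-is n (points k s ν)) (layers-far (points k) w w>0 ν 1 s ν c (s≤s z≤n))
        (λ { refl 1≤ → <-irrefl (sym (∣n-n∣≡0 n)) 1≤ }))
      where
      w = d ^ suc k
      w>0 = d^k>0 d>0 (suc k)

    module _ (m N : ℕ) (1≤N : 1 ≤ N)
      (separated : ∀ k p q → distance d k p q < n → exponent m k p mod N ≡ exponent m k q mod N → p ≡ q) where

      count-≤ : ∀ k → count k n ≤ N
      count-≤ k = subst (_≤ N) (points-length k 0 n) (Pigeonhole.length-≤ N 1≤N (points-unique k 0 n centred) (exponent m k)
        λ i j → separated k _ _ (≤-trans (≤-reflexive (cong suc (sym (+-identityʳ _))))
          (Inside-distance k 0 0 _ _ (All.lookup inside (∈-lookup {xs = points k 0 n} i)) (All.lookup inside (∈-lookup {xs = points k 0 n} j)))))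
        where
        centred : Centred 0 n
        centred = +-identityʳ n
        inside = points-inside k 0 n centred

      noShort : FiniteChecks.NoShort d n m N
      noShort a₀ a₁ a₂ b₀ b₁ b₂ short e = conclude (separated 2 ((a₀ , a₁) , a₂) ((b₀ , b₁) , b₂)
        (≤-trans (≤-reflexive (cong suc (solve 4 (λ x y z d → x :+ y :* (d :* con 1) :+ z :* (d :* (d :* con 1)) := x :+ y :* d :+ z :* (d :* d)) refl ∣ a₀ - b₀ ∣ ∣ a₁ - b₁ ∣ ∣ a₂ - b₂ ∣ d))) short)
        (trans (cong (_mod N) (expand a₀ a₁ a₂)) (trans e (cong (_mod N) (sym (expand b₀ b₁ b₂))))))
        where
        expand : ∀ a b c → a + b * (m * 1) + c * (m * (m * 1)) ≡ a + b * m + c * (m * m)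
        expand = solve 4 (λ m a b c → a :+ b :* (m :* con 1) :+ c :* (m :* (m :* con 1)) := a :+ b :* m :+ c :* (m :* m)) refl m
        conclude : ∀ {a₀ a₁ a₂ b₀ b₁ b₂} → _≡_ {A = Point 2} ((a₀ , a₁) , a₂) ((b₀ , b₁) , b₂) → a₁ ≡ b₁ × a₂ ≡ b₂
        conclude refl = refl , refl

  module Logarithms where
    open ≤-Reasoning

    half-exponent : ∀ {q n d e} → 1 ≤ q → IsCeilMulLog 2 q n d → IsCeilMulLog 1 q n e → e ≡ ⌈ d /2⌉
    half-exponent {q} {n} {d} {e} 1≤q (n²≤qᵈ , d-least) (n≤qᵉ , e-least) =
      ≤-antisym (e-least ⌈ d /2⌉ (≤-trans (≤-reflexive (*-identityʳ n)) (≮⇒≥ λ qʰ<n → <⇒≱ (*-mono-< qʰ<n qʰ<n) square≤)))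
        (≤-trans (⌈n/2⌉-mono (d-least (e + e) (begin
          n * (n * 1)       ≡⟨ cong (n *_) (*-identityʳ n) ⟩
          n * n             ≤⟨ *-mono-≤ n≤ n≤ ⟩
          q ^ e * q ^ e     ≡⟨ ^-distribˡ-+-* q e e ⟨
          q ^ (e + e)       ∎))) (≤-reflexive (sym (n≡⌈n+n/2⌉ e))))
      where
      n≤ : n ≤ q ^ e
      n≤ = ≤-trans (≤-reflexive (sym (*-identityʳ n))) n≤qᵉ
      square≤ : n * n ≤ q ^ ⌈ d /2⌉ * q ^ ⌈ d /2⌉
      square≤ = begin
        n * n                          ≡⟨ cong (n *_) (*-identityʳ n) ⟨
        n * (n * 1)                    ≤⟨ n²≤qᵈ ⟩
        q ^ d                          ≤⟨ ^-monoʳ-≤ q {{>-nonZero 1≤q}} (≤-trans (≤-reflexive (sym (⌊n/2⌋+⌈n/2⌉≡n d))) (+-monoˡ-≤ ⌈ d /2⌉ (⌊n/2⌋≤⌈n/2⌉ d))) ⟩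
        q ^ (⌈ d /2⌉ + ⌈ d /2⌉)        ≡⟨ ^-distribˡ-+-* q ⌈ d /2⌉ ⌈ d /2⌉ ⟩
        q ^ ⌈ d /2⌉ * q ^ ⌈ d /2⌉      ∎

    below-ceiling : ∀ {q n d} → 1 ≤ d → IsCeilMulLog 2 q n d → q ^ (d ∸ 1) < n * n
    below-ceiling {q} {n} {suc d} _ (_ , least) = ≰⇒> λ le → <-irrefl refl (least d (≤-trans (≤-reflexive (cong (n *_) (*-identityʳ n))) le))

    above-floor : ∀ {d n t} → IsFloorLog d n t → n < d ^ suc t
    above-floor {t = t} (_ , greatest) = ≰⇒> λ le → <-irrefl refl (greatest (suc t) le)

  module BoundConversion where
    open import Data.Integer.Base as ℤ using (+_)
    open ≤-Reasoning
    open +-*-Solver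

    rising-binomial : ∀ n t → rising (suc n) t ≡ t ! * ((n + t) C t)
    rising-binomial n zero    = refl
    rising-binomial n (suc t) = begin-equality
      rising (suc n) t * (suc n + t)               ≡⟨ cong (_* (suc n + t)) (rising-binomial n t) ⟩
      t ! * ((n + t) C t) * suc (n + t)            ≡⟨ solve 3 (λ a b c → a :* b :* c := a :* (c :* b)) refl (t !) ((n + t) C t) (suc (n + t)) ⟩
      t ! * (suc (n + t) * ((n + t) C t))          ≡⟨ cong (t ! *_) (BinomialCoefficients.absorption (n + t) t) ⟨
      t ! * (suc t * (suc (n + t) C suc t))        ≡⟨ cong (λ k → t ! * (suc t * (k C suc t))) (+-suc n t) ⟨
      t ! * (suc t * ((n + suc t) C suc t))        ≡⟨ solve 3 (λ a b c → a :* (b :* c) := b :* a :* c) refl (t !) (suc t) ((n + suc t) C suc t) ⟩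
      suc t ! * ((n + suc t) C suc t)              ∎

    product-snoc : ∀ h t → product (applyUpTo h (suc t)) ≡ product (applyUpTo h t) * h t
    product-snoc h zero    = *-comm (h 0) 1
    product-snoc h (suc t) = trans (cong (h 0 *_) (product-snoc (λ i → h (suc i)) t)) (sym (*-assoc (h 0) _ (h (suc t))))

    denominator-product : ∀ d d>0 t → Counting.denominator d d>0 t ≡ t ! * product (applyUpTo (d ^_) t)
    denominator-product d d>0 zero    = refl
    denominator-product d d>0 (suc t) = begin-equality
      Counting.denominator d d>0 t * (suc t * d ^ t)          ≡⟨ cong (_* (suc t * d ^ t)) (denominator-product d d>0 t) ⟩
      t ! * product (applyUpTo (d ^_) t) * (suc t * d ^ t)    ≡⟨ solve 4 (λ a b c e → a :* b :* (c :* e) := c :* a :* (b :* e)) refl (t !) (product (applyUpTo (d ^_) t)) (suc t) (d ^ t) ⟩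
      suc t ! * (product (applyUpTo (d ^_) t) * d ^ t)        ≡⟨ cong (suc t ! *_) (product-snoc (d ^_) t) ⟨
      suc t ! * product (applyUpTo (d ^_) (suc t))            ∎

    reciprocal-* : ∀ {a b} → 0 < a → 0 < b → reciprocal a ℚ.* reciprocal b ≡ reciprocal (a * b)
    reciprocal-* {suc a} {suc b} _ _ = ℚₚ.toℚᵘ-injective (ℚᵘₚ.≃-trans (ℚₚ.toℚᵘ-homo-* (reciprocal (suc a)) (reciprocal (suc b)))
      (ℚᵘₚ.≃-trans (ℚᵘₚ.*-cong (ℚₚ.toℚᵘ-fromℚᵘ (mkℚᵘ (+ 1) a)) (ℚₚ.toℚᵘ-fromℚᵘ (mkℚᵘ (+ 1) b)))
        (ℚᵘₚ.≃-trans (*≡* refl) (ℚᵘₚ.≃-sym (ℚₚ.toℚᵘ-fromℚᵘ (mkℚᵘ (+ 1) (b + a * suc b)))))))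

    reciprocal-product : ∀ (h : ℕ → ℕ) → (∀ i → 0 < h i) → ∀ (g : ℕ → ℕ) t →
      0 < product (applyUpTo (λ i → h (g i)) t) ×
      List.foldr ℚ._*_ 1ℚ (List.map (λ i → reciprocal (h i)) (applyUpTo g t)) ≡ reciprocal (product (applyUpTo (λ i → h (g i)) t))
    reciprocal-product h pos g zero    = s≤s z≤n , refl
    reciprocal-product h pos g (suc t) = let (q>0 , eq) = reciprocal-product h pos (λ i → g (suc i)) t in
      *-mono-≤ (pos (g 0)) q>0 , trans (cong (reciprocal (h (g 0)) ℚ.*_) eq) (reciprocal-* (pos (g 0)) q>0)

    fraction-≤ : ∀ {b P N} → 0 < P → b ≤ P * N → fromℕ b ℚ.* reciprocal P ℚ.≤ fromℕ N
    fraction-≤ {b} {suc P} {N} _ b≤ = ℚₚ.toℚᵘ-cancel-≤ (ℚᵘₚ.≤-trans (ℚᵘₚ.≤-reflexive (ℚᵘₚ.≃-trans (ℚₚ.toℚᵘ-homo-* (fromℕ b) (reciprocal (suc P)))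
        (ℚᵘₚ.*-cong (ℚₚ.toℚᵘ-fromℚᵘ (mkℚᵘ (+ b) 0)) (ℚₚ.toℚᵘ-fromℚᵘ (mkℚᵘ (+ 1) P)))))
      (ℚᵘₚ.≤-trans (*≤* (subst₂ ℤ._≤_ (sym (left b)) (sym (right N P)) (ℤ.+≤+ b≤))) (ℚᵘₚ.≤-reflexive (ℚᵘₚ.≃-sym (ℚₚ.toℚᵘ-fromℚᵘ (mkℚᵘ (+ N) 0))))))
      where
      left : ∀ b → + b ℤ.* + 1 ℤ.* + 1 ≡ + b
      left b = trans (ℤₚ.*-identityʳ (+ b ℤ.* + 1)) (ℤₚ.*-identityʳ (+ b))
      right : ∀ N P → + N ℤ.* + (1 * suc P) ≡ + (suc P * N)
      right N P = trans (sym (ℤₚ.pos-* N (1 * suc P))) (cong +_ (trans (*-comm N (1 * suc P)) (cong (_* N) (*-identityˡ (suc P)))))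

    orderBound-≤ : ∀ n t d N (d>0 : 0 < d) → 1 ≤ n → rising n t ≤ Counting.denominator d d>0 t * N → orderBound n t d ℚ.≤ fromℕ N
    orderBound-≤ (suc n) t d N d>0 _ le = let (P>0 , eq) = reciprocal-product (d ^_) (λ i → m^n>0 d {{>-nonZero d>0}} i) (λ i → i) t in
      subst (λ z → fromℕ ((n + t) C t) ℚ.* z ℚ.≤ fromℕ N) (sym eq) (fraction-≤ P>0
        (*-cancelˡ-≤ (t !) {{t !≢0}} (begin
          t ! * ((n + t) C t)                            ≡⟨ rising-binomial n t ⟨
          rising (suc n) t                               ≤⟨ le ⟩
          Counting.denominator d d>0 t * N               ≡⟨ cong (_* N) (denominator-product d d>0 t) ⟩
          t ! * product (applyUpTo (d ^_) t) * N         ≡⟨ *-assoc (t !) _ N ⟩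
          t ! * (product (applyUpTo (d ^_) t) * N)       ∎)))

  module Differences where
    open ≤-Reasoning
    open +-*-Solver

    differences : ∀ k → Point k → Point k → List (ℕ × ℕ) → List (ℕ × ℕ)
    differences zero    a       b       l = (a ∸ b , b ∸ a) ∷ l
    differences (suc k) (p , x) (q , y) l = differences k p q ((x ∸ y , y ∸ x) ∷ l)

    ∸-max : ∀ x y → x ∸ y + y ≡ y ∸ x + x
    ∸-max zero    zero    = refl
    ∸-max zero    (suc y) = sym (+-identityʳ (suc y))
    ∸-max (suc x) zero    = +-identityʳ (suc x)
    ∸-max (suc x) (suc y) = trans (+-suc (x ∸ y) y) (trans (cong suc (∸-max x y)) (sym (+-suc (y ∸ x) x)))

    ∣-∣≡∸+∸ : ∀ x y → x ∸ y + (y ∸ x) ≡ ∣ x - y ∣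
    ∣-∣≡∸+∸ zero    zero    = refl
    ∣-∣≡∸+∸ zero    (suc y) = refl
    ∣-∣≡∸+∸ (suc x) zero    = +-identityʳ (suc x)
    ∣-∣≡∸+∸ (suc x) (suc y) = ∣-∣≡∸+∸ x y

    exponent-differences : ∀ m k p q l →
      inBase m (List.map proj₁ (differences k p q l)) + exponent m k q + m ^ suc k * inBase m (List.map proj₂ l) ≡
      inBase m (List.map proj₂ (differences k p q l)) + exponent m k p + m ^ suc k * inBase m (List.map proj₁ l)
    exponent-differences m zero    a b l = begin-equality
        a ∸ b + m * A + b + m * 1 * B     ≡⟨ solve 5 (λ x m A b B → x :+ m :* A :+ b :+ m :* con 1 :* B := x :+ b :+ (m :* A :+ m :* B)) refl (a ∸ b) m A b B ⟩
        a ∸ b + b + (m * A + m * B)       ≡⟨ cong (_+ (m * A + m * B)) (∸-max a b) ⟩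
        b ∸ a + a + (m * A + m * B)       ≡⟨ solve 5 (λ x m A b B → x :+ b :+ (m :* A :+ m :* B) := x :+ m :* B :+ b :+ m :* con 1 :* A) refl (b ∸ a) m A a B ⟩
        b ∸ a + m * B + a + m * 1 * A     ∎
      where
      A = inBase m (List.map proj₁ l)
      B = inBase m (List.map proj₂ l)
    exponent-differences m (suc k) (p , x) (q , y) l = +-cancelʳ-≡ (M * (y ∸ x)) _ _ (begin-equality
        I + (Q + y * M) + m * M * B + M * (y ∸ x)    ≡⟨ solve 7 (λ I Q y M m B z → I :+ (Q :+ y :* M) :+ m :* M :* B :+ M :* z := I :+ Q :+ M :* (z :+ m :* B) :+ M :* y) refl I Q y M m B (y ∸ x) ⟩
        I + Q + M * (y ∸ x + m * B) + M * y          ≡⟨ cong (_+ M * y) (exponent-differences m k p q ((x ∸ y , y ∸ x) ∷ l)) ⟩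
        J + P + M * (x ∸ y + m * A) + M * y          ≡⟨ solve 7 (λ J P y M m A z → J :+ P :+ M :* (z :+ m :* A) :+ M :* y := J :+ P :+ m :* M :* A :+ M :* (z :+ y)) refl J P y M m A (x ∸ y) ⟩
        J + P + m * M * A + M * (x ∸ y + y)          ≡⟨ cong (λ z → J + P + m * M * A + M * z) (∸-max x y) ⟩
        J + P + m * M * A + M * (y ∸ x + x)          ≡⟨ solve 7 (λ J P x M m A z → J :+ P :+ m :* M :* A :+ M :* (z :+ x) := J :+ (P :+ x :* M) :+ m :* M :* A :+ M :* z) refl J P x M m A (y ∸ x) ⟩
        J + (P + x * M) + m * M * A + M * (y ∸ x)    ∎)
      where
      M = m ^ suc k
      A = inBase m (List.map proj₁ l)
      B = inBase m (List.map proj₂ l)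
      Q = exponent m k q
      P = exponent m k p
      I = inBase m (List.map proj₁ (differences k p q ((x ∸ y , y ∸ x) ∷ l)))
      J = inBase m (List.map proj₂ (differences k p q ((x ∸ y , y ∸ x) ∷ l)))

    differences-equal : ∀ k p q l → All (λ ab → proj₁ ab ≡ proj₂ ab) (differences k p q l) → p ≡ q × All (λ ab → proj₁ ab ≡ proj₂ ab) l
    differences-equal zero    a b l (e ∷ h) = +-cancelˡ-≡ (a ∸ b) a b (trans (cong (_+ a) e) (sym (∸-max a b))) , h
    differences-equal (suc k) (p , x) (q , y) l h with differences-equal k p q _ h
    ... | refl , e ∷ h′ = cong (p ,_) (+-cancelˡ-≡ (x ∸ y) x y (trans (cong (_+ x) e) (sym (∸-max x y)))) , h′

    module _ (D d : ℕ) (D≤d : D ≤ d) (weight : ℕ → List (ℕ × ℕ) → ℕ)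
      (weight-∷ : ∀ i a b l → weight i ((a , b) ∷ l) ≡ a * D ^ i + (b * D ^ i + weight (suc i) l)) where

      private
        step : ∀ i x y l → weight i ((x ∸ y , y ∸ x) ∷ l) ≤ ∣ x - y ∣ * d ^ i + weight (suc i) l
        step i x y l = begin
          weight i ((x ∸ y , y ∸ x) ∷ l)                              ≡⟨ weight-∷ i (x ∸ y) (y ∸ x) l ⟩
          (x ∸ y) * D ^ i + ((y ∸ x) * D ^ i + weight (suc i) l)      ≡⟨ solve 4 (λ a b c w → a :* c :+ (b :* c :+ w) := (a :+ b) :* c :+ w) refl (x ∸ y) (y ∸ x) (D ^ i) (weight (suc i) l) ⟩
          (x ∸ y + (y ∸ x)) * D ^ i + weight (suc i) l                ≤⟨ +-monoˡ-≤ (weight (suc i) l) (*-mono-≤ (≤-reflexive (∣-∣≡∸+∸ x y)) (^-monoˡ-≤ i D≤d)) ⟩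
          ∣ x - y ∣ * d ^ i + weight (suc i) l                        ∎

      weight-differences : ∀ k p q l → weight 0 (differences k p q l) ≤ distance d k p q + weight (suc k) l
      weight-differences zero    a b l = ≤-trans (step 0 a b l) (≤-reflexive (cong (_+ weight 1 l) (*-identityʳ ∣ a - b ∣)))
      weight-differences (suc k) (p , x) (q , y) l = ≤-trans (weight-differences k p q ((x ∸ y , y ∸ x) ∷ l))
        (≤-trans (+-monoʳ-≤ (distance d k p q) (step (suc k) x y l)) (≤-reflexive (sym (+-assoc (distance d k p q) _ _))))

open Arithmetic
open import Data.Integer.Base as ℤ using (ℤ; +_; -[1+_])

module RingTheory {c ℓ : Level} (R : CommutativeRing c ℓ) where
  open CommutativeRing R
  open RingProperties ring using (-0#≈0#; -‿distribˡ-*; -‿involutive; -‿+-comm)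
  open Exponentiation commutativeSemiring public
    using (_^_; ^-congˡ; ^-homo-*; ^-assocʳ; ^-distrib-*)
  open MonoidMult +-monoid public using (×-homo-+; ×-assocˡ) renaming (_×_ to _·_)
  open SetoidReasoning setoid

  private
    open OptimisedMult +-monoid using (1+×) renaming (_×_ to _∙_; ×-homo-+ to ∙-homo-+)

    fromℤ : ℤ → Carrier
    fromℤ (+ n)    = n ∙ 1#
    fromℤ -[1+ n ] = - (suc n ∙ 1#)

    ∙-homo-* : ∀ m n → (m ℕ.* n) ∙ 1# ≈ m ∙ 1# * n ∙ 1#
    ∙-homo-* zero    n = sym (zeroˡ _)
    ∙-homo-* (suc m) n = begin
      (n ℕ.+ m ℕ.* n) ∙ 1#              ≈⟨ ∙-homo-+ 1# n (m ℕ.* n) ⟩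
      n ∙ 1# + (m ℕ.* n) ∙ 1#           ≈⟨ +-cong (sym (*-identityˡ _)) (∙-homo-* m n) ⟩
      1# * n ∙ 1# + m ∙ 1# * n ∙ 1#     ≈⟨ distribʳ _ _ _ ⟨
      (1# + m ∙ 1#) * n ∙ 1#            ≈⟨ *-congʳ (1+× m 1#) ⟨
      suc m ∙ 1# * n ∙ 1#               ∎

    cancel-suc : ∀ x y → (1# + x) - (1# + y) ≈ x - y
    cancel-suc x y = begin
      (1# + x) + - (1# + y)        ≈⟨ +-cong (+-comm 1# x) (sym (-‿+-comm 1# y)) ⟩
      (x + 1#) + (- 1# + - y)      ≈⟨ +-assoc x 1# _ ⟩
      x + (1# + (- 1# + - y))      ≈⟨ +-congˡ (+-assoc 1# (- 1#) _) ⟨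
      x + ((1# + - 1#) + - y)      ≈⟨ +-congˡ (trans (+-congʳ (-‿inverseʳ 1#)) (+-identityˡ _)) ⟩
      x - y                        ∎

    ⊖-homo : ∀ m n → fromℤ (m ℤ.⊖ n) ≈ m ∙ 1# - n ∙ 1#
    ⊖-homo m       zero    = sym (trans (+-congˡ -0#≈0#) (+-identityʳ _))
    ⊖-homo zero    (suc n) = sym (+-identityˡ _)
    ⊖-homo (suc m) (suc n) = begin
      fromℤ (suc m ℤ.⊖ suc n)    ≡⟨ ≡.cong fromℤ (ℤₚ.[1+m]⊖[1+n]≡m⊖n m n) ⟩
      fromℤ (m ℤ.⊖ n)            ≈⟨ ⊖-homo m n ⟩
      m ∙ 1# - n ∙ 1#            ≈⟨ cancel-suc _ _ ⟨
      (1# + m ∙ 1#) - (1# + n ∙ 1#)  ≈⟨ +-cong (1+× m 1#) (-‿cong (1+× n 1#)) ⟨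
      suc m ∙ 1# - suc n ∙ 1#    ∎

    -‿homo : ∀ i → fromℤ (ℤ.- i) ≈ - fromℤ i
    -‿homo (+ zero)  = sym -0#≈0#
    -‿homo (+ suc n) = refl
    -‿homo -[1+ n ]  = sym (-‿involutive _)

    +-homo : ∀ i j → fromℤ (i ℤ.+ j) ≈ fromℤ i + fromℤ j
    +-homo (+ m)    (+ n)    = ∙-homo-+ 1# m n
    +-homo (+ m)    -[1+ n ] = ⊖-homo m (suc n)
    +-homo -[1+ m ] (+ n)    = trans (⊖-homo n (suc m)) (+-comm _ _)
    +-homo -[1+ m ] -[1+ n ] = begin
      - (suc (suc (m ℕ.+ n)) ∙ 1#)      ≡⟨ ≡.cong (λ k → - (suc k ∙ 1#)) (ℕₚ.+-suc m n) ⟨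
      - ((suc m ℕ.+ suc n) ∙ 1#)        ≈⟨ -‿cong (∙-homo-+ 1# (suc m) (suc n)) ⟩
      - (suc m ∙ 1# + suc n ∙ 1#)       ≈⟨ -‿+-comm _ _ ⟨
      - (suc m ∙ 1#) - suc n ∙ 1#       ∎

    *-homo-+ : ∀ m j → fromℤ (+ m ℤ.* j) ≈ m ∙ 1# * fromℤ j
    *-homo-+ m (+ n)    = trans (reflexive (≡.cong fromℤ (≡.sym (ℤₚ.pos-* m n)))) (∙-homo-* m n)
    *-homo-+ m -[1+ n ] = begin
      fromℤ (+ m ℤ.* -[1+ n ])         ≡⟨ ≡.cong fromℤ (ℤₚ.neg-distribʳ-* (+ m) (+ suc n)) ⟨
      fromℤ (ℤ.- (+ m ℤ.* + suc n))    ≈⟨ -‿homo (+ m ℤ.* + suc n) ⟩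
      - fromℤ (+ m ℤ.* + suc n)        ≈⟨ -‿cong (*-homo-+ m (+ suc n)) ⟩
      - (m ∙ 1# * suc n ∙ 1#)          ≈⟨ RingProperties.-‿distribʳ-* ring _ _ ⟩
      m ∙ 1# * - (suc n ∙ 1#)          ∎

    *-homo : ∀ i j → fromℤ (i ℤ.* j) ≈ fromℤ i * fromℤ j
    *-homo (+ m)    j = *-homo-+ m j
    *-homo -[1+ m ] j = begin
      fromℤ (-[1+ m ] ℤ.* j)           ≡⟨ ≡.cong fromℤ (ℤₚ.neg-distribˡ-* (+ suc m) j) ⟨
      fromℤ (ℤ.- (+ suc m ℤ.* j))      ≈⟨ -‿homo (+ suc m ℤ.* j) ⟩
      - fromℤ (+ suc m ℤ.* j)          ≈⟨ -‿cong (*-homo-+ (suc m) j) ⟩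
      - (suc m ∙ 1# * fromℤ j)         ≈⟨ -‿distribˡ-* _ _ ⟩
      - (suc m ∙ 1#) * fromℤ j         ∎

    ℤ-rawRing : RawRing _ _
    ℤ-rawRing = CommutativeRing.rawRing ℤₚ.+-*-commutativeRing

    fromℤ-hom : ℤ-rawRing -Raw-AlmostCommutative⟶ fromCommutativeRing R
    fromℤ-hom = record
      { ⟦_⟧    = fromℤ
      ; +-homo = +-homo
      ; *-homo = *-homo
      ; -‿homo = -‿homo
      ; 0-homo = refl
      ; 1-homo = refl
      }

    weaklyDecide : ∀ i j → Maybe (fromℤ i ≈ fromℤ j)
    weaklyDecide i j with i ℤₚ.≟ j
    ... | yes i≡j = just (reflexive (≡.cong fromℤ i≡j))
    ... | no  _   = nothing

  module Solver = RingSolver ℤ-rawRing (fromCommutativeRing R) fromℤ-hom weaklyDecide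
    using (solve; _:=_; _:+_; _:*_; _:-_; :-_; _:^_; con)

  open Solver public

  infix 4 _∣_
  _∣_ : Carrier → Carrier → Set (c ⊔ˡ ℓ)
  x ∣ y = ∃[ q ] q * x ≈ y

  ∣-refl : ∀ {x} → x ∣ x
  ∣-refl = 1# , *-identityˡ _

  ∣-respʳ : ∀ {x y z} → y ≈ z → x ∣ y → x ∣ z
  ∣-respʳ y≈z (q , e) = q , trans e y≈z

  ∣-respˡ : ∀ {x y z} → x ≈ y → x ∣ z → y ∣ z
  ∣-respˡ x≈y (q , e) = q , trans (*-congˡ (sym x≈y)) e

  ∣-trans : ∀ {x y z} → x ∣ y → y ∣ z → x ∣ z
  ∣-trans (q , e) (r , f) = r * q , trans (*-assoc _ _ _) (trans (*-congˡ e) f)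

  ∣-*ˡ : ∀ {x} y z → x ∣ z → x ∣ y * z
  ∣-*ˡ y z (q , e) = y * q , trans (*-assoc _ _ _) (*-congˡ e)

  ∣-*ʳ : ∀ {x} y z → x ∣ y → x ∣ y * z
  ∣-*ʳ y z x∣y = ∣-respʳ (*-comm z y) (∣-*ˡ z y x∣y)

  ∣-+ : ∀ {x y z} → x ∣ y → x ∣ z → x ∣ y + z
  ∣-+ (q , e) (r , f) = q + r , trans (distribʳ _ _ _) (+-cong e f)

  ∣-neg : ∀ {x y} → x ∣ y → x ∣ - y
  ∣-neg (q , e) = - q , trans (sym (-‿distribˡ-* _ _)) (-‿cong e)

  ∣-0 : ∀ {x} → x ∣ 0#
  ∣-0 = 0# , zeroˡ _

  x∣x^1+n : ∀ x n → x ∣ x ^ suc n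
  x∣x^1+n x n = x ^ n , *-comm _ _

  ·≈·1* : ∀ n x → n · x ≈ n · 1# * x
  ·≈·1* zero    x = sym (zeroˡ x)
  ·≈·1* (suc n) x = trans (+-cong (sym (*-identityˡ x)) (·≈·1* n x)) (sym (distribʳ x 1# _))

  1^n : ∀ n → 1# ^ n ≈ 1#
  1^n zero    = refl
  1^n (suc n) = trans (*-identityˡ _) (1^n n)

  x-y≈0⇒x≈y : ∀ x y → x - y ≈ 0# → x ≈ y
  x-y≈0⇒x≈y x y e = trans (solve 2 (λ x y → x := (x :- y) :+ y) refl x y)
    (trans (+-congʳ e) (+-identityˡ y))

  x≈y⇒x-y≈0 : ∀ {x y} → x ≈ y → x - y ≈ 0#
  x≈y⇒x-y≈0 e = trans (+-congʳ e) (-‿inverseʳ _)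

  geometric : ℕ → Carrier → Carrier → Carrier
  geometric zero    x y = 0#
  geometric (suc n) x y = x ^ n + y * geometric n x y

  geometric-* : ∀ n x y → (x - y) * geometric n x y ≈ x ^ n - y ^ n
  geometric-* zero    x y = trans (zeroʳ (x - y)) (sym (-‿inverseʳ 1#))
  geometric-* (suc n) x y = begin
    (x - y) * (x ^ n + y * geometric n x y)
      ≈⟨ solve 4 (λ x y a g → (x :- y) :* (a :+ y :* g) := (x :- y) :* a :+ y :* ((x :- y) :* g)) refl x y (x ^ n) (geometric n x y) ⟩
    (x - y) * x ^ n + y * ((x - y) * geometric n x y)
      ≈⟨ +-congˡ (*-congˡ (geometric-* n x y)) ⟩
    (x - y) * x ^ n + y * (x ^ n - y ^ n)
      ≈⟨ solve 4 (λ x y a b → (x :- y) :* a :+ y :* (a :- b) := x :* a :- y :* b) refl x y (x ^ n) (y ^ n) ⟩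
    x ^ suc n - y ^ suc n ∎

  geometric-cong : ∀ n {x x′ y y′} → x ≈ x′ → y ≈ y′ → geometric n x y ≈ geometric n x′ y′
  geometric-cong zero    e f = refl
  geometric-cong (suc n) e f = +-cong (^-congˡ n e) (*-cong f (geometric-cong n e f))

  geometric-0-1 : ∀ n → 1 ≤ n → geometric n 0# 1# ≈ 1#
  geometric-0-1 (suc zero)    _ = trans (+-congˡ (zeroʳ 1#)) (+-identityʳ 1#)
  geometric-0-1 (suc (suc n)) _ = trans (+-cong (zeroˡ _) (trans (*-identityˡ _) (geometric-0-1 (suc n) (s≤s z≤n)))) (+-identityˡ 1#)

  x-y∣xⁿ-yⁿ : ∀ x y n → (x - y) ∣ (x ^ n - y ^ n)
  x-y∣xⁿ-yⁿ x y n = geometric n x y , trans (*-comm _ _) (geometric-* n x y)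

  record Comaximal (x y : Carrier) : Set (c ⊔ˡ ℓ) where
    constructor bezout
    field
      u v      : Carrier
      identity : u * x + v * y ≈ 1#

  comax-sym : ∀ {x y} → Comaximal x y → Comaximal y x
  comax-sym (bezout u v e) = bezout v u (trans (+-comm _ _) e)

  comax-respˡ : ∀ {x y z} → x ≈ y → Comaximal x z → Comaximal y z
  comax-respˡ x≈y (bezout u v e) = bezout u v (trans (+-congʳ (*-congˡ (sym x≈y))) e)

  comax-*ˡ : ∀ {x y z} → Comaximal x z → Comaximal y z → Comaximal (x * y) z
  comax-*ˡ {x} {y} {z} (bezout u v e) (bezout u′ v′ e′) =
    bezout (u * u′) (u * x * v′ + v * (u′ * y + v′ * z)) (begin
      u * u′ * (x * y) + (u * x * v′ + v * (u′ * y + v′ * z)) * z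
        ≈⟨ solve 7 (λ u v u′ v′ x y z →
             u :* u′ :* (x :* y) :+ (u :* x :* v′ :+ v :* (u′ :* y :+ v′ :* z)) :* z
             := (u :* x :+ v :* z) :* (u′ :* y :+ v′ :* z)) refl u v u′ v′ x y z ⟩
      (u * x + v * z) * (u′ * y + v′ * z)  ≈⟨ *-cong e e′ ⟩
      1# * 1#                              ≈⟨ *-identityˡ 1# ⟩
      1#                                   ∎)

  comax-1ˡ : ∀ {x} → Comaximal 1# x
  comax-1ˡ = bezout 1# 0# (trans (+-cong (*-identityˡ 1#) (zeroˡ _)) (+-identityʳ 1#))

  comax-^ˡ : ∀ {x y} n → Comaximal x y → Comaximal (x ^ n) y
  comax-^ˡ zero    _ = comax-1ˡ
  comax-^ˡ (suc n) p = comax-*ˡ p (comax-^ˡ n p)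

  comax-∣ˡ : ∀ {x y z} → z ∣ x → Comaximal x y → Comaximal z y
  comax-∣ˡ {x} {y} {z} (q , f) (bezout u v e) = bezout (u * q) v
    (trans (+-congʳ (trans (*-assoc u q z) (*-congˡ f))) e)

  comax-+ : ∀ {x y} z → x ∣ z → Comaximal x y → Comaximal x (y + z)
  comax-+ {x} {y} z (q , f) (bezout u v e) = bezout (u - v * q) v (begin
    (u - v * q) * x + v * (y + z)
      ≈⟨ +-congˡ (*-congˡ (+-congˡ f)) ⟨
    (u - v * q) * x + v * (y + q * x)
      ≈⟨ solve 5 (λ u v q x y → (u :- v :* q) :* x :+ v :* (y :+ q :* x) := u :* x :+ v :* y) refl u v q x y ⟩
    u * x + v * y ≈⟨ e ⟩
    1#            ∎)

  comax-cancel : ∀ {x} y z → Comaximal x y → x ∣ y * z → x ∣ z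
  comax-cancel {x} y z (bezout u v e) (q , f) = u * z + v * q , (begin
    (u * z + v * q) * x      ≈⟨ solve 5 (λ u v q x z → (u :* z :+ v :* q) :* x := u :* x :* z :+ v :* (q :* x)) refl u v q x z ⟩
    u * x * z + v * (q * x)  ≈⟨ +-congˡ (*-congˡ f) ⟩
    u * x * z + v * (y * z)  ≈⟨ solve 5 (λ u v x y z → u :* x :* z :+ v :* (y :* z) := (u :* x :+ v :* y) :* z) refl u v x y z ⟩
    (u * x + v * y) * z      ≈⟨ *-congʳ e ⟩
    1# * z                   ≈⟨ *-identityˡ z ⟩
    z                        ∎)

  comax-unit : ∀ {x y} → Comaximal x y → x ∣ y → x ∣ 1#
  comax-unit {x} {y} p x∣y = comax-cancel y 1# p (∣-*ʳ y 1# x∣y)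

  Unit : Carrier → Set (c ⊔ˡ ℓ)
  Unit x = x ∣ 1#

  unit-comax : ∀ {x y} → Unit x → Comaximal x y
  unit-comax (q , e) = bezout q 0# (trans (+-cong e (zeroˡ _)) (+-identityʳ 1#))

  record IsDomain : Set (c ⊔ˡ ℓ) where
    field
      1≉0          : ¬ 1# ≈ 0#
      zero-product : ∀ {x y} → x * y ≈ 0# → ¬ x ≈ 0# → y ≈ 0#

module DomainTheory {c ℓ : Level} (R : CommutativeRing c ℓ) (domain : RingTheory.IsDomain R) where
  open CommutativeRing R
  open RingTheory R
  open IsDomain domain
  open SetoidReasoning setoid

  *-cancelˡ : ∀ x {y z} → ¬ x ≈ 0# → x * y ≈ x * z → y ≈ z
  *-cancelˡ x {y} {z} x≉0 e = x-y≈0⇒x≈y y z (zero-product (begin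
    x * (y - z)    ≈⟨ solve 3 (λ x y z → x :* (y :- z) := x :* y :- x :* z) refl x y z ⟩
    x * y - x * z  ≈⟨ x≈y⇒x-y≈0 e ⟩
    0#             ∎) x≉0)

  *-≉0 : ∀ {x y} → ¬ x ≈ 0# → ¬ y ≈ 0# → ¬ x * y ≈ 0#
  *-≉0 x≉0 y≉0 e = y≉0 (zero-product e x≉0)

  ^-≉0 : ∀ {x} n → ¬ x ≈ 0# → ¬ x ^ n ≈ 0#
  ^-≉0 zero    x≉0 = 1≉0
  ^-≉0 (suc n) x≉0 = *-≉0 x≉0 (^-≉0 n x≉0)

module RingHomomorphism {c ℓ c′ ℓ′ : Level} (R : CommutativeRing c ℓ) (S : CommutativeRing c′ ℓ′)
  (φ : CommutativeRing.Carrier R → CommutativeRing.Carrier S)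
  (φ-hom : RingMorphisms.IsRingHomomorphism (CommutativeRing.rawRing R) (CommutativeRing.rawRing S) φ) where
  open CommutativeRing S
  open RingTheory S
  open RingMorphisms.IsRingHomomorphism φ-hom using (+-homo; *-homo; 0#-homo; 1#-homo)

  φ-^ : ∀ x n → φ (RingTheory._^_ R x n) ≈ φ x ^ n
  φ-^ x zero    = 1#-homo
  φ-^ x (suc n) = trans (*-homo x _) (*-congˡ (φ-^ x n))

  φ-·1 : ∀ n → φ (RingTheory._·_ R n (CommutativeRing.1# R)) ≈ n · 1#
  φ-·1 zero    = 0#-homo
  φ-·1 (suc n) = trans (+-homo _ _) (+-cong 1#-homo (φ-·1 n))

module Characteristic {c ℓ : Level} (R : CommutativeRing c ℓ) where
  open CommutativeRing R
  open RingTheory R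

  HasChar : ℕ → Set ℓ
  HasChar p = 1 ≤ p × p · 1# ≈ 0# × (∀ k → 1 ≤ k → k · 1# ≈ 0# → p ≤ k)

  ·-*-zero : ∀ {p} k → p · 1# ≈ 0# → (k ℕ.* p) · 1# ≈ 0#
  ·-*-zero zero    e = refl
  ·-*-zero {p} (suc k) e = trans (×-homo-+ 1# p (k ℕ.* p)) (trans (+-cong e (·-*-zero k e)) (+-identityˡ 0#))

  char-divides : ∀ {p} → HasChar p → ∀ k → k · 1# ≈ 0# → p ∣ⁿ k
  char-divides {suc p′} (_ , p0 , least) k k0 = go (k DivMod.% suc p′) (DivMod.m≡m%n+[m/n]*n k (suc p′)) (DivMod.m%n<n k (suc p′))
    where
    p = suc p′
    go : ∀ r → k ≡ r ℕ.+ k DivMod./ p ℕ.* p → r < p → p ∣ⁿ k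
    go zero    k≡ _   = divides (k DivMod./ p) k≡
    go (suc r) k≡ r<p = ⊥-elim (ℕₚ.<⇒≱ r<p (least (suc r) (s≤s z≤n)
      (trans (sym (+-identityʳ _)) (trans (+-congˡ (sym (·-*-zero (k DivMod./ p) p0)))
        (trans (sym (×-homo-+ 1# (suc r) (k DivMod./ p ℕ.* p))) (trans (reflexive (≡.cong (_· 1#) (≡.sym k≡))) k0))))))

  PrimePowerOrTame : ℕ → ℕ → Set ℓ
  PrimePowerOrTame p D = (∃[ D′ ] ∃[ s ] (D ≡ D′ ℕ.* s × 2 ≤ D′ × 1 ≤ s × ¬ D′ · 1# ≈ 0#)) ⊎ (∃[ l ] D ≡ p ℕ.^ l)

  tame-or-power : ∀ {p} → HasChar p → 2 ≤ p → ∀ D → 1 ≤ D → PrimePowerOrTame p D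
  tame-or-power {p} hp 2≤p D 1≤D = go D 1≤D (<-wellFounded D)
    where
    go : ∀ D → 1 ≤ D → Acc _<_ D → PrimePowerOrTame p D
    go D 1≤D (acc rec) with p ∣ⁿ? D
    go (suc zero)    1≤D (acc rec) | no p∤D = inj₂ (0 , ≡.refl)
    go D@(suc (suc _)) 1≤D (acc rec) | no p∤D =
      inj₁ (D , 1 , ≡.sym (ℕₚ.*-identityʳ D) , s≤s (s≤s z≤n) , s≤s z≤n , λ e → p∤D (char-divides hp D e))
    go D 1≤D (acc rec) | yes (divides zero D≡) = ⊥-elim (ℕₚ.<⇒≢ 1≤D (≡.sym D≡))
    go D 1≤D (acc rec) | yes (divides k@(suc _) D≡)
      with go k (s≤s z≤n) (rec (≡.subst (k <_) (≡.sym D≡) (ℕₚ.m<m*n k p 2≤p)))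
    ... | inj₁ (D′ , s , k≡ , 2≤D′ , 1≤s , D′≉0) = inj₁ (D′ , s ℕ.* p
          , ≡.trans D≡ (≡.trans (≡.cong (ℕ._* p) k≡) (ℕₚ.*-assoc D′ s p)) , 2≤D′
          , ℕₚ.*-mono-≤ 1≤s (ℕₚ.≤-trans (s≤s z≤n) 2≤p) , D′≉0)
    ... | inj₂ (l , k≡) = inj₂ (suc l , ≡.trans D≡ (≡.trans (≡.cong (ℕ._* p) k≡) (ℕₚ.*-comm (p ℕ.^ l) p)))

module PolynomialRing {c ℓ₁ ℓ₂ : Level} (F : HeytingField c ℓ₁ ℓ₂) where
  open Polynomials F public
  private
    FR = fieldRing F
  open CommutativeRing FR
  open RingTheory FR using (solve; _:=_; _:+_; _:*_; _:-_; :-_; con)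
  open RingProperties ring using (-0#≈0#)
  open SetoidReasoning setoid

  infix 4 _≈ᴾ_
  record _≈ᴾ_ (p r : Poly) : Set ℓ₁ where
    constructor coeffwise
    field coeff-≈ : p ≋ r
  open _≈ᴾ_ public

  coeff-+ : ∀ p r i → coeff (p +ᴾ r) i ≈ coeff p i + coeff r i
  coeff-+ []      r       i       = sym (+-identityˡ _)
  coeff-+ (a ∷ p) []      i       = sym (+-identityʳ _)
  coeff-+ (a ∷ p) (b ∷ r) zero    = refl
  coeff-+ (a ∷ p) (b ∷ r) (suc i) = coeff-+ p r i

  coeff-- : ∀ p i → coeff (-ᴾ p) i ≈ - coeff p i
  coeff-- []      i       = sym -0#≈0#
  coeff-- (a ∷ p) zero    = refl
  coeff-- (a ∷ p) (suc i) = coeff-- p i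

  infixr 8 _⋆_
  _⋆_ : Carrier → Poly → Poly
  a ⋆ p = List.map (a *_) p

  coeff-⋆ : ∀ a p i → coeff (a ⋆ p) i ≈ a * coeff p i
  coeff-⋆ a []      i       = sym (zeroʳ a)
  coeff-⋆ a (b ∷ p) zero    = refl
  coeff-⋆ a (b ∷ p) (suc i) = coeff-⋆ a p i

  coeff-*-zero : ∀ a p r → coeff ((a ∷ p) *ᴾ r) 0 ≈ a * coeff r 0
  coeff-*-zero a p r = trans (coeff-+ (a ⋆ r) (0# ∷ p *ᴾ r) 0) (trans (+-identityʳ _) (coeff-⋆ a r 0))

  coeff-*-suc : ∀ a p r i → coeff ((a ∷ p) *ᴾ r) (suc i) ≈ a * coeff r (suc i) + coeff (p *ᴾ r) i
  coeff-*-suc a p r i = trans (coeff-+ (a ⋆ r) (0# ∷ p *ᴾ r) (suc i)) (+-congʳ (coeff-⋆ a r (suc i)))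

  private
    ≋-refl : ∀ p → p ≋ p
    ≋-refl p i = refl

    ∷-≋ : ∀ {a b p r} → a ≈ b → p ≋ r → (a ∷ p) ≋ (b ∷ r)
    ∷-≋ a≈b p≋r zero    = a≈b
    ∷-≋ a≈b p≋r (suc i) = p≋r i

    +-≋ : ∀ p p′ r r′ → p ≋ p′ → r ≋ r′ → (p +ᴾ r) ≋ (p′ +ᴾ r′)
    +-≋ p p′ r r′ e f i = trans (coeff-+ p r i) (trans (+-cong (e i) (f i)) (sym (coeff-+ p′ r′ i)))

    *-≋ʳ : ∀ p r r′ → r ≋ r′ → (p *ᴾ r) ≋ (p *ᴾ r′)
    *-≋ʳ []      r r′ e i       = refl
    *-≋ʳ (a ∷ p) r r′ e zero    = trans (coeff-*-zero a p r) (trans (*-congˡ (e 0)) (sym (coeff-*-zero a p r′)))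
    *-≋ʳ (a ∷ p) r r′ e (suc i) = trans (coeff-*-suc a p r i)
      (trans (+-cong (*-congˡ (e (suc i))) (*-≋ʳ p r r′ e i)) (sym (coeff-*-suc a p r′ i)))

    []-*ʳ : ∀ p → (p *ᴾ []) ≋ []
    []-*ʳ []      i       = refl
    []-*ʳ (a ∷ p) zero    = refl
    []-*ʳ (a ∷ p) (suc i) = []-*ʳ p i

    *-∷ʳ : ∀ p b r → (p *ᴾ (b ∷ r)) ≋ ((b ⋆ p) +ᴾ (0# ∷ p *ᴾ r))
    *-∷ʳ []      b r zero    = refl
    *-∷ʳ []      b r (suc i) = refl
    *-∷ʳ (a ∷ p) b r zero    = trans (coeff-*-zero a p (b ∷ r)) (trans (*-comm a b)
      (sym (trans (coeff-+ (b ⋆ (a ∷ p)) (0# ∷ (a ∷ p) *ᴾ r) 0) (+-identityʳ _))))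
    *-∷ʳ (a ∷ p) b r (suc i) = begin
      coeff ((a ∷ p) *ᴾ (b ∷ r)) (suc i)                          ≈⟨ coeff-*-suc a p (b ∷ r) i ⟩
      a * coeff r i + coeff (p *ᴾ (b ∷ r)) i                      ≈⟨ +-congˡ (*-∷ʳ p b r i) ⟩
      a * coeff r i + coeff ((b ⋆ p) +ᴾ (0# ∷ p *ᴾ r)) i          ≈⟨ +-congˡ (coeff-+ (b ⋆ p) (0# ∷ p *ᴾ r) i) ⟩
      a * coeff r i + (coeff (b ⋆ p) i + coeff (0# ∷ p *ᴾ r) i)   ≈⟨ solve 3 (λ x y z → x :+ (y :+ z) := y :+ (x :+ z)) refl _ _ _ ⟩
      coeff (b ⋆ p) i + (a * coeff r i + coeff (0# ∷ p *ᴾ r) i)   ≈⟨ +-congˡ (+-congʳ (coeff-⋆ a r i)) ⟨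
      coeff (b ⋆ p) i + (coeff (a ⋆ r) i + coeff (0# ∷ p *ᴾ r) i) ≈⟨ +-congˡ (coeff-+ (a ⋆ r) (0# ∷ p *ᴾ r) i) ⟨
      coeff (b ⋆ p) i + coeff ((a ∷ p) *ᴾ r) i                    ≈⟨ coeff-+ (b ⋆ (a ∷ p)) (0# ∷ (a ∷ p) *ᴾ r) (suc i) ⟨
      coeff ((b ⋆ (a ∷ p)) +ᴾ (0# ∷ (a ∷ p) *ᴾ r)) (suc i)        ∎

    *-≋-comm : ∀ p r → (p *ᴾ r) ≋ (r *ᴾ p)
    *-≋-comm []      r i = sym ([]-*ʳ r i)
    *-≋-comm (a ∷ p) r i = trans
      (+-≋ (a ⋆ r) (a ⋆ r) (0# ∷ p *ᴾ r) (0# ∷ r *ᴾ p) (≋-refl (a ⋆ r)) (∷-≋ refl (*-≋-comm p r)) i)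
      (sym (*-∷ʳ r a p i))

    ⋆-* : ∀ a p r → ((a ⋆ p) *ᴾ r) ≋ (a ⋆ (p *ᴾ r))
    ⋆-* a []      r i       = refl
    ⋆-* a (b ∷ p) r zero    = begin
      coeff ((a * b ∷ a ⋆ p) *ᴾ r) 0  ≈⟨ coeff-*-zero (a * b) (a ⋆ p) r ⟩
      a * b * coeff r 0               ≈⟨ *-assoc a b _ ⟩
      a * (b * coeff r 0)             ≈⟨ *-congˡ (coeff-*-zero b p r) ⟨
      a * coeff ((b ∷ p) *ᴾ r) 0      ≈⟨ coeff-⋆ a ((b ∷ p) *ᴾ r) 0 ⟨
      coeff (a ⋆ ((b ∷ p) *ᴾ r)) 0    ∎
    ⋆-* a (b ∷ p) r (suc i) = begin
      coeff ((a * b ∷ a ⋆ p) *ᴾ r) (suc i)              ≈⟨ coeff-*-suc (a * b) (a ⋆ p) r i ⟩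
      a * b * coeff r (suc i) + coeff ((a ⋆ p) *ᴾ r) i  ≈⟨ +-congˡ (trans (⋆-* a p r i) (coeff-⋆ a (p *ᴾ r) i)) ⟩
      a * b * coeff r (suc i) + a * coeff (p *ᴾ r) i    ≈⟨ solve 4 (λ a b x y → a :* b :* x :+ a :* y := a :* (b :* x :+ y)) refl a b _ _ ⟩
      a * (b * coeff r (suc i) + coeff (p *ᴾ r) i)      ≈⟨ *-congˡ (coeff-*-suc b p r i) ⟨
      a * coeff ((b ∷ p) *ᴾ r) (suc i)                  ≈⟨ coeff-⋆ a ((b ∷ p) *ᴾ r) (suc i) ⟨
      coeff (a ⋆ ((b ∷ p) *ᴾ r)) (suc i)                ∎

    *-≋-distribʳ : ∀ p p′ r → ((p +ᴾ p′) *ᴾ r) ≋ ((p *ᴾ r) +ᴾ (p′ *ᴾ r))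
    *-≋-distribʳ []      p′       r i = refl
    *-≋-distribʳ (a ∷ p) []       r i = sym (trans (coeff-+ ((a ∷ p) *ᴾ r) [] i) (+-identityʳ _))
    *-≋-distribʳ (a ∷ p) (b ∷ p′) r zero = begin
      coeff ((a + b ∷ p +ᴾ p′) *ᴾ r) 0                     ≈⟨ coeff-*-zero (a + b) (p +ᴾ p′) r ⟩
      (a + b) * coeff r 0                                  ≈⟨ distribʳ _ a b ⟩
      a * coeff r 0 + b * coeff r 0                        ≈⟨ +-cong (coeff-*-zero a p r) (coeff-*-zero b p′ r) ⟨
      coeff ((a ∷ p) *ᴾ r) 0 + coeff ((b ∷ p′) *ᴾ r) 0     ≈⟨ coeff-+ ((a ∷ p) *ᴾ r) ((b ∷ p′) *ᴾ r) 0 ⟨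
      coeff (((a ∷ p) *ᴾ r) +ᴾ ((b ∷ p′) *ᴾ r)) 0          ∎
    *-≋-distribʳ (a ∷ p) (b ∷ p′) r (suc i) = begin
      coeff ((a + b ∷ p +ᴾ p′) *ᴾ r) (suc i)
        ≈⟨ coeff-*-suc (a + b) (p +ᴾ p′) r i ⟩
      (a + b) * coeff r (suc i) + coeff ((p +ᴾ p′) *ᴾ r) i
        ≈⟨ +-congˡ (trans (*-≋-distribʳ p p′ r i) (coeff-+ (p *ᴾ r) (p′ *ᴾ r) i)) ⟩
      (a + b) * coeff r (suc i) + (coeff (p *ᴾ r) i + coeff (p′ *ᴾ r) i)
        ≈⟨ solve 5 (λ a b x y z → (a :+ b) :* x :+ (y :+ z) := (a :* x :+ y) :+ (b :* x :+ z)) refl a b _ _ _ ⟩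
      (a * coeff r (suc i) + coeff (p *ᴾ r) i) + (b * coeff r (suc i) + coeff (p′ *ᴾ r) i)
        ≈⟨ +-cong (coeff-*-suc a p r i) (coeff-*-suc b p′ r i) ⟨
      coeff ((a ∷ p) *ᴾ r) (suc i) + coeff ((b ∷ p′) *ᴾ r) (suc i)
        ≈⟨ coeff-+ ((a ∷ p) *ᴾ r) ((b ∷ p′) *ᴾ r) (suc i) ⟨
      coeff (((a ∷ p) *ᴾ r) +ᴾ ((b ∷ p′) *ᴾ r)) (suc i)  ∎

    0∷-* : ∀ p r → ((0# ∷ p) *ᴾ r) ≋ (0# ∷ p *ᴾ r)
    0∷-* p r zero    = trans (coeff-*-zero 0# p r) (zeroˡ _)
    0∷-* p r (suc i) = trans (coeff-*-suc 0# p r i) (trans (+-congʳ (zeroˡ _)) (+-identityˡ _))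

    *-≋-assoc : ∀ p r s → ((p *ᴾ r) *ᴾ s) ≋ (p *ᴾ (r *ᴾ s))
    *-≋-assoc []      r s i = refl
    *-≋-assoc (a ∷ p) r s i = trans (*-≋-distribʳ (a ⋆ r) (0# ∷ p *ᴾ r) s i)
      (+-≋ ((a ⋆ r) *ᴾ s) (a ⋆ (r *ᴾ s)) ((0# ∷ p *ᴾ r) *ᴾ s) (0# ∷ p *ᴾ (r *ᴾ s)) (⋆-* a r s)
        (λ j → trans (0∷-* (p *ᴾ r) s j) (∷-≋ refl (*-≋-assoc p r s) j)) i)

    *-≋-identityˡ : ∀ p → (constant 1# *ᴾ p) ≋ p
    *-≋-identityˡ p zero    = trans (coeff-*-zero 1# [] p) (*-identityˡ _)
    *-≋-identityˡ p (suc i) = trans (coeff-*-suc 1# [] p i) (trans (+-identityʳ _) (*-identityˡ _))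

    *-≋ : ∀ p p′ r r′ → p ≋ p′ → r ≋ r′ → (p *ᴾ r) ≋ (p′ *ᴾ r′)
    *-≋ p p′ r r′ e f i = trans (*-≋ʳ p r r′ f i) (trans (*-≋-comm p r′ i)
      (trans (*-≋ʳ r′ p p′ e i) (*-≋-comm r′ p′ i)))

  polyRing : CommutativeRing c ℓ₁
  polyRing = record
    { Carrier = Poly ; _≈_ = _≈ᴾ_ ; _+_ = _+ᴾ_ ; _*_ = _*ᴾ_ ; -_ = -ᴾ_ ; 0# = [] ; 1# = constant 1#
    ; isCommutativeRing = record
      { isRing = record
        { +-isAbelianGroup = record
          { isGroup = record
            { isMonoid = record
              { isSemigroup = record
                { isMagma = record
                  { isEquivalence = record
                    { refl  = coeffwise λ i → refl
                    ; sym   = λ e → coeffwise λ i → sym (coeff-≈ e i)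
                    ; trans = λ e f → coeffwise λ i → trans (coeff-≈ e i) (coeff-≈ f i)
                    }
                  ; ∙-cong = λ {p} {p′} {r} {r′} e f → coeffwise (+-≋ p p′ r r′ (coeff-≈ e) (coeff-≈ f))
                  }
                ; assoc = λ p r s → coeffwise λ i → trans (coeff-+ (p +ᴾ r) s i) (trans (+-congʳ (coeff-+ p r i))
                    (trans (+-assoc _ _ _) (sym (trans (coeff-+ p (r +ᴾ s) i) (+-congˡ (coeff-+ r s i))))))
                }
              ; identity = (λ p → coeffwise λ i → refl)
                         , (λ p → coeffwise λ i → trans (coeff-+ p [] i) (+-identityʳ _))
              }
            ; inverse = (λ p → coeffwise λ i → trans (coeff-+ (-ᴾ p) p i)
                           (trans (+-congʳ (coeff-- p i)) (-‿inverseˡ _)))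
                      , (λ p → coeffwise λ i → trans (coeff-+ p (-ᴾ p) i)
                           (trans (+-congˡ (coeff-- p i)) (-‿inverseʳ _)))
            ; ⁻¹-cong = λ {p} {r} e → coeffwise λ i →
                trans (coeff-- p i) (trans (-‿cong (coeff-≈ e i)) (sym (coeff-- r i)))
            }
          ; comm = λ p r → coeffwise λ i → trans (coeff-+ p r i) (trans (+-comm _ _) (sym (coeff-+ r p i)))
          }
        ; *-cong = λ {p} {p′} {r} {r′} e f → coeffwise (*-≋ p p′ r r′ (coeff-≈ e) (coeff-≈ f))
        ; *-assoc = λ p r s → coeffwise (*-≋-assoc p r s)
        ; *-identity = (λ p → coeffwise (*-≋-identityˡ p))
                     , (λ p → coeffwise λ i → trans (*-≋-comm p (constant 1#) i) (*-≋-identityˡ p i))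
        ; distrib = (λ p r s → coeffwise λ i → trans (*-≋-comm p (r +ᴾ s) i) (trans (*-≋-distribʳ r s p i)
                       (+-≋ (r *ᴾ p) (p *ᴾ r) (s *ᴾ p) (p *ᴾ s) (*-≋-comm r p) (*-≋-comm s p) i)))
                  , (λ p r s → coeffwise (*-≋-distribʳ r s p))
        }
      ; *-comm = λ p r → coeffwise (*-≋-comm p r)
      }
    }

module PolynomialTheory {c ℓ₁ ℓ₂ : Level} (F : HeytingField c ℓ₁ ℓ₂) where
  open PolynomialRing F public
  private
    FR = fieldRing F
    module F = CommutativeRing FR
  open F using (Carrier; _≈_; 0#; 1#)
  module R = CommutativeRing polyRing
  open RingTheory polyRing public using (Unit; Comaximal)
  open RingTheory polyRing using (solve; _:=_; _:+_; _:*_; _:-_; :-_; con; _∣_; ∣-respʳ; ∣-+; ∣-*ˡ; ∣-*ʳ; ∣-refl) renaming (_^_ to _^ᴿ_)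

  C : Carrier → Poly
  C a = constant a

  X : Poly
  X = monomial 1# 1

  at : ∀ {p r} → p ≈ᴾ r → ∀ i → coeff p i ≈ coeff r i
  at = coeff-≈

  ∷-cong : ∀ {a b p r} → a ≈ b → p ≈ᴾ r → (a ∷ p) ≈ᴾ (b ∷ r)
  ∷-cong a≈b p≈r = coeffwise λ { zero → a≈b ; (suc i) → at p≈r i }

  C-cong : ∀ {a b} → a ≈ b → C a ≈ᴾ C b
  C-cong a≈b = ∷-cong a≈b R.refl

  C-0 : C 0# ≈ᴾ []
  C-0 = coeffwise λ { zero → F.refl ; (suc i) → F.refl }

  C-+ : ∀ a b → C (a F.+ b) ≈ᴾ C a +ᴾ C b
  C-+ a b = R.refl

  C*≈⋆ : ∀ a p → C a *ᴾ p ≈ᴾ a ⋆ p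
  C*≈⋆ a p = R.trans (R.+-congˡ {a ⋆ p} C-0) (R.+-identityʳ (a ⋆ p))

  coeff-C* : ∀ a p i → coeff (C a *ᴾ p) i ≈ a F.* coeff p i
  coeff-C* a p i = F.trans (at (C*≈⋆ a p) i) (coeff-⋆ a p i)

  C-* : ∀ a b → C (a F.* b) ≈ᴾ C a *ᴾ C b
  C-* a b = R.sym (C*≈⋆ a (C b))

  C-^ : ∀ a n → C (RingTheory._^_ FR a n) ≈ᴾ C a ^ᴿ n
  C-^ a zero    = R.refl
  C-^ a (suc n) = R.trans (C-* a (RingTheory._^_ FR a n)) (R.*-congˡ {C a} (C-^ a n))

  C-- : ∀ a → C (F.- a) ≈ᴾ -ᴾ C a
  C-- a = R.refl

  0∷≈X* : ∀ p → (0# ∷ p) ≈ᴾ X *ᴾ p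
  0∷≈X* p = R.sym (coeffwise λ
    { zero    → F.trans (coeff-*-zero 0# (1# ∷ []) p) (F.zeroˡ _)
    ; (suc i) → F.trans (coeff-*-suc 0# (1# ∷ []) p i)
        (F.trans (F.+-congʳ (F.zeroˡ _)) (F.trans (F.+-identityˡ _) (at (R.*-identityˡ p) i))) })

  ∷≈C+X* : ∀ a p → (a ∷ p) ≈ᴾ C a +ᴾ X *ᴾ p
  ∷≈C+X* a p = R.trans (coeffwise λ { zero → F.sym (F.+-identityʳ a) ; (suc i) → F.refl })
    (R.+-congˡ {C a} (0∷≈X* p))

  monomial≈ : ∀ a k → monomial a k ≈ᴾ C a *ᴾ X ^ᴿ k
  monomial≈ a zero    = R.sym (R.*-identityʳ (C a))
  monomial≈ a (suc k) = R.trans (0∷≈X* (monomial a k)) (R.trans (R.*-congˡ {X} (monomial≈ a k))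
    (solve 3 (λ x a y → x :* (a :* y) := a :* (x :* y)) R.refl X (C a) (X ^ᴿ k)))

  tail-≈[] : ∀ {a p} → (a ∷ p) ≈ᴾ [] → p ≈ᴾ []
  tail-≈[] e = coeffwise λ i → at e (suc i)

  record DegLe (p : Poly) (n : ℕ) : Set ℓ₁ where
    constructor degLe
    field beyond : ∀ i → n < i → coeff p i ≈ 0#
  open DegLe public

  degLe-cong : ∀ {p r n} → p ≈ᴾ r → DegLe p n → DegLe r n
  degLe-cong e h = degLe λ i lt → F.trans (F.sym (at e i)) (beyond h i lt)

  degLe-mono : ∀ {p m n} → m ≤ n → DegLe p m → DegLe p n
  degLe-mono m≤n h = degLe λ i lt → beyond h i (ℕₚ.≤-<-trans m≤n lt)

  degLe-[] : ∀ {n} → DegLe [] n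
  degLe-[] = degLe λ i _ → F.refl

  degLe-+ : ∀ {p r n} → DegLe p n → DegLe r n → DegLe (p +ᴾ r) n
  degLe-+ {p} {r} h k = degLe λ i lt → F.trans (coeff-+ p r i)
    (F.trans (F.+-cong (beyond h i lt) (beyond k i lt)) (F.+-identityˡ 0#))

  degLe-- : ∀ {p n} → DegLe p n → DegLe (-ᴾ p) n
  degLe-- {p} h = degLe λ i lt → F.trans (coeff-- p i)
    (F.trans (F.-‿cong (beyond h i lt)) (RingProperties.-0#≈0# F.ring))

  degLe-C : ∀ {a n} → DegLe (C a) n
  degLe-C = degLe λ { (suc i) _ → F.refl }

  degLe-∷ : ∀ {a p n} → DegLe p n → DegLe (a ∷ p) (suc n)
  degLe-∷ h = degLe λ { (suc i) (s≤s lt) → beyond h i lt }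

  degLe-tail : ∀ {a p n} → DegLe (a ∷ p) (suc n) → DegLe p n
  degLe-tail h = degLe λ i lt → beyond h (suc i) (s<s lt)

  degLe-0-tail : ∀ {a p} → DegLe (a ∷ p) 0 → p ≈ᴾ []
  degLe-0-tail h = coeffwise λ i → beyond h (suc i) z<s

  degLe-X : DegLe X 1
  degLe-X = degLe-∷ degLe-C

  degLe-0⇒C : ∀ {p} → DegLe p 0 → p ≈ᴾ C (coeff p 0)
  degLe-0⇒C {p} h = coeffwise λ { zero → F.refl ; (suc i) → beyond h (suc i) z<s }

  degLe-* : ∀ {p r m n} → DegLe p m → DegLe r n → DegLe (p *ᴾ r) (m ℕ.+ n)
  degLe-* {[]}    {r} {m} {n} h k = degLe-[]
  degLe-* {a ∷ p} {r} {zero}  {n} h k = degLe-cong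
    (R.sym (R.trans (R.*-congʳ {r} (R.trans (∷≈C+X* a p)
      (R.trans (R.+-congˡ {C a} (R.trans (R.*-congˡ {X} (degLe-0-tail h)) (R.zeroʳ X))) (R.+-identityʳ (C a)))))
      (C*≈⋆ a r)))
    (degLe λ i lt → F.trans (coeff-⋆ a r i) (F.trans (F.*-congˡ (beyond k i lt)) (F.zeroʳ a)))
  degLe-* {a ∷ p} {r} {suc m} {n} h k = degLe-+ {a ⋆ r} {0# ∷ p *ᴾ r}
    (degLe λ i lt → F.trans (coeff-⋆ a r i) (F.trans (F.*-congˡ (beyond k i (ℕₚ.≤-<-trans (ℕₚ.m≤n+m n (suc m)) lt))) (F.zeroʳ a)))
    (degLe-∷ (degLe-* {p} {r} (degLe-tail h) k))

  coeff-*-top : ∀ {p r m n} → DegLe p m → DegLe r n → coeff (p *ᴾ r) (m ℕ.+ n) ≈ coeff p m F.* coeff r n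
  coeff-*-top {[]}    {r} {m} {n} h k = F.sym (F.zeroˡ _)
  coeff-*-top {a ∷ p} {r} {zero} {n} h k = F.trans (at
    (R.trans (R.*-congʳ {r} (R.trans (∷≈C+X* a p)
      (R.trans (R.+-congˡ {C a} (R.trans (R.*-congˡ {X} (degLe-0-tail h)) (R.zeroʳ X))) (R.+-identityʳ (C a)))))
      (C*≈⋆ a r)) n) (coeff-⋆ a r n)
  coeff-*-top {a ∷ p} {r} {suc m} {n} h k = F.trans (coeff-*-suc a p r (m ℕ.+ n))
    (F.trans (F.+-congʳ (F.trans (F.*-congˡ (beyond k (suc m ℕ.+ n) (s≤s (ℕₚ.m≤n+m n m)))) (F.zeroʳ a)))
    (F.trans (F.+-identityˡ _) (coeff-*-top {p} {r} (degLe-tail h) k)))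

  degLe-^ : ∀ {p m} k → DegLe p m → DegLe (p ^ᴿ k) (k ℕ.* m)
  degLe-^ zero    h = degLe-C
  degLe-^ (suc k) h = degLe-* h (degLe-^ k h)

  tail : Poly → Poly
  tail []      = []
  tail (b ∷ p) = p

  tail-cong : ∀ {p r} → p ≈ᴾ r → tail p ≈ᴾ tail r
  tail-cong {[]}    {[]}    e = R.refl
  tail-cong {[]}    {d ∷ r} e = R.sym (tail-≈[] (R.sym e))
  tail-cong {b ∷ p} {[]}    e = tail-≈[] e
  tail-cong {b ∷ p} {d ∷ r} e = coeffwise λ i → coeff-≈ e (suc i)

  coeff-tail : ∀ p i → coeff (tail p) i ≡ coeff p (suc i)
  coeff-tail []      i = ≡.refl
  coeff-tail (b ∷ p) i = ≡.refl

  tail-+ : ∀ p r → tail (p +ᴾ r) ≈ᴾ tail p +ᴾ tail r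
  tail-+ []      r       = R.refl
  tail-+ (b ∷ p) []      = R.sym (R.+-identityʳ p)
  tail-+ (b ∷ p) (d ∷ r) = R.refl

  tail-⋆ : ∀ b p → tail (b ⋆ p) ≡ b ⋆ tail p
  tail-⋆ b []      = ≡.refl
  tail-⋆ b (d ∷ p) = ≡.refl

  degLe-tailᵗ : ∀ {p n} → DegLe p (suc n) → DegLe (tail p) n
  degLe-tailᵗ {[]}    h = degLe-[]
  degLe-tailᵗ {b ∷ p} h = degLe-tail h

  head∷tail : ∀ p → p ≈ᴾ (coeff p 0 ∷ tail p)
  head∷tail []      = R.sym C-0
  head∷tail (b ∷ p) = R.refl

module Evaluation {c ℓ₁ ℓ₂ a ℓ : Level} (F : HeytingField c ℓ₁ ℓ₂) (A : CommutativeRing a ℓ)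
  (φ : HeytingField.Carrier F → CommutativeRing.Carrier A)
  (φ-hom : RingMorphisms.IsRingHomomorphism (CommutativeRing.rawRing (fieldRing F)) (CommutativeRing.rawRing A) φ) where
  open PolynomialTheory F
  open CommutativeRing A
  open RingTheory A
  open RingMorphisms.IsRingHomomorphism φ-hom using (⟦⟧-cong; +-homo; *-homo; 0#-homo; 1#-homo; -‿homo)
  open SetoidReasoning setoid
  private
    module F = CommutativeRing (fieldRing F)
    module PR = RingTheory polyRing

  ev : Poly → Carrier → Carrier
  ev []      x = 0#
  ev (b ∷ p) x = φ b + x * ev p x

  private
    ev-[] : ∀ p x → p ≈ᴾ [] → ev p x ≈ 0#
    ev-[] []      x e = refl
    ev-[] (b ∷ p) x e = begin
      φ b + x * ev p x  ≈⟨ +-cong (trans (⟦⟧-cong (coeff-≈ e 0)) 0#-homo) (*-congˡ (ev-[] p x (tail-≈[] e))) ⟩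
      0# + x * 0#       ≈⟨ trans (+-identityˡ _) (zeroʳ x) ⟩
      0#                ∎

  ev-cong : ∀ {p r} x → p ≈ᴾ r → ev p x ≈ ev r x
  ev-cong {[]}    {r}     x e = sym (ev-[] r x (R.sym e))
  ev-cong {b ∷ p} {[]}    x e = ev-[] (b ∷ p) x e
  ev-cong {b ∷ p} {d ∷ r} x e = +-cong (⟦⟧-cong (coeff-≈ e 0))
    (*-congˡ (ev-cong {p} {r} x (coeffwise λ i → coeff-≈ e (suc i))))

  ev-congʳ : ∀ p {x y} → x ≈ y → ev p x ≈ ev p y
  ev-congʳ []      e = refl
  ev-congʳ (b ∷ p) e = +-congˡ (*-cong e (ev-congʳ p e))

  ev-+ : ∀ p r x → ev (p +ᴾ r) x ≈ ev p x + ev r x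
  ev-+ []      r       x = sym (+-identityˡ _)
  ev-+ (b ∷ p) []      x = sym (+-identityʳ _)
  ev-+ (b ∷ p) (d ∷ r) x = begin
    φ (b F.+ d) + x * ev (p +ᴾ r) x       ≈⟨ +-cong (+-homo b d) (*-congˡ (ev-+ p r x)) ⟩
    φ b + φ d + x * (ev p x + ev r x)     ≈⟨ solve 5 (λ b d x p r → b :+ d :+ x :* (p :+ r) := (b :+ x :* p) :+ (d :+ x :* r)) refl _ _ _ _ _ ⟩
    (φ b + x * ev p x) + (φ d + x * ev r x) ∎

  ev-⋆ : ∀ b p x → ev (b ⋆ p) x ≈ φ b * ev p x
  ev-⋆ b []      x = sym (zeroʳ _)
  ev-⋆ b (d ∷ p) x = begin
    φ (b F.* d) + x * ev (b ⋆ p) x    ≈⟨ +-cong (*-homo b d) (*-congˡ (ev-⋆ b p x)) ⟩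
    φ b * φ d + x * (φ b * ev p x)    ≈⟨ solve 4 (λ b d x p → b :* d :+ x :* (b :* p) := b :* (d :+ x :* p)) refl _ _ _ _ ⟩
    φ b * (φ d + x * ev p x)          ∎

  ev-* : ∀ p r x → ev (p *ᴾ r) x ≈ ev p x * ev r x
  ev-* []      r x = sym (zeroˡ _)
  ev-* (b ∷ p) r x = begin
    ev ((b ⋆ r) +ᴾ (F.0# ∷ p *ᴾ r)) x         ≈⟨ ev-+ (b ⋆ r) (F.0# ∷ p *ᴾ r) x ⟩
    ev (b ⋆ r) x + (φ F.0# + x * ev (p *ᴾ r) x) ≈⟨ +-cong (ev-⋆ b r x) (trans (+-congʳ 0#-homo) (trans (+-identityˡ _) (*-congˡ (ev-* p r x)))) ⟩
    φ b * ev r x + x * (ev p x * ev r x)      ≈⟨ solve 4 (λ b r x p → b :* r :+ x :* (p :* r) := (b :+ x :* p) :* r) refl _ _ _ _ ⟩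
    (φ b + x * ev p x) * ev r x               ∎

  ev-C : ∀ b x → ev (C b) x ≈ φ b
  ev-C b x = trans (+-congˡ (zeroʳ x)) (+-identityʳ _)

  ev-X : ∀ x → ev X x ≈ x
  ev-X x = begin
    φ F.0# + x * ev (C F.1#) x  ≈⟨ +-cong 0#-homo (*-congˡ (trans (ev-C F.1# x) 1#-homo)) ⟩
    0# + x * 1#                 ≈⟨ trans (+-identityˡ _) (*-identityʳ x) ⟩
    x                           ∎

  ev-- : ∀ p x → ev (-ᴾ p) x ≈ - ev p x
  ev-- p x = trans (solve 2 (λ a b → a := (a :+ b) :- b) refl (ev (-ᴾ p) x) (ev p x))
    (trans (+-congʳ (trans (sym (ev-+ (-ᴾ p) p x)) (ev-cong x (R.-‿inverseˡ p)))) (+-identityˡ _))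

  ev-^ : ∀ p k x → ev (p PR.^ k) x ≈ ev p x ^ k
  ev-^ p zero    x = trans (ev-C F.1# x) 1#-homo
  ev-^ p (suc k) x = trans (ev-* p (p PR.^ k) x) (*-congˡ (ev-^ p k x))

record Discrete {c ℓ₁ ℓ₂ : Level} (F : HeytingField c ℓ₁ ℓ₂) : Set (c ⊔ˡ ℓ₁ ⊔ˡ ℓ₂) where
  open HeytingField F
  field
    _≟_   : ∀ x y → Dec (x ≈ y)
    apart : ∀ {x} → ¬ x ≈ 0# → x # 0#

module DiscreteField {c ℓ₁ ℓ₂ : Level} (F : HeytingField c ℓ₁ ℓ₂) (discrete : Discrete F) where
  open HeytingField F
  open Discrete discrete public
  open HeytingProperties heytingCommutativeRing using (1#0; x-0≈x)
  open RingTheory (fieldRing F) using (IsDomain)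
  open SetoidReasoning (CommutativeRing.setoid (fieldRing F))

  #⇒≉ : ∀ {x} → x # 0# → ¬ x ≈ 0#
  #⇒≉ x#0 x≈0 = proj₂ (tight _ _) x≈0 x#0

  inverse : ∀ x → ¬ x ≈ 0# → ∃[ y ] y * x ≈ 1#
  inverse x x≉0 with #⇒invertible (apart x≉0)
  ... | y , e , _ = y , trans (*-congˡ (sym (x-0≈x x))) e

  domain : IsDomain
  domain = record
    { 1≉0          = #⇒≉ 1#0
    ; zero-product = λ {x} {y} xy≈0 x≉0 → let (z , zx≈1) = inverse x x≉0 in begin
        y            ≈⟨ *-identityˡ y ⟨
        1# * y       ≈⟨ *-congʳ zx≈1 ⟨
        z * x * y    ≈⟨ *-assoc z x y ⟩
        z * (x * y)  ≈⟨ *-congˡ xy≈0 ⟩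
        z * 0#       ≈⟨ zeroʳ z ⟩
        0#           ∎
    }

module Homogenization {c ℓ₁ ℓ₂ a ℓ : Level} (F : HeytingField c ℓ₁ ℓ₂) (A : CommutativeRing a ℓ)
  (φ : HeytingField.Carrier F → CommutativeRing.Carrier A)
  (φ-hom : RingMorphisms.IsRingHomomorphism (CommutativeRing.rawRing (fieldRing F)) (CommutativeRing.rawRing A) φ) where
  open PolynomialTheory F
  open Evaluation F A φ φ-hom
  open CommutativeRing A
  open RingTheory A
  open RingMorphisms.IsRingHomomorphism φ-hom using (⟦⟧-cong; +-homo; *-homo; 0#-homo; 1#-homo; -‿homo)
  open SetoidReasoning setoid
  private
    module F = CommutativeRing (fieldRing F)
    module PR = RingTheory polyRing

  -- hom k p u v = Σ pᵢ uⁱ vᵏ⁻ⁱ over i ≤ k; higher coefficients of p are ignored.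
  hom : ℕ → Poly → Carrier → Carrier → Carrier
  hom zero    p u v = φ (coeff p 0)
  hom (suc k) p u v = φ (coeff p 0) * v ^ suc k + u * hom k (tail p) u v

  hom-cong : ∀ k {p r} u v → p ≈ᴾ r → hom k p u v ≈ hom k r u v
  hom-cong zero    u v e = ⟦⟧-cong (coeff-≈ e 0)
  hom-cong (suc k) u v e = +-cong (*-congʳ (⟦⟧-cong (coeff-≈ e 0))) (*-congˡ (hom-cong k u v (tail-cong e)))

  hom-congᵛ : ∀ k p {u u′ v v′} → u ≈ u′ → v ≈ v′ → hom k p u v ≈ hom k p u′ v′
  hom-congᵛ zero    p e f = refl
  hom-congᵛ (suc k) p e f = +-cong (*-congˡ (^-congˡ (suc k) f)) (*-cong e (hom-congᵛ k (tail p) e f))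

  hom-+ : ∀ k p r u v → hom k (p +ᴾ r) u v ≈ hom k p u v + hom k r u v
  hom-+ zero    p r u v = trans (⟦⟧-cong (coeff-+ p r 0)) (+-homo _ _)
  hom-+ (suc k) p r u v = begin
    φ (coeff (p +ᴾ r) 0) * v ^ suc k + u * hom k (tail (p +ᴾ r)) u v
      ≈⟨ +-cong (*-congʳ (trans (⟦⟧-cong (coeff-+ p r 0)) (+-homo _ _)))
                (*-congˡ (trans (hom-cong k u v (tail-+ p r)) (hom-+ k (tail p) (tail r) u v))) ⟩
    (φ (coeff p 0) + φ (coeff r 0)) * v ^ suc k + u * (hom k (tail p) u v + hom k (tail r) u v)
      ≈⟨ solve 6 (λ x y w u s t → (x :+ y) :* w :+ u :* (s :+ t) := (x :* w :+ u :* s) :+ (y :* w :+ u :* t)) refl _ _ _ _ _ _ ⟩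
    hom (suc k) p u v + hom (suc k) r u v ∎

  hom-⋆ : ∀ k b p u v → hom k (b ⋆ p) u v ≈ φ b * hom k p u v
  hom-⋆ zero    b p u v = trans (⟦⟧-cong (coeff-⋆ b p 0)) (*-homo _ _)
  hom-⋆ (suc k) b p u v = begin
    φ (coeff (b ⋆ p) 0) * v ^ suc k + u * hom k (tail (b ⋆ p)) u v
      ≈⟨ +-cong (*-congʳ (trans (⟦⟧-cong (coeff-⋆ b p 0)) (*-homo _ _)))
                (*-congˡ (trans (reflexive (≡.cong (λ r → hom k r u v) (tail-⋆ b p))) (hom-⋆ k b (tail p) u v))) ⟩
    φ b * φ (coeff p 0) * v ^ suc k + u * (φ b * hom k (tail p) u v)
      ≈⟨ solve 5 (λ b x w u s → b :* x :* w :+ u :* (b :* s) := b :* (x :* w :+ u :* s)) refl _ _ _ _ _ ⟩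
    φ b * hom (suc k) p u v ∎

  hom-C* : ∀ k b p u v → hom k (C b *ᴾ p) u v ≈ φ b * hom k p u v
  hom-C* k b p u v = trans (hom-cong k u v (C*≈⋆ b p)) (hom-⋆ k b p u v)

  hom-[] : ∀ k u v → hom k [] u v ≈ 0#
  hom-[] zero    u v = 0#-homo
  hom-[] (suc k) u v = trans (+-cong (trans (*-congʳ 0#-homo) (zeroˡ _)) (trans (*-congˡ (hom-[] k u v)) (zeroʳ u))) (+-identityʳ 0#)

  hom-- : ∀ k p u v → hom k (-ᴾ p) u v ≈ - hom k p u v
  hom-- k p u v = trans (solve 2 (λ a b → a := (a :+ b) :- b) refl (hom k (-ᴾ p) u v) (hom k p u v))
    (trans (+-congʳ (trans (sym (hom-+ k (-ᴾ p) p u v)) (trans (hom-cong k u v (R.-‿inverseˡ p)) (hom-[] k u v)))) (+-identityˡ _))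

  hom-0∷ : ∀ k p u v → hom (suc k) (F.0# ∷ p) u v ≈ u * hom k p u v
  hom-0∷ k p u v = trans (+-congʳ (trans (*-congʳ 0#-homo) (zeroˡ _))) (+-identityˡ _)

  hom-suc : ∀ k p u v → DegLe p k → hom (suc k) p u v ≈ v * hom k p u v
  hom-suc zero    p u v h = begin
    φ (coeff p 0) * (v * 1#) + u * φ (coeff (tail p) 0)
      ≈⟨ +-congˡ (*-congˡ (trans (⟦⟧-cong (F.trans (F.reflexive (coeff-tail p 0)) (beyond h 1 z<s))) 0#-homo)) ⟩
    φ (coeff p 0) * (v * 1#) + u * 0#
      ≈⟨ solve 3 (λ x v u → x :* (v :* con (+ 1)) :+ u :* con (+ 0) := v :* x) refl _ _ _ ⟩
    v * φ (coeff p 0) ∎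
  hom-suc (suc k) p u v h = begin
    φ (coeff p 0) * (v * v ^ suc k) + u * hom (suc k) (tail p) u v
      ≈⟨ +-congˡ (*-congˡ (hom-suc k (tail p) u v (degLe-tailᵗ h))) ⟩
    φ (coeff p 0) * (v * v ^ suc k) + u * (v * hom k (tail p) u v)
      ≈⟨ solve 5 (λ x v w u s → x :* (v :* w) :+ u :* (v :* s) := v :* (x :* w :+ u :* s)) refl _ _ _ _ _ ⟩
    v * hom (suc k) p u v ∎

  hom-raise : ∀ j k p u v → DegLe p k → hom (j ℕ.+ k) p u v ≈ v ^ j * hom k p u v
  hom-raise zero    k p u v h = sym (*-identityˡ _)
  hom-raise (suc j) k p u v h = trans (hom-suc (j ℕ.+ k) p u v (degLe-mono (ℕₚ.m≤n+m k j) h))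
    (trans (*-congˡ (hom-raise j k p u v h)) (sym (*-assoc _ _ _)))

  hom-* : ∀ m n p r u v → DegLe p m → DegLe r n → hom (m ℕ.+ n) (p *ᴾ r) u v ≈ hom m p u v * hom n r u v
  hom-* zero    n p r u v h k = trans (hom-cong n u v (R.*-congʳ {r} (degLe-0⇒C h))) (hom-C* n (coeff p 0) r u v)
  hom-* (suc m) n p r u v h k = begin
    hom (suc m ℕ.+ n) (p *ᴾ r) u v
      ≈⟨ hom-cong (suc m ℕ.+ n) u v (R.*-congʳ {r} (head∷tail p)) ⟩
    hom (suc m ℕ.+ n) ((p₀ ⋆ r) +ᴾ (F.0# ∷ tail p *ᴾ r)) u v
      ≈⟨ hom-+ (suc m ℕ.+ n) (p₀ ⋆ r) (F.0# ∷ tail p *ᴾ r) u v ⟩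
    hom (suc m ℕ.+ n) (p₀ ⋆ r) u v + hom (suc m ℕ.+ n) (F.0# ∷ tail p *ᴾ r) u v
      ≈⟨ +-cong (trans (hom-⋆ (suc m ℕ.+ n) p₀ r u v) (*-congˡ (hom-raise (suc m) n r u v k)))
                (trans (hom-0∷ (m ℕ.+ n) (tail p *ᴾ r) u v) (*-congˡ (hom-* m n (tail p) r u v (degLe-tailᵗ h) k))) ⟩
    φ p₀ * (v ^ suc m * hom n r u v) + u * (hom m (tail p) u v * hom n r u v)
      ≈⟨ solve 5 (λ x w r u s → x :* (w :* r) :+ u :* (s :* r) := (x :* w :+ u :* s) :* r) refl _ _ _ _ _ ⟩
    hom (suc m) p u v * hom n r u v ∎
    where p₀ = coeff p 0

  hom-^ : ∀ m p j u v → DegLe p m → hom (j ℕ.* m) (p PR.^ j) u v ≈ hom m p u v ^ j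
  hom-^ m p zero    u v h = 1#-homo
  hom-^ m p (suc j) u v h = trans (hom-* m (j ℕ.* m) p (p PR.^ j) u v h (degLe-^ j h)) (*-congˡ (hom-^ m p j u v h))

  hom-scale : ∀ k p x v → DegLe p k → hom k p (x * v) v ≈ v ^ k * ev p x
  hom-scale zero    p x v h = sym (trans (*-identityˡ _) (trans (ev-cong x (degLe-0⇒C h)) (ev-C (coeff p 0) x)))
  hom-scale (suc k) p x v h = begin
    φ (coeff p 0) * v ^ suc k + x * v * hom k (tail p) (x * v) v
      ≈⟨ +-congˡ (*-congˡ (hom-scale k (tail p) x v (degLe-tailᵗ h))) ⟩
    φ (coeff p 0) * (v * v ^ k) + x * v * (v ^ k * ev (tail p) x)
      ≈⟨ solve 5 (λ a v w x e → a :* (v :* w) :+ x :* v :* (w :* e) := v :* w :* (a :+ x :* e)) refl _ _ _ _ _ ⟩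
    v ^ suc k * (φ (coeff p 0) + x * ev (tail p) x)
      ≈⟨ *-congˡ (ev-cong x (head∷tail p)) ⟨
    v ^ suc k * ev p x ∎

  hom-homogeneous : ∀ k p s u v → hom k p (s * u) (s * v) ≈ s ^ k * hom k p u v
  hom-homogeneous zero    p s u v = sym (*-identityˡ _)
  hom-homogeneous (suc k) p s u v = begin
    φ (coeff p 0) * (s * v) ^ suc k + s * u * hom k (tail p) (s * u) (s * v)
      ≈⟨ +-cong (*-congˡ (^-distrib-* s v (suc k))) (*-congˡ (hom-homogeneous k (tail p) s u v)) ⟩
    φ (coeff p 0) * (s * s ^ k * v ^ suc k) + s * u * (s ^ k * hom k (tail p) u v)
      ≈⟨ solve 6 (λ a s t w u h → a :* (s :* t :* w) :+ s :* u :* (t :* h) := s :* t :* (a :* w :+ u :* h)) refl _ _ _ _ _ _ ⟩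
    s ^ suc k * hom (suc k) p u v ∎

module PolynomialForms {c ℓ₁ ℓ₂ : Level} (F : HeytingField c ℓ₁ ℓ₂) where
  open PolynomialTheory F
  private module F = CommutativeRing (fieldRing F)
  open F using (0#; 1#)

  C-isRingHomomorphism : RingMorphisms.IsRingHomomorphism F.rawRing R.rawRing C
  C-isRingHomomorphism = record
    { isSemiringHomomorphism = record
      { isNearSemiringHomomorphism = record
        { +-isMonoidHomomorphism = record
          { isMagmaHomomorphism = record
            { isRelHomomorphism = record { cong = C-cong } ; homo = C-+ }
          ; ε-homo = C-0
          }
        ; *-homo = C-*
        }
      ; 1#-homo = R.refl
      }
    ; -‿homo = C--
    }

  open Homogenization F polyRing C C-isRingHomomorphism public
  module Sub = Evaluation F polyRing C C-isRingHomomorphism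
  open RingTheory polyRing using (_^_; ^-homo-*)
  open SetoidReasoning R.setoid

  degLe-hom : ∀ k p {u v D} → DegLe u D → DegLe v D → DegLe (hom k p u v) (k ℕ.* D)
  degLe-hom zero    p hu hv = degLe-C
  degLe-hom (suc k) p {u} {v} {D} hu hv = degLe-+
    (degLe-* {C (coeff p 0)} {m = zero} degLe-C (degLe-^ (suc k) hv))
    (degLe-* hu (degLe-hom k (tail p) hu hv))

  hom-X-1 : ∀ k p → DegLe p k → hom k p X (C 1#) ≈ᴾ p
  hom-X-1 zero    p h = R.sym (degLe-0⇒C h)
  hom-X-1 (suc k) p h = begin
    C (coeff p 0) *ᴾ (C 1#) ^ suc k +ᴾ X *ᴾ hom k (tail p) X (C 1#)
      ≈⟨ R.+-cong (R.trans (R.*-congˡ {C (coeff p 0)} (RingTheory.1^n polyRing (suc k))) (R.*-identityʳ (C (coeff p 0))))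
                  (R.*-congˡ {X} (hom-X-1 k (tail p) (degLe-tailᵗ h))) ⟩
    C (coeff p 0) +ᴾ X *ᴾ tail p  ≈⟨ ∷≈C+X* (coeff p 0) (tail p) ⟨
    coeff p 0 ∷ tail p            ≈⟨ head∷tail p ⟨
    p                             ∎

  module _ {a ℓ : Level} (A : CommutativeRing a ℓ)
    (φ : HeytingField.Carrier F → CommutativeRing.Carrier A)
    (φ-hom : RingMorphisms.IsRingHomomorphism (CommutativeRing.rawRing (fieldRing F)) (CommutativeRing.rawRing A) φ) where
    private
      module A = CommutativeRing A
      module AT = RingTheory A
      module AE = Evaluation F A φ φ-hom
      module AH = Homogenization F A φ φ-hom
      open RingMorphisms.IsRingHomomorphism φ-hom using (1#-homo)

    ev-hom : ∀ k p g h x → AE.ev (hom k p g h) x A.≈ AH.hom k p (AE.ev g x) (AE.ev h x)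
    ev-hom zero    p g h x = AE.ev-C (coeff p 0) x
    ev-hom (suc k) p g h x = A.trans (AE.ev-+ (C (coeff p 0) *ᴾ h ^ suc k) (g *ᴾ hom k (tail p) g h) x)
      (A.+-cong
        (A.trans (AE.ev-* (C (coeff p 0)) (h ^ suc k) x)
          (A.*-cong (AE.ev-C (coeff p 0) x) (AE.ev-^ h (suc k) x)))
        (A.trans (AE.ev-* g (hom k (tail p) g h) x) (A.*-congˡ (ev-hom k (tail p) g h x))))

    hom-hom : ∀ k p g h D u v → DegLe g D → DegLe h D →
      AH.hom (k ℕ.* D) (hom k p g h) u v A.≈ AH.hom k p (AH.hom D g u v) (AH.hom D h u v)
    hom-hom zero    p g h D u v hg hh = A.refl
    hom-hom (suc k) p g h D u v hg hh = A.trans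
      (AH.hom-+ (suc k ℕ.* D) (C (coeff p 0) *ᴾ h ^ suc k) (g *ᴾ hom k (tail p) g h) u v)
      (A.+-cong
        (A.trans (AH.hom-C* (suc k ℕ.* D) (coeff p 0) (h ^ suc k) u v)
          (A.*-congˡ (AH.hom-^ D h (suc k) u v hh)))
        (A.trans (AH.hom-* D (k ℕ.* D) g (hom k (tail p) g h) u v hg (degLe-hom k (tail p) hg hh))
          (A.*-congˡ (hom-hom k (tail p) g h D u v hg hh))))

module RootPolynomials {c ℓ₁ ℓ₂ : Level} (F : HeytingField c ℓ₁ ℓ₂) where
  open PolynomialTheory F
  open RingTheory polyRing using (_^_; geometric)
  private
    FR = fieldRing F
    module F = CommutativeRing FR
    module FT = RingTheory FR

  scalingPolynomial : (D : ℕ) (b c₁ : F.Carrier) → Poly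
  scalingPolynomial D b c₁ = C c₁ *ᴾ (X *ᴾ X ^ D) -ᴾ C b

  multiplier : (s′ : ℕ) (k : F.Carrier) → Poly
  multiplier s′ k = C k *ᴾ (X *ᴾ geometric s′ (X ^ suc (suc s′)) (C F.1#))

  langPolynomial : (s′ : ℕ) (k b c₁ e : F.Carrier) → Poly
  langPolynomial s′ k b c₁ e = let s = suc s′ ; Λ = multiplier s′ k in
    Λ *ᴾ Λ ^ s -ᴾ (C (c₁ F.* b FT.^ s) +ᴾ C e *ᴾ (Λ ^ s *ᴾ (X ^ s) ^ s))

  module _ {a ℓ : Level} (A : CommutativeRing a ℓ) (φ : F.Carrier → CommutativeRing.Carrier A)
    (φ-hom : RingMorphisms.IsRingHomomorphism (CommutativeRing.rawRing FR) (CommutativeRing.rawRing A) φ) where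
    private
      module A = CommutativeRing A
      module AT = RingTheory A
      module PR = RingTheory polyRing
    open Evaluation F A φ φ-hom
    open RingMorphisms.IsRingHomomorphism φ-hom using (*-homo; 1#-homo)
    open RingHomomorphism FR A φ φ-hom using (φ-^)

    ev-geometric : ∀ n x y τ → ev (geometric n x y) τ A.≈ AT.geometric n (ev x τ) (ev y τ)
    ev-geometric zero    x y τ = A.refl
    ev-geometric (suc n) x y τ = A.trans (ev-+ (x PR.^ n) (y *ᴾ geometric n x y) τ) (A.+-cong (ev-^ x n τ)
      (A.trans (ev-* y (geometric n x y) τ) (A.*-congˡ (ev-geometric n x y τ))))

    ev-X^ : ∀ n τ → ev (X PR.^ n) τ A.≈ τ AT.^ n
    ev-X^ n τ = A.trans (ev-^ X n τ) (AT.^-congˡ n (ev-X τ))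

    ev-sub : ∀ p r τ → ev (p -ᴾ r) τ A.≈ ev p τ A.- ev r τ
    ev-sub p r τ = A.trans (ev-+ p (-ᴾ r) τ) (A.+-congˡ (ev-- r τ))

    ev-scaling : ∀ D b c₁ τ → ev (scalingPolynomial D b c₁) τ A.≈ φ c₁ A.* (τ A.* τ AT.^ D) A.- φ b
    ev-scaling D b c₁ τ = A.trans (ev-sub (C c₁ *ᴾ (X *ᴾ X PR.^ D)) (C b) τ) (A.+-cong
      (A.trans (ev-* (C c₁) (X *ᴾ X PR.^ D) τ) (A.*-cong (ev-C c₁ τ) (A.trans (ev-* X (X PR.^ D) τ) (A.*-cong (ev-X τ) (ev-X^ D τ)))))
      (A.-‿cong (ev-C b τ)))

    ev-multiplier : ∀ s′ k τ → ev (multiplier s′ k) τ A.≈ φ k A.* (τ A.* AT.geometric s′ (τ AT.^ suc (suc s′)) A.1#)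
    ev-multiplier s′ k τ = A.trans (ev-* (C k) (X *ᴾ geometric s′ (X PR.^ suc (suc s′)) (C F.1#)) τ) (A.*-cong (ev-C k τ)
      (A.trans (ev-* X (geometric s′ (X PR.^ suc (suc s′)) (C F.1#)) τ) (A.*-cong (ev-X τ)
        (A.trans (ev-geometric s′ (X PR.^ suc (suc s′)) (C F.1#) τ)
          (AT.geometric-cong s′ (ev-X^ (suc (suc s′)) τ) (A.trans (ev-C F.1# τ) 1#-homo))))))

    ev-lang : ∀ s′ k b c₁ e τ → let s = suc s′ ; λ₀ = φ k A.* (τ A.* AT.geometric s′ (τ AT.^ suc s) A.1#) in
      ev (langPolynomial s′ k b c₁ e) τ A.≈
        λ₀ A.* λ₀ AT.^ s A.- (φ c₁ A.* φ b AT.^ s A.+ φ e A.* (λ₀ AT.^ s A.* (τ AT.^ s) AT.^ s))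
    ev-lang s′ k b c₁ e τ = A.trans (ev-sub (Λ *ᴾ Λ PR.^ s) (C c₂ +ᴾ C e *ᴾ (Λ PR.^ s *ᴾ (X PR.^ s) PR.^ s)) τ) (A.+-cong
      (A.trans (ev-* Λ (Λ PR.^ s) τ) (A.*-cong (ev-multiplier s′ k τ) λ^s))
      (A.-‿cong (A.trans (ev-+ (C c₂) (C e *ᴾ (Λ PR.^ s *ᴾ (X PR.^ s) PR.^ s)) τ) (A.+-cong
        (A.trans (ev-C c₂ τ) (A.trans (*-homo c₁ (b FT.^ s)) (A.*-congˡ (φ-^ b s))))
        (A.trans (ev-* (C e) (Λ PR.^ s *ᴾ (X PR.^ s) PR.^ s) τ) (A.*-cong (ev-C e τ)
          (A.trans (ev-* (Λ PR.^ s) ((X PR.^ s) PR.^ s) τ) (A.*-cong λ^s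
            (A.trans (ev-^ (X PR.^ s) s τ) (AT.^-congˡ s (ev-X^ s τ)))))))))))
      where
      s = suc s′
      Λ = multiplier s′ k
      c₂ = c₁ F.* b FT.^ s
      λ^s : ev (Λ PR.^ s) τ A.≈ (φ k A.* (τ A.* AT.geometric s′ (τ AT.^ suc s) A.1#)) AT.^ s
      λ^s = A.trans (ev-^ Λ s τ) (AT.^-congˡ s (ev-multiplier s′ k τ))

module DegreeArithmetic where
  open import Data.Nat.Base using (_+_; _*_)
  open +-*-Solver

  cancel-degrees : ∀ a i l e δ ε → a + (i * δ + (e + l) * ε) ≡ (i + e) * δ + l * ε → e * δ ≡ a + e * ε
  cancel-degrees a i l e δ ε eq = ℕₚ.+-cancelˡ-≡ (i * δ + l * ε) _ _ (≡.trans
    (solve 5 (λ i l e δ ε → (i :* δ :+ l :* ε) :+ e :* δ := (i :+ e) :* δ :+ l :* ε) ≡.refl i l e δ ε)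
    (≡.trans (≡.sym eq)
    (solve 6 (λ a i l e δ ε → a :+ (i :* δ :+ (e :+ l) :* ε) := (i :* δ :+ l :* ε) :+ (a :+ e :* ε)) ≡.refl a i l e δ ε)))

open DegreeArithmetic

module DiscretePolynomials {c ℓ₁ ℓ₂ : Level} (F : HeytingField c ℓ₁ ℓ₂) (discrete : Discrete F) where
  open PolynomialTheory F public
  open PolynomialForms F public
  open RootPolynomials F
  private
    FR = fieldRing F
    module F = CommutativeRing FR
    module FT = RingTheory FR
  open F using (Carrier; _≈_; 0#; 1#)
  open DiscreteField F discrete using (_≟_; apart; #⇒≉; inverse; domain)
  open DomainTheory FR domain using () renaming (*-≉0 to *-≉0ᶠ; ^-≉0 to ^-≉0ᶠ)
  open RingTheory.IsDomain domain using (1≉0; zero-product)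
  open FT using () renaming (_·_ to _·ᶠ_; _^_ to _^ᶠ_; solve to solveᶠ; _:=_ to _:=ᶠ_; _:+_ to _:+ᶠ_; _:*_ to _:*ᶠ_; _:-_ to _:-ᶠ_; :-_ to :-ᶠ_; con to conᶠ)
  open RingTheory polyRing hiding (IsDomain; Unit; Comaximal) public
  open SetoidReasoning R.setoid

  zero? : ∀ p → Dec (p ≈ᴾ [])
  zero? []      = yes R.refl
  zero? (a ∷ p) with a ≟ 0# | zero? p
  ... | no a≉0  | _        = no λ e → a≉0 (at e 0)
  ... | yes a≈0 | no p≉0   = no λ e → p≉0 (tail-≈[] e)
  ... | yes a≈0 | yes p≈0  = yes (R.trans (∷-cong a≈0 p≈0) C-0)

  record HasDeg (p : Poly) (n : ℕ) : Set ℓ₁ where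
    constructor hasDeg
    field
      top    : ¬ coeff p n ≈ 0#
      bound  : DegLe p n
  open HasDeg public

  fromHasDegree : ∀ {p n} → HasDegree p n → HasDeg p n
  fromHasDegree (t , b) = hasDeg (#⇒≉ t) (degLe b)

  toHasDegree : ∀ {p n} → HasDeg p n → HasDegree p n
  toHasDegree h = apart (top h) , beyond (bound h)

  degree : ∀ p → ¬ p ≈ᴾ [] → ∃[ n ] HasDeg p n
  degree []      p≉0 = ⊥-elim (p≉0 R.refl)
  degree (a ∷ p) ap≉0 with zero? p
  ... | no p≉0  = let (n , h) = degree p p≉0 in suc n , hasDeg (top h) (degLe-∷ (bound h))
  ... | yes p≈0 = 0 , hasDeg (λ a≈0 → ap≉0 (R.trans (∷-cong a≈0 p≈0) C-0))
                             (degLe λ { (suc i) _ → at p≈0 i })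

  hasDeg-cong : ∀ {p r n} → p ≈ᴾ r → HasDeg p n → HasDeg r n
  hasDeg-cong e h = hasDeg (λ z → top h (F.trans (at e _) z)) (degLe-cong e (bound h))

  hasDeg-≉0 : ∀ {p n} → HasDeg p n → ¬ p ≈ᴾ []
  hasDeg-≉0 h e = top h (at e _)

  hasDeg-C : ∀ {a} → ¬ a ≈ 0# → HasDeg (C a) 0
  hasDeg-C a≉0 = hasDeg a≉0 degLe-C

  hasDeg-X : HasDeg X 1
  hasDeg-X = hasDeg 1≉0 degLe-X

  hasDeg-* : ∀ {p r m n} → HasDeg p m → HasDeg r n → HasDeg (p *ᴾ r) (m ℕ.+ n)
  hasDeg-* h k = hasDeg (λ e → *-≉0ᶠ (top h) (top k) (F.trans (F.sym (coeff-*-top (bound h) (bound k))) e))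
                        (degLe-* (bound h) (bound k))

  hasDeg-^ : ∀ {p m} k → HasDeg p m → HasDeg (p ^ k) (k ℕ.* m)
  hasDeg-^ zero    h = hasDeg-C 1≉0
  hasDeg-^ (suc k) h = hasDeg-* h (hasDeg-^ k h)

  hasDeg-≤ : ∀ {p m n} → HasDeg p m → DegLe p n → m ≤ n
  hasDeg-≤ h k = ℕₚ.≮⇒≥ λ n<m → top h (beyond k _ n<m)

  hasDeg-unique : ∀ {p m n} → HasDeg p m → HasDeg p n → m ≡ n
  hasDeg-unique h k = ℕₚ.≤-antisym (hasDeg-≤ h (bound k)) (hasDeg-≤ k (bound h))

  polyDomain : RingTheory.IsDomain polyRing
  polyDomain = record
    { 1≉0          = λ e → 1≉0 (at e 0)
    ; zero-product = zp
    }
    where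
    zp : ∀ {p r} → p *ᴾ r ≈ᴾ [] → ¬ p ≈ᴾ [] → r ≈ᴾ []
    zp {p} {r} e p≉0 with zero? r
    ... | yes r≈0 = r≈0
    ... | no r≉0  = ⊥-elim (hasDeg-≉0 (hasDeg-* (proj₂ (degree p p≉0)) (proj₂ (degree r r≉0))) e)

  open DomainTheory polyRing polyDomain public

  ∣⇒deg≤ : ∀ {p r m n} → HasDeg p m → ¬ r ≈ᴾ [] → DegLe r n → p ∣ r → m ≤ n
  ∣⇒deg≤ {p} {r} {m} hp r≉0 hr (q , e) with zero? q
  ... | yes q≈0 = ⊥-elim (r≉0 (R.trans (R.sym e) (R.*-congʳ {p} q≈0)))
  ... | no q≉0  with degree q q≉0
  ...   | k , hq = ℕₚ.≤-trans (ℕₚ.m≤n+m m k) (hasDeg-≤ (hasDeg-cong e (hasDeg-* hq hp)) hr)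

  unit⇒deg0 : ∀ {p n} → HasDeg p n → Unit p → n ≡ 0
  unit⇒deg0 h u = ℕₚ.n≤0⇒n≡0 (∣⇒deg≤ h (hasDeg-≉0 (hasDeg-C 1≉0)) degLe-C u)

  C-unit : ∀ {a} → ¬ a ≈ 0# → Unit (C a)
  C-unit {a} a≉0 = let (b , e) = inverse a a≉0 in C b , R.trans (R.sym (C-* b a)) (C-cong e)

  deg0⇒unit : ∀ {p} → HasDeg p 0 → Unit p
  deg0⇒unit h = ∣-respˡ (R.sym (degLe-0⇒C (bound h))) (C-unit (top h))

  unit⇒C : ∀ {p} → Unit p → ∃[ κ ] (¬ κ ≈ 0# × p ≈ᴾ C κ)
  unit⇒C {p} u@(q , e) = of-degree (degree p p≉0)
    where
    p≉0 : ¬ p ≈ᴾ []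
    p≉0 z = 1≉0 (at (R.trans (R.sym e) (R.trans (R.*-congˡ {q} z) (R.zeroʳ q))) 0)
    of-degree : (∃[ n ] HasDeg p n) → ∃[ κ ] (¬ κ ≈ 0# × p ≈ᴾ C κ)
    of-degree (n , h) with unit⇒deg0 h u
    ... | ≡.refl = coeff p 0 , top h , degLe-0⇒C (bound h)

  record DegLt (p : Poly) (n : ℕ) : Set ℓ₁ where
    constructor degLt
    field vanish : ∀ i → n ≤ i → coeff p i ≈ 0#
  open DegLt public

  degLt-mono : ∀ {p m n} → m ≤ n → DegLt p m → DegLt p n
  degLt-mono m≤n h = degLt λ i le → vanish h i (ℕₚ.≤-trans m≤n le)

  degLt-hasDeg : ∀ {p m n} → HasDeg p m → DegLt p n → m < n
  degLt-hasDeg h k = ℕₚ.≰⇒> λ n≤m → top h (vanish k _ n≤m)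

  module Division (b : Poly) (n : ℕ) (hb : HasDeg b n) where
    private
      lead⁻¹ = proj₁ (inverse (coeff b n) (top hb))

      factor : Carrier → Poly → Carrier
      factor a r = coeff (a ∷ r) n F.* lead⁻¹

    divMod : Poly → Poly × Poly
    divMod []      = [] , []
    divMod (a ∷ p) = let (q , r) = divMod p in
      (factor a r ∷ q) , ((a ∷ r) -ᴾ C (factor a r) *ᴾ b)

    quotient remainder : Poly → Poly
    quotient  p = proj₁ (divMod p)
    remainder p = proj₂ (divMod p)

    divMod-eq : ∀ p → p ≈ᴾ quotient p *ᴾ b +ᴾ remainder p
    divMod-eq []      = R.refl
    divMod-eq (a ∷ p) = let (q , r) = divMod p ; f = factor a r in begin
      a ∷ p                                  ≈⟨ ∷≈C+X* a p ⟩
      C a +ᴾ X *ᴾ p                          ≈⟨ R.+-congˡ {C a} (R.*-congˡ {X} (divMod-eq p)) ⟩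
      C a +ᴾ X *ᴾ (q *ᴾ b +ᴾ r)              ≈⟨ solve 6 (λ a x q b r f → a :+ x :* (q :* b :+ r) := (f :+ x :* q) :* b :+ ((a :+ x :* r) :- f :* b)) R.refl (C a) X q b r (C f) ⟩
      (C f +ᴾ X *ᴾ q) *ᴾ b +ᴾ ((C a +ᴾ X *ᴾ r) -ᴾ C f *ᴾ b)
        ≈⟨ R.+-cong {(C f +ᴾ X *ᴾ q) *ᴾ b} {(f ∷ q) *ᴾ b} (R.*-congʳ {b} (R.sym (∷≈C+X* f q)))
                    (R.+-congʳ { -ᴾ (C f *ᴾ b)} (R.sym (∷≈C+X* a r))) ⟩
      (f ∷ q) *ᴾ b +ᴾ ((a ∷ r) -ᴾ C f *ᴾ b)  ∎

    remainder-< : ∀ p → DegLt (remainder p) n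
    remainder-< []      = degLt λ _ _ → F.refl
    remainder-< (a ∷ p) = degLt λ i n≤i → F.trans (coeff-+ (a ∷ r) (-ᴾ (C f *ᴾ b)) i)
        (F.trans (F.+-congˡ (F.trans (coeff-- (C f *ᴾ b) i) (F.-‿cong (coeff-C* f b i)))) (go i n≤i))
      where
      r = remainder p
      f = factor a r
      go : ∀ i → n ≤ i → coeff (a ∷ r) i F.- f F.* coeff b i ≈ 0#
      go i n≤i with ℕₚ.m≤n⇒m<n∨m≡n n≤i
      ... | inj₂ ≡.refl = F.trans (F.+-congˡ (F.-‿cong (F.trans (F.*-assoc _ _ _)
              (F.trans (F.*-congˡ (proj₂ (inverse (coeff b n) (top hb)))) (F.*-identityʳ _))))) (F.-‿inverseʳ _)
      ... | inj₁ n<i = F.trans (F.+-cong (low i n<i) (F.-‿cong (F.trans (F.*-congˡ (beyond (bound hb) i n<i)) (F.zeroʳ f))))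
              (F.-‿inverseʳ 0#)
        where
        low : ∀ i → n < i → coeff (a ∷ r) i ≈ 0#
        low (suc j) (s≤s n≤j) = vanish (remainder-< p) j n≤j

  record Gcd (p r : Poly) : Set (c ⊔ˡ ℓ₁) where
    field
      g u v : Poly
      g∣p   : g ∣ p
      g∣r   : g ∣ r
      combination : g ≈ᴾ u *ᴾ p +ᴾ v *ᴾ r

  gcd : ∀ p r → Gcd p r
  gcd p r = go (List.length r) p r (degLt (λ i le → beyond-length r i le))
    where
    beyond-length : ∀ p i → List.length p ≤ i → coeff p i ≈ 0#
    beyond-length []      i       le       = F.refl
    beyond-length (a ∷ p) (suc i) (s≤s le) = beyond-length p i le

    go : ∀ n p r → DegLt r n → Gcd p r
    go n p r r<n with zero? r
    go n p r r<n | yes r≈0 = record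
      { g = p ; u = C 1# ; v = [] ; g∣p = ∣-refl ; g∣r = ∣-respʳ (R.sym r≈0) ∣-0
      ; combination = R.sym (R.trans (R.+-identityʳ (C 1# *ᴾ p)) (R.*-identityˡ p)) }
    go zero p r r<n | no r≉0 = ⊥-elim (r≉0 (coeffwise λ i → vanish r<n i z≤n))
    go (suc n) p r r<n | no r≉0 = record
      { g = G.g ; u = G.v ; v = G.u -ᴾ G.v *ᴾ q
      ; g∣p = ∣-respʳ (R.sym (divMod-eq p)) (∣-+ (∣-*ˡ q r G.g∣p) G.g∣r)
      ; g∣r = G.g∣p
      ; combination = begin
          G.g                                 ≈⟨ G.combination ⟩
          G.u *ᴾ r +ᴾ G.v *ᴾ s
            ≈⟨ solve 5 (λ u v q r s → u :* r :+ v :* s := v :* (q :* r :+ s) :+ (u :- v :* q) :* r) R.refl G.u G.v q r s ⟩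
          G.v *ᴾ (q *ᴾ r +ᴾ s) +ᴾ (G.u -ᴾ G.v *ᴾ q) *ᴾ r
            ≈⟨ R.+-congʳ {(G.u -ᴾ G.v *ᴾ q) *ᴾ r} (R.*-congˡ {G.v} (R.sym (divMod-eq p))) ⟩
          G.v *ᴾ p +ᴾ (G.u -ᴾ G.v *ᴾ q) *ᴾ r  ∎
      }
      where
      k  = proj₁ (degree r r≉0)
      hr = proj₂ (degree r r≉0)
      open Division r k hr
      q = quotient p
      s = remainder p
      module G = Gcd (go n r s (degLt-mono (ℕₚ.≤-pred (degLt-hasDeg hr r<n)) (remainder-< p)))

  coprime⇒comaximal : ∀ {p r} → Coprime p r → Comaximal p r
  coprime⇒comaximal {p} {r} cop = bezout (q *ᴾ u) (q *ᴾ v) (begin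
      q *ᴾ u *ᴾ p +ᴾ q *ᴾ v *ᴾ r  ≈⟨ solve 5 (λ q u v p r → q :* u :* p :+ q :* v :* r := q :* (u :* p :+ v :* r)) R.refl q u v p r ⟩
      q *ᴾ (u *ᴾ p +ᴾ v *ᴾ r)     ≈⟨ R.*-congˡ {q} combination ⟨
      q *ᴾ g                      ≈⟨ coeffwise q*g≋1 ⟩
      C 1#                        ∎)
    where
    open Gcd (gcd p r)
    g∣1 = cop {g} (proj₁ g∣p RawMagmaDefinitions., coeff-≈ (proj₂ g∣p)) (proj₁ g∣r RawMagmaDefinitions., coeff-≈ (proj₂ g∣r))
    q = RawMagmaDefinitions._∣ʳ_.quotient g∣1
    q*g≋1 = RawMagmaDefinitions._∣ʳ_.equality g∣1

  module F-ev = Evaluation F FR (λ x → x) (Identity.isRingHomomorphism F.rawRing F.refl)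
  open F-ev public using () renaming (ev to value)

  factor-root : ∀ x p → ∃[ q ] p ≈ᴾ (X -ᴾ C x) *ᴾ q +ᴾ C (value p x)
  factor-root x []      = [] , R.sym (R.trans (R.+-cong {(X -ᴾ C x) *ᴾ []} (R.zeroʳ (X -ᴾ C x)) C-0) R.refl)
  factor-root x (a ∷ p) = let (q , e) = factor-root x p ; v = value p x in C v +ᴾ X *ᴾ q , (begin
    a ∷ p
      ≈⟨ ∷≈C+X* a p ⟩
    C a +ᴾ X *ᴾ p
      ≈⟨ R.+-congˡ {C a} (R.*-congˡ {X} e) ⟩
    C a +ᴾ X *ᴾ ((X -ᴾ C x) *ᴾ q +ᴾ C v)
      ≈⟨ solve 5 (λ a X x q v → a :+ X :* ((X :- x) :* q :+ v) := (X :- x) :* (v :+ X :* q) :+ (a :+ x :* v)) R.refl (C a) X (C x) q (C v) ⟩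
    (X -ᴾ C x) *ᴾ (C v +ᴾ X *ᴾ q) +ᴾ (C a +ᴾ C x *ᴾ C v)
      ≈⟨ R.+-congˡ {(X -ᴾ C x) *ᴾ (C v +ᴾ X *ᴾ q)} (R.+-congˡ {C a} (C-* x v)) ⟨
    (X -ᴾ C x) *ᴾ (C v +ᴾ X *ᴾ q) +ᴾ C (a F.+ x F.* v)  ∎)

  X∣ : ∀ p → coeff p 0 ≈ 0# → X ∣ p
  X∣ []      e = ∣-0
  X∣ (a ∷ p) e = p , R.trans (R.*-comm p X) (R.trans (R.sym (0∷≈X* p)) (∷-cong (F.sym e) R.refl))

  X-comaximal : ∀ p → ¬ coeff p 0 ≈ 0# → Comaximal X p
  X-comaximal []      h = ⊥-elim (h F.refl)
  X-comaximal (a ∷ p) h = comax-sym (comax-respˡ (R.sym (∷≈C+X* a p)) (comax-sym (comax-+ (X *ᴾ p) (∣-*ʳ X p ∣-refl)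
    (comax-sym (unit-comax (C-unit h))))))

  strip-X : ∀ p → ¬ p ≈ᴾ [] → ∃[ v ] ∃[ r ] (p ≈ᴾ X ^ v *ᴾ r × ¬ coeff r 0 ≈ 0#)
  strip-X []      p≉0 = ⊥-elim (p≉0 R.refl)
  strip-X (a ∷ p) ap≉0 with a ≟ 0#
  ... | no a≉0  = 0 , a ∷ p , R.sym (R.*-identityˡ (a ∷ p)) , a≉0
  ... | yes a≈0 with strip-X p (λ p≈0 → ap≉0 (R.trans (∷-cong a≈0 p≈0) C-0))
  ...   | v , r , e , r₀≉0 = suc v , r , R.trans (∷-cong a≈0 R.refl) (R.trans (0∷≈X* p) (R.trans (R.*-congˡ {X} e) (R.sym (R.*-assoc X (X ^ v) r)))) , r₀≉0

  ∣X^⇒monomial : ∀ {p a} → p ∣ X ^ a → ∃[ κ ] ∃[ v ] (¬ κ ≈ 0# × p ≈ᴾ C κ *ᴾ X ^ v)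
  ∣X^⇒monomial {p} {a} p∣X^a@(q , e) = case strip-X p p≉0 of λ { (v , r , p≈ , r₀≉0) →
      case unit⇒C (comax-unit (comax-sym (comax-^ˡ a (X-comaximal r r₀≉0)))
        (∣-trans (∣-respʳ (R.sym p≈) (∣-*ˡ (X ^ v) r ∣-refl)) p∣X^a)) of λ { (κ , κ≉0 , r≈) →
        κ , v , κ≉0 , R.trans p≈ (R.trans (R.*-congˡ {X ^ v} r≈) (R.*-comm (X ^ v) (C κ))) } }
    where
    p≉0 : ¬ p ≈ᴾ []
    p≉0 z = ^-≉0 a (hasDeg-≉0 hasDeg-X) (R.trans (R.sym e) (R.trans (R.*-congˡ {q} z) (R.zeroʳ q)))

  record LowestTerm (k : ℕ) (P J N : Poly) : Set (c ⊔ˡ ℓ₁) where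
    field
      i l        : ℕ
      i+l≡k      : i ℕ.+ l ≡ k
      κ          : Carrier
      κ≉0        : ¬ κ ≈ 0#
      S          : Poly
      equation   : hom k P J N ≈ᴾ J ^ i *ᴾ (C κ *ᴾ N ^ l +ᴾ J *ᴾ S)
      S-degree   : ∀ {δ ε} → DegLe J δ → DegLe N ε → δ < ε → DegLt (J *ᴾ S) (l ℕ.* ε)

    cofactor : Poly
    cofactor = C κ *ᴾ N ^ l +ᴾ J *ᴾ S

    cofactor-comaximal : Comaximal J N → Comaximal J cofactor
    cofactor-comaximal J⊥N = comax-+ (J *ᴾ S) (∣-*ʳ J S ∣-refl)
      (comax-sym (comax-*ˡ (unit-comax (C-unit κ≉0)) (comax-^ˡ l (comax-sym J⊥N))))

    cofactor-degree : ∀ {δ ε} → HasDeg J δ → HasDeg N ε → δ < ε → HasDeg cofactor (l ℕ.* ε)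
    cofactor-degree {δ} {ε} hJ hN δ<ε = hasDeg
      (λ e → top main (F.trans (F.sym (F.+-identityʳ _)) (F.trans (F.+-congˡ (F.sym (vanish small (l ℕ.* ε) ℕₚ.≤-refl)))
        (F.trans (F.sym (coeff-+ (C κ *ᴾ N ^ l) (J *ᴾ S) (l ℕ.* ε))) e))))
      (degLe-+ (bound main) (degLe λ i lt → vanish small i (ℕₚ.<⇒≤ lt)))
      where
      main : HasDeg (C κ *ᴾ N ^ l) (l ℕ.* ε)
      main = hasDeg-* {m = zero} (hasDeg-C κ≉0) (hasDeg-^ l hN)
      small : DegLt (J *ᴾ S) (l ℕ.* ε)
      small = S-degree (bound hJ) (bound hN) δ<ε

  lowestTerm : ∀ k P J N → DegLe P k → ¬ P ≈ᴾ [] → LowestTerm k P J N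
  lowestTerm zero P J N hP P≉0 = record
    { i = 0 ; l = 0 ; i+l≡k = ≡.refl ; κ = coeff P 0
    ; κ≉0 = λ e → P≉0 (R.trans (degLe-0⇒C hP) (R.trans (C-cong e) C-0)) ; S = []
    ; equation = solve 2 (λ a J → a := con (+ 1) :* (a :* con (+ 1) :+ J :* con (+ 0))) R.refl (C (coeff P 0)) J
    ; S-degree = λ _ _ _ → degLt λ i _ → at (R.zeroʳ J) i }
  lowestTerm (suc k) P J N hP P≉0 with coeff P 0 ≟ 0#
  ... | no p₀≉0 = record
    { i = 0 ; l = suc k ; i+l≡k = ≡.refl ; κ = coeff P 0 ; κ≉0 = p₀≉0 ; S = hom k (tail P) J N
    ; equation = R.sym (R.*-identityˡ (hom (suc k) P J N))
    ; S-degree = λ {δ} {ε} hJ hN δ<ε → degLt λ i le →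
        beyond (degLe-* hJ (degLe-hom k (tail P) (degLe-mono (ℕₚ.<⇒≤ δ<ε) hJ) hN)) i
          (ℕₚ.<-≤-trans (ℕₚ.+-monoˡ-< (k ℕ.* ε) δ<ε) le) }
  ... | yes p₀≈0 = record
    { i = suc T.i ; l = T.l ; i+l≡k = ≡.cong suc T.i+l≡k ; κ = T.κ ; κ≉0 = T.κ≉0 ; S = T.S
    ; equation = begin
        C (coeff P 0) *ᴾ N ^ suc k +ᴾ J *ᴾ hom k (tail P) J N
          ≈⟨ R.+-cong (R.*-congʳ {N ^ suc k} (R.trans (C-cong p₀≈0) C-0)) (R.*-congˡ {J} T.equation) ⟩
        [] +ᴾ J *ᴾ (J ^ T.i *ᴾ T.cofactor)  ≈⟨ R.*-assoc J (J ^ T.i) T.cofactor ⟨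
        J ^ suc T.i *ᴾ T.cofactor  ∎
    ; S-degree = T.S-degree }
    where
    module T = LowestTerm (lowestTerm k (tail P) J N (degLe-tailᵗ hP)
      (λ e → P≉0 (R.trans (head∷tail P) (R.trans (∷-cong p₀≈0 e) C-0))))

  record Relation (g h : Poly) : Set (c ⊔ˡ ℓ₁) where
    field
      a k   : ℕ
      P Q   : Poly
      1≤a   : 1 ≤ a
      P-deg : DegLe P k
      Q-deg : DegLe Q k
      P≉0   : ¬ P ≈ᴾ []
      Q≉0   : ¬ Q ≈ᴾ []
      relation : X ^ a *ᴾ hom k P g h ≈ᴾ hom k Q g h

  lin : Carrier → Carrier → Poly → Poly → Poly
  lin s t L M = C s *ᴾ L +ᴾ C t *ᴾ M

  lin-deg : ∀ {s t} → DegLe (lin s t X (C 1#)) 1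
  lin-deg = degLe-+ (degLe-* {m = zero} degLe-C degLe-X) (degLe-* {m = zero} {n = 1} degLe-C degLe-C)

  hom-lin : ∀ s t L M → hom 1 (lin s t X (C 1#)) L M ≈ᴾ lin s t L M
  hom-lin s t L M = begin
    hom 1 (lin s t X (C 1#)) L M
      ≈⟨ hom-+ 1 (C s *ᴾ X) (C t *ᴾ C 1#) L M ⟩
    hom 1 (C s *ᴾ X) L M +ᴾ hom 1 (C t *ᴾ C 1#) L M
      ≈⟨ R.+-cong (hom-C* 1 s X L M) (hom-C* 1 t (C 1#) L M) ⟩
    C s *ᴾ (C 0# *ᴾ M ^ 1 +ᴾ L *ᴾ C 1#) +ᴾ C t *ᴾ (C 1# *ᴾ M ^ 1 +ᴾ L *ᴾ C 0#)
      ≈⟨ R.+-cong (R.*-congˡ {C s} (R.+-congʳ {L *ᴾ C 1#} (R.*-congʳ {M ^ 1} C-0)))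
                  (R.*-congˡ {C t} (R.+-congˡ {C 1# *ᴾ M ^ 1} (R.*-congˡ {L} C-0))) ⟩
    C s *ᴾ ([] *ᴾ M ^ 1 +ᴾ L *ᴾ C 1#) +ᴾ C t *ᴾ (C 1# *ᴾ M ^ 1 +ᴾ L *ᴾ [])
      ≈⟨ solve 4 (λ s t L M → s :* (con (+ 0) :* (M :* con (+ 1)) :+ L :* con (+ 1)) :+ t :* (con (+ 1) :* (M :* con (+ 1)) :+ L :* con (+ 0)) := s :* L :+ t :* M) R.refl (C s) (C t) L M ⟩
    lin s t L M ∎

  hom-substitute : ∀ k P s t s′ t′ L M →
    hom k (hom k P (lin s t X (C 1#)) (lin s′ t′ X (C 1#))) L M ≈ᴾ hom k P (lin s t L M) (lin s′ t′ L M)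
  hom-substitute k P s t s′ t′ L M = begin
    hom k P′ L M
      ≡⟨ ≡.cong (λ j → hom j P′ L M) (ℕₚ.*-identityʳ k) ⟨
    hom (k ℕ.* 1) P′ L M
      ≈⟨ hom-hom polyRing C C-isRingHomomorphism k P _ _ 1 L M lin-deg lin-deg ⟩
    hom k P (hom 1 (lin s t X (C 1#)) L M) (hom 1 (lin s′ t′ X (C 1#)) L M)
      ≈⟨ hom-congᵛ k P (hom-lin s t L M) (hom-lin s′ t′ L M) ⟩
    hom k P (lin s t L M) (lin s′ t′ L M) ∎
    where P′ = hom k P (lin s t X (C 1#)) (lin s′ t′ X (C 1#))

  module ChangeOfBasis (s t s′ t′ : Carrier) (Δ≉0 : ¬ s F.* t′ F.- t F.* s′ ≈ 0#) where
    Δ = s F.* t′ F.- t F.* s′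

    transform : ℕ → Poly → Poly
    transform k P = hom k P (lin s t X (C 1#)) (lin s′ t′ X (C 1#))

    transform-deg : ∀ k P → DegLe (transform k P) k
    transform-deg k P = ≡.subst (DegLe (transform k P)) (ℕₚ.*-identityʳ k) (degLe-hom k P lin-deg lin-deg)

    private
      CΔ : C Δ ≈ᴾ C s *ᴾ C t′ -ᴾ C t *ᴾ C s′
      CΔ = R.+-cong {C (s F.* t′)} {C s *ᴾ C t′} (C-* s t′) (R.-‿cong (C-* t s′))

    transform-≉0 : ∀ k P → DegLe P k → ¬ P ≈ᴾ [] → ¬ transform k P ≈ᴾ []
    transform-≉0 k P hP P≉0 e = *-≉0 (^-≉0 k (hasDeg-≉0 (hasDeg-C Δ≉0))) P≉0 (begin
      C Δ ^ k *ᴾ P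
        ≈⟨ R.*-congˡ {C Δ ^ k} (hom-X-1 k P hP) ⟨
      C Δ ^ k *ᴾ hom k P X (C 1#)
        ≈⟨ hom-homogeneous k P (C Δ) X (C 1#) ⟨
      hom k P (C Δ *ᴾ X) (C Δ *ᴾ C 1#)
        ≈⟨ hom-congᵛ k P
             (R.trans (R.*-congʳ {X} CΔ) (solve 5 (λ s t s′ t′ X → (s :* t′ :- t :* s′) :* X
               := s :* (t′ :* X :+ (:- t) :* con (+ 1)) :+ t :* ((:- s′) :* X :+ s :* con (+ 1))) R.refl (C s) (C t) (C s′) (C t′) X))
             (R.trans (R.*-congʳ {C 1#} CΔ) (solve 5 (λ s t s′ t′ X → (s :* t′ :- t :* s′) :* con (+ 1)
               := s′ :* (t′ :* X :+ (:- t) :* con (+ 1)) :+ t′ :* ((:- s′) :* X :+ s :* con (+ 1))) R.refl (C s) (C t) (C s′) (C t′) X)) ⟩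
      hom k P (lin s t U V) (lin s′ t′ U V)
        ≈⟨ hom-substitute k P s t s′ t′ U V ⟨
      hom k (transform k P) U V
        ≈⟨ hom-cong k U V e ⟩
      hom k [] U V
        ≈⟨ hom-[] k U V ⟩
      [] ∎)
      where
      U V : Poly
      U = lin t′ (F.- t) X (C 1#)
      V = lin (F.- s′) s X (C 1#)

    module _ {g h L M : Poly} (g≈ : g ≈ᴾ lin s t L M) (h≈ : h ≈ᴾ lin s′ t′ L M) where
      hom-transform : ∀ k P → hom k P g h ≈ᴾ hom k (transform k P) L M
      hom-transform k P = R.trans (hom-congᵛ k P g≈ h≈) (R.sym (hom-substitute k P s t s′ t′ L M))

      change : Relation g h → Relation L M
      change rel = record
        { a = a ; k = k ; P = transform k P ; Q = transform k Q ; 1≤a = 1≤a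
        ; P-deg = transform-deg k P ; Q-deg = transform-deg k Q
        ; P≉0 = transform-≉0 k P P-deg P≉0 ; Q≉0 = transform-≉0 k Q Q-deg Q≉0
        ; relation = R.trans (R.*-congˡ {X ^ a} (R.sym (hom-transform k P))) (R.trans relation (hom-transform k Q))
        }
        where open Relation rel

      change-comaximal : Comaximal g h → Comaximal L M
      change-comaximal (bezout u v e) = bezout (u *ᴾ C s +ᴾ v *ᴾ C s′) (u *ᴾ C t +ᴾ v *ᴾ C t′) (begin
        (u *ᴾ C s +ᴾ v *ᴾ C s′) *ᴾ L +ᴾ (u *ᴾ C t +ᴾ v *ᴾ C t′) *ᴾ M
          ≈⟨ solve 8 (λ u v s t s′ t′ L M → (u :* s :+ v :* s′) :* L :+ (u :* t :+ v :* t′) :* M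
               := u :* (s :* L :+ t :* M) :+ v :* (s′ :* L :+ t′ :* M)) R.refl u v (C s) (C t) (C s′) (C t′) L M ⟩
        u *ᴾ lin s t L M +ᴾ v *ᴾ lin s′ t′ L M  ≈⟨ R.+-cong (R.*-congˡ {u} (R.sym g≈)) (R.*-congˡ {v} (R.sym h≈)) ⟩
        u *ᴾ g +ᴾ v *ᴾ h                        ≈⟨ e ⟩
        C 1# ∎)

  X-nonunit : ¬ Unit X
  X-nonunit u = case-absurd (unit⇒deg0 hasDeg-X u)
    where
    case-absurd : ¬ 1 ≡ 0
    case-absurd ()

  self-comaximal-unit : ∀ {p r} → p ∣ r → Comaximal p r → Unit p
  self-comaximal-unit p∣r p⊥r = comax-unit p⊥r p∣r

  -- Comparing the orders of vanishing at 0.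
  divides-X^ : ∀ {L M} → Comaximal L M → X ∣ L → ¬ L ≈ᴾ [] → (rel : Relation L M) → L ∣ X ^ Relation.a rel
  divides-X^ {L} {M} L⊥M X∣L L≉0 rel = go (ℕₚ.<-cmp p.i q.i)
    where
    open Relation rel
    module p = LowestTerm (lowestTerm k P L M P-deg P≉0)
    module q = LowestTerm (lowestTerm k Q L M Q-deg Q≉0)
    A = p.cofactor
    B = q.cofactor
    eq : X ^ a *ᴾ (L ^ p.i *ᴾ A) ≈ᴾ L ^ q.i *ᴾ B
    eq = R.trans (R.*-congˡ {X ^ a} (R.sym p.equation)) (R.trans relation q.equation)

    low : ∀ e → p.i ≡ q.i ℕ.+ e → ⊥
    low e i≡ = X-nonunit (self-comaximal-unit X∣B (comax-∣ˡ X∣L (q.cofactor-comaximal L⊥M)))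
      where
      X∣X^ : ∀ a → 1 ≤ a → X ∣ X ^ a
      X∣X^ (suc a) _ = x∣x^1+n X a
      X∣B : X ∣ B
      X∣B = ∣-respʳ (*-cancelˡ (L ^ q.i) (^-≉0 q.i L≉0) (begin
          L ^ q.i *ᴾ (X ^ a *ᴾ (L ^ e *ᴾ A))
            ≈⟨ solve 4 (λ l x m A → l :* (x :* (m :* A)) := x :* (l :* m :* A)) R.refl (L ^ q.i) (X ^ a) (L ^ e) A ⟩
          X ^ a *ᴾ (L ^ q.i *ᴾ L ^ e *ᴾ A)
            ≈⟨ R.*-congˡ {X ^ a} (R.*-congʳ {A} (R.trans (R.sym (^-homo-* L q.i e)) (R.reflexive (≡.cong (L ^_) (≡.sym i≡))))) ⟩
          X ^ a *ᴾ (L ^ p.i *ᴾ A)  ≈⟨ eq ⟩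
          L ^ q.i *ᴾ B             ∎))
        (∣-*ʳ (X ^ a) (L ^ e *ᴾ A) (X∣X^ a 1≤a))

    high : ∀ e → q.i ≡ p.i ℕ.+ suc e → L ∣ X ^ a
    high e i≡ = comax-cancel A (X ^ a) (p.cofactor-comaximal L⊥M) (∣-respʳ (*-cancelˡ (L ^ p.i) (^-≉0 p.i L≉0) (begin
          L ^ p.i *ᴾ (L ^ suc e *ᴾ B)  ≈⟨ R.*-assoc (L ^ p.i) (L ^ suc e) B ⟨
          L ^ p.i *ᴾ L ^ suc e *ᴾ B    ≈⟨ R.*-congʳ {B} (R.trans (R.sym (^-homo-* L p.i (suc e))) (R.reflexive (≡.cong (L ^_) (≡.sym i≡)))) ⟩
          L ^ q.i *ᴾ B                 ≈⟨ eq ⟨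
          X ^ a *ᴾ (L ^ p.i *ᴾ A)      ≈⟨ solve 3 (λ x l A → x :* (l :* A) := l :* (A :* x)) R.refl (X ^ a) (L ^ p.i) A ⟩
          L ^ p.i *ᴾ (A *ᴾ X ^ a)      ∎))
        (∣-*ʳ (L ^ suc e) B (x∣x^1+n L e)))

    go : _ → L ∣ X ^ a
    go (tri< i<j _ _) = let (e , eq) = ℕₚ.m≤n⇒∃[o]m+o≡n i<j in high e (≡.trans (≡.sym eq) (≡.sym (ℕₚ.+-suc p.i e)))
    go (tri≈ _ i≡j _) = ⊥-elim (low 0 (≡.trans i≡j (≡.sym (ℕₚ.+-identityʳ q.i))))
    go (tri> _ _ j<i) = let (e , eq) = ℕₚ.m≤n⇒∃[o]m+o≡n j<i in ⊥-elim (low (suc e) (≡.trans (≡.sym eq) (≡.sym (ℕₚ.+-suc q.i e))))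

  -- Comparing the orders of growth at infinity.
  lower-degree-unit : ∀ {J N δ ε} → Comaximal J N → HasDeg J δ → HasDeg N ε → δ < ε → Relation J N → Unit J
  lower-degree-unit {J} {N} {δ} {ε} J⊥N hJ hN δ<ε rel = go (ℕₚ.<-cmp p.i q.i)
    where
    open Relation rel
    module p = LowestTerm (lowestTerm k P J N P-deg P≉0)
    module q = LowestTerm (lowestTerm k Q J N Q-deg Q≉0)
    A = p.cofactor
    B = q.cofactor
    eq : X ^ a *ᴾ (J ^ p.i *ᴾ A) ≈ᴾ J ^ q.i *ᴾ B
    eq = R.trans (R.*-congˡ {X ^ a} (R.sym p.equation)) (R.trans relation q.equation)

    degrees : a ℕ.* 1 ℕ.+ (p.i ℕ.* δ ℕ.+ p.l ℕ.* ε) ≡ q.i ℕ.* δ ℕ.+ q.l ℕ.* ε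
    degrees = hasDeg-unique
      (hasDeg-* (hasDeg-^ a hasDeg-X) (hasDeg-* (hasDeg-^ p.i hJ) (p.cofactor-degree hJ hN δ<ε)))
      (hasDeg-cong (R.sym eq) (hasDeg-* (hasDeg-^ q.i hJ) (q.cofactor-degree hJ hN δ<ε)))

    low : ∀ e → q.i ≡ p.i ℕ.+ e → ⊥
    low e j≡ = ℕₚ.<-irrefl degrees′ (ℕₚ.≤-<-trans (ℕₚ.*-monoʳ-≤ e (ℕₚ.<⇒≤ δ<ε))
        (ℕₚ.m<n+m (e ℕ.* ε) (≡.subst (0 <_) (≡.sym (ℕₚ.*-identityʳ a)) 1≤a)))
      where
      l≡ : p.l ≡ e ℕ.+ q.l
      l≡ = ℕₚ.+-cancelˡ-≡ p.i p.l (e ℕ.+ q.l) (≡.trans p.i+l≡k (≡.trans (≡.sym q.i+l≡k)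
             (≡.trans (≡.cong (ℕ._+ q.l) j≡) (ℕₚ.+-assoc p.i e q.l))))
      degrees′ : e ℕ.* δ ≡ a ℕ.* 1 ℕ.+ e ℕ.* ε
      degrees′ = cancel-degrees (a ℕ.* 1) p.i q.l e δ ε
        (≡.subst₂ (λ l j → a ℕ.* 1 ℕ.+ (p.i ℕ.* δ ℕ.+ l ℕ.* ε) ≡ j ℕ.* δ ℕ.+ q.l ℕ.* ε) l≡ j≡ degrees)

    high : ∀ e → p.i ≡ q.i ℕ.+ suc e → Unit J
    high e i≡ = comax-unit (q.cofactor-comaximal J⊥N) (∣-respʳ (*-cancelˡ (J ^ q.i) (^-≉0 q.i (hasDeg-≉0 hJ)) (begin
          J ^ q.i *ᴾ (X ^ a *ᴾ A *ᴾ J ^ suc e)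
            ≈⟨ solve 4 (λ l x m A → l :* (x :* A :* m) := x :* (l :* m :* A)) R.refl (J ^ q.i) (X ^ a) (J ^ suc e) A ⟩
          X ^ a *ᴾ (J ^ q.i *ᴾ J ^ suc e *ᴾ A)
            ≈⟨ R.*-congˡ {X ^ a} (R.*-congʳ {A} (R.trans (R.sym (^-homo-* J q.i (suc e))) (R.reflexive (≡.cong (J ^_) (≡.sym i≡))))) ⟩
          X ^ a *ᴾ (J ^ p.i *ᴾ A)  ≈⟨ eq ⟩
          J ^ q.i *ᴾ B             ∎))
      (∣-*ˡ (X ^ a *ᴾ A) (J ^ suc e) (x∣x^1+n J e)))

    go : _ → Unit J
    go (tri< i<j _ _) = let (e , eq) = ℕₚ.m≤n⇒∃[o]m+o≡n i<j in ⊥-elim (low (suc e) (≡.trans (≡.sym eq) (≡.sym (ℕₚ.+-suc p.i e))))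
    go (tri≈ _ i≡j _) = ⊥-elim (low 0 (≡.trans (≡.sym i≡j) (≡.sym (ℕₚ.+-identityʳ p.i))))
    go (tri> _ _ j<i) = let (e , eq) = ℕₚ.m≤n⇒∃[o]m+o≡n j<i in high e (≡.trans (≡.sym eq) (≡.sym (ℕₚ.+-suc q.i e)))

  swap-Δ≉0 : ¬ 0# F.* 0# F.- 1# F.* 1# ≈ 0#
  swap-Δ≉0 e = 1≉0 (F.trans (solveᶠ 0 (conᶠ (+ 1) :=ᶠ :-ᶠ (conᶠ (+ 0) :*ᶠ conᶠ (+ 0) :-ᶠ conᶠ (+ 1) :*ᶠ conᶠ (+ 1))) F.refl)
    (F.trans (F.-‿cong e) (RingProperties.-0#≈0# F.ring)))

  lin-first : ∀ s t L M → s ≈ 1# → t ≈ 0# → L ≈ᴾ lin s t L M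
  lin-first s t L M s≈1 t≈0 = R.sym (R.trans (R.+-cong (R.*-congʳ {L} (C-cong s≈1)) (R.*-congʳ {M} (R.trans (C-cong t≈0) C-0)))
    (solve 2 (λ L M → con (+ 1) :* L :+ con (+ 0) :* M := L) R.refl L M))

  lin-second : ∀ s t L M → s ≈ 0# → t ≈ 1# → M ≈ᴾ lin s t L M
  lin-second s t L M s≈0 t≈1 = R.sym (R.trans (R.+-cong (R.*-congʳ {L} (R.trans (C-cong s≈0) C-0)) (R.*-congʳ {M} (C-cong t≈1)))
    (solve 2 (λ L M → con (+ 0) :* L :+ con (+ 1) :* M := M) R.refl L M))

  swapped : ∀ {g h} → Relation g h → Relation h g
  swapped {g} {h} = ChangeOfBasis.change 0# 1# 1# 0# swap-Δ≉0
    (lin-second 0# 1# h g F.refl F.refl) (lin-first 1# 0# h g F.refl F.refl)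

  comaximal-0 : ∀ {p r} → p ≈ᴾ [] → Comaximal p r → Unit r
  comaximal-0 {p} {r} p≈0 (bezout u v e) = v , R.trans (R.sym (R.trans (R.+-congʳ {v *ᴾ r} (R.trans (R.*-congˡ {u} p≈0) (R.zeroʳ u))) R.refl)) e

  private
    form-zero : ∀ {k P J N} → Comaximal J N → ¬ Unit J → ¬ J ≈ᴾ [] → DegLe P k → hom k P J N ≈ᴾ [] → P ≈ᴾ []
    form-zero {k} {P} {J} {N} J⊥N J-nonunit J≉0 hP e with zero? P
    ... | yes P≈0 = P≈0
    ... | no P≉0  = ⊥-elim (J-nonunit (comaximal-0
        (zero-productᴾ (R.trans (R.sym equation) e) (^-≉0 i J≉0)) (comax-sym (cofactor-comaximal J⊥N))))
      where
      open LowestTerm (lowestTerm k P J N hP P≉0)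
      open RingTheory.IsDomain polyDomain renaming (zero-product to zero-productᴾ)

  deg-nonunit : ∀ {p n} → HasDeg p n → 1 ≤ n → ¬ Unit p
  deg-nonunit h 1≤n u with unit⇒deg0 h u
  deg-nonunit h () u | ≡.refl

  form-faithful : ∀ {g h D k P} → Comaximal g h → HasDeg g D ⊎ HasDeg h D → 1 ≤ D →
    DegLe P k → hom k P g h ≈ᴾ [] → P ≈ᴾ []
  form-faithful g⊥h (inj₁ hg) 1≤D hP e = form-zero g⊥h (deg-nonunit hg 1≤D) (hasDeg-≉0 hg) hP e
  form-faithful {g} {h} {D} {k} {P} g⊥h (inj₂ hh) 1≤D hP e with zero? P
  ... | yes P≈0 = P≈0
  ... | no P≉0  = ⊥-elim (transform-≉0 k P hP P≉0 (form-zero (comax-sym g⊥h) (deg-nonunit hh 1≤D) (hasDeg-≉0 hh)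
          (transform-deg k P)
          (R.trans (R.sym (hom-transform (lin-second 0# 1# h g F.refl F.refl) (lin-first 1# 0# h g F.refl F.refl) k P)) e)))
    where open ChangeOfBasis 0# 1# 1# 0# swap-Δ≉0

  record Möbius (g h : Poly) (D : ℕ) : Set (c ⊔ˡ ℓ₁) where
    field
      a b c₁ e : Carrier
      Δ≉0 : ¬ a F.* e F.- b F.* c₁ ≈ 0#
      g≈  : g ≈ᴾ lin a b (X ^ D) (C 1#)
      h≈  : h ≈ᴾ lin c₁ e (X ^ D) (C 1#)

  private
    record Adapted (g h : Poly) : Set (c ⊔ˡ ℓ₁) where
      field
        s t s′ t′ : Carrier
        L M : Poly
        Δ≉0 : ¬ s F.* t′ F.- t F.* s′ ≈ 0#
        g≈  : g ≈ᴾ lin s t L M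
        h≈  : h ≈ᴾ lin s′ t′ L M
        X∣L : X ∣ L

    adapt : ∀ g h → Adapted g h
    adapt g h with coeff h 0 ≟ 0#
    ... | yes h₀≈0 = record
      { s = 0# ; t = 1# ; s′ = 1# ; t′ = 0# ; L = h ; M = g ; Δ≉0 = swap-Δ≉0
      ; g≈ = lin-second 0# 1# h g F.refl F.refl ; h≈ = lin-first 1# 0# h g F.refl F.refl
      ; X∣L = X∣ h h₀≈0 }
    ... | no h₀≉0 = record
      { s = γ⁻¹ ; t = γ⁻¹ F.* β ; s′ = 0# ; t′ = 1# ; L = L ; M = h
      ; Δ≉0 = λ e → 1≉0 (F.trans (F.sym γ⁻¹γ) (F.trans (F.*-congʳ (F.trans
          (solveᶠ 2 (λ x y → x :=ᶠ x :*ᶠ conᶠ (+ 1) :-ᶠ (x :*ᶠ y) :*ᶠ conᶠ (+ 0)) F.refl γ⁻¹ β) e)) (F.zeroˡ γ)))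
      ; g≈ = begin
          g
            ≈⟨ R.*-identityˡ g ⟨
          C 1# *ᴾ g
            ≈⟨ R.*-congʳ {g} (R.trans (C-cong (F.sym γ⁻¹γ)) (C-* γ⁻¹ γ)) ⟩
          C γ⁻¹ *ᴾ C γ *ᴾ g
            ≈⟨ solve 5 (λ i γ β g h → i :* γ :* g := i :* (γ :* g :- β :* h) :+ (i :* β) :* h) R.refl (C γ⁻¹) (C γ) (C β) g h ⟩
          C γ⁻¹ *ᴾ L +ᴾ C γ⁻¹ *ᴾ C β *ᴾ h
            ≈⟨ R.+-congˡ {C γ⁻¹ *ᴾ L} (R.*-congʳ {h} (C-* γ⁻¹ β)) ⟨
          lin γ⁻¹ (γ⁻¹ F.* β) L h ∎
      ; h≈ = lin-second 0# 1# L h F.refl F.refl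
      ; X∣L = X∣ L (F.trans (coeff-+ (C γ *ᴾ g) (-ᴾ (C β *ᴾ h)) 0) (F.trans
          (F.+-cong (coeff-C* γ g 0) (F.trans (coeff-- (C β *ᴾ h) 0) (F.-‿cong (coeff-C* β h 0))))
          (solveᶠ 2 (λ γ β → γ :*ᶠ β :-ᶠ β :*ᶠ γ :=ᶠ conᶠ (+ 0)) F.refl γ β))) }
      where
      β = coeff g 0
      γ = coeff h 0
      γ⁻¹ = proj₁ (inverse γ h₀≉0)
      γ⁻¹γ = proj₂ (inverse γ h₀≉0)
      L = C γ *ᴾ g -ᴾ C β *ᴾ h

  lin-C : ∀ {s t L M n} → DegLe L n → DegLe M n → DegLe (lin s t L M) n
  lin-C {n = n} hL hM = degLe-+ (degLe-* {m = zero} degLe-C hL) (degLe-* {m = zero} degLe-C hM)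

  hasDeg-X^ : ∀ v → HasDeg (X ^ v) v
  hasDeg-X^ v = ≡.subst (HasDeg (X ^ v)) (ℕₚ.*-identityʳ v) (hasDeg-^ v hasDeg-X)

  coeff-X^ : ∀ v → coeff (X ^ v) v ≈ 1#
  coeff-X^ v = F.trans (at (R.trans (R.sym (R.*-identityˡ (X ^ v))) (R.sym (monomial≈ 1# v))) v)
    (F.reflexive (coeff-monomial 1# v))

  hasDeg-lin : ∀ {a b v} → ¬ a ≈ 0# → 1 ≤ v → HasDeg (lin a b (X ^ v) (C 1#)) v
  hasDeg-lin {a} {b} {suc v} a≉0 1≤v = hasDeg
    (λ e → a≉0 (F.trans (F.sym (F.trans (coeff-+ (C a *ᴾ X ^ suc v) (C b *ᴾ C 1#) (suc v)) (F.trans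
      (F.+-cong (F.trans (coeff-C* a (X ^ suc v) (suc v)) (F.trans (F.*-congˡ (coeff-X^ (suc v))) (F.*-identityʳ a)))
                (F.trans (coeff-C* b (C 1#) (suc v)) (F.zeroʳ b))) (F.+-identityʳ a)))) e))
    (lin-C (bound (hasDeg-X^ (suc v))) degLe-C)

  private
    complement : ∀ {L M κ v} → ¬ κ ≈ 0# → 1 ≤ v → L ≈ᴾ C κ *ᴾ X ^ v → Comaximal L M → Relation L M →
      ∃[ m ] ∃[ μ ] (¬ μ ≈ 0# × M ≈ᴾ C m *ᴾ X ^ v +ᴾ C μ)
    complement {L} {M} {κ} {v} κ≉0 1≤v L≈ L⊥M rel =
      case unit⇒C (M′-unit (zero? M′)) of λ { (μ , μ≉0 , M′≈) → m , μ , μ≉0 , R.trans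
        (solve 2 (λ M y → M := y :+ (M :- y)) R.refl M (C m *ᴾ X ^ v))
        (R.+-congˡ {C m *ᴾ X ^ v} M′≈) }
      where
      m = coeff M v
      M′ = M -ᴾ C m *ᴾ X ^ v

      coeff-M′ : coeff M′ v ≈ 0#
      coeff-M′ = F.trans (coeff-+ M (-ᴾ (C m *ᴾ X ^ v)) v) (F.trans (F.+-congˡ (F.trans (coeff-- (C m *ᴾ X ^ v) v)
        (F.-‿cong (F.trans (coeff-C* m (X ^ v) v) (F.trans (F.*-congˡ (coeff-X^ v)) (F.*-identityʳ m)))))) (F.-‿inverseʳ m))

      Δ≉0 : ¬ κ F.* 1# F.- 0# F.* m ≈ 0#
      Δ≉0 e = κ≉0 (F.trans (solveᶠ 2 (λ κ m → κ :=ᶠ κ :*ᶠ conᶠ (+ 1) :-ᶠ conᶠ (+ 0) :*ᶠ m) F.refl κ m) e)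

      L≈′ : L ≈ᴾ lin κ 0# (X ^ v) M′
      L≈′ = R.trans L≈ (R.sym (R.trans (R.+-congˡ {C κ *ᴾ X ^ v} (R.*-congʳ {M′} C-0)) (R.+-identityʳ (C κ *ᴾ X ^ v))))

      M≈′ : M ≈ᴾ lin m 1# (X ^ v) M′
      M≈′ = solve 2 (λ M y → M := y :+ con (+ 1) :* (M :- y)) R.refl M (C m *ᴾ X ^ v)

      X^v⊥M′ : Comaximal (X ^ v) M′
      X^v⊥M′ = ChangeOfBasis.change-comaximal κ 0# m 1# Δ≉0 L≈′ M≈′ L⊥M
      rel′ : Relation (X ^ v) M′
      rel′ = ChangeOfBasis.change κ 0# m 1# Δ≉0 L≈′ M≈′ rel

      X^v-nonunit : ¬ Unit (X ^ v)
      X^v-nonunit = deg-nonunit (hasDeg-X^ v) 1≤v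

      M′-unit : Dec (M′ ≈ᴾ []) → Unit M′
      M′-unit (yes M′≈0) = ⊥-elim (X^v-nonunit (comaximal-0 M′≈0 (comax-sym X^v⊥M′)))
      M′-unit (no M′≉0) = case degree M′ M′≉0 of λ { (δ , hδ) → go δ hδ (ℕₚ.<-cmp δ v) }
        where
        go : ∀ δ → HasDeg M′ δ → Tri (δ < v) (δ ≡ v) (v < δ) → Unit M′
        go δ hδ (tri< δ<v _ _)    = lower-degree-unit (comax-sym X^v⊥M′) hδ (hasDeg-X^ v) δ<v (swapped rel′)
        go δ hδ (tri≈ _ ≡.refl _) = ⊥-elim (top hδ coeff-M′)
        go δ hδ (tri> _ _ v<δ)    = ⊥-elim (X^v-nonunit (lower-degree-unit X^v⊥M′ (hasDeg-X^ v) hδ v<δ rel′))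

    expand : ∀ {L M κ v m μ} → L ≈ᴾ C κ *ᴾ X ^ v → M ≈ᴾ C m *ᴾ X ^ v +ᴾ C μ →
      ∀ s t → lin s t L M ≈ᴾ lin (s F.* κ F.+ t F.* m) (t F.* μ) (X ^ v) (C 1#)
    expand {L} {M} {κ} {v} {m} {μ} L≈ M≈ s t = begin
      C s *ᴾ L +ᴾ C t *ᴾ M
        ≈⟨ R.+-cong (R.*-congˡ {C s} L≈) (R.*-congˡ {C t} M≈) ⟩
      C s *ᴾ (C κ *ᴾ X ^ v) +ᴾ C t *ᴾ (C m *ᴾ X ^ v +ᴾ C μ)
        ≈⟨ solve 6 (λ s t κ m μ x → s :* (κ :* x) :+ t :* (m :* x :+ μ) := (s :* κ :+ t :* m) :* x :+ t :* μ :* con (+ 1)) R.refl (C s) (C t) (C κ) (C m) (C μ) (X ^ v) ⟩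
      (C s *ᴾ C κ +ᴾ C t *ᴾ C m) *ᴾ X ^ v +ᴾ C t *ᴾ C μ *ᴾ C 1#
        ≈⟨ R.+-cong (R.*-congʳ {X ^ v} (R.+-cong (C-* s κ) (C-* t m))) (R.*-congʳ {C 1#} (C-* t μ)) ⟨
      lin (s F.* κ F.+ t F.* m) (t F.* μ) (X ^ v) (C 1#) ∎

    exact-degree : ∀ {g h D v a b c₁ e} → 1 ≤ v → DegLe g D → DegLe h D → HasDeg g D ⊎ HasDeg h D →
      ¬ a F.* e F.- b F.* c₁ ≈ 0# →
      g ≈ᴾ lin a b (X ^ v) (C 1#) → h ≈ᴾ lin c₁ e (X ^ v) (C 1#) → Möbius g h D
    exact-degree {g} {h} {D} {v} {a} {b} {c₁} {e} 1≤v g≤D h≤D deg Δ≉0 g≈ h≈ = record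
      { Δ≉0 = Δ≉0
      ; g≈  = ≡.subst (λ v → g ≈ᴾ lin a b (X ^ v) (C 1#)) v≡D g≈
      ; h≈  = ≡.subst (λ v → h ≈ᴾ lin c₁ e (X ^ v) (C 1#)) v≡D h≈ }
      where
      v≤D : Dec (a ≈ 0#) → v ≤ D
      v≤D (no a≉0)  = hasDeg-≤ (hasDeg-cong (R.sym g≈) (hasDeg-lin a≉0 1≤v)) g≤D
      v≤D (yes a≈0) = hasDeg-≤ (hasDeg-cong (R.sym h≈) (hasDeg-lin c≉0 1≤v)) h≤D
        where
        c≉0 : ¬ c₁ ≈ 0#
        c≉0 c≈0 = Δ≉0 (F.trans (F.+-cong (F.trans (F.*-congʳ a≈0) (F.zeroˡ e)) (F.-‿cong (F.trans (F.*-congˡ c≈0) (F.zeroʳ b))))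
          (F.-‿inverseʳ 0#))
      D≤v : HasDeg g D ⊎ HasDeg h D → D ≤ v
      D≤v (inj₁ hg) = hasDeg-≤ hg (degLe-cong (R.sym g≈) (lin-C (bound (hasDeg-X^ v)) degLe-C))
      D≤v (inj₂ hh) = hasDeg-≤ hh (degLe-cong (R.sym h≈) (lin-C (bound (hasDeg-X^ v)) degLe-C))
      v≡D : v ≡ D
      v≡D = ℕₚ.≤-antisym (v≤D (a ≟ 0#)) (D≤v deg)

    adapted⇒Möbius : ∀ {g h D L M} s t s′ t′ → ¬ s F.* t′ F.- t F.* s′ ≈ 0# → g ≈ᴾ lin s t L M → h ≈ᴾ lin s′ t′ L M →
      X ∣ L → Comaximal g h → DegLe g D → DegLe h D → HasDeg g D ⊎ HasDeg h D → 1 ≤ D → Relation g h → Möbius g h D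
    adapted⇒Möbius {g} {h} {D} {L} {M} s t s′ t′ Δ≉0 g≈ h≈ X∣L g⊥h g≤D h≤D deg 1≤D rel =
      go (∣X^⇒monomial {a = Relation.a rel₁} (divides-X^ L⊥M X∣L L≉0 rel₁))
      where
      L⊥M : Comaximal L M
      L⊥M = ChangeOfBasis.change-comaximal s t s′ t′ Δ≉0 g≈ h≈ g⊥h
      rel₁ : Relation L M
      rel₁ = ChangeOfBasis.change s t s′ t′ Δ≉0 g≈ h≈ rel

      L≉0 : ¬ L ≈ᴾ []
      L≉0 L≈0 = case unit⇒C (comaximal-0 L≈0 L⊥M) of λ { (μ , _ , M≈) → bounded (degLe-cong (R.sym L≈0) degLe-[]) (degLe-cong (R.sym M≈) degLe-C) }
        where
        constant-degree : HasDeg g D ⊎ HasDeg h D → DegLe g 0 → DegLe h 0 → D ≤ 0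
        constant-degree (inj₁ hg) kg kh = hasDeg-≤ hg kg
        constant-degree (inj₂ hh) kg kh = hasDeg-≤ hh kh
        bounded : DegLe L 0 → DegLe M 0 → ⊥
        bounded L≤0 M≤0 = ℕₚ.<⇒≱ 1≤D (constant-degree deg (degLe-cong (R.sym g≈) (lin-C L≤0 M≤0)) (degLe-cong (R.sym h≈) (lin-C L≤0 M≤0)))

      go : (∃[ κ ] ∃[ v ] (¬ κ ≈ 0# × L ≈ᴾ C κ *ᴾ X ^ v)) → Möbius g h D
      go (κ , zero , κ≉0 , L≈) = ⊥-elim (X-nonunit (∣-trans X∣L
        (∣-respˡ (R.sym (R.trans L≈ (R.*-identityʳ (C κ)))) (C-unit κ≉0))))
      go (κ , v@(suc _) , κ≉0 , L≈) = case complement {v = v} κ≉0 (s≤s z≤n) L≈ L⊥M rel₁ of λ { (m , μ , μ≉0 , M≈) →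
        exact-degree {v = v} (s≤s z≤n) g≤D h≤D deg
          (λ z → *-≉0ᶠ (*-≉0ᶠ κ≉0 μ≉0) Δ≉0 (F.trans (solveᶠ 7 (λ s t s′ t′ κ m μ →
            κ :*ᶠ μ :*ᶠ (s :*ᶠ t′ :-ᶠ t :*ᶠ s′) :=ᶠ (s :*ᶠ κ :+ᶠ t :*ᶠ m) :*ᶠ (t′ :*ᶠ μ) :-ᶠ (t :*ᶠ μ) :*ᶠ (s′ :*ᶠ κ :+ᶠ t′ :*ᶠ m))
            F.refl s t s′ t′ κ m μ) z))
          (R.trans g≈ (expand {v = v} L≈ M≈ s t)) (R.trans h≈ (expand {v = v} L≈ M≈ s′ t′)) }

  -- A relation forces f = g / h to be totally ramified over f (0) and over f (∞).
  relation⇒Möbius : ∀ {g h D} → Comaximal g h → DegLe g D → DegLe h D → HasDeg g D ⊎ HasDeg h D → 1 ≤ D →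
    Relation g h → Möbius g h D
  relation⇒Möbius {g} {h} = adapted⇒Möbius s t s′ t′ Δ≉0 g≈ h≈ X∣L
    where open Adapted (adapt g h)

  hasDeg-X- : ∀ y → HasDeg (X -ᴾ C y) 1
  hasDeg-X- y = hasDeg 1≉0 (degLe-∷ degLe-C)

  comaximal-root : ∀ y P → ¬ value P y ≈ 0# → Comaximal (X -ᴾ C y) P
  comaximal-root y P Py≉0 = case factor-root y P of λ { (q , e) →
    comax-sym (comax-respˡ (R.sym (R.trans e (R.+-comm ((X -ᴾ C y) *ᴾ q) (C (value P y)))))
      (comax-sym (comax-+ ((X -ᴾ C y) *ᴾ q) (∣-*ʳ (X -ᴾ C y) q ∣-refl) (comax-sym (unit-comax (C-unit Py≉0)))))) }

  factor-out : ∀ y P → ¬ P ≈ᴾ [] → ∃[ i ] ∃[ P′ ] (P ≈ᴾ (X -ᴾ C y) ^ i *ᴾ P′ × ¬ value P′ y ≈ 0#)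
  factor-out y P P≉0 = let (n , h) = degree P P≉0 in go n P h
    where
    divide : ∀ {n} P → HasDeg P n → value P y ≈ 0# →
      ∃[ q ] ∃[ k ] (P ≈ᴾ (X -ᴾ C y) *ᴾ q × HasDeg q k × n ≡ suc k)
    divide P h v≈0 = q , k , P≈ , hk , hasDeg-unique h (hasDeg-cong (R.sym P≈) (hasDeg-* (hasDeg-X- y) hk))
      where
      q = proj₁ (factor-root y P)
      P≈ : P ≈ᴾ (X -ᴾ C y) *ᴾ q
      P≈ = R.trans (proj₂ (factor-root y P)) (R.trans
        (R.+-congˡ {(X -ᴾ C y) *ᴾ q} (R.trans (C-cong v≈0) C-0)) (R.+-identityʳ ((X -ᴾ C y) *ᴾ q)))
      q≉0 : ¬ q ≈ᴾ []
      q≉0 e = hasDeg-≉0 h (R.trans P≈ (R.trans (R.*-congˡ {X -ᴾ C y} e) (R.zeroʳ (X -ᴾ C y))))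
      k  = proj₁ (degree q q≉0)
      hk = proj₂ (degree q q≉0)

    go : ∀ n P → HasDeg P n → ∃[ i ] ∃[ P′ ] (P ≈ᴾ (X -ᴾ C y) ^ i *ᴾ P′ × ¬ value P′ y ≈ 0#)
    go n P h with value P y ≟ 0#
    go n       P h | no v≉0  = 0 , P , R.sym (R.*-identityˡ P) , v≉0
    go zero    P h | yes v≈0 with divide P h v≈0
    ... | _ , _ , _ , _ , ()
    go (suc n) P h | yes v≈0 with divide P h v≈0
    ... | q , k , P≈ , hk , ≡.refl with go n q hk
    ...   | i , P′ , e , v≉0 = suc i , P′ , R.trans P≈ (R.trans (R.*-congˡ {X -ᴾ C y} e) (R.sym (R.*-assoc (X -ᴾ C y) ((X -ᴾ C y) ^ i) P′))) , v≉0

  value-geometric : ∀ n y → y F.* value (geometric n X (C y)) y ≈ n ·ᶠ 1# F.* y ^ᶠ n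
  value-geometric zero    y = F.trans (F.zeroʳ y) (F.sym (F.zeroˡ 1#))
  value-geometric (suc n) y = F.trans
    (F.*-congˡ (F.trans (F-ev.ev-+ (X ^ n) (C y *ᴾ geometric n X (C y)) y)
      (F.+-cong (F.trans (F-ev.ev-^ X n y) (FT.^-congˡ n (F-ev.ev-X y)))
        (F.trans (F-ev.ev-* (C y) (geometric n X (C y)) y) (F.*-congʳ (F-ev.ev-C y y))))))
    (F.trans (F.*-congˡ (F.+-congˡ (value-geometric n y)))
      (solveᶠ 3 (λ y a k → y :*ᶠ (a :+ᶠ k :*ᶠ a) :=ᶠ (conᶠ (+ 1) :+ᶠ k) :*ᶠ (y :*ᶠ a)) F.refl y (y ^ᶠ n) (n ·ᶠ 1#)))

  substᴾ : ℕ → Poly → Poly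
  substᴾ D A = Sub.ev A (X ^ D)

  module _ (D : ℕ) where
    substᴾ-comaximal : ∀ {p r} → Comaximal p r → Comaximal (substᴾ D p) (substᴾ D r)
    substᴾ-comaximal {p} {r} (bezout u v e) = bezout (substᴾ D u) (substᴾ D v) (begin
      substᴾ D u *ᴾ substᴾ D p +ᴾ substᴾ D v *ᴾ substᴾ D r
        ≈⟨ R.+-cong (Sub.ev-* u p (X ^ D)) (Sub.ev-* v r (X ^ D)) ⟨
      substᴾ D (u *ᴾ p) +ᴾ substᴾ D (v *ᴾ r)
        ≈⟨ Sub.ev-+ (u *ᴾ p) (v *ᴾ r) (X ^ D) ⟨
      substᴾ D (u *ᴾ p +ᴾ v *ᴾ r)
        ≈⟨ Sub.ev-cong (X ^ D) e ⟩
      substᴾ D (C 1#)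
        ≈⟨ Sub.ev-C 1# (X ^ D) ⟩
      C 1# ∎)

    IsSubst : Poly → Set (c ⊔ˡ ℓ₁)
    IsSubst p = ∃[ A ] p ≈ᴾ substᴾ D A

    isSubst-cong : ∀ {p r} → p ≈ᴾ r → IsSubst p → IsSubst r
    isSubst-cong e (A , f) = A , R.trans (R.sym e) f

    isSubst-C : ∀ a → IsSubst (C a)
    isSubst-C a = C a , R.sym (Sub.ev-C a (X ^ D))

    isSubst-X^ : IsSubst (X ^ D)
    isSubst-X^ = X , R.sym (Sub.ev-X (X ^ D))

    isSubst-+ : ∀ {p r} → IsSubst p → IsSubst r → IsSubst (p +ᴾ r)
    isSubst-+ (A , e) (B , f) = A +ᴾ B , R.trans (R.+-cong e f) (R.sym (Sub.ev-+ A B (X ^ D)))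

    isSubst-* : ∀ {p r} → IsSubst p → IsSubst r → IsSubst (p *ᴾ r)
    isSubst-* (A , e) (B , f) = A *ᴾ B , R.trans (R.*-cong e f) (R.sym (Sub.ev-* A B (X ^ D)))

    isSubst-^ : ∀ {p} n → IsSubst p → IsSubst (p ^ n)
    isSubst-^ zero    _ = isSubst-C 1#
    isSubst-^ (suc n) h = isSubst-* h (isSubst-^ n h)

    isSubst-hom : ∀ k P {g h} → IsSubst g → IsSubst h → IsSubst (hom k P g h)
    isSubst-hom zero    P hg hh = isSubst-C (coeff P 0)
    isSubst-hom (suc k) P hg hh = isSubst-+ (isSubst-* (isSubst-C (coeff P 0)) (isSubst-^ (suc k) hh))
      (isSubst-* hg (isSubst-hom k (tail P) hg hh))

  -- If y ≠ 0 is a root of order γ of the left side over the right, so are all ζ y with ζ^D = 1.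
  -- Here they are collected in the cofactor U of X − y in X^D′ − y^D′.
  no-isolated-root : ∀ D′ s → 2 ≤ D′ → 1 ≤ s → ¬ D′ ·ᶠ 1# ≈ 0# →
    ∀ {y l A B} γ → 1 ≤ γ → ¬ y ≈ 0# → Comaximal (X -ᴾ C y) l → ¬ A ≈ᴾ [] → ¬ B ≈ᴾ [] →
    (X -ᴾ C y) ^ γ *ᴾ substᴾ (D′ ℕ.* s) A ≈ᴾ l ^ γ *ᴾ substᴾ (D′ ℕ.* s) B → ⊥
  no-isolated-root D′ s 2≤D′ 1≤s D′≉0 {y} {l} {A} {B} γ 1≤γ y≉0 x⊥l A≉0 B≉0 eq =
    go (factor-out z A A≉0) (factor-out z B B≉0)
    where
    D = D′ ℕ.* s
    z = y ^ᶠ D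
    x = X -ᴾ C y
    U = geometric D′ X (C y)
    W = substᴾ D (X -ᴾ C z)

    W≈ : W ≈ᴾ X ^ D -ᴾ C y ^ D
    W≈ = R.trans (Sub.ev-+ X (-ᴾ C z) (X ^ D)) (R.+-cong (Sub.ev-X (X ^ D))
      (R.trans (Sub.ev-- (C z) (X ^ D)) (R.-‿cong (R.trans (Sub.ev-C z (X ^ D)) (C-^ y D)))))

    xU∣W : x *ᴾ U ∣ W
    xU∣W = ∣-respʳ (R.sym W≈) (∣-respˡ (R.sym (geometric-* D′ X (C y)))
      (∣-respʳ (R.+-cong (^-assocʳ X D′ s) (R.-‿cong (^-assocʳ (C y) D′ s))) (x-y∣xⁿ-yⁿ (X ^ D′) (C y ^ D′) s)))

    x∣W : x ∣ W
    x∣W = ∣-trans (∣-*ʳ x U ∣-refl) xU∣W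
    U∣W : U ∣ W
    U∣W = ∣-trans (∣-*ˡ x U ∣-refl) xU∣W

    hasDeg-X^- : ∀ n a → 1 ≤ n → HasDeg (X ^ n -ᴾ C a) n
    hasDeg-X^- n a 1≤n = hasDeg-cong (R.+-cong (R.*-identityˡ (X ^ n)) (R.*-identityʳ (C (F.- a))))
      (hasDeg-lin {1#} {F.- a} {n} 1≉0 1≤n)

    1≤D : 1 ≤ D
    1≤D = ℕₚ.*-mono-≤ (ℕₚ.≤-trans (s≤s z≤n) 2≤D′) 1≤s

    W≉0 : ¬ W ≈ᴾ []
    W≉0 e = hasDeg-≉0 (hasDeg-X^- D z 1≤D) (R.trans (R.sym (R.trans W≈ (R.+-congˡ {X ^ D} (R.-‿cong (R.sym (C-^ y D)))))) e)

    hasDeg-xU : HasDeg (x *ᴾ U) D′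
    hasDeg-xU = hasDeg-cong (R.sym (R.trans (geometric-* D′ X (C y)) (R.+-congˡ {X ^ D′} (R.-‿cong (R.sym (C-^ y D′))))))
      (hasDeg-X^- D′ (y ^ᶠ D′) (ℕₚ.≤-trans (s≤s z≤n) 2≤D′))

    U-nonunit : ¬ Unit U
    U-nonunit u = let
        (κ , κ≉0 , U≈) = unit⇒C u
        D′≡1 = hasDeg-unique hasDeg-xU (hasDeg-* (hasDeg-X- y) (hasDeg-cong (R.sym U≈) (hasDeg-C κ≉0)))
      in ℕₚ.<⇒≢ 2≤D′ (≡.sym D′≡1)

    x-nonunit : ¬ Unit x
    x-nonunit = deg-nonunit (hasDeg-X- y) ℕₚ.≤-refl

    U⊥x : Comaximal U x
    U⊥x = comax-sym (comaximal-root y U λ e → *-≉0ᶠ D′≉0 (^-≉0ᶠ D′ y≉0)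
      (F.trans (F.sym (value-geometric D′ y)) (F.trans (F.*-congˡ e) (F.zeroʳ y))))

    comaximal-W : ∀ P → ¬ value P z ≈ 0# → Comaximal W (substᴾ D P)
    comaximal-W P Pz≉0 = substᴾ-comaximal D (comaximal-root z P Pz≉0)

    expand-factor : ∀ A A′ i → A ≈ᴾ (X -ᴾ C z) ^ i *ᴾ A′ → substᴾ D A ≈ᴾ W ^ i *ᴾ substᴾ D A′
    expand-factor A A′ i e = R.trans (Sub.ev-cong (X ^ D) e) (R.trans (Sub.ev-* ((X -ᴾ C z) ^ i) A′ (X ^ D))
      (R.*-congʳ {substᴾ D A′} (Sub.ev-^ (X -ᴾ C z) i (X ^ D))))

    power-divisible : ∀ p γ → 1 ≤ γ → p ∣ p ^ γ
    power-divisible p (suc γ) _ = x∣x^1+n p γ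

    go : (∃[ i ] ∃[ A′ ] (A ≈ᴾ (X -ᴾ C z) ^ i *ᴾ A′ × ¬ value A′ z ≈ 0#)) →
         (∃[ j ] ∃[ B′ ] (B ≈ᴾ (X -ᴾ C z) ^ j *ᴾ B′ × ¬ value B′ z ≈ 0#)) → ⊥
    go (i , A′ , A≈ , A′z≉0) (j , B′ , B≈ , B′z≉0) = compare (ℕₚ.≤-<-connex j i)
      where
      A″ = substᴾ D A′
      B″ = substᴾ D B′
      eq′ : x ^ γ *ᴾ (W ^ i *ᴾ A″) ≈ᴾ l ^ γ *ᴾ (W ^ j *ᴾ B″)
      eq′ = R.trans (R.*-congˡ {x ^ γ} (R.sym (expand-factor A A′ i A≈))) (R.trans eq (R.*-congˡ {l ^ γ} (expand-factor B B′ j B≈)))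

      W^-split : ∀ i j e → j ℕ.+ e ≡ i → W ^ j *ᴾ W ^ e ≈ᴾ W ^ i
      W^-split i j e ≡i = R.trans (R.sym (^-homo-* W j e)) (R.reflexive (≡.cong (W ^_) ≡i))

      compare : j ≤ i ⊎ i < j → ⊥
      compare (inj₁ j≤i) = case ℕₚ.m≤n⇒∃[o]m+o≡n j≤i of λ { (e , j+e≡i) →
        x-nonunit (comax-unit (comax-sym (comax-*ˡ (comax-^ˡ γ (comax-sym x⊥l)) (comax-sym (comax-∣ˡ x∣W (comaximal-W B′ B′z≉0)))))
          (∣-respʳ (*-cancelˡ (W ^ j) (^-≉0 j W≉0) (begin
              W ^ j *ᴾ (x ^ γ *ᴾ (W ^ e *ᴾ A″))
                ≈⟨ solve 4 (λ w x v A → w :* (x :* (v :* A)) := x :* (w :* v :* A)) R.refl (W ^ j) (x ^ γ) (W ^ e) A″ ⟩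
              x ^ γ *ᴾ (W ^ j *ᴾ W ^ e *ᴾ A″)  ≈⟨ R.*-congˡ {x ^ γ} (R.*-congʳ {A″} (W^-split i j e j+e≡i)) ⟩
              x ^ γ *ᴾ (W ^ i *ᴾ A″)           ≈⟨ eq′ ⟩
              l ^ γ *ᴾ (W ^ j *ᴾ B″)           ≈⟨ solve 3 (λ l w B → l :* (w :* B) := w :* (l :* B)) R.refl (l ^ γ) (W ^ j) B″ ⟩
              W ^ j *ᴾ (l ^ γ *ᴾ B″)           ∎))
            (∣-*ʳ (x ^ γ) (W ^ e *ᴾ A″) (power-divisible x γ 1≤γ)))) }
      compare (inj₂ i<j) = case ℕₚ.m≤n⇒∃[o]m+o≡n i<j of λ { (e , i+e≡j) →
        U-nonunit (comax-unit (comax-sym (comax-*ˡ (comax-^ˡ γ (comax-sym U⊥x)) (comax-sym (comax-∣ˡ U∣W (comaximal-W A′ A′z≉0)))))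
          (∣-respʳ (*-cancelˡ (W ^ i) (^-≉0 i W≉0) (begin
              W ^ i *ᴾ (l ^ γ *ᴾ (W ^ suc e *ᴾ B″))
                ≈⟨ solve 4 (λ w x v A → w :* (x :* (v :* A)) := x :* (w :* v :* A)) R.refl (W ^ i) (l ^ γ) (W ^ suc e) B″ ⟩
              l ^ γ *ᴾ (W ^ i *ᴾ W ^ suc e *ᴾ B″)  ≈⟨ R.*-congˡ {l ^ γ} (R.*-congʳ {B″} (W^-split j i (suc e) (≡.trans (ℕₚ.+-suc i e) i+e≡j))) ⟩
              l ^ γ *ᴾ (W ^ j *ᴾ B″)               ≈⟨ eq′ ⟨
              x ^ γ *ᴾ (W ^ i *ᴾ A″)               ≈⟨ solve 3 (λ l w B → l :* (w :* B) := w :* (l :* B)) R.refl (x ^ γ) (W ^ i) A″ ⟩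
              W ^ i *ᴾ (x ^ γ *ᴾ A″)               ∎))
            (∣-*ˡ (l ^ γ) (W ^ suc e *ᴾ B″) (∣-*ʳ (W ^ suc e) B″ (∣-trans U∣W (power-divisible W (suc e) (s≤s z≤n))))))) }

  linear : Carrier → Carrier → Poly
  linear a b = b ∷ a ∷ []

  linear≈ : ∀ a b → linear a b ≈ᴾ C b +ᴾ C a *ᴾ X
  linear≈ a b = R.trans (∷≈C+X* b (C a)) (R.+-congˡ {C b} (R.*-comm X (C a)))

  linear-nonZero : ∀ a b → ¬ (a ≈ 0# × b ≈ 0#) → NonZeroᴾ (linear a b)
  linear-nonZero a b h with a ≟ 0#
  ... | no a≉0  = 1 , apart a≉0
  ... | yes a≈0 = 0 , apart λ b≈0 → h (a≈0 , b≈0)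

  hasDeg-linear₁ : ∀ {a b} → ¬ a ≈ 0# → HasDeg (linear a b) 1
  hasDeg-linear₁ a≉0 = hasDeg a≉0 (degLe-∷ degLe-C)

  hasDeg-linear₀ : ∀ {a b} → a ≈ 0# → ¬ b ≈ 0# → HasDeg (linear a b) 0
  hasDeg-linear₀ a≈0 b≉0 = hasDeg b≉0 (degLe λ { (suc zero) _ → a≈0 ; (suc (suc i)) _ → F.refl })

  nonZeroᴾ : ∀ {p} → ¬ p ≈ᴾ [] → NonZeroᴾ p
  nonZeroᴾ {p} p≉0 = let (n , h) = degree p p≉0 in n , apart (top h)

  module _ (a b c₁ e : Carrier) (Δ≉0 : ¬ a F.* e F.- b F.* c₁ ≈ 0#) where
    private
      Δ-zero : ∀ {x y} → x ≈ 0# → y ≈ 0# → x F.- y ≈ 0#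
      Δ-zero x≈0 y≈0 = F.trans (F.+-cong x≈0 (F.-‿cong y≈0)) (F.-‿inverseʳ 0#)
      zeroˡ : ∀ {x} y → x ≈ 0# → x F.* y ≈ 0#
      zeroˡ y x≈0 = F.trans (F.*-congʳ x≈0) (F.zeroˡ y)
      zeroʳ : ∀ x {y} → y ≈ 0# → x F.* y ≈ 0#
      zeroʳ x y≈0 = F.trans (F.*-congˡ y≈0) (F.zeroʳ x)

    fraction : RatFun
    fraction = ratFun (linear a b) (linear c₁ e) (linear-nonZero c₁ e λ { (c≈0 , e≈0) → Δ≉0 (Δ-zero (zeroʳ a e≈0) (zeroʳ b c≈0)) })

    fraction-degree : HasDegreeʳ fraction 1
    fraction-degree = lowest , maxDegree (a ≟ 0#) (c₁ ≟ 0#)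
      where
      lowest : InLowestTerms fraction
      lowest {z} (q RawMagmaDefinitions., eq) (r RawMagmaDefinitions., er) = C d *ᴾ (C a *ᴾ r -ᴾ C c₁ *ᴾ q) RawMagmaDefinitions., coeff-≈ (begin
          C d *ᴾ (C a *ᴾ r -ᴾ C c₁ *ᴾ q) *ᴾ z
            ≈⟨ solve 6 (λ d a c q r z → d :* (a :* r :- c :* q) :* z := d :* (a :* (r :* z) :- c :* (q :* z))) R.refl (C d) (C a) (C c₁) q r z ⟩
          C d *ᴾ (C a *ᴾ (r *ᴾ z) -ᴾ C c₁ *ᴾ (q *ᴾ z))
            ≈⟨ R.*-congˡ {C d} (R.+-cong (R.*-congˡ {C a} {r *ᴾ z} {C e +ᴾ C c₁ *ᴾ X} (R.trans {r *ᴾ z} {linear c₁ e} (coeffwise er) (linear≈ c₁ e))) (R.-‿cong (R.*-congˡ {C c₁} {q *ᴾ z} {C b +ᴾ C a *ᴾ X} (R.trans {q *ᴾ z} {linear a b} (coeffwise eq) (linear≈ a b))))) ⟩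
          C d *ᴾ (C a *ᴾ (C e +ᴾ C c₁ *ᴾ X) -ᴾ C c₁ *ᴾ (C b +ᴾ C a *ᴾ X))
            ≈⟨ solve 6 (λ d a b c e x → d :* (a :* (e :+ c :* x) :- c :* (b :+ a :* x)) := d :* (a :* e :- b :* c)) R.refl (C d) (C a) (C b) (C c₁) (C e) X ⟩
          C d *ᴾ (C a *ᴾ C e -ᴾ C b *ᴾ C c₁)
            ≈⟨ R.*-congˡ {C d} (R.+-cong {C (a F.* e)} {C a *ᴾ C e} (C-* a e) (R.-‿cong (C-* b c₁))) ⟨
          C d *ᴾ C (a F.* e F.- b F.* c₁)
            ≈⟨ C-* d _ ⟨
          C (d F.* (a F.* e F.- b F.* c₁))
            ≈⟨ C-cong (proj₂ (inverse _ Δ≉0)) ⟩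
          C 1# ∎)
        where d = proj₁ (inverse _ Δ≉0)
      maxDegree : Dec (a ≈ 0#) → Dec (c₁ ≈ 0#) → HasMaxDegree fraction 1
      maxDegree (no a≉0)  (no c≉0)  = 1 , 1 , toHasDegree (hasDeg-linear₁ {b = b} a≉0) , toHasDegree (hasDeg-linear₁ {b = e} c≉0) , ≡.refl
      maxDegree (no a≉0)  (yes c≈0) = 1 , 0 , toHasDegree (hasDeg-linear₁ {b = b} a≉0)
        , toHasDegree (hasDeg-linear₀ c≈0 λ e≈0 → Δ≉0 (Δ-zero (zeroʳ a e≈0) (zeroʳ b c≈0))) , ≡.refl
      maxDegree (yes a≈0) (no c≉0)  = 0 , 1 , toHasDegree (hasDeg-linear₀ a≈0 λ b≈0 → Δ≉0 (Δ-zero (zeroˡ e a≈0) (zeroˡ c₁ b≈0)))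
        , toHasDegree (hasDeg-linear₁ {b = e} c≉0) , ≡.refl
      maxDegree (yes a≈0) (yes c≈0) = ⊥-elim (Δ≉0 (Δ-zero (zeroˡ e a≈0) (zeroʳ b c≈0)))

  homogenize-linear : ∀ a b U V → homogenize 2 (linear a b) U V ≈ᴾ V *ᴾ (C b *ᴾ V +ᴾ C a *ᴾ U)
  homogenize-linear a b U V = solve 4 (λ a b U V → b :* (V :* (V :* con (+ 1))) :+ U :* (a :* (V :* con (+ 1)) :+ U :* con (+ 0)) := V :* (b :* V :+ a :* U))
    R.refl (C a) (C b) U V

  ^ᴾ≡^ : ∀ v n → v ^ᴾ n ≡ v ^ n
  ^ᴾ≡^ v zero    = ≡.refl
  ^ᴾ≡^ v (suc n) = ≡.cong (v *ᴾ_) (^ᴾ≡^ v n)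

  homogenize≈hom : ∀ N p u v → length p ≤ suc N → homogenize N p u v ≈ᴾ hom N p u v
  homogenize≈hom N       []           u v _ = R.sym (hom-[] N u v)
  homogenize≈hom zero    (a ∷ [])     u v _ = solve 2 (λ a u → a :* con (+ 1) :+ u :* con (+ 0) := a) R.refl (C a) u
  homogenize≈hom zero    (a ∷ b ∷ p)  u v (s≤s ())
  homogenize≈hom (suc N) (a ∷ p)      u v (s≤s le) = R.+-cong (R.*-congˡ {C a} (R.reflexive (^ᴾ≡^ v (suc N)))) (R.*-congˡ {u} (homogenize≈hom N p u v le))

  coeff-beyond : ∀ p i → length p ≤ i → coeff p i ≈ 0#
  coeff-beyond []      i       _        = F.refl
  coeff-beyond (a ∷ p) (suc i) (s≤s le) = coeff-beyond p i le

  hasDeg-length : ∀ {p n} → HasDeg p n → suc n ≤ length p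
  hasDeg-length {p} {n} h = ℕₚ.≰⇒> λ le → top h (coeff-beyond p n le)

  -- For φ = b / (c X^D + e): if b v^D = λ (x + y X^D) and e v^D + c u^D = λ (z + w X^D) for
  -- ψ = u / v = (y + x X) / (w + z X), then φ ∘ ψ = ψ ∘ (1 / X^D).
  module _ (φ φ′ : RatFun) (D : ℕ) (b c₁ e x y z w λ₀ : Carrier) (1≤D : 1 ≤ D)
    (c≉0 : ¬ c₁ ≈ 0#) (λ≉0 : ¬ λ₀ ≈ 0#) (κ≉0 : ¬ x F.* w F.- y F.* z ≈ 0#)
    (num-φ : num φ ≈ᴾ C b) (den-φ : den φ ≈ᴾ lin c₁ e (X ^ D) (C 1#))
    (num-φ′ : num φ′ ≈ᴾ C 1#) (den-φ′ : den φ′ ≈ᴾ X ^ D)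
    (eq₁ : b F.* w ^ᶠ D ≈ λ₀ F.* x) (eq₂ : b F.* z ^ᶠ D ≈ λ₀ F.* y)
    (eq₃ : c₁ F.* y ^ᶠ D F.+ e F.* w ^ᶠ D ≈ λ₀ F.* z) (eq₄ : c₁ F.* x ^ᶠ D F.+ e F.* z ^ᶠ D ≈ λ₀ F.* w)
    (split-u : linear x y ^ D ≈ᴾ C (y ^ᶠ D) +ᴾ C (x ^ᶠ D) *ᴾ X ^ D)
    (split-v : linear z w ^ D ≈ᴾ C (w ^ᶠ D) +ᴾ C (z ^ᶠ D) *ᴾ X ^ D)
    where
    private
      u v U V : Poly
      u = linear x y
      v = linear z w
      U = C x +ᴾ C y *ᴾ X ^ D
      V = C z +ᴾ C w *ᴾ X ^ D
      κ = x F.* w F.- y F.* z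
      N = length (num φ) ℕ.⊔ length (den φ)

      κ′≉0 : ¬ w F.* x F.- F.- y F.* F.- z ≈ 0#
      κ′≉0 h = κ≉0 (F.trans (solveᶠ 4 (λ x y z w → x :*ᶠ w :-ᶠ y :*ᶠ z :=ᶠ w :*ᶠ x :-ᶠ :-ᶠ y :*ᶠ :-ᶠ z) F.refl x y z w) h)

      ψ ψ⁻¹ : RatFun
      ψ   = fraction x y z w κ≉0
      ψ⁻¹ = fraction w (F.- y) (F.- z) x κ′≉0

      Cκ : C κ ≈ᴾ C x *ᴾ C w -ᴾ C y *ᴾ C z
      Cκ = R.+-cong {C (x F.* w)} {C x *ᴾ C w} (C-* x w) (R.-‿cong (C-* y z))

      Cκ≉0 : ¬ C κ ≈ᴾ []
      Cκ≉0 = hasDeg-≉0 (hasDeg-C κ≉0)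

      not-both : ∀ {s t} → (s ≈ 0# → t ≈ 0# → κ ≈ 0#) → ¬ (s ≈ 0# × t ≈ 0#)
      not-both h (s≈0 , t≈0) = κ≉0 (h s≈0 t≈0)

      zw-not-both : ¬ (z ≈ 0# × w ≈ 0#)
      zw-not-both = not-both λ z≈0 w≈0 → F.trans (F.+-cong (F.trans (F.*-congˡ w≈0) (F.zeroʳ x)) (F.-‿cong (F.trans (F.*-congˡ z≈0) (F.zeroʳ y)))) (F.-‿inverseʳ 0#)

      v≉0 : ¬ v ≈ᴾ []
      v≉0 h = zw-not-both (at h 1 , at h 0)

      V≉0 : ¬ V ≈ᴾ []
      V≉0 h = decide (w ≟ 0#)
        where
        V′ : V ≈ᴾ lin w z (X ^ D) (C 1#)
        V′ = solve 3 (λ z w t → z :+ w :* t := w :* t :+ z :* con (+ 1)) R.refl (C z) (C w) (X ^ D)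
        decide : Dec (w ≈ 0#) → ⊥
        decide (no w≉0)  = hasDeg-≉0 (hasDeg-lin {w} {z} {D} w≉0 1≤D) (R.trans (R.sym V′) h)
        decide (yes w≈0) = zw-not-both (z≈0 , w≈0)
          where
          z≈0 : z ≈ 0#
          z≈0 = at (R.trans (R.sym (R.trans (R.+-congˡ {C z} (R.*-congʳ {X ^ D} (R.trans (C-cong w≈0) C-0))) (R.+-identityʳ (C z)))) h) 0

    φ∘ψ : RatFun
    φ∘ψ = ratFun U V (nonZeroᴾ V≉0)

    private
      ψ∘ψ⁻¹ : IsComposite (𝕏^ 1) ψ ψ⁻¹
      ψ∘ψ⁻¹ = nonZeroᴾ (λ h → *-≉0 p≉0 Cκ≉0 (R.trans (R.sym den≈) h)) , coeff-≈ (begin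
          X *ᴾ homogenize 2 (linear z w) (linear w (F.- y)) p     ≈⟨ R.*-congˡ {X} den≈ ⟩
          X *ᴾ (p *ᴾ C κ)                                         ≈⟨ solve 3 (λ x p k → x :* (p :* k) := p :* (k :* x) :* con (+ 1)) R.refl X p (C κ) ⟩
          p *ᴾ (C κ *ᴾ X) *ᴾ C 1#                                 ≈⟨ R.*-congʳ {C 1#} num≈ ⟨
          homogenize 2 (linear x y) (linear w (F.- y)) p *ᴾ C 1#  ∎)
        where
        p = linear (F.- z) x
        p≉0 : ¬ p ≈ᴾ []
        p≉0 h = not-both {F.- z} {x} (λ z≈0 x≈0 → F.trans (F.+-cong (F.trans (F.*-congʳ x≈0) (F.zeroˡ w))
                  (F.trans (solveᶠ 2 (λ y z → :-ᶠ (y :*ᶠ z) :=ᶠ y :*ᶠ :-ᶠ z) F.refl y z) (F.trans (F.*-congˡ z≈0) (F.zeroʳ y)))) (F.+-identityˡ 0#))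
                (at h 1 , at h 0)
        den≈ : homogenize 2 (linear z w) (linear w (F.- y)) p ≈ᴾ p *ᴾ C κ
        den≈ = R.trans (homogenize-linear z w (linear w (F.- y)) p) (R.*-congˡ {p} (R.trans
          (R.+-cong (R.*-congˡ {C w} (linear≈ (F.- z) x)) (R.*-congˡ {C z} (linear≈ w (F.- y))))
          (R.trans (solve 5 (λ x y z w t → w :* (x :+ (:- z) :* t) :+ z :* ((:- y) :+ w :* t) := x :* w :- y :* z) R.refl (C x) (C y) (C z) (C w) X) (R.sym Cκ))))
        num≈ : homogenize 2 (linear x y) (linear w (F.- y)) p ≈ᴾ p *ᴾ (C κ *ᴾ X)
        num≈ = R.trans (homogenize-linear x y (linear w (F.- y)) p) (R.*-congˡ {p} (R.trans
          (R.+-cong (R.*-congˡ {C y} (linear≈ (F.- z) x)) (R.*-congˡ {C x} (linear≈ w (F.- y))))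
          (R.trans (solve 5 (λ x y z w t → y :* (x :+ (:- z) :* t) :+ x :* ((:- y) :+ w :* t) := (x :* w :- y :* z) :* t) R.refl (C x) (C y) (C z) (C w) X)
            (R.*-congʳ {X} (R.sym Cκ)))))

      ψ⁻¹∘ψ : IsComposite (𝕏^ 1) ψ⁻¹ ψ
      ψ⁻¹∘ψ = nonZeroᴾ (λ h → *-≉0 v≉0 Cκ≉0 (R.trans (R.sym den≈) h)) , coeff-≈ (begin
          X *ᴾ homogenize 2 (linear (F.- z) x) u v       ≈⟨ R.*-congˡ {X} den≈ ⟩
          X *ᴾ (v *ᴾ C κ)                                ≈⟨ solve 3 (λ x p k → x :* (p :* k) := p :* (k :* x) :* con (+ 1)) R.refl X v (C κ) ⟩
          v *ᴾ (C κ *ᴾ X) *ᴾ C 1#                        ≈⟨ R.*-congʳ {C 1#} num≈ ⟨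
          homogenize 2 (linear w (F.- y)) u v *ᴾ C 1#    ∎)
        where
        den≈ : homogenize 2 (linear (F.- z) x) u v ≈ᴾ v *ᴾ C κ
        den≈ = R.trans (homogenize-linear (F.- z) x u v) (R.*-congˡ {v} (R.trans
          (R.+-cong (R.*-congˡ {C x} (linear≈ z w)) (R.*-congˡ {C (F.- z)} (linear≈ x y)))
          (R.trans (solve 5 (λ x y z w t → x :* (w :+ z :* t) :+ (:- z) :* (y :+ x :* t) := x :* w :- y :* z) R.refl (C x) (C y) (C z) (C w) X) (R.sym Cκ))))
        num≈ : homogenize 2 (linear w (F.- y)) u v ≈ᴾ v *ᴾ (C κ *ᴾ X)
        num≈ = R.trans (homogenize-linear w (F.- y) u v) (R.*-congˡ {v} (R.trans
          (R.+-cong (R.*-congˡ {C (F.- y)} (linear≈ z w)) (R.*-congˡ {C w} (linear≈ x y)))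
          (R.trans (solve 5 (λ x y z w t → (:- y) :* (w :+ z :* t) :+ w :* (y :+ x :* t) := (x :* w :- y :* z) :* t) R.refl (C x) (C y) (C z) (C w) X)
            (R.*-congʳ {X} (R.sym Cκ)))))

      hasDeg-den-φ : HasDeg (den φ) D
      hasDeg-den-φ = hasDeg-cong (R.sym den-φ) (hasDeg-lin {c₁} {e} {D} c≉0 1≤D)

      D≤N : D ≤ N
      D≤N = ℕₚ.≤-trans (ℕₚ.n≤1+n D) (ℕₚ.≤-trans (hasDeg-length hasDeg-den-φ) (ℕₚ.m≤n⊔m (length (num φ)) (length (den φ))))

      s = N ℕ.∸ D
      s+D≡N : s ℕ.+ D ≡ N
      s+D≡N = ℕₚ.m∸n+n≡m D≤N

      homogenize-N : ∀ p → length p ≤ N → DegLe p D → homogenize N p u v ≈ᴾ v ^ s *ᴾ hom D p u v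
      homogenize-N p le hp = R.trans (homogenize≈hom N p u v (ℕₚ.m≤n⇒m≤1+n le))
        (R.trans (R.reflexive (≡.cong (λ k → hom k p u v) (≡.sym s+D≡N))) (hom-raise s D p u v hp))

      hom-C : ∀ a → hom D (C a) u v ≈ᴾ C a *ᴾ v ^ D
      hom-C a = R.trans (R.reflexive (≡.cong (λ k → hom k (C a) u v) (≡.sym (ℕₚ.+-identityʳ D))))
        (R.trans (hom-raise D 0 (C a) u v degLe-C) (R.*-comm (v ^ D) (C a)))

      hom-X : hom 1 X u v ≈ᴾ u
      hom-X = R.trans (R.+-congʳ {u *ᴾ C 1#} (R.*-congʳ {v ^ 1} C-0)) (solve 2 (λ u v → con (+ 0) :* v :+ u :* con (+ 1) := u) R.refl u (v ^ 1))

      hom-X^D : hom D (X ^ D) u v ≈ᴾ u ^ D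
      hom-X^D = R.trans (R.reflexive (≡.cong (λ k → hom k (X ^ D) u v) (≡.sym (ℕₚ.*-identityʳ D))))
        (R.trans (hom-^ 1 X D u v degLe-X) (^-congˡ D hom-X))

      C-λ : ∀ {p q r} → p F.* q ≈ r → C p *ᴾ C q ≈ᴾ C r
      C-λ {p} {q} eq = R.trans (R.sym (C-* p q)) (C-cong eq)

      num≈ : homogenize N (num φ) u v ≈ᴾ v ^ s *ᴾ (C λ₀ *ᴾ U)
      num≈ = R.trans (homogenize-N (num φ) (ℕₚ.m≤m⊔n (length (num φ)) (length (den φ))) (degLe-cong (R.sym num-φ) degLe-C))
        (R.*-congˡ {v ^ s} (R.trans (hom-cong D u v num-φ) (R.trans (hom-C b) (R.trans (R.*-congˡ {C b} split-v) (begin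
          C b *ᴾ (C (w ^ᶠ D) +ᴾ C (z ^ᶠ D) *ᴾ X ^ D)             ≈⟨ solve 4 (λ b w z t → b :* (w :+ z :* t) := b :* w :+ b :* z :* t) R.refl (C b) (C (w ^ᶠ D)) (C (z ^ᶠ D)) (X ^ D) ⟩
          C b *ᴾ C (w ^ᶠ D) +ᴾ C b *ᴾ C (z ^ᶠ D) *ᴾ X ^ D        ≈⟨ R.+-cong (C-λ eq₁) (R.*-congʳ {X ^ D} (C-λ eq₂)) ⟩
          C (λ₀ F.* x) +ᴾ C (λ₀ F.* y) *ᴾ X ^ D                  ≈⟨ R.+-cong (C-* λ₀ x) (R.*-congʳ {X ^ D} (C-* λ₀ y)) ⟩
          C λ₀ *ᴾ C x +ᴾ C λ₀ *ᴾ C y *ᴾ X ^ D                    ≈⟨ solve 4 (λ l x y t → l :* x :+ l :* y :* t := l :* (x :+ y :* t)) R.refl (C λ₀) (C x) (C y) (X ^ D) ⟩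
          C λ₀ *ᴾ U                                              ∎)))))

      den≈ : homogenize N (den φ) u v ≈ᴾ v ^ s *ᴾ (C λ₀ *ᴾ V)
      den≈ = R.trans (homogenize-N (den φ) (ℕₚ.m≤n⊔m (length (num φ)) (length (den φ))) (bound hasDeg-den-φ))
        (R.*-congˡ {v ^ s} (R.trans (hom-cong D u v den-φ) (begin
          hom D (lin c₁ e (X ^ D) (C 1#)) u v
            ≈⟨ hom-+ D (C c₁ *ᴾ X ^ D) (C e *ᴾ C 1#) u v ⟩
          hom D (C c₁ *ᴾ X ^ D) u v +ᴾ hom D (C e *ᴾ C 1#) u v
            ≈⟨ R.+-cong (R.trans (hom-C* D c₁ (X ^ D) u v) (R.*-congˡ {C c₁} (R.trans hom-X^D split-u)))
                        (R.trans (hom-C* D e (C 1#) u v) (R.*-congˡ {C e} (R.trans (hom-C 1#) (R.trans (R.*-identityˡ (v ^ D)) split-v)))) ⟩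
          C c₁ *ᴾ (C (y ^ᶠ D) +ᴾ C (x ^ᶠ D) *ᴾ X ^ D) +ᴾ C e *ᴾ (C (w ^ᶠ D) +ᴾ C (z ^ᶠ D) *ᴾ X ^ D)
            ≈⟨ solve 7 (λ c e x y z w t → c :* (y :+ x :* t) :+ e :* (w :+ z :* t) := (c :* y :+ e :* w) :+ (c :* x :+ e :* z) :* t)
                 R.refl (C c₁) (C e) (C (x ^ᶠ D)) (C (y ^ᶠ D)) (C (z ^ᶠ D)) (C (w ^ᶠ D)) (X ^ D) ⟩
          (C c₁ *ᴾ C (y ^ᶠ D) +ᴾ C e *ᴾ C (w ^ᶠ D)) +ᴾ (C c₁ *ᴾ C (x ^ᶠ D) +ᴾ C e *ᴾ C (z ^ᶠ D)) *ᴾ X ^ D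
            ≈⟨ R.+-cong (combine eq₃) (R.*-congʳ {X ^ D} (combine eq₄)) ⟩
          C λ₀ *ᴾ C z +ᴾ C λ₀ *ᴾ C w *ᴾ X ^ D
            ≈⟨ solve 4 (λ l x y t → l :* x :+ l :* y :* t := l :* (x :+ y :* t)) R.refl (C λ₀) (C z) (C w) (X ^ D) ⟩
          C λ₀ *ᴾ V ∎)))
        where
        combine : ∀ {p q r} → c₁ F.* p F.+ e F.* q ≈ λ₀ F.* r → C c₁ *ᴾ C p +ᴾ C e *ᴾ C q ≈ᴾ C λ₀ *ᴾ C r
        combine {p} {q} {r} eq = R.trans (R.sym (R.+-cong {C (c₁ F.* p)} {C c₁ *ᴾ C p} {C (e F.* q)} {C e *ᴾ C q} (C-* c₁ p) (C-* e q)))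
          (R.trans (C-cong eq) (C-* λ₀ r))

      φ∘ψ-composite : IsComposite φ∘ψ φ ψ
      φ∘ψ-composite = nonZeroᴾ (λ h → *-≉0 (^-≉0 s v≉0) (*-≉0 (hasDeg-≉0 (hasDeg-C λ≉0)) V≉0) (R.trans (R.sym den≈) h)) , coeff-≈ (begin
        U *ᴾ homogenize N (den φ) u v    ≈⟨ R.*-congˡ {U} den≈ ⟩
        U *ᴾ (v ^ s *ᴾ (C λ₀ *ᴾ V))      ≈⟨ solve 4 (λ U t l V → U :* (t :* (l :* V)) := t :* (l :* U) :* V) R.refl U (v ^ s) (C λ₀) V ⟩
        v ^ s *ᴾ (C λ₀ *ᴾ U) *ᴾ V        ≈⟨ R.*-congʳ {V} num≈ ⟨
        homogenize N (num φ) u v *ᴾ V    ∎)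

      φ′-composite : IsComposite φ′ ψ⁻¹ φ∘ψ
      φ′-composite = nonZeroᴾ (λ h → *-≉0 V≉0 (*-≉0 Cκ≉0 (^-≉0 D (hasDeg-≉0 hasDeg-X))) (R.trans (R.sym den′≈) h)) , coeff-≈ (begin
          num φ′ *ᴾ homogenize 2 (linear (F.- z) x) U V   ≈⟨ R.*-cong num-φ′ den′≈ ⟩
          C 1# *ᴾ (V *ᴾ (C κ *ᴾ X ^ D))                   ≈⟨ solve 3 (λ V k t → con (+ 1) :* (V :* (k :* t)) := V :* k :* t) R.refl V (C κ) (X ^ D) ⟩
          V *ᴾ C κ *ᴾ X ^ D                               ≈⟨ R.*-cong num′≈ den-φ′ ⟨
          homogenize 2 (linear w (F.- y)) U V *ᴾ den φ′   ∎)
        where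
        den′≈ : homogenize 2 (linear (F.- z) x) U V ≈ᴾ V *ᴾ (C κ *ᴾ X ^ D)
        den′≈ = R.trans (homogenize-linear (F.- z) x U V) (R.*-congˡ {V} (R.trans
          (solve 5 (λ x y z w t → x :* (z :+ w :* t) :+ (:- z) :* (x :+ y :* t) := (x :* w :- y :* z) :* t) R.refl (C x) (C y) (C z) (C w) (X ^ D))
          (R.*-congʳ {X ^ D} (R.sym Cκ))))
        num′≈ : homogenize 2 (linear w (F.- y)) U V ≈ᴾ V *ᴾ C κ
        num′≈ = R.trans (homogenize-linear w (F.- y) U V) (R.*-congˡ {V} (R.trans
          (solve 5 (λ x y z w t → (:- y) :* (z :+ w :* t) :+ w :* (x :+ y :* t) := x :* w :- y :* z) R.refl (C x) (C y) (C z) (C w) (X ^ D)) (R.sym Cκ)))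

    conjugate : IsConjugateVia φ φ′
    conjugate = ψ , ψ⁻¹ , φ∘ψ , fraction-degree x y z w κ≉0 , ψ∘ψ⁻¹ , ψ⁻¹∘ψ , φ∘ψ-composite , φ′-composite

  scalingPolynomial-degree : ∀ D {b c₁} → ¬ c₁ ≈ 0# → HasDeg (scalingPolynomial D b c₁) (suc D)
  scalingPolynomial-degree D {b} {c₁} c≉0 = hasDeg-cong (R.+-congˡ {C c₁ *ᴾ X ^ suc D} (R.*-identityʳ (C (F.- b))))
    (hasDeg-lin {c₁} {F.- b} {suc D} c≉0 (s≤s z≤n))

  langPolynomial-degree : ∀ s′ {k b c₁ e} → 1 ≤ s′ → ¬ k ≈ 0# → ¬ b ≈ 0# → ¬ c₁ ≈ 0# →
    ∃[ n ] (1 ≤ n × HasDeg (langPolynomial s′ k b c₁ e) n)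
  langPolynomial-degree s′ {k} {b} {c₁} {e} 1≤s′ k≉0 b≉0 c≉0 = positive (degree P P≉0)
    where
    s = suc s′
    P = langPolynomial s′ k b c₁ e
    Λ = multiplier s′ k
    G = geometric s′ (X ^ suc s) (C 1#)
    c₂ = c₁ F.* b ^ᶠ s

    G-0 : value G 0# ≈ 1#
    G-0 = F.trans (ev-geometric FR (λ x → x) (Identity.isRingHomomorphism F.rawRing F.refl) s′ (X ^ suc s) (C 1#) 0#)
      (F.trans (FT.geometric-cong s′ (F.trans (ev-X^ FR (λ x → x) (Identity.isRingHomomorphism F.rawRing F.refl) (suc s) 0#) (F.zeroˡ _)) (F-ev.ev-C 1# 0#))
        (FT.geometric-0-1 s′ 1≤s′))

    P-0 : value P 0# ≈ F.- c₂
    P-0 = F.trans (ev-lang FR (λ x → x) (Identity.isRingHomomorphism F.rawRing F.refl) s′ k b c₁ e 0#) (F.trans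
      (F.+-cong (F.trans (F.*-congʳ λ-0) (F.zeroˡ _)) (F.-‿cong (F.+-congˡ (F.trans (F.*-congˡ (F.trans (F.*-congʳ
        (F.trans (F.*-congʳ λ-0) (F.zeroˡ _))) (F.zeroˡ _))) (F.zeroʳ e)))))
      (solveᶠ 1 (λ c → conᶠ (+ 0) :-ᶠ (c :+ᶠ conᶠ (+ 0)) :=ᶠ :-ᶠ c) F.refl c₂))
      where
      λ-0 : k F.* (0# F.* FT.geometric s′ (0# ^ᶠ suc s) 1#) ≈ 0#
      λ-0 = F.trans (F.*-congˡ (F.zeroˡ _)) (F.zeroʳ k)

    -c₂≉0 : ¬ F.- c₂ ≈ 0#
    -c₂≉0 h = *-≉0ᶠ c≉0 (^-≉0ᶠ s b≉0) (F.trans (solveᶠ 1 (λ x → x :=ᶠ :-ᶠ (:-ᶠ x)) F.refl c₂) (F.trans (F.-‿cong h) (RingProperties.-0#≈0# F.ring)))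

    P≉0 : ¬ P ≈ᴾ []
    P≉0 h = -c₂≉0 (F.trans (F.sym P-0) (F-ev.ev-cong 0# h))

    Λ≉0 : ¬ Λ ≈ᴾ []
    Λ≉0 = *-≉0 (hasDeg-≉0 (hasDeg-C k≉0)) (*-≉0 (hasDeg-≉0 hasDeg-X) λ h → 1≉0 (F.trans (F.sym G-0) (F-ev.ev-cong 0# h)))

    W = X ^ s′ *ᴾ (X ^ s) ^ s′

    -- If P were constant, cancelling λ^s and X would leave k G = e X^(s²−1), which fails at 0.
    positive : (∃[ n ] HasDeg P n) → ∃[ n ] (1 ≤ n × HasDeg P n)
    positive (suc n , hP) = suc n , s≤s z≤n , hP
    positive (zero  , hP) = ⊥-elim (k≉0 (F.trans (F.sym (F.*-identityʳ k)) (F.trans (F.*-congˡ (F.sym G-0)) (F.trans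
        (F.sym (F.trans (F-ev.ev-* (C k) G 0#) (F.*-congʳ (F-ev.ev-C k 0#))))
        (F.trans (F-ev.ev-cong 0# kG≈) (F.trans (F-ev.ev-* (C e) W 0#) (F.trans (F.*-congˡ W-0) (F.zeroʳ _))))))))
      where
      W-0 : value W 0# ≈ 0#
      W-0 = F.trans (F-ev.ev-* (X ^ s′) ((X ^ s) ^ s′) 0#) (F.trans (F.*-congʳ (F.trans (ev-X^ FR (λ x → x) (Identity.isRingHomomorphism F.rawRing F.refl) s′ 0#) (0^ s′ 1≤s′))) (F.zeroˡ _))
        where
        0^ : ∀ n → 1 ≤ n → 0# ^ᶠ n ≈ 0#
        0^ (suc n) _ = F.zeroˡ _
      P≈ : P ≈ᴾ -ᴾ C c₂
      P≈ = R.trans (degLe-0⇒C (bound hP)) (C-cong (F.trans (F.trans (F.sym (F-ev.ev-C _ 0#))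
        (F-ev.ev-cong 0# (R.sym (degLe-0⇒C (bound hP))))) P-0))
      T = C e *ᴾ (X ^ s) ^ s
      Λ≈ : Λ ≈ᴾ T
      Λ≈ = *-cancelˡ (Λ ^ s) (^-≉0 s Λ≉0) (begin
        Λ ^ s *ᴾ Λ
          ≈⟨ solve 5 (λ L l c e x → L :* l := (l :* L :- (c :+ e :* (L :* x))) :+ (c :+ e :* (L :* x))) R.refl (Λ ^ s) Λ (C c₂) (C e) ((X ^ s) ^ s) ⟩
        P +ᴾ (C c₂ +ᴾ C e *ᴾ (Λ ^ s *ᴾ (X ^ s) ^ s))
          ≈⟨ R.+-congʳ {C c₂ +ᴾ C e *ᴾ (Λ ^ s *ᴾ (X ^ s) ^ s)} P≈ ⟩
        -ᴾ C c₂ +ᴾ (C c₂ +ᴾ C e *ᴾ (Λ ^ s *ᴾ (X ^ s) ^ s))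
          ≈⟨ solve 4 (λ c e L x → (:- c) :+ (c :+ e :* (L :* x)) := L :* (e :* x)) R.refl (C c₂) (C e) (Λ ^ s) ((X ^ s) ^ s) ⟩
        Λ ^ s *ᴾ T ∎)
      kG≈ : C k *ᴾ G ≈ᴾ C e *ᴾ W
      kG≈ = *-cancelˡ X (hasDeg-≉0 hasDeg-X) (begin
        X *ᴾ (C k *ᴾ G)    ≈⟨ solve 3 (λ x k g → x :* (k :* g) := k :* (x :* g)) R.refl X (C k) G ⟩
        Λ                  ≈⟨ Λ≈ ⟩
        T                  ≈⟨ solve 4 (λ e x y z → e :* ((x :* y) :* z) := x :* (e :* (y :* z))) R.refl (C e) X (X ^ s′) ((X ^ s) ^ s′) ⟩
        X *ᴾ (C e *ᴾ W)    ∎)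

  record MinimalDivisor (P : Poly) : Set (c ⊔ˡ ℓ₁) where
    field
      π       : Poly
      k       : ℕ
      1≤k     : 1 ≤ k
      π-deg   : HasDeg π k
      π∣P     : π ∣ P
      minimal : ∀ r j → 1 ≤ j → HasDeg r j → r ∣ P → k ≤ j

  minimalDivisor : ∀ {P n} → HasDeg P n → 1 ≤ n → ¬ ¬ MinimalDivisor P
  minimalDivisor {P} {n} hP 1≤n none = no-divisor n (<-wellFounded n) P 1≤n hP ∣-refl
    where
    no-divisor : ∀ n → Acc _<_ n → ∀ r → 1 ≤ n → HasDeg r n → r ∣ P → ⊥
    no-divisor n (acc rec) r 1≤n hr r∣P = none record
      { π = r ; k = n ; 1≤k = 1≤n ; π-deg = hr ; π∣P = r∣P
      ; minimal = λ s j 1≤j hs s∣P → ℕₚ.≮⇒≥ λ j<n → no-divisor j (rec j<n) s 1≤j hs s∣P }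

  module RootExtension {P : Poly} (divisor : MinimalDivisor P) where
    open MinimalDivisor divisor
    open Division π k π-deg

    infix 4 _~_ _♯_
    _~_ : Poly → Poly → Set ℓ₁
    x ~ y = remainder (x -ᴾ y) ≈ᴾ []

    _♯_ : Poly → Poly → Set ℓ₂
    x ♯ y = NonZeroᴾ (remainder (x -ᴾ y))

    ∣⇒remainder≈0 : ∀ x → π ∣ x → remainder x ≈ᴾ []
    ∣⇒remainder≈0 x π∣x with zero? (remainder x)
    ... | yes r≈0 = r≈0
    ... | no r≉0  = let (j , hj) = degree (remainder x) r≉0 in
      ⊥-elim (ℕₚ.<⇒≱ (degLt-hasDeg hj (remainder-< x)) (∣⇒deg≤ π-deg r≉0 (bound hj) (∣-respʳ
        (R.trans (R.+-congʳ { -ᴾ (quotient x *ᴾ π)} (divMod-eq x))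
          (solve 2 (λ a b → a :+ b :- a := b) R.refl (quotient x *ᴾ π) (remainder x)))
        (∣-+ π∣x (∣-neg (∣-*ˡ (quotient x) π ∣-refl))))))

    remainder≈0⇒∣ : ∀ x → remainder x ≈ᴾ [] → π ∣ x
    remainder≈0⇒∣ x e = quotient x , R.sym (R.trans (divMod-eq x) (R.trans (R.+-congˡ {quotient x *ᴾ π} e) (R.+-identityʳ _)))

    ~⇒∣ : ∀ {x y} → x ~ y → π ∣ (x -ᴾ y)
    ~⇒∣ {x} {y} = remainder≈0⇒∣ (x -ᴾ y)

    ∣⇒~ : ∀ {x y} → π ∣ (x -ᴾ y) → x ~ y
    ∣⇒~ {x} {y} = ∣⇒remainder≈0 (x -ᴾ y)

    ≈⇒~ : ∀ {x y} → x ≈ᴾ y → x ~ y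
    ≈⇒~ {x} {y} e = ∣⇒~ {x} {y} (∣-respʳ (R.sym (x≈y⇒x-y≈0 e)) ∣-0)

    ∣⇒~0 : ∀ {x} → π ∣ x → x ~ []
    ∣⇒~0 {x} d = ∣⇒~ {x} {[]} (∣-respʳ (R.sym (R.+-identityʳ x)) d)

    ~0⇒∣ : ∀ {x} → x ~ [] → π ∣ x
    ~0⇒∣ {x} e = ∣-respʳ (R.+-identityʳ x) (~⇒∣ {x} {[]} e)

    _~?_ : ∀ x y → Dec (x ~ y)
    x ~? y = zero? (remainder (x -ᴾ y))

    ~-refl : ∀ {x} → x ~ x
    ~-refl {x} = ≈⇒~ {x} R.refl

    ~-sym : ∀ {x y} → x ~ y → y ~ x
    ~-sym {x} {y} e = ∣⇒~ {y} {x} (∣-respʳ (solve 2 (λ x y → :- (x :- y) := y :- x) R.refl x y) (∣-neg (~⇒∣ {x} {y} e)))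

    ~-trans : ∀ {x y z} → x ~ y → y ~ z → x ~ z
    ~-trans {x} {y} {z} e f = ∣⇒~ {x} {z} (∣-respʳ (solve 3 (λ x y z → (x :- y) :+ (y :- z) := x :- z) R.refl x y z)
      (∣-+ (~⇒∣ {x} {y} e) (~⇒∣ {y} {z} f)))

    ≁⇒♯ : ∀ {x y} → ¬ x ~ y → x ♯ y
    ≁⇒♯ {x} {y} x≁y = let (j , hj) = degree (remainder (x -ᴾ y)) x≁y in j , apart (top hj)

    ♯⇒≁ : ∀ {x y} → x ♯ y → ¬ x ~ y
    ♯⇒≁ (i , r#0) e = #⇒≉ r#0 (at e i)

    π∤1 : ¬ π ∣ C F.1#
    π∤1 u = ℕₚ.<⇒≢ 1≤k (≡.sym (unit⇒deg0 π-deg u))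

    -- The degree of gcd (x , π) is 0 or at least k by minimality, and in the latter case π ∣ x.
    inverse~ : ∀ x → ¬ x ~ [] → ∃[ y ] y *ᴾ x ~ C F.1#
    inverse~ x x≁0 = result (degree g g≉0)
      where
      open Gcd (gcd x π)
      π≉0 = hasDeg-≉0 π-deg
      g≉0 : ¬ g ≈ᴾ []
      g≉0 e = π≉0 (R.trans (R.sym (proj₂ g∣r)) (R.trans (R.*-congˡ {proj₁ g∣r} e) (R.zeroʳ (proj₁ g∣r))))
      result : (∃[ j ] HasDeg g j) → ∃[ y ] y *ᴾ x ~ C F.1#
      result (zero , hg) = case deg0⇒unit hg of λ { (s , sg≈1) → s *ᴾ u , ∣⇒~ {s *ᴾ u *ᴾ x} {C F.1#} (∣-respʳ
        (R.trans (solve 5 (λ s u v x p → :- (s :* v :* p) := s :* u :* x :- s :* (u :* x :+ v :* p)) R.refl s u v x π)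
          (R.+-congˡ {s *ᴾ u *ᴾ x} (R.-‿cong (R.trans (R.*-congˡ {s} (R.sym combination)) sg≈1))))
        (∣-neg (∣-*ˡ (s *ᴾ v) π ∣-refl))) }
      result (suc j , hg) = ⊥-elim (x≁0 (∣⇒~0 (∣-trans (associate (proj₁ g∣r) (proj₂ g∣r)) g∣p)))
        where
        associate : ∀ q → q *ᴾ g ≈ᴾ π → π ∣ g
        associate q qg≈π = unit (degree q q≉0)
          where
          q≉0 : ¬ q ≈ᴾ []
          q≉0 z = π≉0 (R.trans (R.sym qg≈π) (R.*-congʳ {g} z))
          unit : (∃[ i ] HasDeg q i) → π ∣ g
          unit (i , hq) with ℕₚ.n≤0⇒n≡0 (ℕₚ.+-cancelʳ-≤ (suc j) i 0 (≡.subst (_≤ suc j)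
              (hasDeg-unique π-deg (hasDeg-cong qg≈π (hasDeg-* hq hg))) (minimal g (suc j) (s≤s z≤n) hg (∣-trans g∣r π∣P))))
          ... | ≡.refl = case deg0⇒unit hq of λ { (s , sq≈1) →
            s , R.trans (R.*-congˡ {s} (R.sym qg≈π)) (R.trans (R.sym (R.*-assoc s q g)) (R.trans (R.*-congʳ {g} sq≈1) (R.*-identityˡ g))) }

    private
      +-cong~ : ∀ {x x′ y y′} → x ~ x′ → y ~ y′ → x +ᴾ y ~ x′ +ᴾ y′
      +-cong~ {x} {x′} {y} {y′} e f = ∣⇒~ {x +ᴾ y} {x′ +ᴾ y′} (∣-respʳ
        (solve 4 (λ x x′ y y′ → (x :- x′) :+ (y :- y′) := (x :+ y) :- (x′ :+ y′)) R.refl x x′ y y′) (∣-+ (~⇒∣ {x} {x′} e) (~⇒∣ {y} {y′} f)))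

      *-cong~ : ∀ {x x′ y y′} → x ~ x′ → y ~ y′ → x *ᴾ y ~ x′ *ᴾ y′
      *-cong~ {x} {x′} {y} {y′} e f = ∣⇒~ {x *ᴾ y} {x′ *ᴾ y′} (∣-respʳ
        (solve 4 (λ x x′ y y′ → x :* (y :- y′) :+ y′ :* (x :- x′) := x :* y :- x′ :* y′) R.refl x x′ y y′)
        (∣-+ (∣-*ˡ x (y -ᴾ y′) (~⇒∣ {y} {y′} f)) (∣-*ˡ y′ (x -ᴾ x′) (~⇒∣ {x} {x′} e))))

      -‿cong~ : ∀ {x y} → x ~ y → -ᴾ x ~ -ᴾ y
      -‿cong~ {x} {y} e = ∣⇒~ { -ᴾ x} { -ᴾ y} (∣-respʳ (solve 2 (λ x y → :- (x :- y) := :- x :- :- y) R.refl x y) (∣-neg (~⇒∣ {x} {y} e)))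

      x-y~0 : ∀ {x y} → ¬ x ~ y → ¬ x -ᴾ y ~ []
      x-y~0 {x} {y} x≁y e = x≁y (∣⇒~ {x} {y} (~0⇒∣ {x -ᴾ y} e))

    field′ : HeytingField c ℓ₁ ℓ₂
    field′ = record
      { Carrier = Poly ; _≈_ = _~_ ; _#_ = _♯_ ; _+_ = _+ᴾ_ ; _*_ = _*ᴾ_ ; -_ = -ᴾ_ ; 0# = [] ; 1# = C F.1#
      ; isHeytingField = record
        { isHeytingCommutativeRing = record
          { isCommutativeRing = record
            { isRing = record
              { +-isAbelianGroup = record
                { isGroup = record
                  { isMonoid = record
                    { isSemigroup = record
                      { isMagma = record
                        { isEquivalence = record
                          { refl = λ {x} → ~-refl {x} ; sym = λ {x} {y} → ~-sym {x} {y} ; trans = λ {x} {y} {z} → ~-trans {x} {y} {z} }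
                        ; ∙-cong = λ {x} {x′} {y} {y′} → +-cong~ {x} {x′} {y} {y′}
                        }
                      ; assoc = λ x y z → ≈⇒~ {(x +ᴾ y) +ᴾ z} {x +ᴾ (y +ᴾ z)} (R.+-assoc x y z)
                      }
                    ; identity = (λ x → ≈⇒~ {x} {x} (R.+-identityˡ x)) , (λ x → ≈⇒~ {x +ᴾ []} {x} (R.+-identityʳ x))
                    }
                  ; inverse = (λ x → ≈⇒~ {(-ᴾ x) +ᴾ x} {[]} (R.-‿inverseˡ x)) , (λ x → ≈⇒~ {x +ᴾ (-ᴾ x)} {[]} (R.-‿inverseʳ x))
                  ; ⁻¹-cong = λ {x} {y} → -‿cong~ {x} {y}
                  }
                ; comm = λ x y → ≈⇒~ {x +ᴾ y} {y +ᴾ x} (R.+-comm x y)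
                }
              ; *-cong = λ {x} {x′} {y} {y′} → *-cong~ {x} {x′} {y} {y′}
              ; *-assoc = λ x y z → ≈⇒~ {(x *ᴾ y) *ᴾ z} {x *ᴾ (y *ᴾ z)} (R.*-assoc x y z)
              ; *-identity = (λ x → ≈⇒~ {C F.1# *ᴾ x} {x} (R.*-identityˡ x)) , (λ x → ≈⇒~ {x *ᴾ C F.1#} {x} (R.*-identityʳ x))
              ; distrib = (λ x y z → ≈⇒~ {x *ᴾ (y +ᴾ z)} {x *ᴾ y +ᴾ x *ᴾ z} (R.distribˡ x y z))
                        , (λ x y z → ≈⇒~ {(y +ᴾ z) *ᴾ x} {y *ᴾ x +ᴾ z *ᴾ x} (R.distribʳ x y z))
              }
            ; *-comm = λ x y → ≈⇒~ {x *ᴾ y} {y *ᴾ x} (R.*-comm x y)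
            }
          ; isApartnessRelation = record
            { irrefl  = λ {x} {y} x~y x♯y → ♯⇒≁ {x} {y} x♯y x~y
            ; sym     = λ {x} {y} x♯y → ≁⇒♯ {y} {x} λ y~x → ♯⇒≁ {x} {y} x♯y (~-sym {y} {x} y~x)
            ; cotrans = λ {x} {y} x♯y z → cotrans x y z x♯y
            }
          ; #⇒invertible = λ {x} {y} x♯y → let (z , e) = inverse~ (x -ᴾ y) (x-y~0 {x} {y} (♯⇒≁ {x} {y} x♯y)) in
              z , e , ~-trans {(x -ᴾ y) *ᴾ z} {z *ᴾ (x -ᴾ y)} {C F.1#} (≈⇒~ {(x -ᴾ y) *ᴾ z} (R.*-comm (x -ᴾ y) z)) e
          ; invertible⇒# = λ {x} {y} inv → let (z , e , _) = inv in ≁⇒♯ {x} {y} λ x~y →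
              π∤1 (∣-respʳ (solve 2 (λ a b → a :- (a :- b) := b) R.refl (z *ᴾ (x -ᴾ y)) (C F.1#))
                (∣-+ (∣-*ˡ z (x -ᴾ y) (~⇒∣ {x} {y} x~y)) (∣-neg (~⇒∣ {z *ᴾ (x -ᴾ y)} {C F.1#} e))))
          }
        ; tight = λ x y → (λ ¬x♯y → stable x y ¬x♯y) , (λ x~y x♯y → ♯⇒≁ {x} {y} x♯y x~y)
        }
      }
      where
      stable : ∀ x y → ¬ x ♯ y → x ~ y
      stable x y h with x ~? y
      ... | yes e = e
      ... | no ¬e = ⊥-elim (h (≁⇒♯ {x} {y} ¬e))
      cotrans : ∀ x y z → x ♯ y → x ♯ z ⊎ z ♯ y
      cotrans x y z x♯y with x ~? z
      ... | no x≁z  = inj₁ (≁⇒♯ {x} {z} x≁z)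
      ... | yes x~z = inj₂ (≁⇒♯ {z} {y} λ z~y → ♯⇒≁ {x} {y} x♯y (~-trans {x} {z} {y} x~z z~y))

    discrete′ : Discrete field′
    discrete′ = record
      { _≟_   = _~?_
      ; apart = λ {x} x≁0 → ≁⇒♯ {x} {[]} x≁0
      }

    C-isFieldHom : IsFieldHom F field′ C
    C-isFieldHom = record
      { isSemiringHomomorphism = record
        { isNearSemiringHomomorphism = record
          { +-isMonoidHomomorphism = record
            { isMagmaHomomorphism = record
              { isRelHomomorphism = record { cong = λ {a} {b} a≈b → ≈⇒~ {C a} {C b} (C-cong a≈b) }
              ; homo = λ a b → ~-refl {C (a F.+ b)} }
            ; ε-homo = ≈⇒~ {C F.0#} {[]} C-0
            }
          ; *-homo = λ a b → ≈⇒~ {C (a F.* b)} {C a *ᴾ C b} (C-* a b)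
          }
        ; 1#-homo = ~-refl {C F.1#}
        }
      ; -‿homo = λ a → ~-refl {C (F.- a)}
      }

    root : Evaluation.ev F (fieldRing field′) C C-isFieldHom P X ~ []
    root = ∣⇒~0 {Evaluation.ev F (fieldRing field′) C C-isFieldHom P X} (≡.subst (π ∣_) (≡.sym (same P)) (∣-respʳ (R.sym (ev-self P)) π∣P))
      where
      same : ∀ r → Evaluation.ev F (fieldRing field′) C C-isFieldHom r X ≡ Sub.ev r X
      same []      = ≡.refl
      same (a ∷ r) = ≡.cong (λ z → C a +ᴾ X *ᴾ z) (same r)
      ev-self : ∀ r → Sub.ev r X ≈ᴾ r
      ev-self []      = R.refl
      ev-self (a ∷ r) = R.trans (R.+-congˡ {C a} (R.*-congˡ {X} (ev-self r))) (R.sym (∷≈C+X* a r))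

  module Independence (g h : Poly) (D : ℕ) where
    iterNum iterDen : ℕ → Poly
    iterNum zero    = X
    iterNum (suc i) = hom (D ℕ.^ i) (iterNum i) g h
    iterDen zero    = C 1#
    iterDen (suc i) = hom (D ℕ.^ i) (iterDen i) g h

    -- ∏ gᵢ^aᵢ hᵢ^bᵢ over a list of pairs (aᵢ , bᵢ) starting at the given index i.
    product : ℕ → List (ℕ × ℕ) → Poly
    product i []            = C 1#
    product i ((a , b) ∷ l) = iterNum i ^ a *ᴾ (iterDen i ^ b *ᴾ product (suc i) l)

    weight : ℕ → List (ℕ × ℕ) → ℕ
    weight i []            = 0
    weight i ((a , b) ∷ l) = a ℕ.* D ℕ.^ i ℕ.+ (b ℕ.* D ℕ.^ i ℕ.+ weight (suc i) l)

    flip : List (ℕ × ℕ) → List (ℕ × ℕ)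
    flip = List.map swap

    weight-flip : ∀ i l → weight i (flip l) ≡ weight i l
    weight-flip i []            = ≡.refl
    weight-flip i ((a , b) ∷ l) = ≡.trans (≡.cong (λ w → b ℕ.* D ℕ.^ i ℕ.+ (a ℕ.* D ℕ.^ i ℕ.+ w)) (weight-flip (suc i) l))
      (≡.trans (≡.sym (ℕₚ.+-assoc (b ℕ.* D ℕ.^ i) _ _)) (≡.trans (≡.cong (ℕ._+ weight (suc i) l) (ℕₚ.+-comm (b ℕ.* D ℕ.^ i) _))
        (ℕₚ.+-assoc (a ℕ.* D ℕ.^ i) _ _)))

    record NonConstant : Set (c ⊔ˡ ℓ₁) where
      field
        comaximal : Comaximal g h
        g-deg     : DegLe g D
        h-deg     : DegLe h D
        degree-D  : HasDeg g D ⊎ HasDeg h D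
        2≤D       : 2 ≤ D

      1≤D : 1 ≤ D
      1≤D = ℕₚ.≤-trans (s≤s z≤n) 2≤D

    module _ (nc : NonConstant) where
      open NonConstant nc

      iterNum-deg : ∀ i → DegLe (iterNum i) (D ℕ.^ i)
      iterNum-deg zero    = degLe-X
      iterNum-deg (suc i) = ≡.subst (DegLe (iterNum (suc i))) (ℕₚ.*-comm (D ℕ.^ i) D) (degLe-hom (D ℕ.^ i) (iterNum i) g-deg h-deg)

      iterDen-deg : ∀ i → DegLe (iterDen i) (D ℕ.^ i)
      iterDen-deg zero    = degLe-C
      iterDen-deg (suc i) = ≡.subst (DegLe (iterDen (suc i))) (ℕₚ.*-comm (D ℕ.^ i) D) (degLe-hom (D ℕ.^ i) (iterDen i) g-deg h-deg)

      product-deg : ∀ i l → DegLe (product i l) (weight i l)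
      product-deg i []            = degLe-C
      product-deg i ((a , b) ∷ l) = degLe-* (degLe-^ a (iterNum-deg i)) (degLe-* (degLe-^ b (iterDen-deg i)) (product-deg (suc i) l))

      hom-≉0 : ∀ {k P} → DegLe P k → ¬ P ≈ᴾ [] → ¬ hom k P g h ≈ᴾ []
      hom-≉0 hP P≉0 e = P≉0 (form-faithful comaximal degree-D 1≤D hP e)

      iterNum-≉0 : ∀ i → ¬ iterNum i ≈ᴾ []
      iterNum-≉0 zero    = hasDeg-≉0 hasDeg-X
      iterNum-≉0 (suc i) = hom-≉0 (iterNum-deg i) (iterNum-≉0 i)

      iterDen-≉0 : ∀ i → ¬ iterDen i ≈ᴾ []
      iterDen-≉0 zero    = hasDeg-≉0 (hasDeg-C 1≉0)
      iterDen-≉0 (suc i) = hom-≉0 (iterDen-deg i) (iterDen-≉0 i)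

      product-≉0 : ∀ i l → ¬ product i l ≈ᴾ []
      product-≉0 i []            = hasDeg-≉0 (hasDeg-C 1≉0)
      product-≉0 i ((a , b) ∷ l) = *-≉0 (^-≉0 a (iterNum-≉0 i)) (*-≉0 (^-≉0 b (iterDen-≉0 i)) (product-≉0 (suc i) l))

      hom-product : ∀ i l → hom (weight i l) (product i l) g h ≈ᴾ product (suc i) l
      hom-product i []            = R.refl
      hom-product i ((a , b) ∷ l) = R.trans
        (hom-* (a ℕ.* D ℕ.^ i) _ (iterNum i ^ a) _ g h (degLe-^ a (iterNum-deg i))
          (degLe-* (degLe-^ b (iterDen-deg i)) (product-deg (suc i) l)))
        (R.*-cong (hom-^ (D ℕ.^ i) (iterNum i) a g h (iterNum-deg i))
          (R.trans (hom-* (b ℕ.* D ℕ.^ i) _ (iterDen i ^ b) _ g h (degLe-^ b (iterDen-deg i)) (product-deg (suc i) l))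
            (R.*-cong (hom-^ (D ℕ.^ i) (iterDen i) b g h (iterDen-deg i)) (hom-product (suc i) l))))

      product-step : ∀ a b l → product 0 ((a , b) ∷ l) ≈ᴾ X ^ a *ᴾ hom (weight 0 l) (product 0 l) g h
      product-step a b l = R.*-congˡ {X ^ a} (R.trans (R.*-congʳ {product 1 l} (1^n b))
        (R.trans (R.*-identityˡ (product 1 l)) (R.sym (hom-product 0 l))))

      data Excluded : Set (c ⊔ˡ ℓ₁) where
        diagonal     : (m : Möbius g h D) → Möbius.b m ≈ 0# → Möbius.c₁ m ≈ 0# → Excluded
        antidiagonal : (m : Möbius g h D) → Möbius.a m ≈ 0# → Möbius.e m ≈ 0# → Excluded
        wild         : (m : Möbius g h D) → ∀ {p l} → Characteristic.HasChar FR p → D ≡ p ℕ.^ l → Excluded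

      module _ (m : Möbius g h D) where
        open Möbius m

        isSubst-g : IsSubst D g
        isSubst-g = isSubst-cong D (R.sym g≈) (isSubst-+ D (isSubst-* D (isSubst-C D a) (isSubst-X^ D)) (isSubst-* D (isSubst-C D b) (isSubst-C D 1#)))

        isSubst-h : IsSubst D h
        isSubst-h = isSubst-cong D (R.sym h≈) (isSubst-+ D (isSubst-* D (isSubst-C D c₁) (isSubst-X^ D)) (isSubst-* D (isSubst-C D e) (isSubst-C D 1#)))

        ^-swap : ∀ p a → (p ^ D) ^ a ≈ᴾ (p ^ a) ^ D
        ^-swap p a = R.trans (^-assocʳ p D a) (R.trans (R.reflexive (≡.cong (p ^_) (ℕₚ.*-comm D a))) (R.sym (^-assocʳ p a D)))

        isSubst-product : ∀ i l → IsSubst D (product i l ^ D)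
        isSubst-product i []            = isSubst-^ D D (isSubst-C D 1#)
        isSubst-product i ((a , b) ∷ l) = isSubst-cong D
          (R.sym (R.trans (^-distrib-* (iterNum i ^ a) _ D) (R.*-congˡ {(iterNum i ^ a) ^ D} (^-distrib-* (iterDen i ^ b) _ D))))
          (isSubst-* D (power (iterNum i) a (numer i)) (isSubst-* D (power (iterDen i) b (denom i)) (isSubst-product (suc i) l)))
          where
          power : ∀ p a → IsSubst D (p ^ D) → IsSubst D ((p ^ a) ^ D)
          power p a s = isSubst-cong D (^-swap p a) (isSubst-^ D a s)
          numer : ∀ i → IsSubst D (iterNum i ^ D)
          numer zero    = isSubst-X^ D
          numer (suc i) = isSubst-^ D D (isSubst-hom D (D ℕ.^ i) (iterNum i) isSubst-g isSubst-h)
          denom : ∀ i → IsSubst D (iterDen i ^ D)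
          denom zero    = isSubst-^ D D (isSubst-C D 1#)
          denom (suc i) = isSubst-^ D D (isSubst-hom D (D ℕ.^ i) (iterDen i) isSubst-g isSubst-h)

        l₀ l₁ : Poly
        l₀ = lin e (F.- b) X (C 1#)
        l₁ = lin (F.- c₁) a X (C 1#)

        Δ = a F.* e F.- b F.* c₁

        private
          CΔ : C Δ ≈ᴾ C a *ᴾ C e -ᴾ C b *ᴾ C c₁
          CΔ = R.+-cong {C (a F.* e)} {C a *ᴾ C e} (C-* a e) (R.-‿cong (C-* b c₁))

        l₀-value : hom 1 l₀ g h ≈ᴾ C Δ *ᴾ X ^ D
        l₀-value = R.trans (hom-lin e (F.- b) g h) (R.trans
          (R.+-cong (R.*-congˡ {C e} g≈) (R.*-congˡ {C (F.- b)} h≈))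
          (R.trans (solve 5 (λ a b c e x → e :* (a :* x :+ b :* con (+ 1)) :+ (:- b) :* (c :* x :+ e :* con (+ 1)) := (a :* e :- b :* c) :* x)
            R.refl (C a) (C b) (C c₁) (C e) (X ^ D)) (R.*-congʳ {X ^ D} (R.sym CΔ))))

        l₁-value : hom 1 l₁ g h ≈ᴾ C Δ
        l₁-value = R.trans (hom-lin (F.- c₁) a g h) (R.trans
          (R.+-cong (R.*-congˡ {C (F.- c₁)} g≈) (R.*-congˡ {C a} h≈))
          (R.trans (solve 5 (λ a b c e x → (:- c) :* (a :* x :+ b :* con (+ 1)) :+ a :* (c :* x :+ e :* con (+ 1)) := a :* e :- b :* c)
            R.refl (C a) (C b) (C c₁) (C e) (X ^ D)) (R.sym CΔ)))

        l₀⊥l₁ : Comaximal l₀ l₁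
        l₀⊥l₁ = let (d , dΔ≈1) = inverse Δ Δ≉0 in bezout (C d *ᴾ C c₁) (C d *ᴾ C e) (begin
          C d *ᴾ C c₁ *ᴾ l₀ +ᴾ C d *ᴾ C e *ᴾ l₁
            ≈⟨ solve 6 (λ d a b c e x → d :* c :* (e :* x :+ (:- b) :* con (+ 1)) :+ d :* e :* ((:- c) :* x :+ a :* con (+ 1)) := d :* (a :* e :- b :* c))
                 R.refl (C d) (C a) (C b) (C c₁) (C e) X ⟩
          C d *ᴾ (C a *ᴾ C e -ᴾ C b *ᴾ C c₁)  ≈⟨ R.*-congˡ {C d} CΔ ⟨
          C d *ᴾ C Δ                          ≈⟨ C-* d Δ ⟨
          C (d F.* Δ)                         ≈⟨ C-cong dΔ≈1 ⟩
          C 1# ∎)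

        -- Raising a relation to the power D and using l₀(g, h) = Δ X^D, l₁(g, h) = Δ removes X.
        linear-relation : ∀ n {k P Q} → DegLe P k → DegLe Q k → X ^ n *ᴾ hom k P g h ≈ᴾ hom k Q g h →
          l₀ ^ n *ᴾ P ^ D ≈ᴾ l₁ ^ n *ᴾ Q ^ D
        linear-relation n {k} {P} {Q} hP hQ rel = x-y≈0⇒x≈y _ _ (form-faithful comaximal degree-D 1≤D
            (degLe-+ (both lin-deg hP) (degLe-- (both lin-deg hQ)))
            (R.trans (hom-+ K (l₀ ^ n *ᴾ P ^ D) (-ᴾ (l₁ ^ n *ᴾ Q ^ D)) g h)
            (R.trans (R.+-cong (hom-both l₀ P lin-deg hP)
              (R.trans (hom-- K (l₁ ^ n *ᴾ Q ^ D) g h) (R.-‿cong (hom-both l₁ Q lin-deg hQ))))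
            (x≈y⇒x-y≈0 equal))))
          where
          K = n ℕ.* 1 ℕ.+ D ℕ.* k
          both : ∀ {l P} → DegLe l 1 → DegLe P k → DegLe (l ^ n *ᴾ P ^ D) K
          both hl hP = degLe-* (degLe-^ n hl) (degLe-^ D hP)
          hom-both : ∀ l P → DegLe l 1 → DegLe P k → hom K (l ^ n *ᴾ P ^ D) g h ≈ᴾ hom 1 l g h ^ n *ᴾ hom k P g h ^ D
          hom-both l P hl hP = R.trans (hom-* (n ℕ.* 1) (D ℕ.* k) (l ^ n) (P ^ D) g h (degLe-^ n hl) (degLe-^ D hP))
            (R.*-cong (hom-^ 1 l n g h hl) (hom-^ k P D g h hP))
          equal : hom 1 l₀ g h ^ n *ᴾ hom k P g h ^ D ≈ᴾ hom 1 l₁ g h ^ n *ᴾ hom k Q g h ^ D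
          equal = begin
            hom 1 l₀ g h ^ n *ᴾ hom k P g h ^ D
              ≈⟨ R.*-congʳ {hom k P g h ^ D} (R.trans (^-congˡ n l₀-value) (R.trans (^-distrib-* (C Δ) (X ^ D) n) (R.*-congˡ {C Δ ^ n} (^-swap X n)))) ⟩
            C Δ ^ n *ᴾ (X ^ n) ^ D *ᴾ hom k P g h ^ D
              ≈⟨ R.*-assoc (C Δ ^ n) ((X ^ n) ^ D) (hom k P g h ^ D) ⟩
            C Δ ^ n *ᴾ ((X ^ n) ^ D *ᴾ hom k P g h ^ D)
              ≈⟨ R.*-cong (^-congˡ n (R.sym l₁-value)) (R.trans (R.sym (^-distrib-* (X ^ n) (hom k P g h) D)) (^-congˡ D rel)) ⟩
            hom 1 l₁ g h ^ n *ᴾ hom k Q g h ^ D ∎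

      split-linear : ∀ D′ s → D ≡ D′ ℕ.* s → 2 ≤ D′ → 1 ≤ s → ¬ D′ ·ᶠ 1# ≈ 0# →
        ∀ u v {l P Q} n → 1 ≤ n → ¬ u ≈ 0# → ¬ v ≈ 0# → Comaximal (lin u v X (C 1#)) l →
        ¬ P ≈ᴾ [] → ¬ Q ≈ᴾ [] → IsSubst D P → IsSubst D Q →
        lin u v X (C 1#) ^ n *ᴾ P ≈ᴾ l ^ n *ᴾ Q → ⊥
      split-linear D′ s ≡.refl 2≤D′ 1≤s D′≉0 u v {l} {P} {Q} n 1≤n u≉0 v≉0 lin⊥l P≉0 Q≉0 (A , P≈) (B , Q≈) eq =
        no-isolated-root D′ s 2≤D′ 1≤s D′≉0 {y} {l} {C (u ^ᶠ n) *ᴾ A} {B} n 1≤n y≉0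
          (comax-∣ˡ (C u , R.sym lin≈) lin⊥l)
          (*-≉0 (hasDeg-≉0 (hasDeg-C (^-≉0ᶠ n u≉0))) (nonzero P≈ P≉0)) (nonzero Q≈ Q≉0)
          (begin
            (X -ᴾ C y) ^ n *ᴾ substᴾ D₀ (C (u ^ᶠ n) *ᴾ A)
              ≈⟨ R.*-congˡ {(X -ᴾ C y) ^ n} (R.trans (Sub.ev-* (C (u ^ᶠ n)) A (X ^ D₀))
                   (R.*-cong (R.trans (Sub.ev-C (u ^ᶠ n) (X ^ D₀)) (C-^ u n)) (R.sym P≈))) ⟩
            (X -ᴾ C y) ^ n *ᴾ (C u ^ n *ᴾ P)
              ≈⟨ solve 3 (λ x u P → x :* (u :* P) := u :* x :* P) R.refl ((X -ᴾ C y) ^ n) (C u ^ n) P ⟩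
            C u ^ n *ᴾ (X -ᴾ C y) ^ n *ᴾ P
              ≈⟨ R.*-congʳ {P} (R.trans (R.sym (^-distrib-* (C u) (X -ᴾ C y) n)) (^-congˡ n (R.sym lin≈))) ⟩
            lin u v X (C 1#) ^ n *ᴾ P  ≈⟨ eq ⟩
            l ^ n *ᴾ Q                 ≈⟨ R.*-congˡ {l ^ n} Q≈ ⟩
            l ^ n *ᴾ substᴾ D₀ B       ∎)
        where
        D₀ = D′ ℕ.* s
        u⁻¹ = proj₁ (inverse u u≉0)
        u⁻¹u = proj₂ (inverse u u≉0)
        y = F.- (u⁻¹ F.* v)
        u*y : u F.* y ≈ F.- v
        u*y = F.trans (solveᶠ 3 (λ u i v → u :*ᶠ (:-ᶠ (i :*ᶠ v)) :=ᶠ :-ᶠ (i :*ᶠ u :*ᶠ v)) F.refl u u⁻¹ v)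
          (F.-‿cong (F.trans (F.*-congʳ u⁻¹u) (F.*-identityˡ v)))
        y≉0 : ¬ y ≈ 0#
        y≉0 e = v≉0 (F.trans (solveᶠ 1 (λ v → v :=ᶠ :-ᶠ (:-ᶠ v)) F.refl v) (F.trans (F.-‿cong (F.trans (F.sym u*y) (F.trans (F.*-congˡ e) (F.zeroʳ u))))
          (RingProperties.-0#≈0# F.ring)))
        lin≈ : lin u v X (C 1#) ≈ᴾ C u *ᴾ (X -ᴾ C y)
        lin≈ = R.sym (begin
          C u *ᴾ (X -ᴾ C y)        ≈⟨ solve 3 (λ u x y → u :* (x :- y) := u :* x :- u :* y) R.refl (C u) X (C y) ⟩
          C u *ᴾ X -ᴾ C u *ᴾ C y   ≈⟨ R.+-congˡ {C u *ᴾ X} (R.-‿cong (R.trans (R.sym (C-* u y)) (C-cong u*y))) ⟩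
          C u *ᴾ X -ᴾ C (F.- v)    ≈⟨ solve 2 (λ x v → x :- (:- v) := x :+ v :* con (+ 1)) R.refl (C u *ᴾ X) (C v) ⟩
          lin u v X (C 1#)         ∎)
        nonzero : ∀ {P A} → P ≈ᴾ substᴾ D₀ A → ¬ P ≈ᴾ [] → ¬ A ≈ᴾ []
        nonzero P≈ P≉0 A≈0 = P≉0 (R.trans P≈ (Sub.ev-cong (X ^ D₀) A≈0))

      no-Möbius-relation : ∀ {p} → Characteristic.HasChar FR p → 2 ≤ p → ¬ Excluded → ∀ (m : Möbius g h D) n l → 1 ≤ n →
        l₀ m ^ n *ᴾ product 0 l ^ D ≈ᴾ l₁ m ^ n *ᴾ product 0 (flip l) ^ D → ⊥
      no-Möbius-relation {p} hp 2≤p ¬ex m n l 1≤n eq = go (Characteristic.tame-or-power FR hp 2≤p D 1≤D)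
        where
        open Möbius m
        P^D≉0 = ^-≉0 D (product-≉0 0 l)
        Q^D≉0 = ^-≉0 D (product-≉0 0 (flip l))
        -‿≉0 : ∀ {x} → ¬ x ≈ 0# → ¬ F.- x ≈ 0#
        -‿≉0 {x} x≉0 z = x≉0 (F.trans (solveᶠ 1 (λ x → x :=ᶠ :-ᶠ (:-ᶠ x)) F.refl x) (F.trans (F.-‿cong z) (RingProperties.-0#≈0# F.ring)))
        Δ-zero : ∀ {x y} → x ≈ 0# → y ≈ 0# → x F.- y ≈ 0#
        Δ-zero x≈0 y≈0 = F.trans (F.+-cong x≈0 (F.-‿cong y≈0)) (F.-‿inverseʳ 0#)

        go : Characteristic.PrimePowerOrTame FR p D → ⊥
        go (inj₂ (l , D≡)) = ¬ex (wild m {l = l} hp D≡)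
        go (inj₁ (D′ , s , D≡ , 2≤D′ , 1≤s , D′≉0)) = decide (a ≟ 0#) (b ≟ 0#) (c₁ ≟ 0#) (e ≟ 0#)
          where
          decide : Dec (a ≈ 0#) → Dec (b ≈ 0#) → Dec (c₁ ≈ 0#) → Dec (e ≈ 0#) → ⊥
          decide _ (no b≉0) _ (no e≉0) = split-linear D′ s D≡ 2≤D′ 1≤s D′≉0 e (F.- b) n 1≤n e≉0 (-‿≉0 b≉0) (l₀⊥l₁ m)
            P^D≉0 Q^D≉0 (isSubst-product m 0 l) (isSubst-product m 0 (flip l)) eq
          decide (no a≉0) _ (no c≉0) _ = split-linear D′ s D≡ 2≤D′ 1≤s D′≉0 (F.- c₁) a n 1≤n (-‿≉0 c≉0) a≉0 (comax-sym (l₀⊥l₁ m))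
            Q^D≉0 P^D≉0 (isSubst-product m 0 (flip l)) (isSubst-product m 0 l) (R.sym eq)
          decide _ (yes b≈0) (yes c≈0) _ = ¬ex (diagonal m b≈0 c≈0)
          decide (yes a≈0) _ _ (yes e≈0) = ¬ex (antidiagonal m a≈0 e≈0)
          decide (yes a≈0) (yes b≈0) _ _ = Δ≉0 (Δ-zero (F.trans (F.*-congʳ a≈0) (F.zeroˡ e)) (F.trans (F.*-congʳ b≈0) (F.zeroˡ c₁)))
          decide _ _ (yes c≈0) (yes e≈0) = Δ≉0 (Δ-zero (F.trans (F.*-congˡ e≈0) (F.zeroʳ a)) (F.trans (F.*-congˡ c≈0) (F.zeroʳ b)))

      no-relation : ∀ {p} → Characteristic.HasChar FR p → 2 ≤ p → ¬ Excluded → ∀ n l → 1 ≤ n →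
        X ^ n *ᴾ hom (weight 0 l) (product 0 l) g h ≈ᴾ hom (weight 0 l) (product 0 (flip l)) g h → ⊥
      no-relation {p} hp 2≤p ¬ex n l 1≤n rel = with-form (relation⇒Möbius comaximal g-deg h-deg degree-D 1≤D record
          { a = n ; k = weight 0 l ; P = product 0 l ; Q = product 0 (flip l) ; 1≤a = 1≤n
          ; P-deg = product-deg 0 l ; Q-deg = Q-deg
          ; P≉0 = product-≉0 0 l ; Q≉0 = product-≉0 0 (flip l) ; relation = rel })
        where
        Q-deg : DegLe (product 0 (flip l)) (weight 0 l)
        Q-deg = ≡.subst (DegLe (product 0 (flip l))) (weight-flip 0 l) (product-deg 0 (flip l))
        with-form : Möbius g h D → ⊥
        with-form m = no-Möbius-relation hp 2≤p ¬ex m n l 1≤n (linear-relation m n (product-deg 0 l) Q-deg rel)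

      independence : ∀ {p} → Characteristic.HasChar FR p → 2 ≤ p → ¬ Excluded → ∀ l →
        product 0 l ≈ᴾ product 0 (flip l) → All (λ ab → proj₁ ab ≡ proj₂ ab) l
      independence hp 2≤p ¬ex []            eq = []
      independence hp 2≤p ¬ex ((a , b) ∷ l) eq = compare (ℕₚ.<-cmp a b)
        where
        w = weight 0 l
        P Q : Poly
        P = hom w (product 0 l) g h
        Q = hom w (product 0 (flip l)) g h
        eq′ : X ^ a *ᴾ P ≈ᴾ X ^ b *ᴾ Q
        eq′ = R.trans (R.sym (product-step a b l)) (R.trans eq (R.trans (product-step b a (flip l))
          (R.*-congˡ {X ^ b} (R.reflexive (≡.cong (λ w → hom w (product 0 (flip l)) g h) (weight-flip 0 l))))))
        X^≉0 : ∀ n → ¬ X ^ n ≈ᴾ []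
        X^≉0 n = ^-≉0 n (hasDeg-≉0 hasDeg-X)
        flip-flip : ∀ l → flip (flip l) ≡ l
        flip-flip []      = ≡.refl
        flip-flip (x ∷ l) = ≡.cong (x ∷_) (flip-flip l)

        cancel-X : ∀ {a b P Q} e → a ℕ.+ e ≡ b → X ^ a *ᴾ P ≈ᴾ X ^ b *ᴾ Q → P ≈ᴾ X ^ e *ᴾ Q
        cancel-X {a} {b} {P} {Q} e a+e≡b eq = *-cancelˡ (X ^ a) (X^≉0 a) (R.trans eq
          (R.trans (R.*-congʳ {Q} (R.trans (R.reflexive (≡.cong (X ^_) (≡.sym a+e≡b))) (^-homo-* X a e))) (R.*-assoc (X ^ a) (X ^ e) Q)))

        compare : Tri (a < b) (a ≡ b) (b < a) → All (λ ab → proj₁ ab ≡ proj₂ ab) ((a , b) ∷ l)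
        compare (tri≈ _ ≡.refl _) = ≡.refl ∷ independence hp 2≤p ¬ex l
          (x-y≈0⇒x≈y _ _ (form-faithful comaximal degree-D 1≤D
            (degLe-+ (product-deg 0 l) (degLe-- (≡.subst (DegLe (product 0 (flip l))) (weight-flip 0 l) (product-deg 0 (flip l)))))
            (R.trans (hom-+ w (product 0 l) (-ᴾ product 0 (flip l)) g h) (R.trans (R.+-congˡ {P} (hom-- w (product 0 (flip l)) g h))
              (x≈y⇒x-y≈0 (*-cancelˡ (X ^ a) (X^≉0 a) eq′))))))
        compare (tri< a<b _ _) = case ℕₚ.m≤n⇒∃[o]m+o≡n a<b of λ { (e , eqⁿ) →
          ⊥-elim (no-relation hp 2≤p ¬ex (suc e) (flip l) (s≤s z≤n)
            (≡.subst₂ (λ w l′ → X ^ suc e *ᴾ hom w (product 0 (flip l)) g h ≈ᴾ hom w (product 0 l′) g h)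
              (≡.sym (weight-flip 0 l)) (≡.sym (flip-flip l))
              (R.sym (cancel-X (suc e) (≡.trans (ℕₚ.+-suc a e) eqⁿ) eq′)))) }
        compare (tri> _ _ b<a) = case ℕₚ.m≤n⇒∃[o]m+o≡n b<a of λ { (e , eqⁿ) →
          ⊥-elim (no-relation hp 2≤p ¬ex (suc e) l (s≤s z≤n)
            (R.sym (cancel-X (suc e) (≡.trans (ℕₚ.+-suc b e) eqⁿ) (R.sym eq′)))) }

open BinomialCoefficients using (prime∣binomial)

module Frobenius {c ℓ : Level} (R : CommutativeRing c ℓ) (p : ℕ) (p-prime : Prime p)
  (p·1≈0 : CommutativeRing._≈_ R (RingTheory._·_ R p (CommutativeRing.1# R)) (CommutativeRing.0# R)) where
  open CommutativeRing R hiding (zero)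
  open RingTheory R
  open SetoidReasoning setoid
  open import Data.Nat.Combinatorics using (_C_; nCn≡1)
  open import Data.Vec.Functional using (init; last)
  private module S = Sums +-commutativeMonoid

  private
    binomial-sum : ∀ n x y → p ≡ suc n → (x + y) ^ suc n ≈ x ^ suc n + y ^ suc n
    binomial-sum n x y ≡.refl = begin
        (x + y) ^ suc n                      ≈⟨ Binomial.theorem commutativeSemiring (suc n) x y ⟩
        term zero + S.sum (λ i → term (suc i)) ≈⟨ +-cong first (trans (S.sum-init-last (λ i → term (suc i))) (+-cong middle top)) ⟩
        y ^ suc n + (0# + x ^ suc n)         ≈⟨ trans (+-congˡ (+-identityˡ _)) (+-comm _ _) ⟩
        x ^ suc n + y ^ suc n                ∎
      where
      term : Fin (suc (suc n)) → Carrier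
      term = Binomial.binomialTerm commutativeSemiring x y (suc n)
      first : term zero ≈ y ^ suc n
      first = trans (+-identityʳ _) (*-identityˡ _)
      vanish : ∀ i → term (suc (Fin.inject₁ i)) ≈ 0#
      vanish i with prime∣binomial p-prime (suc (Fin.toℕ (Fin.inject₁ i))) (s≤s z≤n)
                      (s≤s (≡.subst (_< n) (≡.sym (Finₚ.toℕ-inject₁ i)) (Finₚ.toℕ<n i)))
      ... | divides k eq = trans (·≈·1* (suc n C suc (Fin.toℕ (Fin.inject₁ i))) _) (trans (*-congʳ (trans (reflexive (≡.cong (_· 1#) eq))
              (Characteristic.·-*-zero R k p·1≈0))) (zeroˡ _))
      middle : S.sum (init (λ i → term (suc i))) ≈ 0#
      middle = trans (S.sum-cong-≋ vanish) (S.sum-replicate-zero n)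
      top : last (λ i → term (suc i)) ≈ x ^ suc n
      top = begin
        (suc n C suc (Fin.toℕ (Fin.fromℕ n))) · (x ^ suc (Fin.toℕ (Fin.fromℕ n)) * y ^ (n ℕ.∸ Fin.toℕ (Fin.fromℕ n)))
          ≡⟨ ≡.cong (λ k → (suc n C suc k) · (x ^ suc k * y ^ (n ℕ.∸ k))) (Finₚ.toℕ-fromℕ n) ⟩
        (suc n C suc n) · (x ^ suc n * y ^ (n ℕ.∸ n))
          ≡⟨ ≡.cong₂ (λ a b → a · (x ^ suc n * y ^ b)) (nCn≡1 (suc n)) (ℕₚ.n∸n≡0 n) ⟩
        x ^ suc n * 1# + 0#
          ≈⟨ trans (+-identityʳ _) (*-identityʳ _) ⟩
        x ^ suc n ∎

    suc-pred : ∀ {p} → Prime p → ∃[ n ] p ≡ suc n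
    suc-pred {suc n} _ = n , ≡.refl

  frobenius-+ : ∀ x y → (x + y) ^ p ≈ x ^ p + y ^ p
  frobenius-+ x y = let (n , eq) = suc-pred p-prime in
    ≡.subst (λ k → (x + y) ^ k ≈ x ^ k + y ^ k) (≡.sym eq) (binomial-sum n x y eq)

  frobenius^-+ : ∀ l x y → (x + y) ^ (p ℕ.^ l) ≈ x ^ (p ℕ.^ l) + y ^ (p ℕ.^ l)
  frobenius^-+ zero    x y = trans (*-identityʳ _) (sym (+-cong (*-identityʳ x) (*-identityʳ y)))
  frobenius^-+ (suc l) x y = begin
    (x + y) ^ (p ℕ.* p ℕ.^ l)                 ≈⟨ ^-assocʳ (x + y) p (p ℕ.^ l) ⟨
    ((x + y) ^ p) ^ (p ℕ.^ l)                 ≈⟨ ^-congˡ (p ℕ.^ l) (frobenius-+ x y) ⟩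
    (x ^ p + y ^ p) ^ (p ℕ.^ l)               ≈⟨ frobenius^-+ l (x ^ p) (y ^ p) ⟩
    (x ^ p) ^ (p ℕ.^ l) + (y ^ p) ^ (p ℕ.^ l) ≈⟨ +-cong (^-assocʳ x p (p ℕ.^ l)) (^-assocʳ y p (p ℕ.^ l)) ⟩
    x ^ (p ℕ.* p ℕ.^ l) + y ^ (p ℕ.* p ℕ.^ l) ∎

  0^p^ : ∀ l → 0# ^ (p ℕ.^ l) ≈ 0#
  0^p^ l = trans (sym (trans (+-congˡ (-‿inverseʳ _)) (+-identityʳ _)))
    (trans (sym (+-assoc _ _ _)) (trans (+-congʳ (trans (sym (frobenius^-+ l 0# 0#)) (^-congˡ (p ℕ.^ l) (+-identityˡ 0#)))) (-‿inverseʳ _)))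

module FiniteField {c ℓ₁ ℓ₂ : Level} (F : HeytingField c ℓ₁ ℓ₂) (q : ℕ) (card : HasCardinality F q) where
  open HeytingField F hiding (zero)
  open HeytingProperties heytingCommutativeRing using (x-0≈x; invertibleˡ⇒#)
  private FR = fieldRing F
  open CommutativeRing FR using (*-commutativeMonoid)
  open Inverse card using (to; from; to-cong; from-cong; strictlyInverseʳ; strictlyInverseˡ)
  open RingTheory FR using (_^_; ^-congˡ; solve; _:=_; _:*_)
  open SetoidReasoning setoid
  open import Data.Vec.Functional using (replicate)
  private module Π = Sums *-commutativeMonoid

  _≟ᶠ_ : ∀ x y → Dec (x ≈ y)
  x ≟ᶠ y with to x Finₚ.≟ to y
  ... | yes e = yes (trans (sym (strictlyInverseʳ x)) (trans (from-cong e) (strictlyInverseʳ y)))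
  ... | no ¬e = no λ x≈y → ¬e (to-cong x≈y)

  discrete : Discrete F
  discrete = record { _≟_ = _≟ᶠ_ ; apart = apart }
    where
    apart : ∀ {x} → ¬ x ≈ 0# → x # 0#
    apart {x} x≉0 with Finₚ.any? (λ i → (from i * x) ≟ᶠ 1#)
    ... | yes (i , e) = invertibleˡ⇒# (from i , trans (*-congˡ (x-0≈x x)) e)
    ... | no none = ⊥-elim (x≉0 (proj₁ (tight x 0#) λ x#0 → let (y , e , _) = #⇒invertible x#0 in
            none (to y , trans (*-congʳ (strictlyInverseʳ y)) (trans (*-congˡ (sym (x-0≈x x))) e))))

  open DiscreteField F discrete using (domain; inverse)
  open DomainTheory FR domain using (*-cancelˡ; *-≉0)
  open RingTheory.IsDomain domain using (1≉0)

  -- Multiplication by a permutes the nonzero elements, so their product is multiplied by a^(q−1).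
  fermat : ∀ {a n} → q ≡ suc n → ¬ a ≈ 0# → a ^ n ≈ 1#
  fermat {a} {n} ≡.refl a≉0 = trans (sym (Π.sum-replicate n)) (trans (sym removed) ∏t≈1)
    where
    a⁻¹ = proj₁ (inverse a a≉0)
    a⁻¹a = proj₂ (inverse a a≉0)
    u t : Fin (suc n) → Carrier
    u i with from i ≟ᶠ 0#
    ... | yes _ = 1#
    ... | no _  = from i
    t i with from i ≟ᶠ 0#
    ... | yes _ = 1#
    ... | no _  = a

    u≉0 : ∀ i → ¬ u i ≈ 0#
    u≉0 i with from i ≟ᶠ 0#
    ... | yes _ = 1≉0
    ... | no x≉0 = x≉0

    ∏≉0 : ∀ n (f : Fin n → Carrier) → (∀ i → ¬ f i ≈ 0#) → ¬ Π.sum f ≈ 0#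
    ∏≉0 zero    f h = 1≉0
    ∏≉0 (suc n) f h = *-≉0 (h zero) (∏≉0 n (λ i → f (suc i)) (λ i → h (suc i)))

    inverse-pair : ∀ x y → x * y ≈ 1# → ∀ i → to (x * from (to (y * from i))) ≡ i
    inverse-pair x y xy≈1 i = ≡.trans (to-cong (begin
      x * from (to (y * from i))  ≈⟨ *-congˡ (strictlyInverseʳ _) ⟩
      x * (y * from i)            ≈⟨ *-assoc x y _ ⟨
      x * y * from i              ≈⟨ *-congʳ xy≈1 ⟩
      1# * from i                 ≈⟨ *-identityˡ _ ⟩
      from i                      ∎)) (strictlyInverseˡ i)

    π = permutation (λ i → to (a * from i)) (λ i → to (a⁻¹ * from i))
          (inverse-pair a a⁻¹ (trans (*-comm a a⁻¹) a⁻¹a)) (inverse-pair a⁻¹ a a⁻¹a)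

    u∘π : ∀ i → u (to (a * from i)) ≈ t i * u i
    u∘π i with from i ≟ᶠ 0# | from (to (a * from i)) ≟ᶠ 0#
    ... | yes _   | yes _  = sym (*-identityˡ 1#)
    ... | no _    | no _   = strictlyInverseʳ _
    ... | yes x≈0 | no ax≉0 = ⊥-elim (ax≉0 (trans (strictlyInverseʳ _) (trans (*-congˡ x≈0) (zeroʳ a))))
    ... | no x≉0  | yes ax≈0 = ⊥-elim (*-≉0 a≉0 x≉0 (trans (sym (strictlyInverseʳ _)) ax≈0))

    ∏t≈1 : Π.sum t ≈ 1#
    ∏t≈1 = *-cancelˡ (Π.sum u) (∏≉0 (suc n) u u≉0) (begin
      Π.sum u * Π.sum t                     ≈⟨ *-comm _ _ ⟩
      Π.sum t * Π.sum u                     ≈⟨ Π.∑-distrib-+ t u ⟨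
      Π.sum (λ i → t i * u i)               ≈⟨ Π.sum-cong-≋ u∘π ⟨
      Π.sum (λ i → u (to (a * from i)))     ≈⟨ Π.sum-permute u π ⟨
      Π.sum u                               ≈⟨ *-identityʳ _ ⟨
      Π.sum u * 1#                          ∎)

    i₀ = to 0#
    t₀ : t i₀ ≈ 1#
    t₀ with from i₀ ≟ᶠ 0#
    ... | yes _ = refl
    ... | no h  = ⊥-elim (h (strictlyInverseʳ 0#))

    t-other : ∀ i → ¬ i₀ ≡ i → t i ≈ a
    t-other i i≢ with from i ≟ᶠ 0#
    ... | yes e = ⊥-elim (i≢ (≡.trans (to-cong (sym e)) (strictlyInverseˡ i)))
    ... | no _  = refl

    removed : Π.sum t ≈ Π.sum {n} (replicate n a)
    removed = trans (Π.sum-remove {i = i₀} t) (trans (*-congʳ t₀) (trans (*-identityˡ _)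
      (Π.sum-cong-≋ (λ j → t-other (Fin.punchIn i₀ j) (λ e → Finₚ.punchInᵢ≢i i₀ j (≡.sym e))))))

  private
    nonempty : ∃[ n ] q ≡ suc n
    nonempty = go q (to 0#)
      where
      go : ∀ q → Fin q → ∃[ n ] q ≡ suc n
      go (suc n) _ = n , ≡.refl

  fermat-q : ∀ a → a ^ q ≈ a
  fermat-q a with nonempty | a ≟ᶠ 0#
  ... | n , eq | no a≉0  = trans (reflexive (≡.cong (a ^_) eq)) (trans (*-congˡ (fermat eq a≉0)) (*-identityʳ a))
  ... | n , eq | yes a≈0 = trans (reflexive (≡.cong (a ^_) eq)) (trans (*-congʳ a≈0) (trans (zeroˡ _) (sym a≈0)))

  fermat-q^ : ∀ a e → a ^ (q ℕ.^ e) ≈ a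
  fermat-q^ a zero    = *-identityʳ a
  fermat-q^ a (suc e) = trans (sym (RingTheory.^-assocʳ FR a q (q ℕ.^ e))) (trans (^-congˡ (q ℕ.^ e) (fermat-q a)) (fermat-q^ a e))

module RootRelations {c ℓ₁ ℓ₂ c′ ℓ₁′ ℓ₂′ : Level}
  (F : HeytingField c ℓ₁ ℓ₂) (K : HeytingField c′ ℓ₁′ ℓ₂′)
  (ι : HeytingField.Carrier F → HeytingField.Carrier K) (ι-hom : IsFieldHom F K ι)
  (p q : ℕ) (p-prime : Prime p) (2≤p : 2 ≤ p) (card : HasCardinality F q) (char : Characteristic.HasChar (fieldRing F) p)
  (g h : Polynomials.Poly F) (D : ℕ)
  where
  private
    KR = fieldRing K
    FR = fieldRing F
    module F = CommutativeRing FR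
  open CommutativeRing KR hiding (zero)
  open RingTheory KR
  open SetoidReasoning setoid
  open RingMorphisms.IsRingHomomorphism ι-hom using (⟦⟧-cong; +-homo; *-homo; 0#-homo; 1#-homo)
  open FiniteField F q card using (discrete; fermat-q^)
  open DiscretePolynomials.Independence F discrete g h D using (iterNum; iterDen; product; weight; flip; NonConstant; Excluded; independence; product-deg; iterNum-deg; iterDen-deg; weight-flip)
  open DiscretePolynomials F discrete using (HasDeg; hasDeg; hasDeg-unique; fromHasDegree; toHasDegree; zero?; degree; hasDeg-≤; DegLe; degLe-+; degLe--; degLe-mono; hom; Coprime)
  open PolynomialTheory F using (polyRing; C; X; at; _≈ᴾ_; coeffwise; module R; monomial≈) 
  open Evaluation F KR ι ι-hom
  open Homogenization F KR ι ι-hom using () renaming (hom to homᴷ; hom-scale to homᴷ-scale; hom-congᵛ to homᴷ-congᵛ)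
  open PolynomialForms F using (ev-hom)
  open Polynomials F using (Poly; _*ᴾ_; _-ᴾ_; -ᴾ_; monomial; HasDegree)
  open Extension F K ι ι-hom using (extendPoly; IsRootIn; HasDegreeOver)

  open RingHomomorphism FR KR ι ι-hom renaming (φ-^ to ι-^; φ-·1 to ι-·)

  private module Fr = Frobenius KR p p-prime (trans (sym (ι-· p)) (trans (⟦⟧-cong (proj₁ (proj₂ char))) 0#-homo))

  root⇒ev : ∀ P {α} → IsRootIn P α → ev P α ≈ 0#
  root⇒ev P {α} e = trans (reflexive (≡.sym (same P))) e
    where
    same : ∀ P → Polynomials.eval K (extendPoly P) α ≡ ev P α
    same []      = ≡.refl
    same (a ∷ P) = ≡.cong (λ z → ι a + α * z) (same P)

  ev⇒root : ∀ P {α} → ev P α ≈ 0# → IsRootIn P α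
  ev⇒root P {α} e = trans (reflexive (same P)) e
    where
    same : ∀ P → Polynomials.eval K (extendPoly P) α ≡ ev P α
    same []      = ≡.refl
    same (a ∷ P) = ≡.cong (λ z → ι a + α * z) (same P)

  module _ (r e : ℕ) (q≡ : q ≡ p ℕ.^ r) where
    m : ℕ
    m = q ℕ.^ e

    private
      m≡ : m ≡ p ℕ.^ (r ℕ.* e)
      m≡ = ≡.trans (≡.cong (ℕ._^ e) q≡) (ℕₚ.^-*-assoc p r e)

    ι-fixed : ∀ a → ι a ^ m ≈ ι a
    ι-fixed a = trans (sym (ι-^ a m)) (⟦⟧-cong (fermat-q^ a e))

    ev-frobenius : ∀ P x → ev P (x ^ m) ≈ ev P x ^ m
    ev-frobenius []      x = sym (≡.subst (λ k → 0# ^ k ≈ 0#) (≡.sym m≡) (Fr.0^p^ (r ℕ.* e)))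
    ev-frobenius (a ∷ P) x = begin
      ι a + x ^ m * ev P (x ^ m)  ≈⟨ +-cong (sym (ι-fixed a)) (*-congˡ (ev-frobenius P x)) ⟩
      ι a ^ m + x ^ m * ev P x ^ m ≈⟨ +-congˡ (^-distrib-* x (ev P x) m) ⟨
      ι a ^ m + (x * ev P x) ^ m  ≈⟨ ≡.subst (λ k → (ι a + x * ev P x) ^ k ≈ ι a ^ k + (x * ev P x) ^ k) (≡.sym m≡) (Fr.frobenius^-+ (r ℕ.* e) (ι a) (x * ev P x)) ⟨
      ev (a ∷ P) x ^ m            ∎

    module _ (nc : NonConstant) (¬ex : ¬ Excluded nc) {n : ℕ} {α : Carrier}
      (α-degree : HasDegreeOver α n) (α-root : IsRootIn (monomial F.1# m *ᴾ h -ᴾ g) α) where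

      small-root⇒0 : ∀ {P k} → DegLe P k → k < n → ev P α ≈ 0# → P ≈ᴾ []
      small-root⇒0 {P} {k} P≤k k<n e with zero? P
      ... | yes P≈0 = P≈0
      ... | no P≉0  = let (μ , (n′ , μ-deg′ , _ , _ , minimal) , μ-deg) = α-degree
                          (j , P-deg) = degree P P≉0
                          n≡n′ = hasDeg-unique {μ} (fromHasDegree μ-deg) (fromHasDegree μ-deg′)
        in ⊥-elim (ℕₚ.<⇒≱ k<n (ℕₚ.≤-trans (ℕₚ.≤-reflexive n≡n′)
             (ℕₚ.≤-trans (minimal P j (toHasDegree {P} P-deg) (ev⇒root P e)) (hasDeg-≤ P-deg P≤k))))

      g-value : ev g α ≈ α ^ m * ev h α
      g-value = sym (x-y≈0⇒x≈y _ _ (begin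
        α ^ m * ev h α - ev g α
          ≈⟨ +-cong (*-congʳ monomial-value) (ev-- g α) ⟨
        ev (monomial F.1# m) α * ev h α + ev (-ᴾ g) α
          ≈⟨ +-congʳ (ev-* (monomial F.1# m) h α) ⟨
        ev (monomial F.1# m *ᴾ h) α + ev (-ᴾ g) α
          ≈⟨ ev-+ (monomial F.1# m *ᴾ h) (-ᴾ g) α ⟨
        ev (monomial F.1# m *ᴾ h -ᴾ g) α
          ≈⟨ root⇒ev (monomial F.1# m *ᴾ h -ᴾ g) α-root ⟩
        0# ∎))
        where
        monomial-value : ev (monomial F.1# m) α ≈ α ^ m
        monomial-value = trans (ev-cong α (R.trans (monomial≈ F.1# m) (R.*-identityˡ _)))
          (trans (ev-^ X m α) (^-congˡ m (ev-X α)))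

      step-value : ∀ i P → DegLe P (D ℕ.^ i) → ev (hom (D ℕ.^ i) P g h) α ≈ ev h α ^ (D ℕ.^ i) * ev P α ^ m
      step-value i P P-deg = begin
        ev (hom (D ℕ.^ i) P g h) α                    ≈⟨ ev-hom KR ι ι-hom (D ℕ.^ i) P g h α ⟩
        homᴷ (D ℕ.^ i) P (ev g α) (ev h α)            ≈⟨ homᴷ-congᵛ (D ℕ.^ i) P g-value refl ⟩
        homᴷ (D ℕ.^ i) P (α ^ m * ev h α) (ev h α)    ≈⟨ homᴷ-scale (D ℕ.^ i) P (α ^ m) (ev h α) P-deg ⟩
        ev h α ^ (D ℕ.^ i) * ev P (α ^ m)             ≈⟨ *-congˡ (ev-frobenius P α) ⟩
        ev h α ^ (D ℕ.^ i) * ev P α ^ m               ∎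

      iter-value : ∀ i → ev (iterNum i) α ≈ α ^ (m ℕ.^ i) * ev (iterDen i) α
      iter-value zero    = trans (ev-X α) (sym (trans (*-cong (*-identityʳ α) (trans (ev-C F.1# α) 1#-homo)) (*-identityʳ α)))
      iter-value (suc i) = begin
        ev (iterNum (suc i)) α
          ≈⟨ step-value i (iterNum i) (iterNum-deg nc i) ⟩
        H * ev (iterNum i) α ^ m
          ≈⟨ *-congˡ (trans (^-congˡ m (iter-value i)) (^-distrib-* (α ^ (m ℕ.^ i)) (ev (iterDen i) α) m)) ⟩
        H * ((α ^ (m ℕ.^ i)) ^ m * ev (iterDen i) α ^ m)
          ≈⟨ *-congˡ (*-congʳ (trans (^-assocʳ α (m ℕ.^ i) m) (reflexive (≡.cong (α ^_) (ℕₚ.*-comm (m ℕ.^ i) m))))) ⟩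
        H * (α ^ (m ℕ.^ suc i) * ev (iterDen i) α ^ m)
          ≈⟨ solve 3 (λ h a d → h :* (a :* d) := a :* (h :* d)) refl H (α ^ (m ℕ.^ suc i)) (ev (iterDen i) α ^ m) ⟩
        α ^ (m ℕ.^ suc i) * (H * ev (iterDen i) α ^ m)
          ≈⟨ *-congˡ (step-value i (iterDen i) (iterDen-deg nc i)) ⟨
        α ^ (m ℕ.^ suc i) * ev (iterDen (suc i)) α ∎
        where
        H = ev h α ^ (D ℕ.^ i)

      denominators : ℕ → List (ℕ × ℕ) → Carrier
      denominators i []            = 1#
      denominators i ((a , b) ∷ l) = ev (iterDen i) α ^ a * (ev (iterDen i) α ^ b * denominators (suc i) l)

      denominators-flip : ∀ i l → denominators i (flip l) ≈ denominators i l
      denominators-flip i []            = refl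
      denominators-flip i ((a , b) ∷ l) = trans (*-congˡ (*-congˡ (denominators-flip (suc i) l)))
        (solve 3 (λ x y z → x :* (y :* z) := y :* (x :* z)) refl _ _ _)

      product-value : ∀ i l → ev (product i l) α ≈ α ^ (m ℕ.^ i ℕ.* inBase m (List.map proj₁ l)) * denominators i l
      product-value i []            = trans (ev-C F.1# α) (trans 1#-homo
        (sym (trans (*-identityʳ _) (reflexive (≡.cong (α ^_) (ℕₚ.*-zeroʳ (m ℕ.^ i)))))))
      product-value i ((a , b) ∷ l) = begin
        ev (product i ((a , b) ∷ l)) α
          ≈⟨ trans (ev-* (iterNum i PR.^ a) _ α) (*-cong (ev-^ (iterNum i) a α)
               (trans (ev-* (iterDen i PR.^ b) (product (suc i) l) α) (*-congʳ (ev-^ (iterDen i) b α)))) ⟩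
        ev (iterNum i) α ^ a * (d ^ b * ev (product (suc i) l) α)
          ≈⟨ *-cong (trans (^-congˡ a (iter-value i)) (trans (^-distrib-* (α ^ (m ℕ.^ i)) d a) (*-congʳ (^-assocʳ α (m ℕ.^ i) a))))
                    (*-congˡ (product-value (suc i) l)) ⟩
        α ^ (m ℕ.^ i ℕ.* a) * d ^ a * (d ^ b * (α ^ (m ℕ.^ suc i ℕ.* E) * denominators (suc i) l))
          ≈⟨ solve 5 (λ x u v y w → x :* u :* (v :* (y :* w)) := x :* y :* (u :* (v :* w))) refl
               (α ^ (m ℕ.^ i ℕ.* a)) (d ^ a) (d ^ b) (α ^ (m ℕ.^ suc i ℕ.* E)) (denominators (suc i) l) ⟩
        α ^ (m ℕ.^ i ℕ.* a) * α ^ (m ℕ.^ suc i ℕ.* E) * denominators i ((a , b) ∷ l)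
          ≈⟨ *-congʳ (trans (sym (^-homo-* α (m ℕ.^ i ℕ.* a) (m ℕ.^ suc i ℕ.* E))) (reflexive (≡.cong (α ^_)
               (+-*-Solver.solve 4 (λ M a m E → M S.:* a S.:+ m S.:* M S.:* E S.:= M S.:* (a S.:+ m S.:* E)) ≡.refl (m ℕ.^ i) a m E)))) ⟩
        α ^ (m ℕ.^ i ℕ.* (a ℕ.+ m ℕ.* E)) * denominators i ((a , b) ∷ l) ∎
        where
        E = inBase m (List.map proj₁ l)
        d = ev (iterDen i) α
        module S = +-*-Solver
        module PR = RingTheory polyRing

      no-short-relation : ∀ l → weight 0 l < n →
        α ^ inBase m (List.map proj₁ l) ≈ α ^ inBase m (List.map proj₂ l) → All (λ ab → proj₁ ab ≡ proj₂ ab) l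
      no-short-relation l short e = independence nc char 2≤p ¬ex l (RingTheory.x-y≈0⇒x≈y polyRing _ _
        (small-root⇒0 (degLe-+ (product-deg nc 0 l) (degLe-- (≡.subst (DegLe (product 0 (flip l))) (weight-flip 0 l) (product-deg nc 0 (flip l)))))
          short
          (trans (ev-+ (product 0 l) (-ᴾ product 0 (flip l)) α) (trans (+-congˡ (ev-- (product 0 (flip l)) α)) (x≈y⇒x-y≈0 equal)))))
        where
        second-flip : ∀ l → List.map proj₁ (flip l) ≡ List.map proj₂ l
        second-flip []      = ≡.refl
        second-flip (x ∷ l) = ≡.cong (proj₂ x ∷_) (second-flip l)
        equal : ev (product 0 l) α ≈ ev (product 0 (flip l)) α
        equal = begin
          ev (product 0 l) α
            ≈⟨ product-value 0 l ⟩
          α ^ (1 ℕ.* inBase m (List.map proj₁ l)) * denominators 0 l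
            ≈⟨ *-cong (trans (reflexive (≡.cong (α ^_) (ℕₚ.*-identityˡ (inBase m (List.map proj₁ l))))) e) (sym (denominators-flip 0 l)) ⟩
          α ^ inBase m (List.map proj₂ l) * denominators 0 (flip l)
            ≡⟨ ≡.cong (λ xs → α ^ inBase m xs * denominators 0 (flip l)) (second-flip l) ⟨
          α ^ inBase m (List.map proj₁ (flip l)) * denominators 0 (flip l)
            ≡⟨ ≡.cong (λ k → α ^ k * denominators 0 (flip l)) (ℕₚ.*-identityˡ (inBase m (List.map proj₁ (flip l)))) ⟨
          α ^ (1 ℕ.* inBase m (List.map proj₁ (flip l))) * denominators 0 (flip l)
            ≈⟨ product-value 0 (flip l) ⟨
          ev (product 0 (flip l)) α ∎

module PowerOfCharacteristic {c ℓ : Level} (R : CommutativeRing c ℓ) (p : ℕ) (p-prime : Prime p)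
  (p·1≈0 : CommutativeRing._≈_ R (RingTheory._·_ R p (CommutativeRing.1# R)) (CommutativeRing.0# R))
  (s l : ℕ) (s≡p^l : s ≡ p ℕ.^ l) where
  open CommutativeRing R hiding (zero)
  open RingTheory R
  open Frobenius R p p-prime p·1≈0 using (frobenius^-+; 0^p^)

  ^s-+ : ∀ x y → (x + y) ^ s ≈ x ^ s + y ^ s
  ^s-+ x y = ≡.subst (λ k → (x + y) ^ k ≈ x ^ k + y ^ k) (≡.sym s≡p^l) (frobenius^-+ l x y)

  0^s : 0# ^ s ≈ 0#
  0^s = ≡.subst (λ k → 0# ^ k ≈ 0#) (≡.sym s≡p^l) (0^p^ l)

  ^s-- : ∀ x y → (x - y) ^ s ≈ x ^ s - y ^ s
  ^s-- x y = trans (solve 2 (λ a b → a := (a :+ b) :- b) refl ((x - y) ^ s) (y ^ s))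
    (+-congʳ (trans (sym (^s-+ (x - y) y)) (^-congˡ s (solve 2 (λ x y → (x :- y) :+ y := x) refl x y))))

  s·1≈0 : 1 ≤ l → s · 1# ≈ 0#
  s·1≈0 1≤l = trans (reflexive (≡.cong (_· 1#) (≡.trans s≡p^l (split l 1≤l)))) (Characteristic.·-*-zero R (p ℕ.^ ℕ.pred l) p·1≈0)
    where
    split : ∀ l → 1 ≤ l → p ℕ.^ l ≡ p ℕ.^ ℕ.pred l ℕ.* p
    split (suc l) _ = ℕₚ.*-comm p (p ℕ.^ l)

module LangIdentities {c ℓ : Level} (R : CommutativeRing c ℓ) where
  open CommutativeRing R using (Carrier; _≈_; _+_; _*_; _-_; -_; 0#; 1#; refl; sym; trans; +-cong; +-congˡ; +-congʳ; *-congˡ; *-cong; +-identityʳ; setoid)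
  open RingTheory R using (solve; _:=_; _:+_; _:*_; _:-_; :-_; con; x≈y⇒x-y≈0)
  open SetoidReasoning setoid

  third-equation : ∀ {c₂ z w Γ W Z E L l : Carrier} → l * L ≈ c₂ + E * w → E ≈ c₂ * (z * Γ) → (z * w - 1#) * Γ ≈ W - 1# → z * W ≈ Z →
    c₂ * Z + E ≈ L * (l * z)
  third-equation {c₂} {z} {w} {Γ} {W} {Z} {E} {L} {l} root E≈ Γ≈ zW≈ = begin
    c₂ * Z + E
      ≈⟨ +-congʳ (*-congˡ (sym zW≈)) ⟩
    c₂ * (z * W) + E
      ≈⟨ solve 4 (λ c z W E → c :* (z :* W) :+ E := c :* (z :* ((W :- con (+ 1)) :+ con (+ 1))) :+ E) refl c₂ z W E ⟩
    c₂ * (z * ((W - 1#) + 1#)) + E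
      ≈⟨ +-congʳ (*-congˡ (*-congˡ (+-congʳ (sym Γ≈)))) ⟩
    c₂ * (z * ((z * w - 1#) * Γ + 1#)) + E
      ≈⟨ solve 5 (λ c z w G E → c :* (z :* ((z :* w :- con (+ 1)) :* G :+ con (+ 1))) :+ E := z :* (c :+ c :* (z :* G) :* w) :+ (E :- c :* (z :* G))) refl c₂ z w Γ E ⟩
    z * (c₂ + c₂ * (z * Γ) * w) + (E - c₂ * (z * Γ))
      ≈⟨ +-cong (*-congˡ (+-congˡ (*-cong (sym E≈) refl))) (x≈y⇒x-y≈0 E≈) ⟩
    z * (c₂ + E * w) + 0#
      ≈⟨ trans (+-identityʳ _) (*-congˡ (sym root)) ⟩
    z * (l * L)
      ≈⟨ solve 3 (λ z l L → z :* (l :* L) := L :* (l :* z)) refl z l L ⟩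
    L * (l * z) ∎

  degenerate : ∀ {c₂ z w Γ E : Carrier} → E ≈ c₂ * (z * Γ) → Γ ≈ - 1# → z * w ≈ 1# → c₂ + E * w ≈ 0#
  degenerate {c₂} {z} {w} {Γ} {E} E≈ Γ≈ zw≈ = begin
    c₂ + E * w                ≈⟨ +-congˡ (*-cong E≈ refl) ⟩
    c₂ + c₂ * (z * Γ) * w     ≈⟨ +-congˡ (solve 4 (λ c z G w → c :* (z :* G) :* w := c :* (G :* (z :* w))) refl c₂ z Γ w) ⟩
    c₂ + c₂ * (Γ * (z * w))   ≈⟨ +-congˡ (*-congˡ (*-cong Γ≈ zw≈)) ⟩
    c₂ + c₂ * (- 1# * 1#)     ≈⟨ solve 1 (λ c → c :+ c :* (:- con (+ 1) :* con (+ 1)) := con (+ 0)) refl c₂ ⟩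
    0#                        ∎

module Conjugation {c ℓ₁ ℓ₂ : Level} (F E : HeytingField c ℓ₁ ℓ₂) (discreteᴱ : Discrete E)
  (ι : HeytingField.Carrier F → HeytingField.Carrier E) (ι-hom : IsFieldHom F E ι) where
  private
    FR = fieldRing F
    module F  = CommutativeRing FR
    module FP = PolynomialTheory F using (C; _≈ᴾ_; at; coeff-+)
    module FPoly = Polynomials F
    module L  = DiscretePolynomials E discreteᴱ using (1^n; C; C-0; C-^; C-cong; X; ^-congˡ; ^-distrib-*; _*ᴾ_; _+ᴾ_; _^_; _·_; _≈ᴾ_; coeff; coeff-+; coeffwise; conjugate; linear; linear≈; monomial; monomial≈; polyRing; ∷-cong; module R)
  open CommutativeRing (fieldRing E) hiding (zero)
  open RingTheory (fieldRing E)
  open DiscreteField E discreteᴱ using (inverse; domain)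
  open DomainTheory (fieldRing E) domain
  open RingTheory.IsDomain domain using (1≉0)
  open RingMorphisms.IsRingHomomorphism ι-hom using (⟦⟧-cong; +-homo; *-homo; 0#-homo; 1#-homo)
  open Extension F E ι ι-hom using (extendPoly; extendRatFun; ι-#)
  open SetoidReasoning setoid

  coeff-extend : ∀ p i → L.coeff (extendPoly p) i ≈ ι (FPoly.coeff p i)
  coeff-extend []      i       = sym 0#-homo
  coeff-extend (a ∷ p) zero    = refl
  coeff-extend (a ∷ p) (suc i) = coeff-extend p i

  extend-cong : ∀ {p r} → p FP.≈ᴾ r → extendPoly p L.≈ᴾ extendPoly r
  extend-cong {p} {r} e = L.coeffwise λ i → trans (coeff-extend p i) (trans (⟦⟧-cong (FP.at e i)) (sym (coeff-extend r i)))

  extend-+ : ∀ p r → extendPoly (p FPoly.+ᴾ r) L.≈ᴾ extendPoly p L.+ᴾ extendPoly r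
  extend-+ p r = L.coeffwise λ i → trans (coeff-extend (p FPoly.+ᴾ r) i) (trans (⟦⟧-cong (FP.coeff-+ p r i))
    (trans (+-homo _ _) (trans (+-cong (sym (coeff-extend p i)) (sym (coeff-extend r i))) (sym (L.coeff-+ (extendPoly p) (extendPoly r) i)))))

  extend-monomial : ∀ a k → extendPoly (FPoly.monomial a k) L.≈ᴾ L.C (ι a) L.*ᴾ L.X L.^ k
  extend-monomial a k = L.R.trans (shift k) (L.monomial≈ (ι a) k)
    where
    shift : ∀ k → extendPoly (FPoly.monomial a k) L.≈ᴾ L.monomial (ι a) k
    shift zero    = L.R.refl
    shift (suc k) = L.∷-cong 0#-homo (shift k)

  linearlyConjugate : ∀ f D {b c₁ e} x y z w λ₀ → 1 ≤ D → ¬ ι c₁ ≈ 0# → ¬ λ₀ ≈ 0# → ¬ x * w - y * z ≈ 0# →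
    FPoly.num f FP.≈ᴾ FP.C b → FPoly.den f FP.≈ᴾ FPoly.monomial c₁ D FPoly.+ᴾ FP.C e →
    ι b * w ^ D ≈ λ₀ * x → ι b * z ^ D ≈ λ₀ * y →
    ι c₁ * y ^ D + ι e * w ^ D ≈ λ₀ * z → ι c₁ * x ^ D + ι e * z ^ D ≈ λ₀ * w →
    L.linear x y L.^ D L.≈ᴾ L.C (y ^ D) L.+ᴾ L.C (x ^ D) L.*ᴾ L.X L.^ D →
    L.linear z w L.^ D L.≈ᴾ L.C (w ^ D) L.+ᴾ L.C (z ^ D) L.*ᴾ L.X L.^ D →
    LinearlyConjugate F f (FPoly.1/𝕏^ D)
  linearlyConjugate f D {b} {c₁} {e} x y z w λ₀ 1≤D c≉0 λ≉0 κ≉0 num≈ den≈ eq₁ eq₂ eq₃ eq₄ split-u split-v =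
    E , ι , ι-hom , L.conjugate (extendRatFun f) (extendRatFun (FPoly.1/𝕏^ D)) D (ι b) (ι c₁) (ι e) x y z w λ₀ 1≤D c≉0 λ≉0 κ≉0
      (extend-cong num≈)
      (L.R.trans (extend-cong den≈) (L.R.trans (extend-+ (FPoly.monomial c₁ D) (FP.C e))
        (L.R.+-cong (extend-monomial c₁ D) (L.R.sym (L.R.*-identityʳ (L.C (ι e)))))))
      (L.C-cong 1#-homo)
      (L.R.trans (extend-monomial F.1# D) (L.R.trans (L.R.*-congʳ {L.X L.^ D} (L.C-cong 1#-homo)) (L.R.*-identityˡ (L.X L.^ D))))
      eq₁ eq₂ eq₃ eq₄ split-u split-v

  -- f = b / (c X^D) is conjugate to 1 / X^D by the scaling β X with c β^(D+1) = b.
  scaling : ∀ f D {b c₁ e} β → 1 ≤ D → ¬ ι b ≈ 0# → ¬ ι c₁ ≈ 0# → ι e ≈ 0# → ι c₁ * (β * β ^ D) ≈ ι b →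
    FPoly.num f FP.≈ᴾ FP.C b → FPoly.den f FP.≈ᴾ FPoly.monomial c₁ D FPoly.+ᴾ FP.C e →
    LinearlyConjugate F f (FPoly.1/𝕏^ D)
  scaling f D {b} {c₁} {e} β 1≤D b≉0 c≉0 e≈0 root num≈ den≈ =
    linearlyConjugate f D β 0# 0# 1# (ι c₁ * β ^ D) 1≤D c≉0 (*-≉0 c≉0 (^-≉0 D β≉0))
      (λ h → β≉0 (trans (solve 1 (λ x → x := x :* con (+ 1) :- con (+ 0) :* con (+ 0)) refl β) h))
      num≈ den≈
      (trans (trans (*-congˡ (1^n D)) (*-identityʳ (ι b))) (trans (sym root) (solve 3 (λ c x y → c :* (x :* y) := c :* y :* x) refl (ι c₁) β (β ^ D))))
      (trans (*-congˡ 0^D) (trans (zeroʳ (ι b)) (sym (zeroʳ _))))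
      (trans (+-cong (trans (*-congˡ 0^D) (zeroʳ _)) (trans (*-congʳ e≈0) (zeroˡ _))) (trans (+-identityˡ 0#) (sym (zeroʳ _))))
      (trans (+-congˡ (trans (*-congʳ e≈0) (zeroˡ _))) (trans (+-identityʳ _) (sym (*-identityʳ _))))
      (L.R.trans (L.^-congˡ D (L.R.trans (L.linear≈ β 0#) (L.R.trans (L.R.+-congʳ {L.C β L.*ᴾ L.X} L.C-0) (L.R.+-identityˡ (L.C β L.*ᴾ L.X)))))
        (L.R.trans (L.^-distrib-* (L.C β) L.X D) (L.R.trans (L.R.*-congʳ {L.X L.^ D} (L.R.sym (L.C-^ β D)))
          (L.R.sym (L.R.trans (L.R.+-congʳ {L.C (β ^ D) L.*ᴾ L.X L.^ D} (L.R.trans (L.C-cong 0^D) L.C-0)) (L.R.+-identityˡ _))))))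
      (L.R.trans (L.^-congˡ D (L.R.trans (L.linear≈ 0# 1#) (drop 1#)))
        (L.R.trans (L.1^n D) (L.R.trans (L.C-cong (sym (1^n D)))
          (L.R.sym (L.R.trans (L.R.+-congˡ {L.C (1# ^ D)} (L.R.trans (L.R.*-congʳ {L.X L.^ D} (L.R.trans (L.C-cong 0^D) L.C-0)) (L.R.zeroˡ (L.X L.^ D)))) (L.R.+-identityʳ (L.C (1# ^ D))))))))
    where
    β≉0 : ¬ β ≈ 0#
    β≉0 h = b≉0 (trans (sym root) (trans (*-congˡ (trans (*-congʳ h) (zeroˡ _))) (zeroʳ _)))
    0^D : 0# ^ D ≈ 0#
    0^D = power D 1≤D
      where
      power : ∀ D → 1 ≤ D → 0# ^ D ≈ 0#
      power (suc D) _ = zeroˡ _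
    drop : ∀ a → L.C a L.+ᴾ L.C 0# L.*ᴾ L.X L.≈ᴾ L.C a
    drop a = L.R.trans (L.R.+-congˡ {L.C a} (L.R.trans (L.R.*-congʳ {L.X} L.C-0) (L.R.zeroˡ L.X))) (L.R.+-identityʳ (L.C a))

  -- Lang's theorem for the map X ↦ b / (c X^s + e): with z = τ^s and w = 1 the four equations for ψ reduce
  -- to the single one λ^(s+1) = c b^s + e λ^s z^s, where λ = k τ (τ^(s²−1) − 1) / (τ^(s+1) − 1) and e k^s = c b^s.
  module _ (p : ℕ) (p-prime : Prime p) (p·1≈0 : p · 1# ≈ 0#) (s s′ l : ℕ) (s≡1+s′ : s ≡ suc s′) (s≡p^l : s ≡ p ℕ.^ l) (1≤l : 1 ≤ l) where
    open PowerOfCharacteristic (fieldRing E) p p-prime p·1≈0 s l s≡p^l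

    private
      C-· : ∀ n → L.C (n · 1#) L.≈ᴾ n L.· L.C 1#
      C-· zero    = L.C-0
      C-· (suc n) = L.R.+-congˡ {L.C 1#} (C-· n)

      p·1≈0ᴾ : p L.· L.C 1# L.≈ᴾ []
      p·1≈0ᴾ = L.R.trans (L.R.sym (C-· p)) (L.R.trans (L.C-cong p·1≈0) L.C-0)

      module Pow = PowerOfCharacteristic L.polyRing p p-prime p·1≈0ᴾ s l s≡p^l

      split : ∀ x y → L.linear x y L.^ s L.≈ᴾ L.C (y ^ s) L.+ᴾ L.C (x ^ s) L.*ᴾ L.X L.^ s
      split x y = L.R.trans (L.^-congˡ s (L.linear≈ x y)) (L.R.trans (Pow.^s-+ (L.C y) (L.C x L.*ᴾ L.X))
        (L.R.+-cong (L.R.sym (L.C-^ y s)) (L.R.trans (L.^-distrib-* (L.C x) L.X s) (L.R.*-congʳ {L.X L.^ s} (L.R.sym (L.C-^ x s))))))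

      ^-swap : ∀ x a b → (x ^ a) ^ b ≈ (x ^ b) ^ a
      ^-swap x a b = trans (^-assocʳ x a b) (trans (reflexive (≡.cong (x ^_) (ℕₚ.*-comm a b))) (sym (^-assocʳ x b a)))

      -- This is s − 1 = −1.
      geometric-1 : geometric s′ 1# 1# ≈ - 1#
      geometric-1 = trans (count s′) (trans (solve 1 (λ x → x := (con (+ 1) :+ x) :- con (+ 1)) refl (s′ · 1#))
        (trans (+-congʳ (trans (reflexive (≡.cong (_· 1#) (≡.sym s≡1+s′))) (s·1≈0 1≤l))) (+-identityˡ _)))
        where
        count : ∀ n → geometric n 1# 1# ≈ n · 1#
        count zero    = refl
        count (suc n) = +-cong (1^n n) (trans (*-identityˡ _) (count n))

    lang-equations : ∀ f {b c₁ e} k τ G λ₀ → ¬ ι b ≈ 0# → ¬ ι c₁ ≈ 0# → ι e * k ^ s ≈ ι c₁ * ι b ^ s →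
      (τ ^ suc s - 1#) * G ≈ (τ ^ suc s) ^ s′ - 1# → (τ ^ suc s ≈ 1# → G ≈ - 1#) → λ₀ ≈ k * (τ * G) →
      λ₀ * λ₀ ^ s ≈ ι c₁ * ι b ^ s + ι e * (λ₀ ^ s * (τ ^ s) ^ s) →
      FPoly.num f FP.≈ᴾ FP.C b → FPoly.den f FP.≈ᴾ FPoly.monomial c₁ s FPoly.+ᴾ FP.C e →
      LinearlyConjugate F f (FPoly.1/𝕏^ s)
    lang-equations f {b} {c₁} {e} k τ G λ₀ b≉0 c≉0 k^s τG G-1 λ≈ root num≈ den≈ =
      linearlyConjugate f s x y z 1# λ₀ (≡.subst (1 ≤_) (≡.sym s≡1+s′) (s≤s z≤n)) c≉0 λ≉0 κ≉0 num≈ den≈ eq₁ eq₂ eq₃ eq₄ (split x y) (split z 1#)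
      where
      z  = τ ^ s
      B  = ι b
      c₂ = ι c₁ * B ^ s
      c₂≉0 : ¬ c₂ ≈ 0#
      c₂≉0 = *-≉0 c≉0 (^-≉0 s b≉0)
      λ≉0 : ¬ λ₀ ≈ 0#
      λ≉0 h = c₂≉0 (begin
        c₂                                             ≈⟨ solve 2 (λ x y → x := (x :+ y) :- y) refl c₂ (ι e * (λ₀ ^ s * z ^ s)) ⟩
        (c₂ + ι e * (λ₀ ^ s * z ^ s)) - ι e * (λ₀ ^ s * z ^ s)
          ≈⟨ +-cong (trans (sym root) (trans (*-congʳ h) (zeroˡ _)))
                    (-‿cong (trans (*-congˡ (trans (*-congʳ (trans (^-congˡ s h) 0^s)) (zeroˡ _))) (zeroʳ _))) ⟩
        0# - 0#                                        ≈⟨ -‿inverseʳ 0# ⟩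
        0#                                             ∎)
      μ  = proj₁ (inverse λ₀ λ≉0)
      λμ : λ₀ * μ ≈ 1#
      λμ = trans (*-comm λ₀ μ) (proj₂ (inverse λ₀ λ≉0))
      x = μ * B
      y = μ * (B * z ^ s)
      λ-cancel : ∀ a → λ₀ * (μ * a) ≈ a
      λ-cancel a = trans (sym (*-assoc λ₀ μ a)) (trans (*-congʳ λμ) (*-identityˡ a))

      eq₁ : B * 1# ^ s ≈ λ₀ * x
      eq₁ = trans (trans (*-congˡ (1^n s)) (*-identityʳ B)) (sym (λ-cancel B))
      eq₂ : B * z ^ s ≈ λ₀ * y
      eq₂ = sym (λ-cancel (B * z ^ s))

      eλ^s : ι e * λ₀ ^ s ≈ c₂ * (z * G ^ s)
      eλ^s = begin
        ι e * λ₀ ^ s                     ≈⟨ *-congˡ (trans (^-congˡ s λ≈) (trans (^-distrib-* k (τ * G) s) (*-congˡ (^-distrib-* τ G s)))) ⟩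
        ι e * (k ^ s * (z * G ^ s))      ≈⟨ *-assoc (ι e) (k ^ s) (z * G ^ s) ⟨
        ι e * k ^ s * (z * G ^ s)        ≈⟨ *-congʳ k^s ⟩
        c₂ * (z * G ^ s)                 ∎

      root′ : λ₀ * λ₀ ^ s ≈ c₂ + ι e * λ₀ ^ s * z ^ s
      root′ = trans root (+-congˡ (sym (*-assoc (ι e) (λ₀ ^ s) (z ^ s))))

      G^s : (z ^ suc s - 1#) * G ^ s ≈ (z ^ suc s) ^ s′ - 1#
      G^s = begin
        (z ^ suc s - 1#) * G ^ s
          ≈⟨ *-congʳ (+-cong (^-swap τ s (suc s)) (-‿cong (sym (1^n s)))) ⟩
        ((τ ^ suc s) ^ s - 1# ^ s) * G ^ s
          ≈⟨ *-congʳ (^s-- (τ ^ suc s) 1#) ⟨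
        (τ ^ suc s - 1#) ^ s * G ^ s
          ≈⟨ ^-distrib-* (τ ^ suc s - 1#) G s ⟨
        ((τ ^ suc s - 1#) * G) ^ s
          ≈⟨ ^-congˡ s τG ⟩
        ((τ ^ suc s) ^ s′ - 1#) ^ s
          ≈⟨ ^s-- ((τ ^ suc s) ^ s′) 1# ⟩
        ((τ ^ suc s) ^ s′) ^ s - 1# ^ s
          ≈⟨ +-cong (trans (^-swap (τ ^ suc s) s′ s) (^-congˡ s′ (^-swap τ (suc s) s))) (-‿cong (1^n s)) ⟩
        (z ^ suc s) ^ s′ - 1# ∎

      z^s² : z * (z ^ suc s) ^ s′ ≈ (z ^ s) ^ s
      z^s² = trans (*-congˡ (^-assocʳ z (suc s) s′)) (trans (reflexive (≡.cong (z ^_) square)) (sym (^-assocʳ z s s)))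
        where
        module S = +-*-Solver
        square : suc (suc s ℕ.* s′) ≡ s ℕ.* s
        square = ≡.subst (λ s → suc (suc s ℕ.* s′) ≡ s ℕ.* s) (≡.sym s≡1+s′)
          (S.solve 1 (λ s′ → S.con 1 S.:+ (S.con 2 S.:+ s′) S.:* s′ S.:= (S.con 1 S.:+ s′) S.:* (S.con 1 S.:+ s′)) ≡.refl s′)

      λ^s-pull : ∀ a b → λ₀ * a ≈ b → λ₀ ^ s * a ^ s ≈ b ^ s
      λ^s-pull a b h = trans (sym (^-distrib-* λ₀ a s)) (^-congˡ s h)

      eq₄ : ι c₁ * x ^ s + ι e * z ^ s ≈ λ₀ * 1#
      eq₄ = *-cancelˡ (λ₀ ^ s) (^-≉0 s λ≉0) (begin
        λ₀ ^ s * (ι c₁ * x ^ s + ι e * z ^ s)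
          ≈⟨ solve 5 (λ L c x e z → L :* (c :* x :+ e :* z) := c :* (L :* x) :+ e :* (L :* z)) refl (λ₀ ^ s) (ι c₁) (x ^ s) (ι e) (z ^ s) ⟩
        ι c₁ * (λ₀ ^ s * x ^ s) + ι e * (λ₀ ^ s * z ^ s)
          ≈⟨ +-congʳ (*-congˡ (λ^s-pull x B (λ-cancel B))) ⟩
        c₂ + ι e * (λ₀ ^ s * z ^ s)
          ≈⟨ root ⟨
        λ₀ * λ₀ ^ s
          ≈⟨ solve 2 (λ l L → l :* L := L :* (l :* con (+ 1))) refl λ₀ (λ₀ ^ s) ⟩
        λ₀ ^ s * (λ₀ * 1#) ∎)

      eq₃ : ι c₁ * y ^ s + ι e * 1# ^ s ≈ λ₀ * z
      eq₃ = *-cancelˡ (λ₀ ^ s) (^-≉0 s λ≉0) (begin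
        λ₀ ^ s * (ι c₁ * y ^ s + ι e * 1# ^ s)
          ≈⟨ *-congˡ (+-congˡ (trans (*-congˡ (1^n s)) (*-identityʳ (ι e)))) ⟩
        λ₀ ^ s * (ι c₁ * y ^ s + ι e)
          ≈⟨ solve 4 (λ L c y e → L :* (c :* y :+ e) := c :* (L :* y) :+ e :* L) refl (λ₀ ^ s) (ι c₁) (y ^ s) (ι e) ⟩
        ι c₁ * (λ₀ ^ s * y ^ s) + ι e * λ₀ ^ s
          ≈⟨ +-congʳ (trans (*-congˡ (trans (λ^s-pull y (B * z ^ s) (λ-cancel (B * z ^ s))) (^-distrib-* B (z ^ s) s))) (sym (*-assoc (ι c₁) (B ^ s) ((z ^ s) ^ s)))) ⟩
        c₂ * (z ^ s) ^ s + ι e * λ₀ ^ s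
          ≈⟨ LangIdentities.third-equation (fieldRing E) {c₂} {z} {z ^ s} {G ^ s} {(z ^ suc s) ^ s′} {(z ^ s) ^ s} {ι e * λ₀ ^ s} {λ₀ ^ s} {λ₀} root′ eλ^s G^s z^s² ⟩
        λ₀ ^ s * (λ₀ * z) ∎)

      -- If z^(s+1) = 1, then τ^(s+1) = 1 and λ = −k τ, so the equation for λ reads λ^(s+1) = 0.
      κ≉0 : ¬ x * 1# - y * z ≈ 0#
      κ≉0 h = *-≉0 λ≉0 (^-≉0 s λ≉0) (begin
        λ₀ * λ₀ ^ s                               ≈⟨ root′ ⟩
        c₂ + ι e * λ₀ ^ s * z ^ s                 ≈⟨ LangIdentities.degenerate (fieldRing E) {c₂} {z} {z ^ s} {G ^ s} {ι e * λ₀ ^ s} eλ^s (trans (^-congˡ s (G-1 τ≈1)) -1^s) z≈1 ⟩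
        0#                                        ∎)
        where
        z≈1 : z ^ suc s ≈ 1#
        z≈1 = sym (x-y≈0⇒x≈y 1# (z ^ suc s) (zero-product′ (begin
          μ * B * (1# - z ^ suc s)              ≈⟨ solve 4 (λ m b z w → m :* b :* (con (+ 1) :- z :* w) := m :* b :* con (+ 1) :- m :* (b :* w) :* z) refl μ B z (z ^ s) ⟩
          x * 1# - y * z                        ≈⟨ h ⟩
          0#                                    ∎)))
          where
          zero-product′ : ∀ {a} → μ * B * a ≈ 0# → a ≈ 0#
          zero-product′ e = RingTheory.IsDomain.zero-product domain e (*-≉0 (λ μ≈0 → 1≉0 (trans (sym λμ) (trans (*-congˡ μ≈0) (zeroʳ λ₀)))) b≉0)
        -1^s : (- 1#) ^ s ≈ - 1#
        -1^s = trans (^-congˡ s (sym (+-identityˡ (- 1#)))) (trans (^s-- 0# 1#) (trans (+-cong 0^s (-‿cong (1^n s))) (+-identityˡ (- 1#))))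
        τ≈1 : τ ^ suc s ≈ 1#
        τ≈1 = x-y≈0⇒x≈y (τ ^ suc s) 1# (reduced (begin
          (τ ^ suc s - 1#) ^ s       ≈⟨ ^s-- (τ ^ suc s) 1# ⟩
          (τ ^ suc s) ^ s - 1# ^ s   ≈⟨ +-cong (trans (^-swap τ (suc s) s) z≈1) (-‿cong (1^n s)) ⟩
          1# - 1#                    ≈⟨ -‿inverseʳ 1# ⟩
          0#                         ∎))
          where
          reduced : (τ ^ suc s - 1#) ^ s ≈ 0# → τ ^ suc s - 1# ≈ 0#
          reduced e with Discrete._≟_ discreteᴱ (τ ^ suc s - 1#) 0#
          ... | yes h = h
          ... | no h  = ⊥-elim (^-≉0 s h e)

    lang : ∀ f {b c₁ e} k τ → ¬ ι b ≈ 0# → ¬ ι c₁ ≈ 0# → ι e * k ^ s ≈ ι c₁ * ι b ^ s →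
      let λ₀ = k * (τ * geometric s′ (τ ^ suc s) 1#) in
      λ₀ * λ₀ ^ s ≈ ι c₁ * ι b ^ s + ι e * (λ₀ ^ s * (τ ^ s) ^ s) →
      FPoly.num f FP.≈ᴾ FP.C b → FPoly.den f FP.≈ᴾ FPoly.monomial c₁ s FPoly.+ᴾ FP.C e →
      LinearlyConjugate F f (FPoly.1/𝕏^ s)
    lang f k τ b≉0 c≉0 k^s = lang-equations f k τ (geometric s′ (τ ^ suc s) 1#) (k * (τ * geometric s′ (τ ^ suc s) 1#)) b≉0 c≉0 k^s
      (trans (geometric-* s′ (τ ^ suc s) 1#) (+-congˡ (-‿cong (1^n s′)))) (λ τ≈1 → trans (geometric-cong s′ τ≈1 refl) geometric-1) refl

module ConjugationAtRoots {c ℓ₁ ℓ₂ : Level} (F E : HeytingField c ℓ₁ ℓ₂) (discrete : Discrete F) (discreteᴱ : Discrete E)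
  (ι : HeytingField.Carrier F → HeytingField.Carrier E) (ι-hom : IsFieldHom F E ι) where
  private
    FR = fieldRing F
    ER = fieldRing E
    module F  = CommutativeRing FR
    module FT = RingTheory FR
    module FP = PolynomialTheory F using (C; _≈ᴾ_)
    module FPoly = Polynomials F
    module Cj = Conjugation F E discreteᴱ ι ι-hom using (scaling; lang)
  open CommutativeRing ER hiding (zero)
  open RingTheory ER
  open RootPolynomials F using (scalingPolynomial; langPolynomial; ev-scaling; ev-lang)
  open Evaluation F ER ι ι-hom using (ev)
  open RingMorphisms.IsRingHomomorphism ι-hom using (⟦⟧-cong; *-homo; 0#-homo)
  open RingHomomorphism FR ER ι ι-hom

  ι-≉0 : ∀ {a} → ¬ a F.≈ F.0# → ¬ ι a ≈ 0#
  ι-≉0 a≉0 = DiscreteField.#⇒≉ E discreteᴱ (Extension.ι-# F E ι ι-hom (Discrete.apart discrete a≉0))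

  scaling-at-root : ∀ f D {b c₁ e} → 1 ≤ D → ¬ b F.≈ F.0# → ¬ c₁ F.≈ F.0# → e F.≈ F.0# →
    FPoly.num f FP.≈ᴾ FP.C b → FPoly.den f FP.≈ᴾ FPoly.monomial c₁ D FPoly.+ᴾ FP.C e →
    ∀ β → ev (scalingPolynomial D b c₁) β ≈ 0# → LinearlyConjugate F f (FPoly.1/𝕏^ D)
  scaling-at-root f D {b} {c₁} 1≤D b≉0 c≉0 e≈0 num≈ den≈ β root =
    Cj.scaling f D β 1≤D (ι-≉0 b≉0) (ι-≉0 c≉0) (trans (⟦⟧-cong e≈0) 0#-homo)
      (x-y≈0⇒x≈y _ _ (trans (sym (ev-scaling ER ι ι-hom D b c₁ β)) root)) num≈ den≈

  lang-at-root : ∀ p → Prime p → p FT.· F.1# F.≈ F.0# → ∀ s′ l → suc s′ ≡ p ℕ.^ l → 1 ≤ l →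
    ∀ f {b c₁ e} k → ¬ b F.≈ F.0# → ¬ c₁ F.≈ F.0# → e F.* k FT.^ suc s′ F.≈ c₁ F.* b FT.^ suc s′ →
    FPoly.num f FP.≈ᴾ FP.C b → FPoly.den f FP.≈ᴾ FPoly.monomial c₁ (suc s′) FPoly.+ᴾ FP.C e →
    ∀ τ → ev (langPolynomial s′ k b c₁ e) τ ≈ 0# → LinearlyConjugate F f (FPoly.1/𝕏^ suc s′)
  lang-at-root p p-prime p·1≈0 s′ l s≡ 1≤l f {b} {c₁} {e} k b≉0 c≉0 k^s num≈ den≈ τ root =
    Cj.lang p p-prime (trans (sym (φ-·1 p)) (trans (⟦⟧-cong p·1≈0) 0#-homo)) (suc s′) s′ l ≡.refl s≡ 1≤l f {b} {c₁} {e} (ι k) τ (ι-≉0 b≉0) (ι-≉0 c≉0)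
      (trans (*-congˡ (sym (φ-^ k (suc s′)))) (trans (sym (*-homo e (k FT.^ suc s′))) (trans (⟦⟧-cong k^s)
        (trans (*-homo c₁ (b FT.^ suc s′)) (*-congˡ (φ-^ b (suc s′)))))))
      (x-y≈0⇒x≈y _ _ (trans (sym (ev-lang ER ι ι-hom s′ k b c₁ e τ)) root)) num≈ den≈

module Derivatives {c ℓ₁ ℓ₂ : Level} (F : HeytingField c ℓ₁ ℓ₂) where
  open PolynomialTheory F
  private
    FR = fieldRing F
    module F = CommutativeRing FR
    module FT = RingTheory FR
  open F using (_≈_; 0#)

  coeff-derivative : ∀ p i → coeff (derivative p) i ≈ suc i FT.· coeff p (suc i)
  coeff-derivative []      i       = F.sym (·-0 (suc i))
    where
    ·-0 : ∀ n → n FT.· 0# ≈ 0#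
    ·-0 zero    = F.refl
    ·-0 (suc n) = F.trans (F.+-identityˡ _) (·-0 n)
  coeff-derivative (a ∷ p) zero    = coeff-+ p (0# ∷ derivative p) 0
  coeff-derivative (a ∷ p) (suc i) = F.trans (coeff-+ p (0# ∷ derivative p) (suc i)) (F.+-congˡ (coeff-derivative p i))

  coeff-monomial-≢ : ∀ a {k i} → i ≢ k → coeff (monomial a k) i ≈ 0#
  coeff-monomial-≢ a {zero}  {zero}  i≢k = ⊥-elim (i≢k ≡.refl)
  coeff-monomial-≢ a {zero}  {suc i} i≢k = F.refl
  coeff-monomial-≢ a {suc k} {zero}  i≢k = F.refl
  coeff-monomial-≢ a {suc k} {suc i} i≢k = coeff-monomial-≢ a λ e → i≢k (≡.cong suc e)

  derivative≈0 : ∀ {p a b D} → D FT.· F.1# ≈ 0# → p ≈ᴾ monomial a D +ᴾ C b → derivative p ≈ᴾ []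
  derivative≈0 {p} {a} {b} {D} D≈0 e = coeffwise λ i → F.trans (coeff-derivative p i) (vanishes i (suc i ℕₚ.≟ D))
    where
    vanishes : ∀ i → Dec (suc i ≡ D) → suc i FT.· coeff p (suc i) ≈ 0#
    vanishes i (yes e′) = F.trans (FT.·≈·1* (suc i) _) (F.trans (F.*-congʳ (F.trans (F.reflexive (≡.cong (FT._· F.1#) e′)) D≈0)) (F.zeroˡ _))
    vanishes i (no i≢D) = F.trans (FT.·≈·1* (suc i) _) (F.trans (F.*-congˡ (F.trans (at e (suc i)) (F.trans
      (coeff-+ (monomial a D) (C b) (suc i)) (F.trans (F.+-identityʳ _) (coeff-monomial-≢ a i≢D))))) (F.zeroʳ _))

module ExcludedCases {c ℓ₁ ℓ₂ : Level} (F : HeytingField c ℓ₁ ℓ₂) (q : ℕ) (card : HasCardinality F q)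
  (p : ℕ) (p-prime : Prime p) (char : Characteristic.HasChar (fieldRing F) p)
  (r : ℕ) (1≤r : 1 ≤ r) (q≡ : q ≡ p ℕ.^ r) (f : Polynomials.RatFun F) (D : ℕ) where
  private
    FR = fieldRing F
    module F = CommutativeRing FR
    module FT = RingTheory FR
    discrete = FiniteField.discrete F q card
    module I = DiscretePolynomials.Independence F discrete (Polynomials.num f) (Polynomials.den f) D using (NonConstant; Excluded; diagonal; antidiagonal; wild)
  open DiscretePolynomials F discrete using (-ᴾ_; 1/𝕏^_; :-_; C; C-*; C-0; C-cong; HasDeg; IsComposite; IsLinearInPPower; IsMonomial; IsPPowerBinomial; IsSeparable; Möbius; X; _*ᴾ_; _+ᴾ_; _-ᴾ_; _:*_; _:+_; _:-_; _:=_; _^_; _≈ᴾ_; coeff-≈; con; den; derivative; fraction; fraction-degree; hasDeg-cong; hasDeg-lin; hasDeg-unique; hasDeg-≉0; homogenize; homogenize-linear; langPolynomial-degree; lin; linear; minimalDivisor; monomial; monomial≈; nonZeroᴾ; num; scalingPolynomial-degree; solve; zero?; 𝕏^_; module R; module Möbius)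
  open F using (Carrier; _≈_; 0#; 1#)
  open DiscreteField F discrete using (_≟_; apart; inverse; domain)
  open DomainTheory FR domain using () renaming (*-≉0 to *-≉0ᶠ; ^-≉0 to ^-≉0ᶠ)
  open FT using () renaming (_^_ to _^ᶠ_; solve to solveᶠ; _:=_ to _:=ᶠ_; _:+_ to _:+ᶠ_; _:*_ to _:*ᶠ_; _:-_ to _:-ᶠ_; :-_ to :-ᶠ_; con to conᶠ)
  open RootPolynomials F using (scalingPolynomial; langPolynomial)
  open SetoidReasoning R.setoid

  lin≈monomial+C : ∀ a b → lin a b (X ^ D) (C 1#) ≈ᴾ monomial a D +ᴾ C b
  lin≈monomial+C a b = R.+-cong (R.sym (monomial≈ a D)) (R.*-identityʳ (C b))

  constant-if : ∀ {a b} → a ≈ 0# → lin a b (X ^ D) (C 1#) ≈ᴾ C b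
  constant-if {a} {b} a≈0 = R.trans (R.+-cong (R.*-congʳ {X ^ D} (R.trans (C-cong a≈0) C-0)) (R.*-identityʳ (C b))) (R.+-identityˡ (C b))

  scaling-excluded : ∀ {b c₁ e} → 1 ≤ D → ¬ b ≈ 0# → ¬ c₁ ≈ 0# → e ≈ 0# → num f ≈ᴾ C b → den f ≈ᴾ monomial c₁ D +ᴾ C e →
    ¬ ¬ LinearlyConjugate F f (1/𝕏^ D)
  scaling-excluded {b} {c₁} {e} 1≤D b≉0 c≉0 e≈0 num≈ den≈ ¬conj =
    minimalDivisor (scalingPolynomial-degree D {b} c≉0) (s≤s z≤n) λ divisor →
      let module E = DiscretePolynomials.RootExtension F discrete divisor using (field′; discrete′; C-isFieldHom; root) in
      ¬conj (ConjugationAtRoots.scaling-at-root F E.field′ discrete E.discrete′ C E.C-isFieldHom f D {b} {c₁} {e} 1≤D b≉0 c≉0 e≈0 num≈ den≈ X E.root)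

  -- Taking s-th roots is iterating Frobenius: q^l = s · p^((r−1) l) for s = p^l.
  root-of-power : ∀ l x → ∃[ k ] k ^ᶠ (p ℕ.^ l) ≈ x
  root-of-power l x = x ^ᶠ (p ℕ.^ (ℕ.pred r ℕ.* l)) , F.trans (FT.^-assocʳ x (p ℕ.^ (ℕ.pred r ℕ.* l)) (p ℕ.^ l))
    (F.trans (F.reflexive (≡.cong (x ^ᶠ_) (exponents r 1≤r q≡))) (FiniteField.fermat-q^ F q card x l))
    where
    exponents : ∀ r → 1 ≤ r → q ≡ p ℕ.^ r → p ℕ.^ (ℕ.pred r ℕ.* l) ℕ.* p ℕ.^ l ≡ q ℕ.^ l
    exponents (suc r) _ q≡ = ≡.trans (≡.sym (ℕₚ.^-distribˡ-+-* p (r ℕ.* l) l)) (≡.trans (≡.cong (p ℕ.^_) (ℕₚ.+-comm (r ℕ.* l) l))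
      (≡.trans (≡.sym (ℕₚ.^-*-assoc p (suc r) l)) (≡.cong (ℕ._^ l) (≡.sym q≡))))

  lang-excluded : ∀ {b c₁ e} s′ l → suc s′ ≡ p ℕ.^ l → 1 ≤ l → 1 ≤ s′ → ¬ b ≈ 0# → ¬ c₁ ≈ 0# → ¬ e ≈ 0# →
    num f ≈ᴾ C b → den f ≈ᴾ monomial c₁ (suc s′) +ᴾ C e → ¬ ¬ LinearlyConjugate F f (1/𝕏^ suc s′)
  lang-excluded {b} {c₁} {e} s′ l s≡ 1≤l 1≤s′ b≉0 c≉0 e≉0 num≈ den≈ ¬conj = at-root (langPolynomial-degree s′ {e = e} 1≤s′ k≉0 b≉0 c≉0)
    where
    e⁻¹ = proj₁ (inverse e e≉0)
    c₂ = c₁ F.* b ^ᶠ suc s′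
    root = root-of-power l (e⁻¹ F.* c₂)
    k = proj₁ root
    ek^s : e F.* k ^ᶠ suc s′ ≈ c₂
    ek^s = F.trans (F.*-congˡ (F.trans (F.reflexive (≡.cong (k ^ᶠ_) s≡)) (proj₂ root)))
      (F.trans (F.sym (F.*-assoc e e⁻¹ c₂)) (F.trans (F.*-congʳ (F.trans (F.*-comm e e⁻¹) (proj₂ (inverse e e≉0)))) (F.*-identityˡ c₂)))
    k≉0 : ¬ k ≈ 0#
    k≉0 h = *-≉0ᶠ c≉0 (^-≉0ᶠ (suc s′) b≉0) (F.trans (F.sym ek^s) (F.trans (F.*-congˡ (F.trans (F.*-congʳ h) (F.zeroˡ _))) (F.zeroʳ e)))
    at-root : (∃[ n ] (1 ≤ n × HasDeg (langPolynomial s′ k b c₁ e) n)) → ⊥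
    at-root (n , 1≤n , hP) = minimalDivisor hP 1≤n λ divisor →
      let module E = DiscretePolynomials.RootExtension F discrete divisor using (field′; discrete′; C-isFieldHom; root) in
      ¬conj (ConjugationAtRoots.lang-at-root F E.field′ discrete E.discrete′ C E.C-isFieldHom p p-prime (proj₁ (proj₂ char)) s′ l s≡ 1≤l
        f {b} {c₁} {e} k b≉0 c≉0 ek^s num≈ den≈ X E.root)

  module _ (m : Möbius (num f) (den f) D) where
    open Möbius m

    private
      Δ-zero : ∀ {x y} → x ≈ 0# → y ≈ 0# → x F.- y ≈ 0#
      Δ-zero x≈0 y≈0 = F.trans (F.+-cong x≈0 (F.-‿cong y≈0)) (F.-‿inverseʳ 0#)

    num≈′ : num f ≈ᴾ monomial a D +ᴾ C b
    num≈′ = R.trans g≈ (lin≈monomial+C a b)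
    den≈′ : den f ≈ᴾ monomial c₁ D +ᴾ C e
    den≈′ = R.trans h≈ (lin≈monomial+C c₁ e)

    module _ (c≈0 : c₁ ≈ 0#) where
      a≉0 : ¬ a ≈ 0#
      a≉0 a≈0 = Δ≉0 (Δ-zero (F.trans (F.*-congʳ a≈0) (F.zeroˡ e)) (F.trans (F.*-congˡ c≈0) (F.zeroʳ b)))
      e≉0 : ¬ e ≈ 0#
      e≉0 e≈0 = Δ≉0 (Δ-zero (F.trans (F.*-congˡ e≈0) (F.zeroʳ a)) (F.trans (F.*-congˡ c≈0) (F.zeroʳ b)))
      e⁻¹ = proj₁ (inverse e e≉0)
      e⁻¹e = proj₂ (inverse e e≉0)

      quotient≉0 : ¬ a F.* e⁻¹ ≈ 0#
      quotient≉0 h = a≉0 (F.trans (F.sym (F.trans (F.*-assoc a e⁻¹ e) (F.trans (F.*-congˡ e⁻¹e) (F.*-identityʳ a))))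
        (F.trans (F.*-congʳ h) (F.zeroˡ e)))

      binomial : num f *ᴾ C 1# ≈ᴾ (monomial (a F.* e⁻¹) D +ᴾ C (b F.* e⁻¹)) *ᴾ den f
      binomial = begin
        num f *ᴾ C 1#
          ≈⟨ R.*-congʳ {C 1#} g≈ ⟩
        lin a b (X ^ D) (C 1#) *ᴾ C 1#
          ≈⟨ solve 3 (λ a b x → (a :* x :+ b :* con (+ 1)) :* con (+ 1) := (a :* x :+ b) :* con (+ 1)) R.refl (C a) (C b) (X ^ D) ⟩
        (C a *ᴾ X ^ D +ᴾ C b) *ᴾ C 1#
          ≈⟨ R.*-congˡ {C a *ᴾ X ^ D +ᴾ C b} (R.trans (R.sym (C-cong e⁻¹e)) (C-* e⁻¹ e)) ⟩
        (C a *ᴾ X ^ D +ᴾ C b) *ᴾ (C e⁻¹ *ᴾ C e)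
          ≈⟨ solve 5 (λ a b x i e → (a :* x :+ b) :* (i :* e) := (a :* i :* x :+ b :* i) :* e) R.refl (C a) (C b) (X ^ D) (C e⁻¹) (C e) ⟩
        (C a *ᴾ C e⁻¹ *ᴾ X ^ D +ᴾ C b *ᴾ C e⁻¹) *ᴾ C e
          ≈⟨ R.*-cong (R.+-cong {C a *ᴾ C e⁻¹ *ᴾ X ^ D} {monomial (a F.* e⁻¹) D} {C b *ᴾ C e⁻¹} {C (b F.* e⁻¹)} (R.trans {C a *ᴾ C e⁻¹ *ᴾ X ^ D} {C (a F.* e⁻¹) *ᴾ X ^ D} (R.*-congʳ {X ^ D} (R.sym (C-* a e⁻¹))) (R.sym (monomial≈ (a F.* e⁻¹) D))) (R.sym (C-* b e⁻¹)))
                      (R.sym (R.trans h≈ (constant-if c≈0))) ⟩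
        (monomial (a F.* e⁻¹) D +ᴾ C (b F.* e⁻¹)) *ᴾ den f ∎

      isPPowerBinomial : ∀ l → D ≡ p ℕ.^ l → IsPPowerBinomial p f
      isPPowerBinomial l D≡ = a F.* e⁻¹ , b F.* e⁻¹ , l , apart quotient≉0 , coeff-≈
        (≡.subst (λ k → num f *ᴾ C 1# ≈ᴾ (monomial (a F.* e⁻¹) k +ᴾ C (b F.* e⁻¹)) *ᴾ den f) D≡ binomial)

      isMonomial : b ≈ 0# → IsMonomial f
      isMonomial b≈0 = a F.* e⁻¹ , D , apart quotient≉0 , coeff-≈ (R.trans binomial (R.*-congʳ {den f}
        (R.trans (R.+-congˡ {monomial (a F.* e⁻¹) D} (R.trans (C-cong (F.trans (F.*-congʳ b≈0) (F.zeroˡ e⁻¹))) C-0)) (R.+-identityʳ _))))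

    ¬isSeparable : D FT.· 1# ≈ 0# → ¬ IsSeparable f
    ¬isSeparable D≈0 sep = sep (coeff-≈ (begin
      derivative (num f) *ᴾ den f -ᴾ num f *ᴾ derivative (den f)
        ≈⟨ R.+-cong (R.*-congʳ {den f} (Derivatives.derivative≈0 F D≈0 num≈′)) (R.-‿cong (R.*-congˡ {num f} (Derivatives.derivative≈0 F D≈0 den≈′))) ⟩
      [] *ᴾ den f -ᴾ num f *ᴾ []
        ≈⟨ solve 2 (λ g h → con (+ 0) :* h :- g :* con (+ 0) := con (+ 0)) R.refl (num f) (den f) ⟩
      [] ∎))

    isLinearInPPower : ∀ l → 1 ≤ l → D ≡ p ℕ.^ l → den f ≈ᴾ [] ⊎ IsLinearInPPower p f
    isLinearInPPower l 1≤l D≡ with zero? (den f)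
    ... | yes z = inj₁ z
    ... | no h≉0 = inj₂ (fraction a b c₁ e Δ≉0 , l , fraction-degree a b c₁ e Δ≉0 , 1≤l
        , ≡.subst (λ k → IsComposite f (fraction a b c₁ e Δ≉0) (𝕏^ k)) D≡
            (nonZeroᴾ (λ z → h≉0 (R.trans (R.sym (value-den)) z))
            , coeff-≈ (R.trans (R.*-congˡ {num f} value-den) (R.*-congʳ {den f} (R.sym value-num)))))
      where
      substitute : ∀ a b → homogenize 2 (linear a b) (monomial 1# D) (C 1#) ≈ᴾ lin a b (X ^ D) (C 1#)
      substitute a b = R.trans (homogenize-linear a b (monomial 1# D) (C 1#)) (R.trans
        (R.*-congˡ {C 1#} (R.+-congˡ {C b *ᴾ C 1#} (R.*-congˡ {C a} (R.trans (monomial≈ 1# D) (R.*-identityˡ (X ^ D))))))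
        (solve 3 (λ a b x → con (+ 1) :* (b :* con (+ 1) :+ a :* x) := a :* x :+ b :* con (+ 1)) R.refl (C a) (C b) (X ^ D)))
      value-num : homogenize 2 (linear a b) (monomial 1# D) (C 1#) ≈ᴾ num f
      value-num = R.trans (substitute a b) (R.sym g≈)
      value-den : homogenize 2 (linear c₁ e) (monomial 1# D) (C 1#) ≈ᴾ den f
      value-den = R.trans (substitute c₁ e) (R.sym h≈)

  module _ {dg dh : ℕ} (g-deg : HasDeg (num f) dg) (h-deg : HasDeg (den f) dh) (2≤D : 2 ≤ D)
    (¬monomial : ¬ IsMonomial f) (¬binomial : ¬ IsPPowerBinomial p f) (¬conjugate : ¬ LinearlyConjugate F f (1/𝕏^ D))
    (condition : dg ≢ dh ⊎ IsSeparable f ⊎ ¬ IsLinearInPPower p f) where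

    private
      1≤D : 1 ≤ D
      1≤D = ℕₚ.≤-trans (s≤s z≤n) 2≤D

    constant-numerator : (m : Möbius (num f) (den f) D) → Möbius.a m ≈ 0# →
      ¬ Möbius.b m ≈ 0# × ¬ Möbius.c₁ m ≈ 0# × num f ≈ᴾ C (Möbius.b m)
    constant-numerator m a≈0 = (λ b≈0 → Δ≉0 (Δ-zero (F.trans (F.*-congʳ a≈0) (F.zeroˡ e)) (F.trans (F.*-congʳ b≈0) (F.zeroˡ c₁))))
        , (λ c≈0 → Δ≉0 (Δ-zero (F.trans (F.*-congʳ a≈0) (F.zeroˡ e)) (F.trans (F.*-congˡ c≈0) (F.zeroʳ b))))
        , R.trans g≈ (constant-if a≈0)
      where
      open Möbius m
      Δ-zero : ∀ {x y} → x ≈ 0# → y ≈ 0# → x F.- y ≈ 0#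
      Δ-zero x≈0 y≈0 = F.trans (F.+-cong x≈0 (F.-‿cong y≈0)) (F.-‿inverseʳ 0#)

    antidiagonal-excluded : (m : Möbius (num f) (den f) D) → Möbius.a m ≈ 0# → ¬ Möbius.e m ≈ 0#
    antidiagonal-excluded m a≈0 e≈0 = let (b≉0 , c≉0 , num≈) = constant-numerator m a≈0 in
      scaling-excluded 1≤D b≉0 c≉0 e≈0 num≈ (den≈′ m) ¬conjugate

    wild-excluded : (m : Möbius (num f) (den f) D) → ∀ l → ¬ D ≡ p ℕ.^ l
    wild-excluded m zero    D≡ = ℕₚ.<⇒≢ 2≤D (≡.sym D≡)
    wild-excluded m (suc l) D≡ = decide condition
      where
      open Möbius m
      D≈0 : D FT.· 1# ≈ 0#
      D≈0 = PowerOfCharacteristic.s·1≈0 FR p p-prime (proj₁ (proj₂ char)) D (suc l) D≡ (s≤s z≤n)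

      lang : ∀ D → 2 ≤ D → D ≡ p ℕ.^ suc l → ¬ e ≈ 0# → ¬ b ≈ 0# → ¬ c₁ ≈ 0# → num f ≈ᴾ C b → den f ≈ᴾ monomial c₁ D +ᴾ C e →
        ¬ LinearlyConjugate F f (1/𝕏^ D) → ⊥
      lang (suc s′) (s≤s 1≤s′) D≡ e≉0 b≉0 c≉0 num≈ den≈ = lang-excluded s′ (suc l) D≡ (s≤s z≤n) 1≤s′ b≉0 c≉0 e≉0 num≈ den≈

      unequal-degrees : dg ≢ dh → Dec (a ≈ 0#) → Dec (c₁ ≈ 0#) → ⊥
      unequal-degrees dg≢dh _         (yes c≈0) = ¬binomial (isPPowerBinomial m c≈0 (suc l) D≡)
      unequal-degrees dg≢dh (yes a≈0) _         = let (b≉0 , c≉0 , num≈) = constant-numerator m a≈0 in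
        lang D 2≤D D≡ (antidiagonal-excluded m a≈0) b≉0 c≉0 num≈ (den≈′ m) ¬conjugate
      unequal-degrees dg≢dh (no a≉0) (no c≉0)   = dg≢dh (≡.trans
        (hasDeg-unique g-deg (hasDeg-cong (R.sym g≈) (hasDeg-lin a≉0 1≤D)))
        (hasDeg-unique (hasDeg-cong (R.sym h≈) (hasDeg-lin c≉0 1≤D)) h-deg))

      decide : dg ≢ dh ⊎ IsSeparable f ⊎ ¬ IsLinearInPPower p f → ⊥
      decide (inj₁ dg≢dh)       = unequal-degrees dg≢dh (a ≟ 0#) (c₁ ≟ 0#)
      decide (inj₂ (inj₁ sep))  = ¬isSeparable m D≈0 sep
      decide (inj₂ (inj₂ ¬lin)) with isLinearInPPower m (suc l) (s≤s z≤n) D≡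
      ... | inj₁ h≈0 = hasDeg-≉0 h-deg h≈0
      ... | inj₂ lin′ = ¬lin lin′

    not-excluded : (nc : I.NonConstant) → ¬ I.Excluded nc
    not-excluded nc (I.diagonal m b≈0 c≈0)     = ¬monomial (isMonomial m c≈0 b≈0)
    not-excluded nc (I.antidiagonal m a≈0 e≈0) = antidiagonal-excluded m a≈0 e≈0
    not-excluded nc (I.wild m {p′} {l} (1≤p′ , p′·1≈0 , least) D≡) = wild-excluded m l (≡.trans D≡ (≡.cong (ℕ._^ l) (ℕₚ.≤-antisym
      (least p (proj₁ char) (proj₁ (proj₂ char))) (proj₂ (proj₂ char) p′ 1≤p′ p′·1≈0))))

module MultiplicativeOrder {c ℓ₁ ℓ₂ : Level} (K : HeytingField c ℓ₁ ℓ₂) (discrete : Discrete K) (N : ℕ)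
  {α : HeytingField.Carrier K} (order : HasMultiplicativeOrder K α N) where
  open CommutativeRing (fieldRing K) hiding (zero)
  open RingTheory (fieldRing K) using (^-homo-*; ^-assocʳ; ^-congˡ; 1^n) renaming (_^_ to _^ᴷ_)
  open DiscreteField K discrete using (domain)
  open DomainTheory (fieldRing K) domain
  open RingTheory.IsDomain domain using (1≉0)
  open SetoidReasoning setoid

  1≤N : 1 ≤ N
  1≤N = proj₁ order

  α≉0 : ¬ α ≈ 0#
  α≉0 α≈0 = power N 1≤N (proj₁ (proj₂ order))
    where
    power : ∀ N → 1 ≤ N → ¬ α ^ᴷ N ≈ 1#
    power (suc N) _ e = 1≉0 (trans (sym e) (trans (*-congʳ α≈0) (zeroˡ _)))

  ^-cancelˡ : ∀ x {y z} → α ^ᴷ (x ℕ.+ y) ≈ α ^ᴷ (x ℕ.+ z) → α ^ᴷ y ≈ α ^ᴷ z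
  ^-cancelˡ x {y} {z} e = *-cancelˡ (α ^ᴷ x) (^-≉0 x α≉0) (trans (sym (^-homo-* α x y)) (trans e (^-homo-* α x z)))

  private
    reduce : ∀ N → 1 ≤ N → α ^ᴷ N ≈ 1# → ∀ x → α ^ᴷ x ≈ α ^ᴷ (x mod N)
    reduce (suc N) _ e x = begin
      α ^ᴷ x                                                      ≡⟨ ≡.cong (α ^ᴷ_) (≡.trans (DivMod.m≡m%n+[m/n]*n x (suc N)) (≡.cong (x DivMod.% suc N ℕ.+_) (ℕₚ.*-comm (x DivMod./ suc N) (suc N)))) ⟩
      α ^ᴷ (x DivMod.% suc N ℕ.+ suc N ℕ.* (x DivMod./ suc N))    ≈⟨ ^-homo-* α (x DivMod.% suc N) _ ⟩
      α ^ᴷ (x DivMod.% suc N) * α ^ᴷ (suc N ℕ.* (x DivMod./ suc N)) ≈⟨ *-congˡ (^-assocʳ α (suc N) (x DivMod./ suc N)) ⟨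
      α ^ᴷ (x DivMod.% suc N) * (α ^ᴷ suc N) ^ᴷ (x DivMod./ suc N) ≈⟨ *-congˡ (trans (^-congˡ (x DivMod./ suc N) e) (1^n (x DivMod./ suc N))) ⟩
      α ^ᴷ (x DivMod.% suc N) * 1#                                ≈⟨ *-identityʳ _ ⟩
      α ^ᴷ (x DivMod.% suc N)                                     ∎

    mod-< : ∀ N x → 1 ≤ N → x mod N < N
    mod-< (suc N) x _ = DivMod.m%n<n x (suc N)

  ^-mod : ∀ x → α ^ᴷ x ≈ α ^ᴷ (x mod N)
  ^-mod = reduce N 1≤N (proj₁ (proj₂ order))

  mod≡⇒^≈ : ∀ {x y} → x mod N ≡ y mod N → α ^ᴷ x ≈ α ^ᴷ y
  mod≡⇒^≈ {x} {y} e = trans (^-mod x) (trans (reflexive (≡.cong (α ^ᴷ_) e)) (sym (^-mod y)))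

  ^≈⇒mod≡ : ∀ {x y} → α ^ᴷ x ≈ α ^ᴷ y → x mod N ≡ y mod N
  ^≈⇒mod≡ {x} {y} e = compare (ℕₚ.<-cmp (x mod N) (y mod N))
    where
    small : α ^ᴷ (x mod N) ≈ α ^ᴷ (y mod N)
    small = trans (sym (^-mod x)) (trans e (^-mod y))
    no-gap : ∀ {u v} → u < v → v < N → ¬ α ^ᴷ u ≈ α ^ᴷ v
    no-gap {u} {v} u<v v<N e = let (w , u+w) = ℕₚ.m≤n⇒∃[o]m+o≡n u<v in
      ℕₚ.<⇒≱ v<N (ℕₚ.≤-trans (proj₂ (proj₂ order) (suc w) (s≤s z≤n) (sym (^-cancelˡ u {0} {suc w}
        (trans (reflexive (≡.cong (α ^ᴷ_) (ℕₚ.+-identityʳ u))) (trans e (reflexive (≡.cong (α ^ᴷ_) (≡.trans (≡.sym u+w) (≡.sym (ℕₚ.+-suc u w))))))))))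
        (ℕₚ.≤-trans (ℕₚ.m≤n+m (suc w) u) (ℕₚ.≤-reflexive (≡.trans (ℕₚ.+-suc u w) u+w))))
    compare : Tri (x mod N < y mod N) (x mod N ≡ y mod N) (y mod N < x mod N) → x mod N ≡ y mod N
    compare (tri≈ _ eq _)  = eq
    compare (tri< lt _ _)  = ⊥-elim (no-gap lt (mod-< N y 1≤N) small)
    compare (tri> _ _ gt)  = ⊥-elim (no-gap gt (mod-< N x 1≤N) (sym small))

open import Data.Nat using (_^_; _⊔_)
open import Data.Rational using () renaming (_≤_ to _≤ℚ_)

theorem3 :
    ∀ {c ℓ₁ ℓ₂ c′ ℓ₁′ ℓ₂′}
    (p r q n d e t : ℕ) →
    Prime p → 1 ≤ r → q ≡ p ^ r →
    1 ≤ n →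
    IsCeilMulLog 2 q n d →
    IsCeilMulLog 1 q n e →
    IsFloorLog d n t →
    let m = q ^ e in
    (F : HeytingField c ℓ₁ ℓ₂) → HasCardinality F q → HasCharacteristic F p →
    (K : HeytingField c′ ℓ₁′ ℓ₂′) → HasCardinality K (q ^ n) →
    (ι : HeytingField.Carrier F → HeytingField.Carrier K) (ι-hom : IsFieldHom F K ι) →
    let open Polynomials F
        open Extension F K ι ι-hom in
    (f : RatFun) →
    let g = num f
        h = den f in
    InLowestTerms f →
    (deg-g deg-h : ℕ) → HasDegree g deg-g → HasDegree h deg-h →
    deg-g ≤ d → deg-h ≤ d →
    2 ≤ deg-g ⊔ deg-h →
    ¬ IsMonomial f →
    ¬ IsPPowerBinomial p f →
    ¬ LinearlyConjugate F f (1/𝕏^ (deg-g ⊔ deg-h)) →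
    (deg-g ≢ deg-h ⊎ IsSeparable f ⊎ ¬ IsLinearInPPower p f) →
    (α : HeytingField.Carrier K) →
    HasDegreeOver α n →
    IsRootIn (monomial (HeytingField.1# F) m *ᴾ h -ᴾ g) α →
    (N : ℕ) → HasMultiplicativeOrder K α N →
    orderBound n t d ≤ℚ fromℕ N
theorem3 p r q n d e t p-prime 1≤r q≡ 1≤n d-ceil e-ceil t-floor F cardF char K cardK ι ι-hom f lowest deg-g deg-h g-deg h-deg
  deg-g≤d deg-h≤d 2≤D ¬monomial ¬binomial ¬conjugate condition α α-degree α-root N order =
  BoundConversion.orderBound-≤ n t d N d>0 1≤n
    (LowerBound.lower-bound d n N q 2≤d 2≤q
      (ℕₚ.≤-trans (ℕₚ.≤-reflexive (≡.cong (n ℕ.*_) (≡.sym (ℕₚ.*-identityʳ n)))) (proj₁ d-ceil))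
      (Logarithms.below-ceiling {q} {n} {d} d>0 d-ceil) count-≤ q^n≡1
      (≡.subst (λ k → FiniteChecks.NoShort d n (q ^ k) N) (Logarithms.half-exponent {q} {n} {d} {e} (ℕₚ.≤-trans (s≤s z≤n) 2≤q) d-ceil e-ceil) noShort)
      t (proj₁ t-floor) (Logarithms.above-floor {d} {n} {t} t-floor))
  where
  open Polynomials F using (num; den)
  D = deg-g ⊔ deg-h
  2≤p : 2 ≤ p
  2≤p = ℕ.nonTrivial⇒n>1 p {{prime⇒nonTrivial p-prime}}
  2≤q : 2 ≤ q
  2≤q = ℕₚ.≤-trans 2≤p (ℕₚ.≤-trans (ℕₚ.≤-reflexive (≡.sym (ℕₚ.*-identityʳ p)))
    (ℕₚ.≤-trans (ℕₚ.^-monoʳ-≤ p {{ℕ.>-nonZero (ℕₚ.≤-trans (s≤s z≤n) 2≤p)}} 1≤r) (ℕₚ.≤-reflexive (≡.sym q≡))))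
  D≤d : D ≤ d
  D≤d = ℕₚ.⊔-lub deg-g≤d deg-h≤d
  2≤d : 2 ≤ d
  2≤d = ℕₚ.≤-trans 2≤D D≤d
  d>0 : 0 < d
  d>0 = ℕₚ.≤-trans (s≤s z≤n) 2≤d

  discreteF = FiniteField.discrete F q cardF
  module P = DiscretePolynomials F discreteF using (HasDeg; module HasDeg; fromHasDegree; coprime⇒comaximal; degLe-mono)
  module I = DiscretePolynomials.Independence F discreteF (num f) (den f) D using (NonConstant; Excluded; weight)

  g-deg′ : P.HasDeg (num f) deg-g
  g-deg′ = P.fromHasDegree g-deg
  h-deg′ : P.HasDeg (den f) deg-h
  h-deg′ = P.fromHasDegree h-deg

  nonConstant : I.NonConstant
  nonConstant = record
    { comaximal = P.coprime⇒comaximal {num f} {den f} λ {z} → lowest {z}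
    ; g-deg     = P.degLe-mono (ℕₚ.m≤m⊔n deg-g deg-h) (P.HasDeg.bound g-deg′)
    ; h-deg     = P.degLe-mono (ℕₚ.m≤n⊔m deg-g deg-h) (P.HasDeg.bound h-deg′)
    ; degree-D  = degree-D (ℕₚ.⊔-sel deg-g deg-h)
    ; 2≤D       = 2≤D
    }
    where
    degree-D : D ≡ deg-g ⊎ D ≡ deg-h → P.HasDeg (num f) D ⊎ P.HasDeg (den f) D
    degree-D (inj₁ eq) = inj₁ (≡.subst (P.HasDeg (num f)) (≡.sym eq) g-deg′)
    degree-D (inj₂ eq) = inj₂ (≡.subst (P.HasDeg (den f)) (≡.sym eq) h-deg′)

  ¬excluded : ¬ I.Excluded nonConstant
  ¬excluded = ExcludedCases.not-excluded F q cardF p p-prime char r 1≤r q≡ f D g-deg′ h-deg′ 2≤D ¬monomial ¬binomial ¬conjugate condition nonConstant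

  open MultiplicativeOrder K (FiniteField.discrete K (q ^ n) cardK) N order
  module K = CommutativeRing (fieldRing K)
  module KT = RingTheory (fieldRing K)

  q^n≡1 : (q ^ n) mod N ≡ 1 mod N
  q^n≡1 = ^≈⇒mod≡ (K.trans (FiniteField.fermat-q K (q ^ n) cardK α) (K.sym (K.*-identityʳ α)))

  separated : ∀ k (u v : Point k) → distance d k u v < n → exponent (q ^ e) k u mod N ≡ exponent (q ^ e) k v mod N → u ≡ v
  separated k u v close same = proj₁ (Differences.differences-equal k u v []
    (RootRelations.no-short-relation F K ι ι-hom p q p-prime 2≤p cardF char (num f) (den f) D r e q≡ nonConstant ¬excluded α-degree α-root
      l short relation))
    where
    m = q ^ e
    l = Differences.differences k u v []
    x = inBase m (List.map proj₁ l)
    y = inBase m (List.map proj₂ l)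
    short : I.weight 0 l < n
    short = ℕₚ.≤-<-trans (Differences.weight-differences D d D≤d I.weight (λ i a b l → ≡.refl) k u v [])
      (ℕₚ.≤-<-trans (ℕₚ.≤-reflexive (ℕₚ.+-identityʳ (distance d k u v))) close)
    balance : exponent m k v ℕ.+ x ≡ exponent m k u ℕ.+ y
    balance = ≡.trans (ℕₚ.+-comm (exponent m k v) x) (≡.trans (≡.trans (≡.sym (drop (x ℕ.+ exponent m k v)))
      (≡.trans (Differences.exponent-differences m k u v []) (drop (y ℕ.+ exponent m k u)))) (ℕₚ.+-comm y (exponent m k u)))
      where
      drop : ∀ z → z ℕ.+ m ^ suc k ℕ.* 0 ≡ z
      drop z = ≡.trans (≡.cong (z ℕ.+_) (ℕₚ.*-zeroʳ (m ^ suc k))) (ℕₚ.+-identityʳ z)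
    relation : α KT.^ x K.≈ α KT.^ y
    relation = ^-cancelˡ (exponent m k v) (K.trans (K.reflexive (≡.cong (α KT.^_) balance))
      (K.trans (KT.^-homo-* α (exponent m k u) y) (K.trans (K.*-congʳ (mod≡⇒^≈ same)) (K.sym (KT.^-homo-* α (exponent m k v) y)))))

  count-≤ : ∀ k → Counting.count d k n ≤ N
  count-≤ = Anticode.count-≤ d n d>0 (q ^ e) N 1≤N separated
  noShort : FiniteChecks.NoShort d n (q ^ e) N
  noShort = Anticode.noShort d n d>0 (q ^ e) N 1≤N separated
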